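{- Let $l$ be a prime and let $F$ be a field with $\mathrm{char}(F)\neq l$ and $\boldsymbol{\mu}_{l^\infty}\subset F$. Fix a separable closure $F^{sep}$ of $F$. Let $\widehat{F^*}:=\varprojlim_n F^*/(F^*)^{l^n}$ and $V:=\mathbb{Q}_l\otimes_{\mathbb{Z}_l}\widehat{F^*}$. Then the set of $\mathbb{Z}_l^d$-extensions of $F$ contained in $F^{sep}$ is in bijection with $\mathrm{Grass}_d(V)$.
   Context: $\boldsymbol{\mu}_{l^\infty}$ is the group of all roots of unity of $l$-power order. A $\mathbb{Z}_l^d$-extension of $F$ is a Galois extension with Galois group isomorphic to $\mathbb{Z}_l^d$. $\mathrm{Grass}_d(V)$ is the set of all $d$-dimensional $\mathbb{Q}_l$-subspaces of $V$. -}

module Defs where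

open import Level using (Level; _⊔_; suc; 0ℓ)
open import Algebra.Bundles
  using (Group; AbelianGroup; CommutativeRing; RawRing)
open import Algebra.Apartness.Bundles using (HeytingField; HeytingCommutativeRing)
open import Algebra.Module.Bundles using (LeftModule)
open import Algebra.Morphism.Structures
  using (IsRingHomomorphism; IsRingIsomorphism; IsGroupHomomorphism)
import Algebra.Construct.Pointwise as Pointwise
import Algebra.Definitions.RawMonoid as RawMonoidDefs
import Algebra.Morphism.Construct.Composition as Compose
import Algebra.Morphism.Construct.Identity as Identity
import Algebra.Properties.AbelianGroup as AbelianGroupProperties
import Algebra.Properties.CommutativeMonoid.Mult as Mult
import Algebra.Properties.Ring as RingProperties
import Algebra.Properties.Semiring.Exp as Exp
import Algebra.Solver.Ring.NaturalCoefficients.Default as Solver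
open import Data.Fin.Base using (Fin)
open import Data.Integer.Base as ℤ using (ℤ; +_; -[1+_]; 0ℤ; 1ℤ; _⊖_)
import Data.Integer.Properties as ℤ
open import Data.Integer.Divisibility.Signed as ℤ∣ using (divides)
open import Data.Integer.Tactic.RingSolver using (solve-∀)
open import Data.List.Base using (List; []; _∷_; map; _++_)
open import Data.List.Relation.Unary.All as All using (All)
import Data.List.Relation.Unary.All.Properties as All
open import Data.Nat.Base as ℕ using (ℕ; zero; _>_)
import Data.Nat.Divisibility as ℕ
import Data.Nat.Properties as ℕ
open import Data.Product.Base using (Σ; ∃; _×_; _,_; proj₁; proj₂)
open import Function.Base using (_∘_; id)
open import Function.Bundles using (Inverse; _⇔_)
open import Relation.Binary.Bundles using (Setoid)
open import Relation.Binary.PropositionalEquality as ≡ using (_≡_)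
open import Relation.Nullary.Negation using (¬_)
open import Relation.Unary using (Pred; _∈_; _≐_)
import Relation.Binary.Reasoning.Setoid as SetoidReasoning

infix 4 _≡_[mod_]

record _≡_[mod_] (a b : ℤ) (m : ℕ) : Set where
  constructor mod∣
  field
    m∣a-b : + m ℤ∣.∣ a ℤ.- b

open _≡_[mod_] public

module _ {m : ℕ} where

  mod-via : ∀ {a b c} → c ≡ a ℤ.- b → + m ℤ∣.∣ c → a ≡ b [mod m ]
  mod-via e p = mod∣ (≡.subst (+ m ℤ∣.∣_) e p)

  mod-reflexive : ∀ {a b} → a ≡ b → a ≡ b [mod m ]
  mod-reflexive {a} ≡.refl = mod∣ (divides 0ℤ (ℤ.+-inverseʳ a))

  mod-sym : ∀ {a b} → a ≡ b [mod m ] → b ≡ a [mod m ]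
  mod-sym {a} {b} (mod∣ p) = mod-via (eq a b) (ℤ∣.∣m⇒∣-m p)
    where
    eq : ∀ a b → ℤ.- (a ℤ.- b) ≡ b ℤ.- a
    eq = solve-∀

  mod-trans : ∀ {a b c} → a ≡ b [mod m ] → b ≡ c [mod m ] → a ≡ c [mod m ]
  mod-trans {a} {b} {c} (mod∣ p) (mod∣ q) = mod-via (eq a b c) (ℤ∣.∣m∣n⇒∣m+n p q)
    where
    eq : ∀ a b c → (a ℤ.- b) ℤ.+ (b ℤ.- c) ≡ a ℤ.- c
    eq = solve-∀

  mod-+ : ∀ {a a′ b b′} → a ≡ a′ [mod m ] → b ≡ b′ [mod m ] →
          a ℤ.+ b ≡ a′ ℤ.+ b′ [mod m ]
  mod-+ {a} {a′} {b} {b′} (mod∣ p) (mod∣ q) = mod-via (eq a a′ b b′) (ℤ∣.∣m∣n⇒∣m+n p q)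
    where
    eq : ∀ a a′ b b′ → (a ℤ.- a′) ℤ.+ (b ℤ.- b′) ≡ (a ℤ.+ b) ℤ.- (a′ ℤ.+ b′)
    eq = solve-∀

  mod-* : ∀ {a a′ b b′} → a ≡ a′ [mod m ] → b ≡ b′ [mod m ] →
          a ℤ.* b ≡ a′ ℤ.* b′ [mod m ]
  mod-* {a} {a′} {b} {b′} (mod∣ p) (mod∣ q) =
    mod-via (eq a a′ b b′) (ℤ∣.∣m∣n⇒∣m+n (ℤ∣.∣n⇒∣m*n b p) (ℤ∣.∣n⇒∣m*n a′ q))
    where
    eq : ∀ a a′ b b′ → b ℤ.* (a ℤ.- a′) ℤ.+ a′ ℤ.* (b ℤ.- b′) ≡ a ℤ.* b ℤ.- a′ ℤ.* b′
    eq = solve-∀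

  mod-neg : ∀ {a a′} → a ≡ a′ [mod m ] → ℤ.- a ≡ ℤ.- a′ [mod m ]
  mod-neg {a} {a′} (mod∣ p) = mod-via (eq a a′) (ℤ∣.∣m⇒∣-m p)
    where
    eq : ∀ a a′ → ℤ.- (a ℤ.- a′) ≡ (ℤ.- a) ℤ.- (ℤ.- a′)
    eq = solve-∀

module _ (l : ℕ) where

  -- An element of lim ℤ/lⁿ, each component being given by an integer representative.
  record AdicInteger : Set where
    constructor mkAdic
    field
      seq        : ℕ → ℤ
      compatible : ∀ n → seq (ℕ.suc n) ≡ seq n [mod l ℕ.^ n ]

  open AdicInteger

  ℤ-adic : CommutativeRing 0ℓ 0ℓ
  ℤ-adic = record
    { Carrier = AdicInteger
    ; _≈_ = λ a b → ∀ n → seq a n ≡ seq b n [mod l ℕ.^ n ]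
    ; _+_ = λ a b → mkAdic (λ n → seq a n ℤ.+ seq b n)
                           (λ n → mod-+ (compatible a n) (compatible b n))
    ; _*_ = λ a b → mkAdic (λ n → seq a n ℤ.* seq b n)
                           (λ n → mod-* {a = seq a (ℕ.suc n)} (compatible a n) (compatible b n))
    ; -_ = λ a → mkAdic (λ n → ℤ.- seq a n) (λ n → mod-neg (compatible a n))
    ; 0# = mkAdic (λ _ → 0ℤ) (λ _ → mod-reflexive ≡.refl)
    ; 1# = mkAdic (λ _ → 1ℤ) (λ _ → mod-reflexive ≡.refl)
    ; isCommutativeRing = record
      { isRing = record
        { +-isAbelianGroup = record
          { isGroup = record
            { isMonoid = record
              { isSemigroup = record
                { isMagma = record
                  { isEquivalence = record
                    { refl  = λ _ → mod-reflexive ≡.refl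
                    ; sym   = λ p n → mod-sym (p n)
                    ; trans = λ p q n → mod-trans (p n) (q n)
                    }
                  ; ∙-cong = λ p q n → mod-+ (p n) (q n)
                  }
                ; assoc = λ a b c n → mod-reflexive (ℤ.+-assoc (seq a n) (seq b n) (seq c n))
                }
              ; identity = (λ a n → mod-reflexive (ℤ.+-identityˡ (seq a n)))
                         , (λ a n → mod-reflexive (ℤ.+-identityʳ (seq a n)))
              }
            ; inverse = (λ a n → mod-reflexive (ℤ.+-inverseˡ (seq a n)))
                      , (λ a n → mod-reflexive (ℤ.+-inverseʳ (seq a n)))
            ; ⁻¹-cong = λ p n → mod-neg (p n)
            }
          ; comm = λ a b n → mod-reflexive (ℤ.+-comm (seq a n) (seq b n))
          }
        ; *-cong = λ {a} p q n → mod-* {a = seq a n} (p n) (q n)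
        ; *-assoc = λ a b c n → mod-reflexive (ℤ.*-assoc (seq a n) (seq b n) (seq c n))
        ; *-identity = (λ a n → mod-reflexive (ℤ.*-identityˡ (seq a n)))
                     , (λ a n → mod-reflexive (ℤ.*-identityʳ (seq a n)))
        ; distrib = (λ a b c n → mod-reflexive (ℤ.*-distribˡ-+ (seq a n) (seq b n) (seq c n)))
                  , (λ a b c n → mod-reflexive (ℤ.*-distribʳ-+ (seq a n) (seq b n) (seq c n)))
        }
      ; *-comm = λ a b n → mod-reflexive (ℤ.*-comm (seq a n) (seq b n))
      }
    }

-- The pair (a , k) stands for a / sᵏ.
module Localisation {c ℓ : Level} (R : CommutativeRing c ℓ) (s : CommutativeRing.Carrier R) where

  open CommutativeRing R
  open Exp semiring using (_^_; ^-homo-*)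
  open Solver commutativeSemiring using (solve; _:=_; _:+_; _:*_)
  open SetoidReasoning setoid

  Fraction : Set c
  Fraction = Carrier × ℕ

  infix 4 _∼_

  record _∼_ (x y : Fraction) : Set ℓ where
    constructor equal-by
    field
      exponent    : ℕ
      cross-equal : s ^ exponent * (s ^ proj₂ y * proj₁ x) ≈ s ^ exponent * (s ^ proj₂ x * proj₁ y)

  add mul : Fraction → Fraction → Fraction
  add (a , j) (b , k) = s ^ k * a + s ^ j * b , j ℕ.+ k
  mul (a , j) (b , k) = a * b , j ℕ.+ k

  neg : Fraction → Fraction
  neg (a , j) = - a , j

  split : ∀ j k → s ^ (j ℕ.+ k) ≈ s ^ j * s ^ k
  split = ^-homo-* s

  cross : ∀ {a j b k} → s ^ k * a ≈ s ^ j * b → (a , j) ∼ (b , k)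
  cross p = equal-by 0 (*-congˡ p)

  ∼-refl : ∀ {x} → x ∼ x
  ∼-refl = cross refl

  ∼-sym : ∀ {x y} → x ∼ y → y ∼ x
  ∼-sym (equal-by t p) = equal-by t (sym p)

  ∼-trans : ∀ {x y z} → x ∼ y → y ∼ z → x ∼ z
  ∼-trans {a , j} {b , k} {c , m} (equal-by t p) (equal-by u q) = equal-by (t ℕ.+ (u ℕ.+ k)) (begin
    s ^ (t ℕ.+ (u ℕ.+ k)) * (M * a)
      ≈⟨ *-congʳ pw ⟩
    (T * (U * K)) * (M * a)
      ≈⟨ solve 5 (λ T U K M a → (T :* (U :* K)) :* (M :* a) := (U :* M) :* (T :* (K :* a))) refl T U K M a ⟩
    (U * M) * (T * (K * a))
      ≈⟨ *-congˡ p ⟩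
    (U * M) * (T * (J * b))
      ≈⟨ solve 5 (λ T U J M b → (U :* M) :* (T :* (J :* b)) := (T :* J) :* (U :* (M :* b))) refl T U J M b ⟩
    (T * J) * (U * (M * b))
      ≈⟨ *-congˡ q ⟩
    (T * J) * (U * (K * c))
      ≈⟨ solve 5 (λ T U K J c → (T :* J) :* (U :* (K :* c)) := (T :* (U :* K)) :* (J :* c)) refl T U K J c ⟩
    (T * (U * K)) * (J * c)
      ≈⟨ *-congʳ pw ⟨
    s ^ (t ℕ.+ (u ℕ.+ k)) * (J * c) ∎)
    where
    T = s ^ t
    U = s ^ u
    J = s ^ j
    K = s ^ k
    M = s ^ m
    pw : s ^ (t ℕ.+ (u ℕ.+ k)) ≈ T * (U * K)
    pw = trans (split t (u ℕ.+ k)) (*-congˡ (split u k))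

  add-cong : ∀ {x x′ y y′} → x ∼ x′ → y ∼ y′ → add x y ∼ add x′ y′
  add-cong {a , j} {a′ , j′} {b , k} {b′ , k′} (equal-by t p) (equal-by u q) = equal-by (t ℕ.+ u) (begin
    s ^ (t ℕ.+ u) * (s ^ (j′ ℕ.+ k′) * (K * a + J * b))
      ≈⟨ *-cong (split t u) (*-congʳ (split j′ k′)) ⟩
    (T * U) * ((J′ * K′) * (K * a + J * b))
      ≈⟨ solve 8 (λ T U J′ K′ K J a b →
           (T :* U) :* ((J′ :* K′) :* (K :* a :+ J :* b)) :=
           (U :* (K′ :* K)) :* (T :* (J′ :* a)) :+ (T :* (J′ :* J)) :* (U :* (K′ :* b))) refl T U J′ K′ K J a b ⟩
    (U * (K′ * K)) * (T * (J′ * a)) + (T * (J′ * J)) * (U * (K′ * b))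
      ≈⟨ +-cong (*-congˡ p) (*-congˡ q) ⟩
    (U * (K′ * K)) * (T * (J * a′)) + (T * (J′ * J)) * (U * (K * b′))
      ≈⟨ solve 8 (λ T U J′ K′ K J a′ b′ →
           (U :* (K′ :* K)) :* (T :* (J :* a′)) :+ (T :* (J′ :* J)) :* (U :* (K :* b′)) :=
           (T :* U) :* ((J :* K) :* (K′ :* a′ :+ J′ :* b′))) refl T U J′ K′ K J a′ b′ ⟩
    (T * U) * ((J * K) * (K′ * a′ + J′ * b′))
      ≈⟨ *-cong (split t u) (*-congʳ (split j k)) ⟨
    s ^ (t ℕ.+ u) * (s ^ (j ℕ.+ k) * (K′ * a′ + J′ * b′)) ∎)
    where
    T = s ^ t
    U = s ^ u
    J = s ^ j
    J′ = s ^ j′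
    K = s ^ k
    K′ = s ^ k′

  mul-cong : ∀ {x x′ y y′} → x ∼ x′ → y ∼ y′ → mul x y ∼ mul x′ y′
  mul-cong {a , j} {a′ , j′} {b , k} {b′ , k′} (equal-by t p) (equal-by u q) = equal-by (t ℕ.+ u) (begin
    s ^ (t ℕ.+ u) * (s ^ (j′ ℕ.+ k′) * (a * b))
      ≈⟨ *-cong (split t u) (*-congʳ (split j′ k′)) ⟩
    (T * U) * ((J′ * K′) * (a * b))
      ≈⟨ shuffle T U J′ K′ a b ⟩
    (T * (J′ * a)) * (U * (K′ * b))
      ≈⟨ *-cong p q ⟩
    (T * (J * a′)) * (U * (K * b′))
      ≈⟨ shuffle T U J K a′ b′ ⟨
    (T * U) * ((J * K) * (a′ * b′))
      ≈⟨ *-cong (split t u) (*-congʳ (split j k)) ⟨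
    s ^ (t ℕ.+ u) * (s ^ (j ℕ.+ k) * (a′ * b′)) ∎)
    where
    T = s ^ t
    U = s ^ u
    J = s ^ j
    J′ = s ^ j′
    K = s ^ k
    K′ = s ^ k′
    shuffle : ∀ t u j k a b → (t * u) * ((j * k) * (a * b)) ≈ (t * (j * a)) * (u * (k * b))
    shuffle = solve 6 (λ t u j k a b →
      (t :* u) :* ((j :* k) :* (a :* b)) := (t :* (j :* a)) :* (u :* (k :* b))) refl

  neg-cong : ∀ {x x′} → x ∼ x′ → neg x ∼ neg x′
  neg-cong {a , j} {a′ , j′} (equal-by t p) = equal-by t (begin
    s ^ t * (s ^ j′ * (- a))    ≈⟨ *-congˡ (-‿distribʳ-* _ a) ⟨
    s ^ t * (- (s ^ j′ * a))    ≈⟨ -‿distribʳ-* _ _ ⟨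
    - (s ^ t * (s ^ j′ * a))    ≈⟨ -‿cong p ⟩
    - (s ^ t * (s ^ j * a′))    ≈⟨ -‿distribʳ-* _ _ ⟩
    s ^ t * (- (s ^ j * a′))    ≈⟨ *-congˡ (-‿distribʳ-* _ a′) ⟩
    s ^ t * (s ^ j * (- a′))    ∎)
    where open RingProperties ring using (-‿distribʳ-*)

  same : ∀ {a b j k} → j ≡ k → a ≈ b → (a , j) ∼ (b , k)
  same ≡.refl p = cross (*-congˡ p)

  add-assoc : ∀ x y z → add (add x y) z ∼ add x (add y z)
  add-assoc (a , j) (b , k) (c , m) = same (ℕ.+-assoc j k m) (begin
    M * (K * a + J * b) + s ^ (j ℕ.+ k) * c
      ≈⟨ +-congˡ (*-congʳ (split j k)) ⟩
    M * (K * a + J * b) + (J * K) * c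
      ≈⟨ solve 6 (λ J K M a b c →
           M :* (K :* a :+ J :* b) :+ (J :* K) :* c := (K :* M) :* a :+ J :* (M :* b :+ K :* c)) refl J K M a b c ⟩
    (K * M) * a + J * (M * b + K * c)
      ≈⟨ +-congʳ (*-congʳ (split k m)) ⟨
    s ^ (k ℕ.+ m) * a + J * (M * b + K * c) ∎)
    where
    J = s ^ j
    K = s ^ k
    M = s ^ m

  add-comm : ∀ x y → add x y ∼ add y x
  add-comm (a , j) (b , k) = same (ℕ.+-comm j k) (+-comm _ _)

  add-identityˡ : ∀ x → add (0# , 0) x ∼ x
  add-identityˡ (a , j) = same ≡.refl (begin
    s ^ j * 0# + 1# * a   ≈⟨ +-cong (zeroʳ _) (*-identityˡ a) ⟩
    0# + a                ≈⟨ +-identityˡ a ⟩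
    a                     ∎)

  add-inverseˡ : ∀ x → add (neg x) x ∼ (0# , 0)
  add-inverseˡ (a , j) = cross (begin
    1# * (s ^ j * (- a) + s ^ j * a)   ≈⟨ *-identityˡ _ ⟩
    s ^ j * (- a) + s ^ j * a          ≈⟨ distribˡ _ _ _ ⟨
    s ^ j * (- a + a)                  ≈⟨ *-congˡ (-‿inverseˡ a) ⟩
    s ^ j * 0#                         ≈⟨ zeroʳ _ ⟩
    0#                                 ≈⟨ zeroʳ _ ⟨
    s ^ (j ℕ.+ j) * 0#                 ∎)

  mul-comm : ∀ x y → mul x y ∼ mul y x
  mul-comm (a , j) (b , k) = same (ℕ.+-comm j k) (*-comm a b)

  mul-distribˡ : ∀ x y z → mul x (add y z) ∼ add (mul x y) (mul x z)
  mul-distribˡ (a , j) (b , k) (c , m) = cross (begin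
    s ^ ((j ℕ.+ k) ℕ.+ (j ℕ.+ m)) * (a * (M * b + K * c))
      ≈⟨ *-congʳ (trans (split (j ℕ.+ k) (j ℕ.+ m)) (*-cong (split j k) (split j m))) ⟩
    ((J * K) * (J * M)) * (a * (M * b + K * c))
      ≈⟨ solve 6 (λ J K M a b c →
           ((J :* K) :* (J :* M)) :* (a :* (M :* b :+ K :* c)) :=
           (J :* (K :* M)) :* ((J :* M) :* (a :* b) :+ (J :* K) :* (a :* c))) refl J K M a b c ⟩
    (J * (K * M)) * ((J * M) * (a * b) + (J * K) * (a * c))
      ≈⟨ *-cong (trans (split j (k ℕ.+ m)) (*-congˡ (split k m)))
                (+-cong (*-congʳ (split j m)) (*-congʳ (split j k))) ⟨
    s ^ (j ℕ.+ (k ℕ.+ m)) * (s ^ (j ℕ.+ m) * (a * b) + s ^ (j ℕ.+ k) * (a * c)) ∎)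
    where
    J = s ^ j
    K = s ^ k
    M = s ^ m

  R[1/s] : CommutativeRing c ℓ
  R[1/s] = record
    { Carrier = Fraction
    ; _≈_ = _∼_
    ; _+_ = add
    ; _*_ = mul
    ; -_ = neg
    ; 0# = 0# , 0
    ; 1# = 1# , 0
    ; isCommutativeRing = record
      { isRing = record
        { +-isAbelianGroup = record
          { isGroup = record
            { isMonoid = record
              { isSemigroup = record
                { isMagma = record
                  { isEquivalence = record { refl = ∼-refl ; sym = ∼-sym ; trans = ∼-trans }
                  ; ∙-cong = add-cong
                  }
                ; assoc = add-assoc
                }
              ; identity = add-identityˡ
                         , (λ x → ∼-trans (add-comm x (0# , 0)) (add-identityˡ x))
              }
            ; inverse = add-inverseˡ
                      , (λ x → ∼-trans (add-comm x (neg x)) (add-inverseˡ x))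
            ; ⁻¹-cong = neg-cong
            }
          ; comm = add-comm
          }
        ; *-cong = mul-cong
        ; *-assoc = λ (a , j) (b , k) (c , m) → same (ℕ.+-assoc j k m) (*-assoc a b c)
        ; *-identity = (λ (a , j) → same ≡.refl (*-identityˡ a))
                     , (λ (a , j) → same (ℕ.+-identityʳ j) (*-identityʳ a))
        ; distrib = mul-distribˡ
                  , (λ x y z → ∼-trans (mul-comm (add y z) x)
                      (∼-trans (mul-distribˡ x y z) (add-cong (mul-comm x y) (mul-comm x z))))
        }
      ; *-comm = mul-comm
      }
    }

  fromR : Carrier → Fraction
  fromR a = a , 0

  fromR-isRingHomomorphism :
    IsRingHomomorphism rawRing (CommutativeRing.rawRing R[1/s]) fromR
  fromR-isRingHomomorphism = record
    { isSemiringHomomorphism = record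
      { isNearSemiringHomomorphism = record
        { +-isMonoidHomomorphism = record
          { isMagmaHomomorphism = record
            { isRelHomomorphism = record { cong = λ p → same ≡.refl p }
            ; homo = λ a b → same ≡.refl (sym (+-cong (*-identityˡ a) (*-identityˡ b)))
            }
          ; ε-homo = ∼-refl
          }
        ; *-homo = λ _ _ → ∼-refl
        }
      ; 1#-homo = ∼-refl
      }
    ; -‿homo = λ _ → ∼-refl
    }

module _ (l : ℕ) where

  private
    module ℤₗ = CommutativeRing (ℤ-adic l)
    l# : ℤₗ.Carrier
    l# = l ×# ℤₗ.1#
      where open RawMonoidDefs ℤₗ.+-rawMonoid renaming (_×_ to _×#_)

  -- ℚ_l = ℤ_l[1/l], the fraction field of ℤ_l.
  ℚ-adic : CommutativeRing 0ℓ 0ℓ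
  ℚ-adic = Localisation.R[1/s] (ℤ-adic l) l#

  ℤ→ℚ-adic : ℤₗ.Carrier → CommutativeRing.Carrier ℚ-adic
  ℤ→ℚ-adic = Localisation.fromR (ℤ-adic l) l#

  ℤ→ℚ-adic-isRingHomomorphism :
    IsRingHomomorphism ℤₗ.rawRing (CommutativeRing.rawRing ℚ-adic) ℤ→ℚ-adic
  ℤ→ℚ-adic-isRingHomomorphism = Localisation.fromR-isRingHomomorphism (ℤ-adic l) l#

module _ {c ℓ : Level} (A : AbelianGroup c ℓ) where

  open AbelianGroup A
  open AbelianGroupProperties A
    using (⁻¹-∙-comm; ⁻¹-involutive; ε⁻¹≈ε)
  open Mult commutativeMonoid
    using (×-congʳ; ×-congˡ; ×-homo-+; ×-distrib-+) renaming (_×_ to _×ᴬ_)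
  open import Algebra.Properties.CommutativeSemigroup commutativeSemigroup using (interchange)
  open SetoidReasoning setoid

  infixr 8 _·_

  _·_ : ℤ → Carrier → Carrier
  (+ n)    · x = n ×ᴬ x
  -[1+ n ] · x = (ℕ.suc n ×ᴬ x) ⁻¹

  ·-congˡ : ∀ z {x y} → x ≈ y → z · x ≈ z · y
  ·-congˡ (+ n)    p = ×-congʳ n p
  ·-congˡ -[1+ n ] p = ⁻¹-cong (×-congʳ (ℕ.suc n) p)

  ·-congʳ : ∀ {w z} x → w ≡ z → w · x ≈ z · x
  ·-congʳ x ≡.refl = refl

  ·-⊖ : ∀ x m n → (m ⊖ n) · x ≈ (m ×ᴬ x) ∙ (n ×ᴬ x) ⁻¹
  ·-⊖ x m zero = sym (trans (∙-congˡ ε⁻¹≈ε) (identityʳ _))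
  ·-⊖ x zero (ℕ.suc n) = sym (identityˡ _)
  ·-⊖ x (ℕ.suc m) (ℕ.suc n) = begin
    (ℕ.suc m ⊖ ℕ.suc n) · x                ≈⟨ ·-congʳ x (ℤ.[1+m]⊖[1+n]≡m⊖n m n) ⟩
    (m ⊖ n) · x                            ≈⟨ ·-⊖ x m n ⟩
    p ∙ q ⁻¹                               ≈⟨ identityˡ _ ⟨
    ε ∙ (p ∙ q ⁻¹)                         ≈⟨ ∙-congʳ (inverseʳ x) ⟨
    (x ∙ x ⁻¹) ∙ (p ∙ q ⁻¹)                ≈⟨ interchange x (x ⁻¹) p (q ⁻¹) ⟩
    (x ∙ p) ∙ (x ⁻¹ ∙ q ⁻¹)                ≈⟨ ∙-congˡ (⁻¹-∙-comm x q) ⟩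
    (x ∙ p) ∙ (x ∙ q) ⁻¹                   ∎
    where
    p = m ×ᴬ x
    q = n ×ᴬ x

  ·-+ : ∀ x w z → (w ℤ.+ z) · x ≈ w · x ∙ z · x
  ·-+ x (+ m) (+ n) = ×-homo-+ x m n
  ·-+ x (+ m) -[1+ n ] = ·-⊖ x m (ℕ.suc n)
  ·-+ x -[1+ m ] (+ n) = trans (·-⊖ x n (ℕ.suc m)) (comm _ _)
  ·-+ x -[1+ m ] -[1+ n ] = begin
    (ℕ.suc (ℕ.suc (m ℕ.+ n)) ×ᴬ x) ⁻¹
      ≈⟨ ⁻¹-cong (×-congˡ (≡.cong ℕ.suc (≡.sym (ℕ.+-suc m n)))) ⟩
    ((ℕ.suc m ℕ.+ ℕ.suc n) ×ᴬ x) ⁻¹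
      ≈⟨ ⁻¹-cong (×-homo-+ x (ℕ.suc m) (ℕ.suc n)) ⟩
    ((ℕ.suc m ×ᴬ x) ∙ (ℕ.suc n ×ᴬ x)) ⁻¹
      ≈⟨ ⁻¹-∙-comm _ _ ⟨
    (ℕ.suc m ×ᴬ x) ⁻¹ ∙ (ℕ.suc n ×ᴬ x) ⁻¹ ∎

  ·-neg : ∀ x z → (ℤ.- z) · x ≈ (z · x) ⁻¹
  ·-neg x (+ zero)    = sym ε⁻¹≈ε
  ·-neg x (+ ℕ.suc n) = refl
  ·-neg x -[1+ n ]    = sym (⁻¹-involutive _)

  ·-+* : ∀ x m z → (+ m ℤ.* z) · x ≈ m ×ᴬ (z · x)
  ·-+* x zero z = ·-congʳ x (ℤ.*-zeroˡ z)
  ·-+* x (ℕ.suc m) z = begin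
    (+ ℕ.suc m ℤ.* z) · x         ≈⟨ ·-congʳ x (ℤ.suc-* (+ m) z) ⟩
    (z ℤ.+ + m ℤ.* z) · x         ≈⟨ ·-+ x z (+ m ℤ.* z) ⟩
    z · x ∙ (+ m ℤ.* z) · x       ≈⟨ ∙-congˡ (·-+* x m z) ⟩
    z · x ∙ m ×ᴬ (z · x)          ∎

  ·-* : ∀ x w z → (w ℤ.* z) · x ≈ w · (z · x)
  ·-* x (+ m)    z = ·-+* x m z
  ·-* x -[1+ m ] z = begin
    (-[1+ m ] ℤ.* z) · x            ≈⟨ ·-congʳ x (ℤ.neg-distribˡ-* (+ ℕ.suc m) z) ⟨
    (ℤ.- (+ ℕ.suc m ℤ.* z)) · x     ≈⟨ ·-neg x (+ ℕ.suc m ℤ.* z) ⟩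
    ((+ ℕ.suc m ℤ.* z) · x) ⁻¹      ≈⟨ ⁻¹-cong (·-+* x (ℕ.suc m) z) ⟩
    (ℕ.suc m ×ᴬ (z · x)) ⁻¹         ∎

  ×-⁻¹ : ∀ n x → n ×ᴬ (x ⁻¹) ≈ (n ×ᴬ x) ⁻¹
  ×-⁻¹ zero      x = sym ε⁻¹≈ε
  ×-⁻¹ (ℕ.suc n) x = trans (∙-congˡ (×-⁻¹ n x)) (⁻¹-∙-comm x _)

  ·-∙ : ∀ z x y → z · (x ∙ y) ≈ z · x ∙ z · y
  ·-∙ (+ n)    x y = ×-distrib-+ x y n
  ·-∙ -[1+ n ] x y = trans (⁻¹-cong (×-distrib-+ x y (ℕ.suc n))) (sym (⁻¹-∙-comm _ _))

  ·-ε : ∀ z → z · ε ≈ ε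
  ·-ε z = ·-* ε z 0ℤ ⟨∘⟩ ·-congʳ ε (ℤ.*-zeroʳ z)
    where
    _⟨∘⟩_ : ∀ {a b c} → a ≈ b → a ≈ c → b ≈ c
    p ⟨∘⟩ q = trans (sym p) q

  infix 4 _≡ᴬ_[mod_]

  -- Congruence modulo the subgroup of m-th multiples (m-th powers, if A is
  -- written multiplicatively).
  record _≡ᴬ_[mod_] (x y : Carrier) (m : ℕ) : Set (c ⊔ ℓ) where
    constructor mod-by
    field
      {quotient} : Carrier
      x≈y∙mz     : x ≈ y ∙ (m ×ᴬ quotient)

  module _ {m : ℕ} where

    modᴬ-reflexive : ∀ {x y} → x ≈ y → x ≡ᴬ y [mod m ]
    modᴬ-reflexive {x} {y} p = mod-by {quotient = ε} (begin
      x               ≈⟨ p ⟩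
      y               ≈⟨ identityʳ y ⟨
      y ∙ ε           ≈⟨ ∙-congˡ (·-ε (+ m)) ⟨
      y ∙ (m ×ᴬ ε)    ∎)

    modᴬ-sym : ∀ {x y} → x ≡ᴬ y [mod m ] → y ≡ᴬ x [mod m ]
    modᴬ-sym {x} {y} (mod-by {z} p) = mod-by {quotient = z ⁻¹} (begin
      y                                    ≈⟨ identityʳ y ⟨
      y ∙ ε                                ≈⟨ ∙-congˡ (inverseʳ _) ⟨
      y ∙ ((m ×ᴬ z) ∙ (m ×ᴬ z) ⁻¹)         ≈⟨ assoc _ _ _ ⟨
      (y ∙ (m ×ᴬ z)) ∙ (m ×ᴬ z) ⁻¹         ≈⟨ ∙-cong p (×-⁻¹ m z) ⟨
      x ∙ (m ×ᴬ (z ⁻¹))                    ∎)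

    modᴬ-trans : ∀ {x y w} → x ≡ᴬ y [mod m ] → y ≡ᴬ w [mod m ] → x ≡ᴬ w [mod m ]
    modᴬ-trans {x} {y} {w} (mod-by {z} p) (mod-by {z′} q) = mod-by {quotient = z′ ∙ z} (begin
      x                                ≈⟨ p ⟩
      y ∙ (m ×ᴬ z)                     ≈⟨ ∙-congʳ q ⟩
      (w ∙ (m ×ᴬ z′)) ∙ (m ×ᴬ z)       ≈⟨ assoc _ _ _ ⟩
      w ∙ ((m ×ᴬ z′) ∙ (m ×ᴬ z))       ≈⟨ ∙-congˡ (×-distrib-+ z′ z m) ⟨
      w ∙ (m ×ᴬ (z′ ∙ z))              ∎)

    modᴬ-∙ : ∀ {x x′ y y′} → x ≡ᴬ x′ [mod m ] → y ≡ᴬ y′ [mod m ] → x ∙ y ≡ᴬ x′ ∙ y′ [mod m ]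
    modᴬ-∙ {x} {x′} {y} {y′} (mod-by {z} p) (mod-by {w} q) = mod-by {quotient = z ∙ w} (begin
      x ∙ y                                  ≈⟨ ∙-cong p q ⟩
      (x′ ∙ (m ×ᴬ z)) ∙ (y′ ∙ (m ×ᴬ w))      ≈⟨ interchange _ _ _ _ ⟩
      (x′ ∙ y′) ∙ ((m ×ᴬ z) ∙ (m ×ᴬ w))      ≈⟨ ∙-congˡ (×-distrib-+ z w m) ⟨
      (x′ ∙ y′) ∙ (m ×ᴬ (z ∙ w))             ∎)

    modᴬ-· : ∀ {w z x y} → w ≡ z [mod m ] → x ≡ᴬ y [mod m ] → w · x ≡ᴬ z · y [mod m ]
    modᴬ-· {w} {z} {x} {y} (mod∣ (divides q e)) (mod-by {u} p) = modᴬ-trans step₁ step₂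
      where
      w≡z+mq : w ≡ z ℤ.+ (+ m) ℤ.* q
      w≡z+mq = ≡.trans (eq w z) (≡.cong (ℤ._+_ z) (≡.trans e (ℤ.*-comm q (+ m))))
        where
        eq : ∀ w z → w ≡ z ℤ.+ (w ℤ.- z)
        eq = solve-∀

      step₁ : w · x ≡ᴬ z · x [mod m ]
      step₁ = mod-by {quotient = q · x} (begin
        w · x                          ≈⟨ ·-congʳ x w≡z+mq ⟩
        (z ℤ.+ + m ℤ.* q) · x          ≈⟨ ·-+ x z (+ m ℤ.* q) ⟩
        z · x ∙ (+ m ℤ.* q) · x        ≈⟨ ∙-congˡ (·-+* x m q) ⟩
        z · x ∙ (m ×ᴬ (q · x))         ∎)

      step₂ : z · x ≡ᴬ z · y [mod m ]
      step₂ = mod-by {quotient = z · u} (begin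
        z · x                          ≈⟨ ·-congˡ z p ⟩
        z · (y ∙ (m ×ᴬ u))             ≈⟨ ·-∙ z y (m ×ᴬ u) ⟩
        z · y ∙ z · (m ×ᴬ u)           ≈⟨ ∙-congˡ (·-* u z (+ m)) ⟨
        z · y ∙ (z ℤ.* + m) · u        ≈⟨ ∙-congˡ (·-congʳ u (ℤ.*-comm z (+ m))) ⟩
        z · y ∙ (+ m ℤ.* z) · u        ≈⟨ ∙-congˡ (·-+* u m z) ⟩
        z · y ∙ (m ×ᴬ (z · u))         ∎)

    modᴬ-⁻¹ : ∀ {x y} → x ≡ᴬ y [mod m ] → x ⁻¹ ≡ᴬ y ⁻¹ [mod m ]
    modᴬ-⁻¹ {x} {y} (mod-by {z} p) = mod-by {quotient = z ⁻¹} (begin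
      x ⁻¹                        ≈⟨ ⁻¹-cong p ⟩
      (y ∙ (m ×ᴬ z)) ⁻¹           ≈⟨ ⁻¹-∙-comm _ _ ⟨
      y ⁻¹ ∙ (m ×ᴬ z) ⁻¹          ≈⟨ ∙-congˡ (×-⁻¹ m z) ⟨
      y ⁻¹ ∙ (m ×ᴬ (z ⁻¹))        ∎)

  -- An element of lim A/lⁿA, each component being given by a representative in A.
  record CompatibleSequence (l : ℕ) : Set (c ⊔ ℓ) where
    constructor mkSeq
    field
      seq        : ℕ → Carrier
      compatible : ∀ n → seq (ℕ.suc n) ≡ᴬ seq n [mod l ℕ.^ n ]

  adicCompletion : ∀ l → LeftModule (CommutativeRing.ring (ℤ-adic l)) (c ⊔ ℓ) (c ⊔ ℓ)
  adicCompletion l = record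
    { Carrierᴹ = CompatibleSequence l
    ; _≈ᴹ_ = λ a b → ∀ n → seq a n ≡ᴬ seq b n [mod l ℕ.^ n ]
    ; _+ᴹ_ = λ a b → mkSeq (λ n → seq a n ∙ seq b n)
                           (λ n → modᴬ-∙ (compatible a n) (compatible b n))
    ; _*ₗ_ = λ z a → mkSeq (λ n → Z.seq z n · seq a n)
                           (λ n → modᴬ-· {w = Z.seq z (ℕ.suc n)} (Z.compatible z n) (compatible a n))
    ; 0ᴹ = mkSeq (λ _ → ε) (λ _ → modᴬ-reflexive refl)
    ; -ᴹ_ = λ a → mkSeq (λ n → seq a n ⁻¹) (λ n → modᴬ-⁻¹ (compatible a n))
    ; isLeftModule = record
      { isLeftSemimodule = record
        { +ᴹ-isCommutativeMonoid = record
          { isMonoid = record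
            { isSemigroup = record
              { isMagma = record
                { isEquivalence = record
                  { refl  = λ _ → modᴬ-reflexive refl
                  ; sym   = λ p n → modᴬ-sym (p n)
                  ; trans = λ p q n → modᴬ-trans (p n) (q n)
                  }
                ; ∙-cong = λ p q n → modᴬ-∙ (p n) (q n)
                }
              ; assoc = λ a b c n → modᴬ-reflexive (assoc _ _ _)
              }
            ; identity = (λ a n → modᴬ-reflexive (identityˡ _))
                       , (λ a n → modᴬ-reflexive (identityʳ _))
            }
          ; comm = λ a b n → modᴬ-reflexive (comm _ _)
          }
        ; isPreleftSemimodule = record
          { *ₗ-cong = λ {z} p q n → modᴬ-· {w = Z.seq z n} (p n) (q n)
          ; *ₗ-zeroˡ = λ a n → modᴬ-reflexive refl
          ; *ₗ-distribʳ = λ a w z n → modᴬ-reflexive (·-+ _ (Z.seq w n) (Z.seq z n))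
          ; *ₗ-identityˡ = λ a n → modᴬ-reflexive (identityʳ _)
          ; *ₗ-assoc = λ w z a n → modᴬ-reflexive (·-* _ (Z.seq w n) (Z.seq z n))
          ; *ₗ-zeroʳ = λ z n → modᴬ-reflexive (·-ε (Z.seq z n))
          ; *ₗ-distribˡ = λ z a b n → modᴬ-reflexive (·-∙ (Z.seq z n) _ _)
          }
        }
      ; -ᴹ‿cong = λ p n → modᴬ-⁻¹ (p n)
      ; -ᴹ‿inverse = (λ a n → modᴬ-reflexive (inverseˡ _))
                   , (λ a n → modᴬ-reflexive (inverseʳ _))
      }
    }
    where
    open CompatibleSequence
    module Z = AdicInteger

module _ {r ℓr s ℓs m ℓm : Level} {R : CommutativeRing r ℓr} {S : CommutativeRing s ℓs}
         {φ : CommutativeRing.Carrier R → CommutativeRing.Carrier S}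
         (φ-homo : IsRingHomomorphism (CommutativeRing.rawRing R) (CommutativeRing.rawRing S) φ)
         (M : LeftModule (CommutativeRing.ring R) m ℓm) where

  private
    module R = CommutativeRing R
    module S = CommutativeRing S
    module M = LeftModule M

  infix 9 _⊗_
  infixl 6 _⊕_

  data Tensor : Set (s ⊔ m) where
    _⊗_ : S.Carrier → M.Carrierᴹ → Tensor
    _⊕_ : Tensor → Tensor → Tensor
    ⊝_  : Tensor → Tensor
    𝟘   : Tensor

  infix 4 _≋_

  -- The least abelian group congruence making _⊗_ balanced over R.
  data _≋_ : Tensor → Tensor → Set (r ⊔ s ⊔ ℓs ⊔ m ⊔ ℓm) where
    ≋-refl      : ∀ {x} → x ≋ x
    ≋-sym       : ∀ {x y} → x ≋ y → y ≋ x
    ≋-trans     : ∀ {x y z} → x ≋ y → y ≋ z → x ≋ z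
    ⊗-cong      : ∀ {a b x y} → a S.≈ b → x M.≈ᴹ y → a ⊗ x ≋ b ⊗ y
    ⊕-cong      : ∀ {x x′ y y′} → x ≋ x′ → y ≋ y′ → x ⊕ y ≋ x′ ⊕ y′
    ⊝-cong      : ∀ {x y} → x ≋ y → ⊝ x ≋ ⊝ y
    ⊕-assoc     : ∀ x y z → (x ⊕ y) ⊕ z ≋ x ⊕ (y ⊕ z)
    ⊕-comm      : ∀ x y → x ⊕ y ≋ y ⊕ x
    ⊕-identityˡ : ∀ x → 𝟘 ⊕ x ≋ x
    ⊝-inverseˡ  : ∀ x → (⊝ x) ⊕ x ≋ 𝟘
    ⊗-distribˡ  : ∀ a x y → a ⊗ (x M.+ᴹ y) ≋ a ⊗ x ⊕ a ⊗ y
    ⊗-distribʳ  : ∀ x a b → (a S.+ b) ⊗ x ≋ a ⊗ x ⊕ b ⊗ x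
    ⊗-balanced  : ∀ a c x → (a S.* φ c) ⊗ x ≋ a ⊗ (c M.*ₗ x)

  scale : S.Carrier → Tensor → Tensor
  scale a (b ⊗ x) = (a S.* b) ⊗ x
  scale a (x ⊕ y) = scale a x ⊕ scale a y
  scale a (⊝ x)   = ⊝ scale a x
  scale a 𝟘       = 𝟘

  tensorAbelianGroup : AbelianGroup (s ⊔ m) (r ⊔ s ⊔ ℓs ⊔ m ⊔ ℓm)
  tensorAbelianGroup = record
    { Carrier = Tensor
    ; _≈_ = _≋_
    ; _∙_ = _⊕_
    ; ε = 𝟘
    ; _⁻¹ = ⊝_
    ; isAbelianGroup = record
      { isGroup = record
        { isMonoid = record
          { isSemigroup = record
            { isMagma = record
              { isEquivalence = record { refl = ≋-refl ; sym = ≋-sym ; trans = ≋-trans }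
              ; ∙-cong = ⊕-cong
              }
            ; assoc = ⊕-assoc
            }
          ; identity = ⊕-identityˡ , (λ x → ≋-trans (⊕-comm x 𝟘) (⊕-identityˡ x))
          }
        ; inverse = ⊝-inverseˡ , (λ x → ≋-trans (⊕-comm x (⊝ x)) (⊝-inverseˡ x))
        ; ⁻¹-cong = ⊝-cong
        }
      ; comm = ⊕-comm
      }
    }

  open AbelianGroup tensorAbelianGroup using (inverse; isCommutativeMonoid; commutativeSemigroup)
  open AbelianGroupProperties tensorAbelianGroup using (⁻¹-∙-comm; ε⁻¹≈ε; identityʳ-unique)
  open import Algebra.Properties.CommutativeSemigroup commutativeSemigroup using (interchange)

  scale-congˡ : ∀ a {x y} → x ≋ y → scale a x ≋ scale a y
  scale-congˡ a ≋-refl             = ≋-refl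
  scale-congˡ a (≋-sym p)          = ≋-sym (scale-congˡ a p)
  scale-congˡ a (≋-trans p q)      = ≋-trans (scale-congˡ a p) (scale-congˡ a q)
  scale-congˡ a (⊗-cong p q)       = ⊗-cong (S.*-congˡ p) q
  scale-congˡ a (⊕-cong p q)       = ⊕-cong (scale-congˡ a p) (scale-congˡ a q)
  scale-congˡ a (⊝-cong p)         = ⊝-cong (scale-congˡ a p)
  scale-congˡ a (⊕-assoc x y z)    = ⊕-assoc _ _ _
  scale-congˡ a (⊕-comm x y)       = ⊕-comm _ _
  scale-congˡ a (⊕-identityˡ x)    = ⊕-identityˡ _
  scale-congˡ a (⊝-inverseˡ x)     = ⊝-inverseˡ _
  scale-congˡ a (⊗-distribˡ b x y) = ⊗-distribˡ _ x y
  scale-congˡ a (⊗-distribʳ x b c) =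
    ≋-trans (⊗-cong (S.distribˡ a b c) M.≈ᴹ-refl) (⊗-distribʳ x _ _)
  scale-congˡ a (⊗-balanced b c x) =
    ≋-trans (⊗-cong (S.sym (S.*-assoc a b (φ c))) M.≈ᴹ-refl) (⊗-balanced _ c x)

  scale-congʳ : ∀ {a b} x → a S.≈ b → scale a x ≋ scale b x
  scale-congʳ (c ⊗ x) p = ⊗-cong (S.*-congʳ p) M.≈ᴹ-refl
  scale-congʳ (x ⊕ y) p = ⊕-cong (scale-congʳ x p) (scale-congʳ y p)
  scale-congʳ (⊝ x)   p = ⊝-cong (scale-congʳ x p)
  scale-congʳ 𝟘       p = ≋-refl

  scale-distribʳ : ∀ x a b → scale (a S.+ b) x ≋ scale a x ⊕ scale b x
  scale-distribʳ (c ⊗ x) a b =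
    ≋-trans (⊗-cong (S.distribʳ c a b) M.≈ᴹ-refl) (⊗-distribʳ x _ _)
  scale-distribʳ (x ⊕ y) a b =
    ≋-trans (⊕-cong (scale-distribʳ x a b) (scale-distribʳ y a b)) (interchange _ _ _ _)
  scale-distribʳ (⊝ x)   a b =
    ≋-trans (⊝-cong (scale-distribʳ x a b)) (≋-sym (⁻¹-∙-comm _ _))
  scale-distribʳ 𝟘       a b = ≋-sym (⊕-identityˡ 𝟘)

  scale-identityˡ : ∀ x → scale S.1# x ≋ x
  scale-identityˡ (c ⊗ x) = ⊗-cong (S.*-identityˡ c) M.≈ᴹ-refl
  scale-identityˡ (x ⊕ y) = ⊕-cong (scale-identityˡ x) (scale-identityˡ y)
  scale-identityˡ (⊝ x)   = ⊝-cong (scale-identityˡ x)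
  scale-identityˡ 𝟘       = ≋-refl

  scale-assoc : ∀ a b x → scale (a S.* b) x ≋ scale a (scale b x)
  scale-assoc a b (c ⊗ x) = ⊗-cong (S.*-assoc a b c) M.≈ᴹ-refl
  scale-assoc a b (x ⊕ y) = ⊕-cong (scale-assoc a b x) (scale-assoc a b y)
  scale-assoc a b (⊝ x)   = ⊝-cong (scale-assoc a b x)
  scale-assoc a b 𝟘       = ≋-refl

  scale-zeroˡ : ∀ x → scale S.0# x ≋ 𝟘
  scale-zeroˡ x = identityʳ-unique (scale S.0# x) (scale S.0# x)
    (≋-trans (≋-sym (scale-distribʳ x S.0# S.0#)) (scale-congʳ x (S.+-identityˡ S.0#)))

  extendScalars : LeftModule S.ring (s ⊔ m) (r ⊔ s ⊔ ℓs ⊔ m ⊔ ℓm)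
  extendScalars = record
    { Carrierᴹ = Tensor
    ; _≈ᴹ_ = _≋_
    ; _+ᴹ_ = _⊕_
    ; _*ₗ_ = scale
    ; 0ᴹ = 𝟘
    ; -ᴹ_ = ⊝_
    ; isLeftModule = record
      { isLeftSemimodule = record
        { +ᴹ-isCommutativeMonoid = isCommutativeMonoid
        ; isPreleftSemimodule = record
          { *ₗ-cong = λ {a} {b} {x} {y} p q → ≋-trans (scale-congʳ x p) (scale-congˡ b q)
          ; *ₗ-zeroˡ = scale-zeroˡ
          ; *ₗ-distribʳ = scale-distribʳ
          ; *ₗ-identityˡ = scale-identityˡ
          ; *ₗ-assoc = scale-assoc
          ; *ₗ-zeroʳ = λ _ → ≋-refl
          ; *ₗ-distribˡ = λ _ _ _ → ≋-refl
          }
        }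
      ; -ᴹ‿cong = ⊝-cong
      ; -ᴹ‿inverse = inverse
      }
    }

module _ {r ℓr v : Level} (k : CommutativeRing r ℓr)
         (V : LeftModule (CommutativeRing.ring k) v v) where

  private
    module k = CommutativeRing k
    module V = LeftModule V
    open RawMonoidDefs V.+ᴹ-rawMonoid using (sum)

  record Subspace : Set (r ⊔ suc v) where
    field
      ∣_∣      : Pred V.Carrierᴹ v
      resp     : ∀ {x y} → x V.≈ᴹ y → x ∈ ∣_∣ → y ∈ ∣_∣
      0∈       : V.0ᴹ ∈ ∣_∣
      +-closed : ∀ {x y} → x ∈ ∣_∣ → y ∈ ∣_∣ → x V.+ᴹ y ∈ ∣_∣
      *-closed : ∀ a {x} → x ∈ ∣_∣ → a V.*ₗ x ∈ ∣_∣

  open Subspace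

  linearCombination : ∀ {d} → (Fin d → k.Carrier) → (Fin d → V.Carrierᴹ) → V.Carrierᴹ
  linearCombination a b = sum (λ i → a i V.*ₗ b i)

  record IsBasis {d : ℕ} (W : Subspace) (b : Fin d → V.Carrierᴹ) : Set (r ⊔ ℓr ⊔ v) where
    field
      b∈W         : ∀ i → b i ∈ ∣ W ∣
      independent : ∀ a → linearCombination a b V.≈ᴹ V.0ᴹ → ∀ i → a i k.≈ k.0#
      spanning    : ∀ {x} → x ∈ ∣ W ∣ → ∃ λ a → x V.≈ᴹ linearCombination a b

  HasDimension : ℕ → Subspace → Set (r ⊔ ℓr ⊔ v)
  HasDimension d W = ∃ λ (b : Fin d → V.Carrierᴹ) → IsBasis W b

  Grass : ℕ → Setoid (r ⊔ ℓr ⊔ suc v) v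
  Grass d = record
    { Carrier = Σ Subspace (HasDimension d)
    ; _≈_ = λ W W′ → ∣ proj₁ W ∣ ≐ ∣ proj₁ W′ ∣
    ; isEquivalence = record
      { refl  = id , id
      ; sym   = λ (p , q) → q , p
      ; trans = λ (p , q) (p′ , q′) → p′ ∘ p , q ∘ q′
      }
    }

-- Under excluded middle the apartness of a Heyting field is forced to be _≉_, so
-- Heyting fields are then exactly fields.
ringOf : ∀ {ℓ} → HeytingField ℓ ℓ ℓ → CommutativeRing ℓ ℓ
ringOf F = HeytingCommutativeRing.commutativeRing (HeytingField.heytingCommutativeRing F)

HasCharacteristic : ∀ {c ℓ} → CommutativeRing c ℓ → ℕ → Set ℓ
HasCharacteristic R p = ∀ n → (n ×ᴿ 1# ≈ 0#) ⇔ (p ℕ.∣ n)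
  where
  open CommutativeRing R
  open RawMonoidDefs +-rawMonoid renaming (_×_ to _×ᴿ_)

module _ {c ℓ : Level} (R : CommutativeRing c ℓ) where

  open CommutativeRing R
  open SetoidReasoning setoid
  open Solver commutativeSemiring using (solve; _:=_; _:*_)

  record Unit : Set (c ⊔ ℓ) where
    constructor mkUnit
    field
      value   : Carrier
      inverse : Carrier
      isUnit  : value * inverse ≈ 1#

  open Unit

  isUnit-* : ∀ x y → (value x * value y) * (inverse x * inverse y) ≈ 1#
  isUnit-* x y = begin
    (value x * value y) * (inverse x * inverse y)
      ≈⟨ solve 4 (λ a b a′ b′ → (a :* b) :* (a′ :* b′) := (a :* a′) :* (b :* b′)) refl
           (value x) (value y) (inverse x) (inverse y) ⟩
    (value x * inverse x) * (value y * inverse y)   ≈⟨ *-cong (isUnit x) (isUnit y) ⟩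
    1# * 1#                                         ≈⟨ *-identityˡ 1# ⟩
    1#                                              ∎

  inverse-cong : ∀ {x y} → value x ≈ value y → inverse x ≈ inverse y
  inverse-cong {x} {y} p = begin
    inverse x                              ≈⟨ *-identityʳ _ ⟨
    inverse x * 1#                         ≈⟨ *-congˡ (isUnit y) ⟨
    inverse x * (value y * inverse y)      ≈⟨ *-assoc _ _ _ ⟨
    (inverse x * value y) * inverse y      ≈⟨ *-congʳ (*-congˡ p) ⟨
    (inverse x * value x) * inverse y      ≈⟨ *-congʳ (trans (*-comm _ _) (isUnit x)) ⟩
    1# * inverse y                         ≈⟨ *-identityˡ _ ⟩
    inverse y                              ∎

  unitGroup : AbelianGroup (c ⊔ ℓ) ℓ
  unitGroup = record
    { Carrier = Unit
    ; _≈_ = λ x y → value x ≈ value y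
    ; _∙_ = λ x y → mkUnit (value x * value y) (inverse x * inverse y) (isUnit-* x y)
    ; ε = mkUnit 1# 1# (*-identityˡ 1#)
    ; _⁻¹ = λ x → mkUnit (inverse x) (value x) (trans (*-comm _ _) (isUnit x))
    ; isAbelianGroup = record
      { isGroup = record
        { isMonoid = record
          { isSemigroup = record
            { isMagma = record
              { isEquivalence = record { refl = refl ; sym = sym ; trans = trans }
              ; ∙-cong = *-cong
              }
            ; assoc = λ _ _ _ → *-assoc _ _ _
            }
          ; identity = (λ _ → *-identityˡ _) , (λ _ → *-identityʳ _)
          }
        ; inverse = (λ x → trans (*-comm _ _) (isUnit x)) , isUnit
        ; ⁻¹-cong = λ {x} {y} → inverse-cong {x} {y}
        }
      ; comm = λ _ _ → *-comm _ _
      }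
    }

module _ {ℓ : Level} (l : ℕ) (F : HeytingField ℓ ℓ ℓ) where

  F̂* : LeftModule (CommutativeRing.ring (ℤ-adic l)) ℓ ℓ
  F̂* = adicCompletion (unitGroup (ringOf F)) l

  ℚ⊗F̂* : LeftModule (CommutativeRing.ring (ℚ-adic l)) ℓ ℓ
  ℚ⊗F̂* = extendScalars {R = ℤ-adic l} {S = ℚ-adic l} (ℤ→ℚ-adic-isRingHomomorphism l) F̂*

-- Polynomials are lists of coefficients starting from the constant term; trailing
-- zeros are allowed, so equality is that of all coefficients.
module Polynomial {c ℓ : Level} (R : CommutativeRing c ℓ) where

  open CommutativeRing R

  Poly : Set c
  Poly = List Carrier

  coeff : Poly → ℕ → Carrier
  coeff []      _         = 0#
  coeff (a ∷ p) zero      = a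
  coeff (a ∷ p) (ℕ.suc n) = coeff p n

  infix  4 _≈ᴾ_
  infixl 6 _+ᴾ_
  infixl 7 _*ᴾ_

  _≈ᴾ_ : Poly → Poly → Set ℓ
  p ≈ᴾ q = ∀ n → coeff p n ≈ coeff q n

  1ᴾ : Poly
  1ᴾ = 1# ∷ []

  _+ᴾ_ : Poly → Poly → Poly
  []      +ᴾ q       = q
  (a ∷ p) +ᴾ []      = a ∷ p
  (a ∷ p) +ᴾ (b ∷ q) = a + b ∷ p +ᴾ q

  _*ᴾ_ : Poly → Poly → Poly
  []      *ᴾ q = []
  (a ∷ p) *ᴾ q = map (a *_) q +ᴾ (0# ∷ p *ᴾ q)

  eval : Poly → Carrier → Carrier
  eval []      x = 0#
  eval (a ∷ p) x = a + x * eval p x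

  -- (a + X p)′ = p + X p′
  derivative : Poly → Poly
  derivative []      = []
  derivative (a ∷ p) = p +ᴾ (0# ∷ derivative p)

  Separable : Poly → Set (c ⊔ ℓ)
  Separable p = ∃ λ u → ∃ λ v → u *ᴾ p +ᴾ v *ᴾ derivative p ≈ᴾ 1ᴾ

  Monic : Poly → Set ℓ
  Monic p = ∃ λ n → coeff p n ≈ 1# × (∀ m → m > n → coeff p m ≈ 0#)

  NonConstant : Poly → Set ℓ
  NonConstant p = ∃ λ n → ¬ (coeff p (ℕ.suc n) ≈ 0#)

-- A topological group presented by a neighbourhood basis of the identity that
-- consists of subgroups N j.
record LinearTopologicalGroup (c ℓ i n : Level) : Set (suc (c ⊔ ℓ ⊔ i ⊔ n)) where
  field
    group : Group c ℓ

  open Group group public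

  field
    Index     : Set i
    N         : Index → Pred Carrier n
    N-resp    : ∀ j {x y} → x ≈ y → x ∈ N j → y ∈ N j
    N-ε       : ∀ j → ε ∈ N j
    N-∙       : ∀ j {x y} → x ∈ N j → y ∈ N j → x ∙ y ∈ N j
    N-⁻¹      : ∀ j {x} → x ∈ N j → x ⁻¹ ∈ N j
    nonempty  : Index
    _⊓_       : Index → Index → Index
    N-⊓       : ∀ j k {x} → x ∈ N (j ⊓ k) → x ∈ N j × x ∈ N k
    N-conj    : ∀ j g → ∃ λ k → ∀ {x} → x ∈ N k → (g ∙ x) ∙ g ⁻¹ ∈ N j

module _ {c₁ ℓ₁ i₁ n₁ c₂ ℓ₂ i₂ n₂ : Level}
         (G : LinearTopologicalGroup c₁ ℓ₁ i₁ n₁) (H : LinearTopologicalGroup c₂ ℓ₂ i₂ n₂) where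

  private
    module G = LinearTopologicalGroup G
    module H = LinearTopologicalGroup H

  Continuous : (G.Carrier → H.Carrier) → Set (c₁ ⊔ i₁ ⊔ n₁ ⊔ i₂ ⊔ n₂)
  Continuous f = ∀ x k → ∃ λ j → ∀ y → x G.⁻¹ G.∙ y ∈ G.N j → f x H.⁻¹ H.∙ f y ∈ H.N k

record TopologicalGroupIsomorphism {c₁ ℓ₁ i₁ n₁ c₂ ℓ₂ i₂ n₂ : Level}
         (G : LinearTopologicalGroup c₁ ℓ₁ i₁ n₁) (H : LinearTopologicalGroup c₂ ℓ₂ i₂ n₂)
         : Set (c₁ ⊔ ℓ₁ ⊔ i₁ ⊔ n₁ ⊔ c₂ ⊔ ℓ₂ ⊔ i₂ ⊔ n₂) where
  private
    module G = LinearTopologicalGroup G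
    module H = LinearTopologicalGroup H
  field
    bijection : Inverse G.setoid H.setoid
  open Inverse bijection public
  field
    isGroupHomomorphism : IsGroupHomomorphism G.rawGroup H.rawGroup to
    to-continuous       : Continuous G H to
    from-continuous     : Continuous H G from

-- ℤ_l^d with the product topology; the n-th basic neighbourhood of 0 is the
-- kernel of the projection onto (ℤ/lⁿ)^d.
ℤ-adic^ : ℕ → ℕ → LinearTopologicalGroup 0ℓ 0ℓ 0ℓ 0ℓ
ℤ-adic^ l d = record
  { group  = G
  ; Index  = ℕ
  ; N      = N
  ; N-resp = λ n p q i → mod-trans (mod-sym (p i n)) (q i)
  ; N-ε    = λ n i → mod-reflexive ≡.refl
  ; N-∙    = λ n p q i → mod-+ (p i) (q i)
  ; N-⁻¹   = λ n p i → mod-neg (p i)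
  ; nonempty = 0
  ; _⊓_    = ℕ._+_
  ; N-⊓    = λ j k {x} p →
      (λ i → down j (x i) (≡.subst (λ e → at (x i) e) (ℕ.+-comm j k) (p i)))
    , (λ i → down k (x i) (p i))
  ; N-conj = λ n g → n , λ {x} p i → mod-trans
      (mod-reflexive (eq (seq (g i) n) (seq (x i) n))) (p i)
  }
  where
  open AdicInteger
  G : Group 0ℓ 0ℓ
  G = Pointwise.group (Fin d) (CommutativeRing.+-group (ℤ-adic l))

  at : AdicInteger l → ℕ → Set
  at a n = seq a n ≡ 0ℤ [mod l ℕ.^ n ]

  N : ℕ → Pred (Fin d → AdicInteger l) 0ℓ
  N n x = ∀ i → at (x i) n

  weaken : ∀ n {a b} → a ≡ b [mod l ℕ.^ ℕ.suc n ] → a ≡ b [mod l ℕ.^ n ]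
  weaken n (mod∣ p) = mod∣ (ℤ∣.∣-trans (ℤ∣.∣ᵤ⇒∣ (ℕ.divides l ≡.refl)) p)

  down : ∀ {j} k a → at a (j ℕ.+ k) → at a k
  down {zero}    k a p = p
  down {ℕ.suc j} k a p =
    down {j} k a (mod-trans (mod-sym (compatible a (j ℕ.+ k))) (weaken (j ℕ.+ k) p))

  eq : ∀ g x → (g ℤ.+ x) ℤ.+ ℤ.- g ≡ x
  eq = solve-∀

module Extension {ℓ : Level} (F Ω : HeytingField ℓ ℓ ℓ)
                 (ι : HeytingField.Carrier F → HeytingField.Carrier Ω) where

  private
    module F = HeytingField F
    module Ω = HeytingField Ω
    module F[X] = Polynomial (ringOf F)
    module Ω[X] = Polynomial (ringOf Ω)
    module ΩR = CommutativeRing (ringOf Ω)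

  evalᶠ : F[X].Poly → Ω.Carrier → Ω.Carrier
  evalᶠ p x = Ω[X].eval (map ι p) x

  IsAlgebraic : Ω.Carrier → Set ℓ
  IsAlgebraic x = ∃ λ p → ¬ (p F[X].≈ᴾ []) × evalᶠ p x Ω.≈ Ω.0#

  -- The monic generator of the ideal of polynomials vanishing at x.
  record IsMinimalPolynomial (x : Ω.Carrier) (p : F[X].Poly) : Set ℓ where
    field
      monic     : F[X].Monic p
      vanishes  : evalᶠ p x Ω.≈ Ω.0#
      generates : ∀ q → evalᶠ q x Ω.≈ Ω.0# → ∃ λ u → q F[X].≈ᴾ u F[X].*ᴾ p

  IsSeparable : Ω.Carrier → Set ℓ
  IsSeparable x = ∃ λ p → IsMinimalPolynomial x p × F[X].Separable p

  _∈F : Ω.Carrier → Set ℓ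
  x ∈F = ∃ λ a → ι a Ω.≈ x

  record IntermediateField : Set (suc ℓ) where
    field
      ∣_∣        : Pred Ω.Carrier ℓ
      resp       : ∀ {x y} → x Ω.≈ y → x ∈ ∣_∣ → y ∈ ∣_∣
      F⊆         : ∀ a → ι a ∈ ∣_∣
      +-closed   : ∀ {x y} → x ∈ ∣_∣ → y ∈ ∣_∣ → x Ω.+ y ∈ ∣_∣
      *-closed   : ∀ {x y} → x ∈ ∣_∣ → y ∈ ∣_∣ → x Ω.* y ∈ ∣_∣
      neg-closed : ∀ {x} → x ∈ ∣_∣ → Ω.- x ∈ ∣_∣
      0∈         : Ω.0# ∈ ∣_∣
      1∈         : Ω.1# ∈ ∣_∣
      inv-closed : ∀ {x y} → x ∈ ∣_∣ → x Ω.* y Ω.≈ Ω.1# → y ∈ ∣_∣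

  module _ (K : IntermediateField) where

    private
      module K = IntermediateField K

    subfield : RawRing ℓ ℓ
    subfield = record
      { Carrier = ∃ λ x → x ∈ K.∣_∣
      ; _≈_ = λ x y → proj₁ x Ω.≈ proj₁ y
      ; _+_ = λ (x , x∈) (y , y∈) → x Ω.+ y , K.+-closed x∈ y∈
      ; _*_ = λ (x , x∈) (y , y∈) → x Ω.* y , K.*-closed x∈ y∈
      ; -_ = λ (x , x∈) → Ω.- x , K.neg-closed x∈
      ; 0# = Ω.0# , K.0∈
      ; 1# = Ω.1# , K.1∈
      }

    private
      module Kᴿ = RawRing subfield

    record Automorphism : Set ℓ where
      field
        to                : Kᴿ.Carrier → Kᴿ.Carrier
        isRingIsomorphism : IsRingIsomorphism subfield subfield to
        fixesF            : ∀ a → to (ι a , K.F⊆ a) Kᴿ.≈ (ι a , K.F⊆ a)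

      open IsRingIsomorphism isRingIsomorphism public
        using (injective; surjective; +-homo; *-homo; -‿homo; 0#-homo; 1#-homo)
        renaming (⟦⟧-cong to to-cong)

      from : Kᴿ.Carrier → Kᴿ.Carrier
      from y = proj₁ (surjective y)

      to∘from : ∀ y → to (from y) Kᴿ.≈ y
      to∘from y = proj₂ (surjective y) Ω.refl

    open Automorphism

    idᴬ : Automorphism
    idᴬ = record
      { to = id
      ; isRingIsomorphism = Identity.isRingIsomorphism subfield Ω.refl
      ; fixesF = λ _ → Ω.refl
      }

    _∘ᴬ_ : Automorphism → Automorphism → Automorphism
    σ ∘ᴬ τ = record
      { to = to σ ∘ to τ
      ; isRingIsomorphism = Compose.isRingIsomorphism Ω.trans
          (isRingIsomorphism τ) (isRingIsomorphism σ)
      ; fixesF = λ a → Ω.trans (to-cong σ (fixesF τ a)) (fixesF σ a)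
      }

    module _ (σ : Automorphism) where

      pull : ∀ {x y} → to σ x Kᴿ.≈ y → x Kᴿ.≈ from σ y
      pull p = injective σ (Ω.trans p (Ω.sym (to∘from σ _)))

      from-cong : ∀ {x y} → x Kᴿ.≈ y → from σ x Kᴿ.≈ from σ y
      from-cong p = pull (Ω.trans (to∘from σ _) p)

      invᴬ : Automorphism
      invᴬ = record
        { to = from σ
        ; isRingIsomorphism = record
          { isRingMonomorphism = record
            { isRingHomomorphism = record
              { isSemiringHomomorphism = record
                { isNearSemiringHomomorphism = record
                  { +-isMonoidHomomorphism = record
                    { isMagmaHomomorphism = record
                      { isRelHomomorphism = record { cong = from-cong }
                      ; homo = λ x y → Ω.sym (pull
                          (Ω.trans (+-homo σ _ _) (ΩR.+-cong (to∘from σ x) (to∘from σ y))))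
                      }
                    ; ε-homo = Ω.sym (pull (0#-homo σ))
                    }
                  ; *-homo = λ x y → Ω.sym (pull
                      (Ω.trans (*-homo σ _ _) (ΩR.*-cong (to∘from σ x) (to∘from σ y))))
                  }
                ; 1#-homo = Ω.sym (pull (1#-homo σ))
                }
              ; -‿homo = λ x → Ω.sym (pull
                  (Ω.trans (-‿homo σ _) (ΩR.-‿cong (to∘from σ x))))
              }
            ; injective = λ {x} {y} p →
                Ω.trans (Ω.sym (to∘from σ x)) (Ω.trans (to-cong σ p) (to∘from σ y))
            }
          ; surjective = λ y → to σ y , λ {z} p →
              Ω.trans (from-cong {z} {to σ y} p) (Ω.sym (pull Ω.refl))
          }
        ; fixesF = λ a → Ω.sym (pull (fixesF σ a))
        }

    automorphismGroup : Group ℓ ℓ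
    automorphismGroup = record
      { Carrier = Automorphism
      ; _≈_ = λ σ τ → ∀ x → to σ x Kᴿ.≈ to τ x
      ; _∙_ = _∘ᴬ_
      ; ε = idᴬ
      ; _⁻¹ = invᴬ
      ; isGroup = record
        { isMonoid = record
          { isSemigroup = record
            { isMagma = record
              { isEquivalence = record
                { refl  = λ _ → Ω.refl
                ; sym   = λ p x → Ω.sym (p x)
                ; trans = λ p q x → Ω.trans (p x) (q x)
                }
              ; ∙-cong = λ {σ} {σ′} {τ} {τ′} p q x → Ω.trans (p (to τ x)) (to-cong σ′ (q x))
              }
            ; assoc = λ _ _ _ _ → Ω.refl
            }
          ; identity = (λ _ _ → Ω.refl) , (λ _ _ → Ω.refl)
          }
        ; inverse = (λ σ x → Ω.sym (pull σ Ω.refl)) , (λ σ x → to∘from σ x)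
        ; ⁻¹-cong = λ {σ} {τ} p x → Ω.sym (pull σ (Ω.trans (p _) (to∘from τ x)))
        }
      }

    -- The Krull topology: the fixer of a finite subset xs of K is Gal(K/F(xs)).
    galoisGroup : LinearTopologicalGroup ℓ ℓ ℓ ℓ
    galoisGroup = record
      { group  = automorphismGroup
      ; Index  = List Kᴿ.Carrier
      ; N      = λ xs σ → All (λ x → to σ x Kᴿ.≈ x) xs
      ; N-resp = λ xs p → All.map (λ {x} q → Ω.trans (Ω.sym (p x)) q)
      ; N-ε    = λ xs → All.universal (λ _ → Ω.refl) xs
      ; N-∙    = λ xs {σ} {τ} p q →
          All.zipWith (λ (a , b) → Ω.trans (to-cong σ b) a) (p , q)
      ; N-⁻¹   = λ xs {σ} → All.map (λ p → Ω.sym (pull σ p))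
      ; nonempty = []
      ; _⊓_    = _++_
      ; N-⊓    = λ xs ys → All.++⁻ xs
      ; N-conj = λ xs g → map (from g) xs , λ {σ} p →
          All.map (λ {x} q → Ω.trans (to-cong g q) (to∘from g x)) (All.map⁻ p)
      }

    record IsGalois : Set ℓ where
      field
        algebraic  : ∀ {x} → x ∈ K.∣_∣ → IsAlgebraic x
        fixedField : ∀ x → (∀ (σ : Automorphism) → to σ x Kᴿ.≈ x) → proj₁ x ∈F

    record IsℤₗExtension (l d : ℕ) : Set ℓ where
      field
        isGalois    : IsGalois
        isomorphism : TopologicalGroupIsomorphism galoisGroup (ℤ-adic^ l d)

  ℤₗExtensions : (l d : ℕ) → Setoid (suc ℓ) ℓ
  ℤₗExtensions l d = record
    { Carrier = Σ IntermediateField (λ K → IsℤₗExtension K l d)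
    ; _≈_ = λ K K′ → IntermediateField.∣ proj₁ K ∣ ≐ IntermediateField.∣ proj₁ K′ ∣
    ; isEquivalence = record
      { refl  = id , id
      ; sym   = λ (p , q) → q , p
      ; trans = λ (p , q) (p′ , q′) → p′ ∘ p , q ∘ q′
      }
    }

record SeparableClosure {ℓ : Level} (F : HeytingField ℓ ℓ ℓ) : Set (suc ℓ) where
  field
    Ω : HeytingField ℓ ℓ ℓ
    ι : HeytingField.Carrier F → HeytingField.Carrier Ω
    ι-isRingHomomorphism :
      IsRingHomomorphism (CommutativeRing.rawRing (ringOf F)) (CommutativeRing.rawRing (ringOf Ω)) ι

  open HeytingField Ω using (_≈_; 0#)
  open Polynomial (ringOf Ω)
  open Extension F Ω ι public

  field
    separable       : ∀ x → IsSeparable x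
    separablyClosed : ∀ p → NonConstant p → Separable p → ∃ λ x → eval p x ≈ 0#

ContainsRootsOfUnity : {ℓ : Level} {F : HeytingField ℓ ℓ ℓ} → SeparableClosure F → ℕ → Set ℓ
ContainsRootsOfUnity Fˢᵉᵖ l = ∀ ζ n → ζ ^ (l ℕ.^ n) ≈ 1# → ζ ∈F
  where
  open SeparableClosure Fˢᵉᵖ
  open CommutativeRing (ringOf Ω) using (_≈_; 1#; semiring)
  open Exp semiring using (_^_)

{-# OPTIONS --safe #-}
module Submission where

-- Kummer theory matches a ℤ_lᵈ-extension K of F with the closed subgroup of F̂* of those
-- elements whose lⁿ-th roots lie in K for every n. Since μ_{l^∞} ⊂ F, the l-power torsion of
-- F* is divisible, so F̂* is torsion free, and the d-dimensional subspaces of V correspond to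
-- the saturated subgroups of rank d, that is, to those with a "pure" basis: one for which a
-- ℤ-combination is an lⁿ-th power in F* only if lⁿ divides all its coefficients.
--
-- From a pure basis to an extension: adjoin coherent systems of lⁿ-th roots. Conjugating one
-- root at a time by roots of unity is possible because the minimal polynomial of t = ᴺ√a over
-- a subfield L divides Xᴺ − a; its constant term therefore puts some root of unity times tᵐ
-- into L, with m its degree, and purity forces m = N. So every element of ℤ_lᵈ acts.
--
-- From an extension to a pure basis: for each coordinate of ℤ_lᵈ ≅ Gal(K/F), Hilbert 90
-- (by independence of characters on the finite quotients) gives a radical on which Gal acts
-- through that coordinate. Every element of K is a sum of simultaneous eigenvectors of the
-- topological generators, and each of these is an element of F times a monomial in the
-- radicals; hence the radicals generate K and determine it.

open import Level as Level using (Level; _⊔_; 0ℓ)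
open import Algebra.Bundles using (AbelianGroup; CommutativeMonoid; CommutativeRing; Group; RawRing)
open import Algebra.Apartness.Bundles using (HeytingField)
open import Algebra.Module.Bundles using (LeftModule)
open import Algebra.Morphism.Structures using (IsGroupHomomorphism; IsRingHomomorphism)
import Algebra.Properties.AbelianGroup as AbelianGroupProperties
import Algebra.Definitions.RawMonoid as RawMonoidDefs
import Algebra.Properties.Semiring.Exp as Exp
import Algebra.Properties.Semiring.Mult as SemiringMult
import Algebra.Properties.Group as GroupProperties
import Algebra.Properties.Ring as RingProperties
import Algebra.Solver.Ring.NaturalCoefficients.Default as Solver
import Algebra.Properties.CommutativeMonoid.Mult as Mult
import Algebra.Properties.CommutativeMonoid.Sum as Sum
import Algebra.Properties.CommutativeSemigroup as CommutativeSemigroupProperties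
open import Axiom.ExcludedMiddle using (ExcludedMiddle)
open import Data.Empty using (⊥)
open import Data.Fin.Base using (Fin; zero; suc; toℕ; fromℕ; fromℕ<; inject₁)
import Data.Fin.Properties as Fin
open import Data.Integer.Base as ℤ using (ℤ; +_; -[1+_]; 0ℤ; 1ℤ)
import Data.Integer.DivMod as ℤ
import Data.Integer.Properties as ℤ
open import Data.Integer.Divisibility.Signed as ℤ∣ using (divides)
open import Data.Integer.Tactic.RingSolver using (solve-∀)
open import Data.Nat.Base as ℕ using (ℕ; zero; suc)
open import Data.List.Base as List using (List; []; _∷_; map; replicate)
import Data.List.Relation.Unary.All as ListAll
open import Data.List.Relation.Unary.Any as Any using (Any; here; there)
import Data.List.Relation.Unary.Any.Properties as Any
open import Data.List.Relation.Unary.AllPairs as AllPairs using (AllPairs; []; _∷_)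
import Data.List.Membership.Propositional.Properties as List
import Data.List.Relation.Unary.All.Properties as ListAll
import Data.Nat.Divisibility as ℕ
open import Data.Nat.GCD using (GCD; module Bézout)
import Data.Nat.Properties as ℕ
open import Data.Nat.Tactic.RingSolver using () renaming (solve-∀ to ℕ-solve-∀)
open import Data.Nat.Primality as ℕ using (Prime)
import Data.Nat.Induction as ℕ
open import Data.Product.Base using (Σ; ∃; _×_; _,_; proj₁; proj₂)
open import Data.Sum.Base using (_⊎_; inj₁; inj₂)
open import Data.Vec.Base as Vec using (Vec; []; _∷_)
open import Data.Vec.Relation.Unary.All using (All; []; _∷_)
open import Function.Base using (_∘_; id; case_of_)
open import Function.Bundles using (_⇔_; mk⇔; Equivalence; Bijection)
open import Relation.Binary.PropositionalEquality as ≡ using (_≡_)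
open import Relation.Nullary.Decidable.Core using (Dec; yes; no; decidable-stable)
open import Relation.Binary.Bundles using (Setoid)
open import Relation.Binary.Definitions using (tri<; tri≈; tri>)
open import Relation.Nullary.Negation using (¬_; contradiction)
open import Relation.Unary using (Pred; _∈_; _⊆_; _≐_)
import Relation.Binary.Reasoning.Setoid as SetoidReasoning
open import Defs

-- Arithmetic modulo prime powers

-- Two obstacles shape the construction. Adjoining a further radical requires it to have full degree
-- over the field `L` generated by the earlier ones, and this is already Kummer theory for `L`: an
-- element of `L` whose `l`-th power lies in `F*` must be a monomial in the earlier radicals, up to
-- `F*`. Conjugacy (`Conjugate`) and the shape of semi-invariant elements (`Monomial`) are therefore
-- proved by one induction. Secondly, extension of embeddings is not presupposed. Elements of a
-- radical field are named by polynomial expressions, an automorphism re-evaluates the expression at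
-- another system of roots, and its well-definedness says that a vanishing expression vanishes at
-- every system.
--
-- Neither passage is canonical, since roots and resolvents are chosen. The correspondence is well
-- defined all the same, because the ℤ_l-span of the basis is determined by a condition on the
-- extension alone, `RootsIn`. Purity makes this span saturated, which is what allows it to be
-- recovered from the subspace of V.

infix 4 _≡0[mod_]

_≡0[mod_] : ℤ → ℕ → Set
a ≡0[mod m ] = a ≡ 0ℤ [mod m ]

module _ {m : ℕ} where

  ∣⇒≡0 : ∀ {a} → + m ℤ∣.∣ a → a ≡0[mod m ]
  ∣⇒≡0 {a} p = mod-via (≡.sym (ℤ.+-identityʳ a)) p

  ≡0⇒∣ : ∀ {a} → a ≡0[mod m ] → + m ℤ∣.∣ a
  ≡0⇒∣ {a} (mod∣ p) = ≡.subst (+ m ℤ∣.∣_) (ℤ.+-identityʳ a) p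

  ≡⇒-≡0 : ∀ {a b} → a ≡ b [mod m ] → a ℤ.- b ≡0[mod m ]
  ≡⇒-≡0 (mod∣ p) = ∣⇒≡0 p

  -≡0⇒≡ : ∀ {a b} → a ℤ.- b ≡0[mod m ] → a ≡ b [mod m ]
  -≡0⇒≡ p = mod∣ (≡0⇒∣ p)

  multiple≡0 : ∀ k → + m ℤ.* k ≡0[mod m ]
  multiple≡0 k = ∣⇒≡0 (divides k (ℤ.*-comm (+ m) k))

  mod-reduce : .{{_ : ℕ.NonZero m}} → ∀ a → ∃ λ n → n ℕ.< m × a ≡ + n [mod m ]
  mod-reduce a = a ℤ.%ℕ m , ℤ.n%ℕd<d a m ,
    mod-via (≡.trans (eq (+ (a ℤ.%ℕ m)) ((a ℤ./ℕ m) ℤ.* + m))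
                     (≡.cong (ℤ._- + (a ℤ.%ℕ m)) (≡.sym (ℤ.a≡a%ℕn+[a/ℕn]*n a m))))
            (divides (a ℤ./ℕ m) ≡.refl)
    where
    eq : ∀ r s → s ≡ (r ℤ.+ s) ℤ.- r
    eq = solve-∀

mod-unique : ∀ {m a b} → a ℕ.< m → b ℕ.< m → + a ≡ + b [mod m ] → a ≡ b
mod-unique {m} {a} {b} a<m b<m (mod∣ p) with ℤ.∣ a ℤ.⊖ b ∣ in e
... | zero  = ℤ.+-injective (ℤ.i-j≡0⇒i≡j (+ a) (+ b) (≡.trans (ℤ.m-n≡m⊖n a b) (ℤ.∣i∣≡0⇒i≡0 e)))
... | suc k = contradiction
  (≡.subst (m ℕ.∣_) (≡.trans (≡.cong ℤ.∣_∣ (ℤ.m-n≡m⊖n a b)) e) (ℤ∣.∣⇒∣ᵤ p))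
  (ℕ.>⇒∤ (ℕ.≤-<-trans (≡.subst (ℕ._≤ a ℕ.⊔ b) e (ℤ.∣m⊝n∣≤m⊔n a b)) (ℕ.⊔-pres-<m a<m b<m)))

mod-weaken : ∀ {k m a b} → a ≡ b [mod k ℕ.* m ] → a ≡ b [mod m ]
mod-weaken {k} {m} (mod∣ p) = mod∣ (ℤ∣.∣-trans (ℤ∣.∣ᵤ⇒∣ (ℕ.divides k ≡.refl)) p)

mod-scale : ∀ {k m a b} → a ≡ b [mod m ] → + k ℤ.* a ≡ + k ℤ.* b [mod k ℕ.* m ]
mod-scale {k} {m} {a} {b} (mod∣ (divides q e)) = mod∣ (divides q (begin
  + k ℤ.* a ℤ.- + k ℤ.* b   ≡⟨ eq (+ k) a b ⟩
  + k ℤ.* (a ℤ.- b)         ≡⟨ ≡.cong (+ k ℤ.*_) e ⟩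
  + k ℤ.* (q ℤ.* + m)       ≡⟨ eq′ (+ k) q (+ m) ⟩
  q ℤ.* (+ k ℤ.* + m)       ≡⟨ ≡.cong (q ℤ.*_) (ℤ.pos-* k m) ⟨
  q ℤ.* + (k ℕ.* m)         ∎))
  where
  open ≡.≡-Reasoning
  eq : ∀ k a b → k ℤ.* a ℤ.- k ℤ.* b ≡ k ℤ.* (a ℤ.- b)
  eq = solve-∀
  eq′ : ∀ k q m → k ℤ.* (q ℤ.* m) ≡ q ℤ.* (k ℤ.* m)
  eq′ = solve-∀

mod-unscale : ∀ k {m a b} .{{_ : ℕ.NonZero k}} →
              + k ℤ.* a ≡ + k ℤ.* b [mod k ℕ.* m ] → a ≡ b [mod m ]
mod-unscale (suc k) {m} {a} {b} (mod∣ p) =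
  mod∣ (ℤ∣.*-cancelˡ-∣ (+ suc k) (≡.subst₂ ℤ∣._∣_ (ℤ.pos-* (suc k) m) (eq (+ suc k) a b) p))
  where
  eq : ∀ k a b → k ℤ.* a ℤ.- k ℤ.* b ≡ k ℤ.* (a ℤ.- b)
  eq = solve-∀

module PrimePowers {l : ℕ} (l-prime : Prime l) where

  instance
    l-nonZero : ℕ.NonZero l
    l-nonZero = ℕ.prime⇒nonZero l-prime

  l^-nonZero : ∀ n → ℕ.NonZero (l ℕ.^ n)
  l^-nonZero n = ℕ.m^n≢0 l n

  l∤1 : ¬ (1ℤ ≡0[mod l ])
  l∤1 p = ℕ.>⇒∤ (ℕ.nonTrivial⇒n>1 l {{ℕ.prime⇒nonTrivial l-prime}}) (ℤ∣.∣⇒∣ᵤ (≡0⇒∣ p))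

  inverse-mod-l : ∀ {c} → ¬ (c ≡0[mod l ]) → ∃ λ u → u ℤ.* c ≡ 1ℤ [mod l ]
  inverse-mod-l {c} l∤c with mod-reduce {l} c
  ... | n , _ , c≡n with Bézout.lemma n l
  ... | Bézout.result d g b with ℕ.prime⇒irreducible l-prime (proj₂ (GCD.commonDivisor g))
  ... | inj₂ ≡.refl = contradiction
          (mod-trans c≡n (∣⇒≡0 (ℤ∣.∣ᵤ⇒∣ (proj₁ (GCD.commonDivisor g))))) l∤c
  ... | inj₁ ≡.refl with b
  ... | Bézout.+- x y eq = + x , mod-trans (mod-* {a = + x} (mod-reflexive ≡.refl) c≡n)
          (mod-via (≡.trans (lemma (+ y ℤ.* + l)) (≡.cong (ℤ._- 1ℤ) (cast x y n l eq)))
                   (divides (+ y) ≡.refl))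
    where
    lemma : ∀ z → z ≡ (1ℤ ℤ.+ z) ℤ.- 1ℤ
    lemma = solve-∀
    cast : ∀ x y n l → 1 ℕ.+ y ℕ.* l ≡ x ℕ.* n → 1ℤ ℤ.+ + y ℤ.* + l ≡ + x ℤ.* + n
    cast x y n l e rewrite ≡.sym (ℤ.pos-* y l) | ≡.sym (ℤ.pos-* x n) = ≡.cong +_ e
  ... | Bézout.-+ x y eq = ℤ.- + x , mod-trans (mod-* {a = ℤ.- + x} (mod-reflexive ≡.refl) c≡n)
          (mod-via (≡.trans (≡.cong ℤ.-_ (≡.sym (cast x y n l eq))) (lemma (+ x) (+ n)))
                   (divides (ℤ.- + y) (ℤ.neg-distribˡ-* (+ y) (+ l))))
    where
    lemma : ∀ x n → ℤ.- (1ℤ ℤ.+ x ℤ.* n) ≡ (ℤ.- x) ℤ.* n ℤ.- 1ℤ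
    lemma = solve-∀
    cast : ∀ x y n l → 1 ℕ.+ x ℕ.* n ≡ y ℕ.* l → 1ℤ ℤ.+ + x ℤ.* + n ≡ + y ℤ.* + l
    cast x y n l e rewrite ≡.sym (ℤ.pos-* y l) | ≡.sym (ℤ.pos-* x n) = ≡.cong +_ e

  -- The errors multiply: `1 - (1 - u * c) * (1 - u′ * c)` is divisible by `c`, and its cofactor is
  -- the new inverse. It is correct modulo `l * lⁿ` when `u` is correct modulo `l` and `u′` modulo
  -- `lⁿ`.
  inverse-mod-l^ : ∀ {c} → ¬ (c ≡0[mod l ]) → ∀ n → ∃ λ u → u ℤ.* c ≡ 1ℤ [mod l ℕ.^ n ]
  inverse-mod-l^ {c} l∤c zero = 0ℤ , mod∣ (divides (0ℤ ℤ.* c ℤ.- 1ℤ) (≡.sym (ℤ.*-identityʳ _)))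
  inverse-mod-l^ {c} l∤c (suc n)
    with inverse-mod-l l∤c | inverse-mod-l^ l∤c n
  ... | u , mod∣ (divides v p) | u′ , mod∣ (divides v′ p′) =
    u ℤ.+ u′ ℤ.- u ℤ.* u′ ℤ.* c , mod∣ (divides (ℤ.- (v ℤ.* v′)) (begin
      (u ℤ.+ u′ ℤ.- u ℤ.* u′ ℤ.* c) ℤ.* c ℤ.- 1ℤ        ≡⟨ eq u u′ c ⟩
      ℤ.- ((u ℤ.* c ℤ.- 1ℤ) ℤ.* (u′ ℤ.* c ℤ.- 1ℤ))      ≡⟨ ≡.cong ℤ.-_ (≡.cong₂ ℤ._*_ p p′) ⟩
      ℤ.- ((v ℤ.* + l) ℤ.* (v′ ℤ.* + (l ℕ.^ n)))        ≡⟨ eq′ v v′ (+ l) (+ (l ℕ.^ n)) ⟩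
      ℤ.- (v ℤ.* v′) ℤ.* (+ l ℤ.* + (l ℕ.^ n))          ≡⟨ ≡.cong (ℤ.- (v ℤ.* v′) ℤ.*_) (ℤ.pos-* l (l ℕ.^ n)) ⟨
      ℤ.- (v ℤ.* v′) ℤ.* + (l ℕ.* l ℕ.^ n)              ∎))
    where
    open ≡.≡-Reasoning
    eq : ∀ u u′ c → (u ℤ.+ u′ ℤ.- u ℤ.* u′ ℤ.* c) ℤ.* c ℤ.- 1ℤ ≡
                    ℤ.- ((u ℤ.* c ℤ.- 1ℤ) ℤ.* (u′ ℤ.* c ℤ.- 1ℤ))
    eq = solve-∀
    eq′ : ∀ v v′ l m → ℤ.- ((v ℤ.* l) ℤ.* (v′ ℤ.* m)) ≡ ℤ.- (v ℤ.* v′) ℤ.* (l ℤ.* m)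
    eq′ = solve-∀

module _ {l : ℕ} where

  open AdicInteger

  private
    module ℤₗ = CommutativeRing (ℤ-adic l)
    open Exp ℤₗ.semiring using (_^_)
    open RawMonoidDefs ℤₗ.+-rawMonoid renaming (_×_ to _×#_)

  seq-compatible : ∀ (a : AdicInteger l) k n → seq a (k ℕ.+ n) ≡ seq a n [mod l ℕ.^ n ]
  seq-compatible a zero    n = mod-reflexive ≡.refl
  seq-compatible a (suc k) n = mod-trans (weaken-+ k n (compatible a (k ℕ.+ n))) (seq-compatible a k n)
    where
    weaken-+ : ∀ k n {a b} → a ≡ b [mod l ℕ.^ (k ℕ.+ n) ] → a ≡ b [mod l ℕ.^ n ]
    weaken-+ zero    n p = p
    weaken-+ (suc k) n p = weaken-+ k n (mod-weaken {l} p)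

  constant : ℤ → AdicInteger l
  constant a = mkAdic (λ _ → a) (λ _ → mod-reflexive ≡.refl)

  -- Unfolds to the private element that `ℚ-adic` inverts; the final instantiation relies on this
  -- coincidence.
  l# : AdicInteger l
  l# = l ×# ℤₗ.1#

  seq-×1 : ∀ m n → seq (m ×# ℤₗ.1#) n ≡ + m
  seq-×1 zero    n = ≡.refl
  seq-×1 (suc m) n = ≡.cong (ℤ._+_ 1ℤ) (seq-×1 m n)

  seq-l#^ : ∀ k n → seq (l# ^ k) n ≡ + (l ℕ.^ k)
  seq-l#^ zero    n = ≡.refl
  seq-l#^ (suc k) n = ≡.trans (≡.cong₂ ℤ._*_ (seq-×1 l n) (seq-l#^ k n)) (≡.sym (ℤ.pos-* l (l ℕ.^ k)))

  seq-compatibleʳ : ∀ (a : AdicInteger l) n k → seq a (n ℕ.+ k) ≡ seq a n [mod l ℕ.^ n ]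
  seq-compatibleʳ a n k = ≡.subst (λ i → seq a i ≡ seq a n [mod l ℕ.^ n ]) (ℕ.+-comm k n) (seq-compatible a k n)

module _ {l : ℕ} (l-prime : Prime l) where

  open AdicInteger
  open PrimePowers l-prime

  private
    module ℤₗ = CommutativeRing (ℤ-adic l)

  -- Cancelling `lᵏ` costs `k` digits, so component `n` is read off from component `k + n`. The same
  -- shift of levels governs the divisions in the completion below.
  ℤₗ-torsionFree : ∀ k (a : AdicInteger l) → constant (+ (l ℕ.^ k)) ℤₗ.* a ℤₗ.≈ ℤₗ.0# → a ℤₗ.≈ ℤₗ.0#
  ℤₗ-torsionFree k a p n = mod-trans (mod-sym (seq-compatible a k n)) (mod-unscale (l ℕ.^ k)
      (mod-trans (≡.subst (+ (l ℕ.^ k) ℤ.* seq a (k ℕ.+ n) ≡0[mod_]) (ℕ.^-distribˡ-+-* l k n) (p (k ℕ.+ n)))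
        (mod-reflexive (≡.sym (ℤ.*-zeroʳ (+ (l ℕ.^ k)))))))
    where instance _ = l^-nonZero k

-- Congruences in abelian groups and l-adic completions

module Congruence {a : Level} (A : AbelianGroup (a ⊔ a) a) where

  open AbelianGroup A
  open AbelianGroupProperties A using (⁻¹-∙-comm; ε⁻¹≈ε)
  open Sum commutativeMonoid public using (sum; sum-cong-≋; ∑-distrib-+)
  open CommutativeSemigroupProperties commutativeSemigroup using (interchange)
  open SetoidReasoning setoid

  infixr 7.5 _•_
  _•_ : ℤ → Carrier → Carrier
  _•_ = _·_ A

  infix 4 _≡ₐ_[_]
  _≡ₐ_[_] : Carrier → Carrier → ℕ → Set a
  x ≡ₐ y [ m ] = _≡ᴬ_[mod_] A x y m

  •-1 : ∀ x → 1ℤ • x ≈ x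
  •-1 x = identityʳ x

  •-⁻¹ : ∀ z x → z • (x ⁻¹) ≈ (z • x) ⁻¹
  •-⁻¹ z x = begin
    z • (x ⁻¹)                              ≈⟨ identityʳ _ ⟨
    z • (x ⁻¹) ∙ ε                          ≈⟨ ∙-congˡ (inverseʳ (z • x)) ⟨
    z • (x ⁻¹) ∙ (z • x ∙ (z • x) ⁻¹)       ≈⟨ assoc _ _ _ ⟨
    (z • (x ⁻¹) ∙ z • x) ∙ (z • x) ⁻¹       ≈⟨ ∙-congʳ (·-∙ A z (x ⁻¹) x) ⟨
    z • (x ⁻¹ ∙ x) ∙ (z • x) ⁻¹             ≈⟨ ∙-congʳ (trans (·-congˡ A z (inverseˡ x)) (·-ε A z)) ⟩
    ε ∙ (z • x) ⁻¹                          ≈⟨ identityˡ _ ⟩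
    (z • x) ⁻¹                              ∎

  •-comm : ∀ w z x → w • z • x ≈ z • w • x
  •-comm w z x = begin
    w • z • x        ≈⟨ ·-* A x w z ⟨
    (w ℤ.* z) • x    ≈⟨ ·-congʳ A x (ℤ.*-comm w z) ⟩
    (z ℤ.* w) • x    ≈⟨ ·-* A x z w ⟩
    z • w • x        ∎

  •-pos-* : ∀ m n x → + (m ℕ.* n) • x ≈ + m • + n • x
  •-pos-* m n x = trans (·-congʳ A x (ℤ.pos-* m n)) (·-* A x (+ m) (+ n))

  ∙⁻¹≈⇒≈∙ : ∀ {x y z} → x ∙ y ⁻¹ ≈ z → x ≈ z ∙ y
  ∙⁻¹≈⇒≈∙ {x} {y} {z} p = begin
    x                  ≈⟨ identityʳ x ⟨
    x ∙ ε              ≈⟨ ∙-congˡ (inverseˡ y) ⟨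
    x ∙ (y ⁻¹ ∙ y)     ≈⟨ assoc _ _ _ ⟨
    (x ∙ y ⁻¹) ∙ y     ≈⟨ ∙-congʳ p ⟩
    z ∙ y              ∎

  ∙-cancel-⁻¹ : ∀ x y z → (x ∙ y) ∙ (x ∙ z) ⁻¹ ≈ y ∙ z ⁻¹
  ∙-cancel-⁻¹ x y z = begin
    (x ∙ y) ∙ (x ∙ z) ⁻¹       ≈⟨ ∙-congˡ (⁻¹-∙-comm x z) ⟨
    (x ∙ y) ∙ (x ⁻¹ ∙ z ⁻¹)    ≈⟨ interchange x y (x ⁻¹) (z ⁻¹) ⟩
    (x ∙ x ⁻¹) ∙ (y ∙ z ⁻¹)    ≈⟨ ∙-congʳ (inverseʳ x) ⟩
    ε ∙ (y ∙ z ⁻¹)             ≈⟨ identityˡ _ ⟩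
    y ∙ z ⁻¹                   ∎

  ∙⁻¹≈ε⇒≈ : ∀ {x y} → x ∙ y ⁻¹ ≈ ε → x ≈ y
  ∙⁻¹≈ε⇒≈ p = trans (∙⁻¹≈⇒≈∙ p) (identityˡ _)

  ≡ₐ-refl : ∀ {m x} → x ≡ₐ x [ m ]
  ≡ₐ-refl = modᴬ-reflexive A refl

  module _ {m : ℕ} where

    ≈⇒≡ₐ : ∀ {x y} → x ≈ y → x ≡ₐ y [ m ]
    ≈⇒≡ₐ = modᴬ-reflexive A

    ≡ₐ-respˡ : ∀ {x x′ y} → x ≈ x′ → x ≡ₐ y [ m ] → x′ ≡ₐ y [ m ]
    ≡ₐ-respˡ p = modᴬ-trans A (≈⇒≡ₐ (sym p))

    ≡ₐ-respʳ : ∀ {x y y′} → y ≈ y′ → x ≡ₐ y [ m ] → x ≡ₐ y′ [ m ]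
    ≡ₐ-respʳ p q = modᴬ-trans A q (≈⇒≡ₐ p)

    ≡ₐ⇒∙⁻¹ : ∀ {x y} → x ≡ₐ y [ m ] → x ∙ y ⁻¹ ≡ₐ ε [ m ]
    ≡ₐ⇒∙⁻¹ {x} {y} p = ≡ₐ-respʳ (inverseʳ y) (modᴬ-∙ A p ≡ₐ-refl)

    ∙⁻¹⇒≡ₐ : ∀ {x y} → x ∙ y ⁻¹ ≡ₐ ε [ m ] → x ≡ₐ y [ m ]
    ∙⁻¹⇒≡ₐ {x} {y} p = ≡ₐ-respˡ (trans (assoc _ _ _) (trans (∙-congˡ (inverseˡ y)) (identityʳ x)))
                         (≡ₐ-respʳ (identityˡ y) (modᴬ-∙ A p ≡ₐ-refl))

    multiple≡ₐε : ∀ x → + m • x ≡ₐ ε [ m ]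
    multiple≡ₐε x = mod-by (sym (identityˡ _))

    •≡ₐε : ∀ {z} x → z ≡0[mod m ] → z • x ≡ₐ ε [ m ]
    •≡ₐε x p = modᴬ-· A p (≡ₐ-refl {x = x})

    ≡ₐ-• : ∀ z {x y} → x ≡ₐ y [ m ] → z • x ≡ₐ z • y [ m ]
    ≡ₐ-• z p = modᴬ-· A {w = z} (mod-reflexive ≡.refl) p

    •-≡ : ∀ {w z} x → w ≡ z [mod m ] → w • x ≡ₐ z • x [ m ]
    •-≡ x p = modᴬ-· A p (≡ₐ-refl {x = x})

  ≡ₐ-scale : ∀ k {m x y} → x ≡ₐ y [ m ] → + k • x ≡ₐ + k • y [ k ℕ.* m ]
  ≡ₐ-scale k {m} {x} {y} (mod-by {z} p) = mod-by {quotient = z} (begin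
    + k • x                           ≈⟨ ·-congˡ A (+ k) p ⟩
    + k • (y ∙ + m • z)               ≈⟨ ·-∙ A (+ k) y (+ m • z) ⟩
    + k • y ∙ + k • + m • z           ≈⟨ ∙-congˡ (•-pos-* k m z) ⟨
    + k • y ∙ + (k ℕ.* m) • z         ∎)

  ≡ₐ-weaken : ∀ k {m x y} → x ≡ₐ y [ k ℕ.* m ] → x ≡ₐ y [ m ]
  ≡ₐ-weaken k {m} {x} {y} (mod-by {z} p) = mod-by {quotient = + k • z} (begin
    x                          ≈⟨ p ⟩
    y ∙ + (k ℕ.* m) • z        ≈⟨ ∙-congˡ (•-pos-* k m z) ⟩
    y ∙ + k • + m • z          ≈⟨ ∙-congˡ (•-comm (+ k) (+ m) z) ⟩
    y ∙ + m • + k • z          ∎)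

  ≡ₐ-modulus : ∀ {m m′ x y} → m ≡ m′ → x ≡ₐ y [ m ] → x ≡ₐ y [ m′ ]
  ≡ₐ-modulus ≡.refl p = p

  ≡ₐ-1 : ∀ {x y} → x ≡ₐ y [ 1 ]
  ≡ₐ-1 {x} {y} = mod-by {quotient = y ⁻¹ ∙ x} (sym (begin
    y ∙ 1ℤ • (y ⁻¹ ∙ x)    ≈⟨ ∙-congˡ (•-1 _) ⟩
    y ∙ (y ⁻¹ ∙ x)         ≈⟨ assoc _ _ _ ⟨
    (y ∙ y ⁻¹) ∙ x         ≈⟨ ∙-congʳ (inverseʳ y) ⟩
    ε ∙ x                  ≈⟨ identityˡ x ⟩
    x                      ∎))

  comb : ∀ {d} → (Fin d → ℤ) → (Fin d → Carrier) → Carrier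
  comb c x = sum (λ j → c j • x j)

  comb-congˡ : ∀ {d} {c c′ : Fin d → ℤ} x → (∀ j → c j ≡ c′ j) → comb c x ≈ comb c′ x
  comb-congˡ x p = sum-cong-≋ λ j → ·-congʳ A (x j) (p j)

  comb-congʳ : ∀ {d} (c : Fin d → ℤ) {x x′} → (∀ j → x j ≈ x′ j) → comb c x ≈ comb c x′
  comb-congʳ c p = sum-cong-≋ λ j → ·-congˡ A (c j) (p j)

  comb-mod : ∀ {m d} {c c′ : Fin d → ℤ} {x x′} → (∀ j → c j ≡ c′ j [mod m ]) →
             (∀ j → x j ≡ₐ x′ j [ m ]) → comb c x ≡ₐ comb c′ x′ [ m ]
  comb-mod {d = zero}  p q = ≡ₐ-refl
  comb-mod {d = suc d} {c} p q =
    modᴬ-∙ A (modᴬ-· A {w = c zero} (p zero) (q zero)) (comb-mod {c = c ∘ suc} (p ∘ suc) (q ∘ suc))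

  comb-modʳ : ∀ {m d} (c : Fin d → ℤ) {x x′} → (∀ j → x j ≡ₐ x′ j [ m ]) → comb c x ≡ₐ comb c x′ [ m ]
  comb-modʳ c = comb-mod {c = c} (λ _ → mod-reflexive ≡.refl)

  comb-+ : ∀ {d} (c c′ : Fin d → ℤ) x → comb (λ j → c j ℤ.+ c′ j) x ≈ comb c x ∙ comb c′ x
  comb-+ c c′ x = trans (sum-cong-≋ λ j → ·-+ A (x j) (c j) (c′ j))
                        (∑-distrib-+ (λ j → c j • x j) (λ j → c′ j • x j))

  comb-∙ : ∀ {d} (c : Fin d → ℤ) x x′ → comb c (λ j → x j ∙ x′ j) ≈ comb c x ∙ comb c x′
  comb-∙ c x x′ = trans (sum-cong-≋ λ j → ·-∙ A (c j) (x j) (x′ j))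
                        (∑-distrib-+ (λ j → c j • x j) (λ j → c j • x′ j))

  •-sum : ∀ {d} z (f : Fin d → Carrier) → z • sum f ≈ sum (λ j → z • f j)
  •-sum {zero}  z f = ·-ε A z
  •-sum {suc d} z f = trans (·-∙ A z _ _) (∙-congˡ (•-sum z (f ∘ suc)))

  comb-* : ∀ {d} z (c : Fin d → ℤ) x → comb (λ j → z ℤ.* c j) x ≈ z • comb c x
  comb-* z c x = trans (sum-cong-≋ λ j → ·-* A (x j) z (c j)) (sym (•-sum z (λ j → c j • x j)))

  comb-*ʳ : ∀ {d} z (c : Fin d → ℤ) x → comb c (λ j → z • x j) ≈ z • comb c x
  comb-*ʳ z c x = trans (sum-cong-≋ λ j → •-comm (c j) z (x j)) (sym (•-sum z (λ j → c j • x j)))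

  comb-neg : ∀ {d} (c : Fin d → ℤ) x → comb (λ j → ℤ.- c j) x ≈ comb c x ⁻¹
  comb-neg {zero}  c x = sym ε⁻¹≈ε
  comb-neg {suc d} c x = trans (∙-cong (·-neg A (x zero) (c zero)) (comb-neg (c ∘ suc) (x ∘ suc)))
                               (⁻¹-∙-comm _ _)

  comb-- : ∀ {d} (c c′ : Fin d → ℤ) x → comb (λ j → c j ℤ.- c′ j) x ≈ comb c x ∙ comb c′ x ⁻¹
  comb-- c c′ x = trans (comb-+ c (λ j → ℤ.- c′ j) x) (∙-congˡ (comb-neg c′ x))

  comb-divisible : ∀ {d m} (c : Fin d → ℤ) x → (∀ j → c j ≡0[mod m ]) →
                   ∃ λ q → comb c x ≈ + m • comb q x
  comb-divisible {m = m} c x p = q , trans (comb-congˡ x eq) (comb-* (+ m) q x)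
    where
    q = λ j → ℤ∣.quotient (≡0⇒∣ (p j))
    eq : ∀ j → c j ≡ + m ℤ.* q j
    eq j = ≡.trans (ℤ∣._∣_.equality (≡0⇒∣ (p j))) (ℤ.*-comm (q j) (+ m))

-- Linear combinations

module LinearCombination {v : Level} {k : CommutativeRing 0ℓ 0ℓ}
  (V : LeftModule (CommutativeRing.ring k) v v) where

  private
    module k = CommutativeRing k
    module ΣV = Sum (LeftModule.+ᴹ-commutativeMonoid V)
  open LeftModule V
  open Subspace

  lin : ∀ {d} → (Fin d → k.Carrier) → (Fin d → Carrierᴹ) → Carrierᴹ
  lin = linearCombination k V

  lin-cong : ∀ {d} {q q′ : Fin d → k.Carrier} (b : Fin d → Carrierᴹ) →
             (∀ j → q j k.≈ q′ j) → lin q b ≈ᴹ lin q′ b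
  lin-cong {zero}  b p = ≈ᴹ-refl
  lin-cong {suc d} b p = +ᴹ-cong (*ₗ-cong (p zero) ≈ᴹ-refl) (lin-cong (b ∘ suc) (p ∘ suc))

  lin-+ : ∀ {d} (c c′ : Fin d → k.Carrier) x → lin (λ j → c j k.+ c′ j) x ≈ᴹ lin c x +ᴹ lin c′ x
  lin-+ c c′ x = ≈ᴹ-trans (ΣV.sum-cong-≋ λ j → *ₗ-distribʳ (x j) (c j) (c′ j))
                          (ΣV.∑-distrib-+ (λ j → c j *ₗ x j) (λ j → c′ j *ₗ x j))

  lin-* : ∀ {d} a (c : Fin d → k.Carrier) x → lin (λ j → a k.* c j) x ≈ᴹ a *ₗ lin c x
  lin-* {zero}  a c x = ≈ᴹ-sym (*ₗ-zeroʳ a)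
  lin-* {suc d} a c x = ≈ᴹ-trans (+ᴹ-cong (*ₗ-assoc _ _ _) (lin-* a (c ∘ suc) (x ∘ suc)))
                                 (≈ᴹ-sym (*ₗ-distribˡ a _ _))

  lin-zero : ∀ {d} (x : Fin d → Carrierᴹ) → lin (λ _ → k.0#) x ≈ᴹ 0ᴹ
  lin-zero {zero}  x = ≈ᴹ-refl
  lin-zero {suc d} x = ≈ᴹ-trans (+ᴹ-cong (*ₗ-zeroˡ (x zero)) (lin-zero (x ∘ suc))) (+ᴹ-identityˡ 0ᴹ)

  lin∈ : ∀ {d} (U : Subspace k V) (q : Fin d → k.Carrier) {b} → (∀ j → b j ∈ ∣ U ∣) → lin q b ∈ ∣ U ∣
  lin∈ {zero}  U q p = 0∈ U
  lin∈ {suc d} U q p = +-closed U (*-closed U (q zero) (p zero)) (lin∈ U (q ∘ suc) (p ∘ suc))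

  neg-closed : (U : Subspace k V) → ∀ {x} → x ∈ ∣ U ∣ → -ᴹ x ∈ ∣ U ∣
  neg-closed U {x} p = resp U (inverseˡ-unique _ _ (≈ᴹ-trans
      (+ᴹ-cong ≈ᴹ-refl (≈ᴹ-sym (*ₗ-identityˡ x)))
      (≈ᴹ-trans (≈ᴹ-sym (*ₗ-distribʳ x (k.- k.1#) k.1#))
        (≈ᴹ-trans (*ₗ-cong (k.-‿inverseˡ k.1#) ≈ᴹ-refl) (*ₗ-zeroˡ x)))))
    (*-closed U (k.- k.1#) p)
    where open AbelianGroupProperties +ᴹ-abelianGroup using (inverseˡ-unique)

  linSpan : ∀ {d} → (Fin d → Carrierᴹ) → Subspace k V
  linSpan b = record
    { ∣_∣      = λ v → ∃ λ q → v ≈ᴹ lin q b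
    ; resp     = λ v≈w (q , p) → q , ≈ᴹ-trans (≈ᴹ-sym v≈w) p
    ; 0∈       = (λ _ → k.0#) , ≈ᴹ-sym (lin-zero b)
    ; +-closed = λ (q , p) (q′ , p′) → (λ j → q j k.+ q′ j) ,
        ≈ᴹ-trans (+ᴹ-cong p p′) (≈ᴹ-sym (lin-+ q q′ b))
    ; *-closed = λ a (q , p) → (λ j → a k.* q j) ,
        ≈ᴹ-trans (*ₗ-cong k.refl p) (≈ᴹ-sym (lin-* a q b))
    }

  private
    cons : ∀ {d} → k.Carrier → (Fin d → k.Carrier) → Fin (suc d) → k.Carrier
    cons a q zero    = a
    cons a q (suc j) = q j

  b∈linSpan : ∀ {d} (b : Fin d → Carrierᴹ) j → b j ∈ ∣ linSpan b ∣
  b∈linSpan b zero = cons k.1# (λ _ → k.0#) , ≈ᴹ-sym (≈ᴹ-trans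
    (+ᴹ-cong (*ₗ-identityˡ (b zero)) (lin-zero (b ∘ suc))) (+ᴹ-identityʳ _))
  b∈linSpan b (suc j) with b∈linSpan (b ∘ suc) j
  ... | q , p = cons k.0# q , ≈ᴹ-trans p (≈ᴹ-sym (≈ᴹ-trans
    (+ᴹ-cong (*ₗ-zeroˡ (b zero)) ≈ᴹ-refl) (+ᴹ-identityˡ _)))

  LinearlyIndependent : ∀ {d} → (Fin d → Carrierᴹ) → Set v
  LinearlyIndependent b = ∀ q → lin q b ≈ᴹ 0ᴹ → ∀ j → q j k.≈ k.0#

  tail-independent : ∀ {d} (b : Fin (suc d) → Carrierᴹ) →
                     LinearlyIndependent b → LinearlyIndependent (b ∘ suc)
  tail-independent b independent q p j = independent (cons k.0# q)
    (≈ᴹ-trans (+ᴹ-cong (*ₗ-zeroˡ (b zero)) p) (+ᴹ-identityˡ _)) (suc j)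

  head∉tail : ∀ {d} (b : Fin (suc d) → Carrierᴹ) → LinearlyIndependent b →
              b zero ∈ ∣ linSpan (b ∘ suc) ∣ → k.1# k.≈ k.0#
  head∉tail b independent (q , p) = k.trans (k.sym (k.+-identityʳ k.1#))
    (k.trans (k.+-congˡ (k.sym -1≈0)) (k.-‿inverseʳ k.1#))
    where
    -1≈0 : k.- k.1# k.≈ k.0#
    -1≈0 = independent (cons (k.- k.1#) q) (≈ᴹ-trans (+ᴹ-cong ≈ᴹ-refl (≈ᴹ-sym p))
      (≈ᴹ-trans (+ᴹ-cong ≈ᴹ-refl (≈ᴹ-sym (*ₗ-identityˡ (b zero))))
        (≈ᴹ-trans (≈ᴹ-sym (*ₗ-distribʳ (b zero) _ _))
          (≈ᴹ-trans (*ₗ-cong (k.-‿inverseˡ k.1#) ≈ᴹ-refl) (*ₗ-zeroˡ (b zero)))))) zero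

-- Completions of groups with divisible l-power torsion, and pure families

module Completion {a : Level} {l : ℕ} (l-prime : Prime l) (A : AbelianGroup (a ⊔ a) a)
  (torsionDivisible : ∀ j m x → AbelianGroup._≈_ A (_·_ A (+ (l ℕ.^ j)) x) (AbelianGroup.ε A) →
                      _≡ᴬ_[mod_] A x (AbelianGroup.ε A) (l ℕ.^ m)) where

  open PrimePowers l-prime
  open AbelianGroup A
  open Congruence A
  open CompatibleSequence
  module Z = AdicInteger

  module ℤₗ = CommutativeRing (ℤ-adic l)

  open LeftModule (adicCompletion A l) using (Carrierᴹ; _≈ᴹ_; _*ₗ_; 0ᴹ)

  -- The l-power torsion of A being divisible is what makes the completion torsion free.
  ≡ₐ-unscale : ∀ j m {x y} → + (l ℕ.^ j) • x ≡ₐ + (l ℕ.^ j) • y [ l ℕ.^ j ℕ.* l ℕ.^ m ] →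
               x ≡ₐ y [ l ℕ.^ m ]
  ≡ₐ-unscale j m {x} {y} (mod-by {z} p) = modᴬ-trans A
      (∙⁻¹⇒≡ₐ (torsionDivisible j m (x ∙ (y ∙ + M • z) ⁻¹) torsion))
      (≡ₐ-respʳ (identityʳ y) (modᴬ-∙ A ≡ₐ-refl (multiple≡ₐε z)))
    where
    J = l ℕ.^ j
    M = l ℕ.^ m
    open SetoidReasoning setoid
    torsion : + J • (x ∙ (y ∙ + M • z) ⁻¹) ≈ ε
    torsion = begin
      + J • (x ∙ (y ∙ + M • z) ⁻¹)                ≈⟨ ·-∙ A (+ J) x _ ⟩
      + J • x ∙ + J • ((y ∙ + M • z) ⁻¹)          ≈⟨ ∙-cong p (•-⁻¹ (+ J) _) ⟩
      W ∙ (+ J • (y ∙ + M • z)) ⁻¹                ≈⟨ ∙-congˡ (⁻¹-cong (trans (·-∙ A (+ J) y (+ M • z))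
                                                       (∙-congˡ (sym (•-pos-* J M z))))) ⟩
      W ∙ W ⁻¹                                    ≈⟨ inverseʳ _ ⟩
      ε                                           ∎
      where
      W = + J • y ∙ + (J ℕ.* M) • z

  ≡ₐ-unscaleε : ∀ j m {x} → + (l ℕ.^ j) • x ≡ₐ ε [ l ℕ.^ j ℕ.* l ℕ.^ m ] → x ≡ₐ ε [ l ℕ.^ m ]
  ≡ₐ-unscaleε j m p = ≡ₐ-unscale j m (≡ₐ-respʳ (sym (·-ε A (+ (l ℕ.^ j)))) p)

  l^-+ : ∀ j k → l ℕ.^ (j ℕ.+ k) ≡ l ℕ.^ j ℕ.* l ℕ.^ k
  l^-+ = ℕ.^-distribˡ-+-* l

  Â-compatible : ∀ (x : Carrierᴹ) k n → seq x (k ℕ.+ n) ≡ₐ seq x n [ l ℕ.^ n ]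
  Â-compatible x zero    n = ≡ₐ-refl
  Â-compatible x (suc k) n = modᴬ-trans A (weaken-+ k n (compatible x (k ℕ.+ n))) (Â-compatible x k n)
    where
    weaken-+ : ∀ k n {x y} → x ≡ₐ y [ l ℕ.^ (k ℕ.+ n) ] → x ≡ₐ y [ l ℕ.^ n ]
    weaken-+ zero    n p = p
    weaken-+ (suc k) n p = weaken-+ k n (≡ₐ-weaken l p)

  Â-compatibleʳ : ∀ (x : Carrierᴹ) n k → seq x (n ℕ.+ k) ≡ₐ seq x n [ l ℕ.^ n ]
  Â-compatibleʳ x n k = ≡.subst (λ i → seq x i ≡ₐ seq x n [ l ℕ.^ n ]) (ℕ.+-comm k n) (Â-compatible x k n)

  l^ : ℕ → AdicInteger l
  l^ k = constant (+ (l ℕ.^ k))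

  -- Divisibility by `lᵏ` is visible at level `k` alone, since all later components agree with that
  -- one modulo `lᵏ`. Component `n` of the quotient comes from component `n + k` of `x`; cancelling
  -- `lᵏ` makes these quotients compatible.
  Â-divide : ∀ k (x : Carrierᴹ) → seq x k ≡ₐ ε [ l ℕ.^ k ] → ∃ λ y → x ≈ᴹ l^ k *ₗ y
  Â-divide k x p = y , λ n → modᴬ-trans A (modᴬ-sym A (Â-compatibleʳ x n k))
      (≈⇒≡ₐ (x≈ n))
    where
    root : ∀ n → seq x (n ℕ.+ k) ≡ₐ ε [ l ℕ.^ k ]
    root n = modᴬ-trans A (Â-compatible x n k) p
    q : ℕ → Carrier
    q n = _≡ᴬ_[mod_].quotient (root n)
    x≈ : ∀ n → seq x (n ℕ.+ k) ≈ + (l ℕ.^ k) • q n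
    x≈ n = trans (_≡ᴬ_[mod_].x≈y∙mz (root n)) (identityˡ _)
    y : Carrierᴹ
    y = mkSeq q λ n → ≡ₐ-unscale k n (≡ₐ-respˡ (x≈ (suc n)) (≡ₐ-respʳ (x≈ n)
          (≡ₐ-modulus (≡.trans (ℕ.^-distribˡ-+-* l n k) (ℕ.*-comm (l ℕ.^ n) (l ℕ.^ k)))
                      (compatible x (n ℕ.+ k)))))

  Â-cancel : ∀ k {x y : Carrierᴹ} → l^ k *ₗ x ≈ᴹ l^ k *ₗ y → x ≈ᴹ y
  Â-cancel k {x} {y} p n = modᴬ-trans A (modᴬ-sym A (Â-compatible x k n))
    (modᴬ-trans A (≡ₐ-unscale k n (≡ₐ-modulus (l^-+ k n) (p (k ℕ.+ n))))
      (Â-compatible y k n))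

  at : ∀ {d} → (Fin d → Carrierᴹ) → ℕ → Fin d → Carrier
  at x n j = seq (x j) n

  -- Injectivity of `(ℤ/lⁿ)ᵈ → A/lⁿA` for every `n`. This single condition yields both independence
  -- over ℤ_l and saturation of the span in the completion.
  record Pure {d : ℕ} (x : Fin d → Carrierᴹ) : Set a where
    constructor mkPure
    field
      pure-at : ∀ n (c : Fin d → ℤ) → comb c (at x n) ≡ₐ ε [ l ℕ.^ n ] → ∀ j → c j ≡0[mod l ℕ.^ n ]

  open Pure public

  private
    toModulus-l : ∀ {x y} → x ≡ₐ y [ l ℕ.^ 1 ] → x ≡ₐ y [ l ]
    toModulus-l = ≡ₐ-modulus (ℕ.*-identityʳ l)

    comb-compatible : ∀ {d} (c : Fin d → ℤ) (x : Fin d → Carrierᴹ) k n →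
                      comb c (at x (k ℕ.+ n)) ≡ₐ comb c (at x n) [ l ℕ.^ n ]
    comb-compatible c x k n = comb-modʳ c λ j → Â-compatible (x j) k n

  -- Digit by digit: a relation modulo `lⁿ⁺¹` has coefficients divisible by `lⁿ` by induction.
  -- Cancelling `lⁿ` leaves a relation modulo `l` between the components of level `n + 1`, to which
  -- the hypothesis applies.
  pure-from-mod-l : ∀ {d} (x : Fin d → Carrierᴹ) →
    (∀ n (c : Fin d → ℤ) → comb c (at x (suc n)) ≡ₐ ε [ l ] → ∀ j → c j ≡0[mod l ]) → Pure x
  pure-from-mod-l {d} x pure = mkPure go
    where
    go : ∀ n (c : Fin d → ℤ) → comb c (at x n) ≡ₐ ε [ l ℕ.^ n ] → ∀ j → c j ≡0[mod l ℕ.^ n ]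
    go zero    c p j = mod∣ (divides (c j ℤ.- 0ℤ) (≡.sym (ℤ.*-identityʳ _)))
    go (suc n) c p j = lift (pure n q q≡0 j)
      where
      c≡0 = go n c
              (modᴬ-trans A (modᴬ-sym A (comb-compatible c x 1 n)) (≡ₐ-weaken l p))
      factor = comb-divisible c (at x (suc n)) c≡0
      q = proj₁ factor
      q≡0 : comb q (at x (suc n)) ≡ₐ ε [ l ]
      q≡0 = toModulus-l (≡ₐ-unscaleε n 1 (≡ₐ-respˡ (proj₂ factor)
              (≡ₐ-modulus (≡.trans (ℕ.*-comm l (l ℕ.^ n))
                                   (≡.cong (l ℕ.^ n ℕ.*_) (≡.sym (ℕ.*-identityʳ l)))) p)))
      lift : q j ≡0[mod l ] → c j ≡0[mod l ℕ.^ suc n ]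
      lift r = mod-trans (mod-reflexive (≡.trans (ℤ∣._∣_.equality (≡0⇒∣ (c≡0 j))) (ℤ.*-comm (q j) _)))
        (≡.subst (+ (l ℕ.^ n) ℤ.* q j ≡0[mod_]) (ℕ.*-comm (l ℕ.^ n) l)
          (mod-trans (mod-scale {l ℕ.^ n} r) (mod-reflexive (ℤ.*-zeroʳ (+ (l ℕ.^ n))))))

  lin : ∀ {d} → (Fin d → AdicInteger l) → (Fin d → Carrierᴹ) → Carrierᴹ
  lin = linearCombination (ℤ-adic l) (adicCompletion A l)

  seq-lin : ∀ {d} (c : Fin d → AdicInteger l) x n →
            seq (lin c x) n ≡ comb (λ j → Z.seq (c j) n) (at x n)
  seq-lin {zero}  c x n = ≡.refl
  seq-lin {suc d} c x n = ≡.cong (Z.seq (c zero) n • seq (x zero) n ∙_) (seq-lin (c ∘ suc) (x ∘ suc) n)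

  lin≡comb : ∀ {d} (c : Fin d → AdicInteger l) x n {m} →
             seq (lin c x) n ≡ₐ comb (λ j → Z.seq (c j) n) (at x n) [ m ]
  lin≡comb c x n = ≈⇒≡ₐ (reflexive (seq-lin c x n))

  module _ {d : ℕ} {x : Fin d → Carrierᴹ} (pure : Pure x) where

    pure-injective : ∀ n {c c′ : Fin d → ℤ} → comb c (at x n) ≡ₐ comb c′ (at x n) [ l ℕ.^ n ] →
                     ∀ j → c j ≡ c′ j [mod l ℕ.^ n ]
    pure-injective n {c} {c′} p j = -≡0⇒≡ (pure-at pure n (λ j → c j ℤ.- c′ j)
      (≡ₐ-respˡ (sym (comb-- c c′ (at x n))) (≡ₐ⇒∙⁻¹ p)) j)

    -- The coefficients are unique modulo lⁿ by purity, hence compatible.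
    pure-closed : ∀ z → (∀ n → ∃ λ (c : Fin d → ℤ) → seq z n ≡ₐ comb c (at x n) [ l ℕ.^ n ]) →
                  ∃ λ c → z ≈ᴹ lin c x
    pure-closed z approx = c , λ n → modᴬ-trans A (proj₂ (approx n)) (modᴬ-sym A (lin≡comb c x n))
      where
      c : Fin d → AdicInteger l
      c j = mkAdic (λ n → proj₁ (approx n) j) λ n → pure-injective n {proj₁ (approx (suc n))} {proj₁ (approx n)} (modᴬ-trans A
        (modᴬ-sym A (comb-compatible (proj₁ (approx (suc n))) x 1 n)) (modᴬ-trans A
        (modᴬ-sym A (≡ₐ-weaken l (proj₂ (approx (suc n))))) (modᴬ-trans A
        (compatible z n) (proj₂ (approx n))))) j

    pure-independent : ∀ c → lin c x ≈ᴹ 0ᴹ → ∀ j → c j ℤₗ.≈ ℤₗ.0#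
    pure-independent c p j n =
      pure-at pure n (λ j → Z.seq (c j) n) (modᴬ-trans A (modᴬ-sym A (lin≡comb c x n)) (p n)) j

    -- At level `k` the combination is an `lᵏ`-fold multiple, so purity makes all coefficients
    -- divisible by `lᵏ`; the factor is then cancelled at level `k + n` to approximate component `n`
    -- of `z`.
    pure-saturated : ∀ k z c → l^ k *ₗ z ≈ᴹ lin c x → ∃ λ c′ → z ≈ᴹ lin c′ x
    pure-saturated k z c p = pure-closed z λ n →
      let K = l ℕ.^ k
          N = k ℕ.+ n
          e : + K • seq z N ≡ₐ comb (λ j → Z.seq (c j) N) (at x N) [ l ℕ.^ N ]
          e = modᴬ-trans A (p N) (lin≡comb c x N)
          c≡0 : ∀ j → Z.seq (c j) N ≡0[mod K ]
          c≡0 j = mod-trans (seq-compatibleʳ (c j) k n) (pure-at pure k (λ j → Z.seq (c j) k)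
            (modᴬ-trans A (modᴬ-sym A (lin≡comb c x k)) (modᴬ-trans A (modᴬ-sym A (p k))
              (multiple≡ₐε (seq z k)))) j)
          (q , e′) = comb-divisible (λ j → Z.seq (c j) N) (at x N) c≡0
      in q , modᴬ-trans A (modᴬ-sym A (Â-compatible z k n))
               (modᴬ-trans A (≡ₐ-unscale k n (≡ₐ-modulus (l^-+ k n) (≡ₐ-respʳ e′ e)))
                 (comb-compatible q x k n))

-- Localised modules

module LocalisedModule {m : Level} (R : CommutativeRing 0ℓ 0ℓ) (s : CommutativeRing.Carrier R)
  (M : LeftModule (CommutativeRing.ring R) m m) where

  private module R = CommutativeRing R
  open Exp R.semiring using (_^_; ^-homo-*)
  open Localisation R s using (R[1/s]; fromR-isRingHomomorphism; equal-by; cross; same)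
  private module S = CommutativeRing R[1/s]
  private module M = LeftModule M
  open Subspace
  open M using (Carrierᴹ; _≈ᴹ_; _+ᴹ_; _*ₗ_; 0ᴹ; -ᴹ_; ≈ᴹ-refl; ≈ᴹ-sym; ≈ᴹ-trans)

  M[1/s] : LeftModule S.ring m m
  M[1/s] = extendScalars {R = R} {S = R[1/s]} fromR-isRingHomomorphism M

  private
    module V = LeftModule M[1/s]
    module VP = AbelianGroupProperties V.+ᴹ-abelianGroup
    module LM = LinearCombination {k = R} M
    module LV = LinearCombination {k = R[1/s]} M[1/s]

  -- frac k x is s⁻ᵏ ⊗ x.
  frac : ℕ → Carrierᴹ → V.Carrierᴹ
  frac k x = (R.1# , k) ⊗ x

  frac-cong : ∀ k {x y} → x ≈ᴹ y → frac k x V.≈ᴹ frac k y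
  frac-cong k = ⊗-cong S.refl

  ⊗-frac : ∀ c k x → (c , k) ⊗ x V.≈ᴹ frac k (c *ₗ x)
  ⊗-frac c k x = V.≈ᴹ-trans
    (⊗-cong (same (≡.sym (ℕ.+-identityʳ k)) (R.sym (R.*-identityˡ c))) ≈ᴹ-refl)
    (⊗-balanced (R.1# , k) c x)

  frac-raise : ∀ j k x → frac j x V.≈ᴹ frac (k ℕ.+ j) (s ^ k *ₗ x)
  frac-raise j k x = V.≈ᴹ-trans (⊗-cong (cross eq) ≈ᴹ-refl) (⊗-frac (s ^ k) (k ℕ.+ j) x)
    where
    eq : s ^ (k ℕ.+ j) R.* R.1# R.≈ s ^ j R.* s ^ k
    eq = R.trans (R.*-identityʳ (s ^ (k ℕ.+ j)))
           (R.trans (^-homo-* s k j) (R.*-comm (s ^ k) (s ^ j)))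

  frac-+ : ∀ k x y → frac k (x +ᴹ y) V.≈ᴹ frac k x V.+ᴹ frac k y
  frac-+ k = ⊗-distribˡ (R.1# , k)

  ⊗-zero : ∀ q → q ⊗ 0ᴹ V.≈ᴹ V.0ᴹ
  ⊗-zero q = VP.identityʳ-unique (q ⊗ 0ᴹ) (q ⊗ 0ᴹ)
    (V.≈ᴹ-trans (V.≈ᴹ-sym (⊗-distribˡ q 0ᴹ 0ᴹ)) (⊗-cong S.refl (M.+ᴹ-identityˡ 0ᴹ)))

  frac-neg : ∀ k x → frac k (-ᴹ x) V.≈ᴹ V.-ᴹ frac k x
  frac-neg k x = VP.inverseˡ-unique (frac k (-ᴹ x)) (frac k x)
    (V.≈ᴹ-trans (V.≈ᴹ-sym (frac-+ k (-ᴹ x) x))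
      (V.≈ᴹ-trans (frac-cong k (M.-ᴹ‿inverseˡ x)) (⊗-zero (R.1# , k))))

  add-frac : ∀ {v w j k x y} → v V.≈ᴹ frac j x → w V.≈ᴹ frac k y →
             v V.+ᴹ w V.≈ᴹ frac (k ℕ.+ j) (s ^ k *ₗ x +ᴹ s ^ j *ₗ y)
  add-frac {j = j} {k} {x} {y} p q = V.≈ᴹ-trans
    (V.+ᴹ-cong (V.≈ᴹ-trans p (frac-raise j k x))
               (V.≈ᴹ-trans q (≡.subst (λ i → frac k y V.≈ᴹ frac i (s ^ j *ₗ y))
                                      (ℕ.+-comm j k) (frac-raise k j y))))
    (V.≈ᴹ-sym (frac-+ (k ℕ.+ j) _ _))

  normalForm : ∀ v → ∃ λ k → ∃ λ x → v V.≈ᴹ frac k x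
  normalForm ((c , k) ⊗ x) = k , c *ₗ x , ⊗-frac c k x
  normalForm (v ⊕ w) =
    let (j , x , p) = normalForm v
        (k , y , q) = normalForm w
    in k ℕ.+ j , s ^ k *ₗ x +ᴹ s ^ j *ₗ y , add-frac p q
  normalForm (⊝ v) =
    let (k , x , p) = normalForm v
    in k , -ᴹ x , V.≈ᴹ-trans (V.-ᴹ‿cong p) (V.≈ᴹ-sym (frac-neg k x))
  normalForm 𝟘 = 0 , 0ᴹ , V.≈ᴹ-sym (⊗-zero (R.1# , 0))

  -- sᴺ v, provided that N is at least every exponent occurring in v.
  numerator : ℕ → V.Carrierᴹ → Carrierᴹ
  numerator N ((c , k) ⊗ x) = s ^ (N ℕ.∸ k) *ₗ c *ₗ x
  numerator N (v ⊕ w)       = numerator N v +ᴹ numerator N w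
  numerator N (⊝ v)         = -ᴹ numerator N v
  numerator N 𝟘             = 0ᴹ

  private
    s^-+ : ∀ {k} i j → k ≡ i ℕ.+ j → s ^ k R.≈ s ^ i R.* s ^ j
    s^-+ i j ≡.refl = ^-homo-* s i j

    *-numerator : ∀ {a b} x → a R.≈ b → a *ₗ x ≈ᴹ b *ₗ x
    *-numerator x p = M.*ₗ-cong p ≈ᴹ-refl

    rearrange : ∀ {N} r t j k → N ≡ r ℕ.+ (t ℕ.+ (j ℕ.+ k)) → N ℕ.∸ j ≡ r ℕ.+ (t ℕ.+ k)
    rearrange r t j k ≡.refl = ≡.trans (≡.cong (ℕ._∸ j) (eq r t j k)) (ℕ.m+n∸n≡m (r ℕ.+ (t ℕ.+ k)) j)
      where
      eq : ∀ r t j k → r ℕ.+ (t ℕ.+ (j ℕ.+ k)) ≡ (r ℕ.+ (t ℕ.+ k)) ℕ.+ j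
      eq = ℕ-solve-∀

    cross-scale : ∀ {N} a b r t j k → N ≡ r ℕ.+ (t ℕ.+ (j ℕ.+ k)) →
                  s ^ t R.* (s ^ k R.* a) R.≈ s ^ t R.* (s ^ j R.* b) →
                  s ^ (N ℕ.∸ j) R.* a R.≈ s ^ (N ℕ.∸ k) R.* b
    cross-scale {N} a b r t j k e p = begin
      s ^ (N ℕ.∸ j) R.* a                     ≈⟨ expand a j k (rearrange r t j k e) ⟩
      s ^ r R.* (s ^ t R.* (s ^ k R.* a))     ≈⟨ R.*-congˡ p ⟩
      s ^ r R.* (s ^ t R.* (s ^ j R.* b))     ≈⟨ expand b k j (rearrange r t k j
                                                   (≡.trans e (≡.cong (λ i → r ℕ.+ (t ℕ.+ i)) (ℕ.+-comm j k)))) ⟨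
      s ^ (N ℕ.∸ k) R.* b                     ∎
      where
      open SetoidReasoning R.setoid
      expand : ∀ a j k → N ℕ.∸ j ≡ r ℕ.+ (t ℕ.+ k) →
               s ^ (N ℕ.∸ j) R.* a R.≈ s ^ r R.* (s ^ t R.* (s ^ k R.* a))
      expand a j k e = begin
        s ^ (N ℕ.∸ j) R.* a                       ≈⟨ R.*-congʳ (R.trans (s^-+ r (t ℕ.+ k) e) (R.*-congˡ (^-homo-* s t k))) ⟩
        (s ^ r R.* (s ^ t R.* s ^ k)) R.* a       ≈⟨ R.*-assoc _ _ _ ⟩
        s ^ r R.* ((s ^ t R.* s ^ k) R.* a)       ≈⟨ R.*-congˡ (R.*-assoc _ _ _) ⟩
        s ^ r R.* (s ^ t R.* (s ^ k R.* a))       ∎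

    add-scale : ∀ {N} j k b → j ℕ.+ k ℕ.≤ N →
                s ^ (N ℕ.∸ (j ℕ.+ k)) R.* (s ^ k R.* b) R.≈ s ^ (N ℕ.∸ j) R.* b
    add-scale {N} j k b le = R.trans (R.sym (R.*-assoc _ _ _)) (R.*-congʳ (R.sym (s^-+ (N ℕ.∸ (j ℕ.+ k)) k eq)))
      where
      open ≡.≡-Reasoning
      eq : N ℕ.∸ j ≡ (N ℕ.∸ (j ℕ.+ k)) ℕ.+ k
      eq = begin
        N ℕ.∸ j                                    ≡⟨ ≡.cong (ℕ._∸ j) (ℕ.m∸n+n≡m le) ⟨
        ((N ℕ.∸ (j ℕ.+ k)) ℕ.+ (j ℕ.+ k)) ℕ.∸ j     ≡⟨ rearrange (N ℕ.∸ (j ℕ.+ k)) 0 j k ≡.refl ⟩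
        (N ℕ.∸ (j ℕ.+ k)) ℕ.+ k                    ∎

  -- Equality of tensors is a derivation in the least congruence, so an invariant has to be checked
  -- rule by rule. The bound `N₀` collects the exponents met on the way, including those of
  -- intermediate terms, because `N ∸ k` is truncated; it also absorbs the slack `sᵗ` in the
  -- equality of fractions.
  numerator-cong : ∀ {v w} → v V.≈ᴹ w → ∃ λ N₀ → ∀ N → N₀ ℕ.≤ N → numerator N v ≈ᴹ numerator N w
  numerator-cong ≋-refl = 0 , λ _ _ → ≈ᴹ-refl
  numerator-cong (≋-sym p) with numerator-cong p
  ... | N₀ , f = N₀ , λ N le → ≈ᴹ-sym (f N le)
  numerator-cong (≋-trans p q) with numerator-cong p | numerator-cong q
  ... | N₁ , f | N₂ , g = N₁ ℕ.+ N₂ , λ N le →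
    ≈ᴹ-trans (f N (ℕ.m+n≤o⇒m≤o N₁ le)) (g N (ℕ.m+n≤o⇒n≤o N₁ le))
  numerator-cong (⊗-cong {a , j} {b , k} {x} {y} (equal-by t p) q) = t ℕ.+ (j ℕ.+ k) , λ N le →
    ≈ᴹ-trans (≈ᴹ-sym (M.*ₗ-assoc _ _ _))
      (≈ᴹ-trans (M.*ₗ-cong (cross-scale a b (N ℕ.∸ (t ℕ.+ (j ℕ.+ k))) t j k
                             (≡.sym (ℕ.m∸n+n≡m le)) p) q)
                (M.*ₗ-assoc _ _ _))
  numerator-cong (⊕-cong p q) with numerator-cong p | numerator-cong q
  ... | N₁ , f | N₂ , g = N₁ ℕ.+ N₂ , λ N le →
    M.+ᴹ-cong (f N (ℕ.m+n≤o⇒m≤o N₁ le)) (g N (ℕ.m+n≤o⇒n≤o N₁ le))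
  numerator-cong (⊝-cong p) with numerator-cong p
  ... | N₀ , f = N₀ , λ N le → M.-ᴹ‿cong (f N le)
  numerator-cong (⊕-assoc u v w) = 0 , λ N _ → M.+ᴹ-assoc _ _ _
  numerator-cong (⊕-comm v w) = 0 , λ N _ → M.+ᴹ-comm _ _
  numerator-cong (⊕-identityˡ v) = 0 , λ N _ → M.+ᴹ-identityˡ _
  numerator-cong (⊝-inverseˡ v) = 0 , λ N _ → M.-ᴹ‿inverseˡ _
  numerator-cong (⊗-distribˡ (a , k) x y) = 0 , λ N _ →
    ≈ᴹ-trans (M.*ₗ-cong R.refl (M.*ₗ-distribˡ a x y)) (M.*ₗ-distribˡ _ _ _)
  numerator-cong (⊗-distribʳ x (a , j) (b , k)) = j ℕ.+ k , λ N le →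
    ≈ᴹ-trans (≈ᴹ-sym (M.*ₗ-assoc _ _ _))
      (≈ᴹ-trans (*-numerator x (R.trans (R.distribˡ _ _ _) (R.+-cong
                  (add-scale j k a le)
                  (R.trans (R.*-congʳ (R.reflexive (≡.cong (λ i → s ^ (N ℕ.∸ i)) (ℕ.+-comm j k))))
                           (add-scale k j b (≡.subst (ℕ._≤ N) (ℕ.+-comm j k) le))))))
        (≈ᴹ-trans (M.*ₗ-distribʳ x _ _) (M.+ᴹ-cong (M.*ₗ-assoc _ _ _) (M.*ₗ-assoc _ _ _))))
  numerator-cong (⊗-balanced (a , k) c x) = 0 , λ N _ →
    ≈ᴹ-trans (M.*ₗ-cong (R.reflexive (≡.cong (λ i → s ^ (N ℕ.∸ i)) (ℕ.+-identityʳ k))) (M.*ₗ-assoc a c x))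
             ≈ᴹ-refl

  -- Equal fractions have equal numerators for a large common exponent; cancellation removes the
  -- surplus factor `s ^ N₀`.
  frac-injective : (∀ k {x y} → s ^ k *ₗ x ≈ᴹ s ^ k *ₗ y → x ≈ᴹ y) →
                   ∀ j k {x y} → frac j x V.≈ᴹ frac k y → s ^ k *ₗ x ≈ᴹ s ^ j *ₗ y
  frac-injective cancel j k {x} {y} p with numerator-cong p
  ... | N₀ , f = cancel N₀ (≈ᴹ-trans (≈ᴹ-sym (expand k j x ≡.refl))
      (≈ᴹ-trans (f N (ℕ.m≤m+n N₀ (j ℕ.+ k))) (expand j k y (≡.cong (N₀ ℕ.+_) (ℕ.+-comm j k)))))
    where
    N = N₀ ℕ.+ (j ℕ.+ k)
    expand : ∀ k j x → N ≡ N₀ ℕ.+ (j ℕ.+ k) → s ^ (N ℕ.∸ j) *ₗ R.1# *ₗ x ≈ᴹ s ^ N₀ *ₗ s ^ k *ₗ x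
    expand k j x e = ≈ᴹ-trans (M.*ₗ-cong (s^-+ N₀ k (rearrange N₀ 0 j k e)) (M.*ₗ-identityˡ x))
                              (M.*ₗ-assoc _ _ _)

  scale-frac : ∀ c j k x → (c , j) V.*ₗ frac k x V.≈ᴹ frac (j ℕ.+ k) (c *ₗ x)
  scale-frac c j k x = V.≈ᴹ-trans (⊗-cong (same ≡.refl (R.*-identityʳ c)) ≈ᴹ-refl) (⊗-frac c (j ℕ.+ k) x)

  frac⁻¹ : ∀ k x → frac 0 x V.≈ᴹ (s ^ k , 0) V.*ₗ frac k x
  frac⁻¹ k x = V.≈ᴹ-trans (frac-raise 0 k x)
    (V.≈ᴹ-sym (V.≈ᴹ-trans (scale-frac (s ^ k) 0 k x)
      (V.≈ᴹ-reflexive (≡.cong (λ i → frac i (s ^ k *ₗ x)) (≡.sym (ℕ.+-identityʳ k))))))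

  commonDenominator : ∀ {d} (q : Fin d → S.Carrier) → ∃ λ k → ∃ λ (c : Fin d → R.Carrier) → ∀ j → q j S.≈ (c j , k)
  commonDenominator {zero}  q = 0 , (λ ()) , λ ()
  commonDenominator {suc d} q with q zero in q₀ | commonDenominator (q ∘ suc)
  ... | a , j | k , c , p = j ℕ.+ k , c′ , eq
    where
    c′ : Fin (suc d) → R.Carrier
    c′ zero    = s ^ k R.* a
    c′ (suc i) = s ^ j R.* c i
    eq : ∀ i → q i S.≈ (c′ i , j ℕ.+ k)
    eq zero    = S.trans (S.reflexive q₀) (cross (R.trans (R.*-congʳ (^-homo-* s j k)) (R.*-assoc _ _ _)))
    eq (suc i) = S.trans (p i) (cross (R.trans (R.*-congʳ
      (R.trans (^-homo-* s j k) (R.*-comm _ _))) (R.*-assoc _ _ _)))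

  lin-frac : ∀ {d} k (c : Fin d → R.Carrier) x →
    LV.lin (λ j → c j , k) (λ j → frac 0 (x j)) V.≈ᴹ frac k (LM.lin c x)
  lin-frac {zero}  k c x = V.≈ᴹ-sym (⊗-zero (R.1# , k))
  lin-frac {suc d} k c x = V.≈ᴹ-trans
    (V.+ᴹ-cong (V.≈ᴹ-trans (scale-frac (c zero) k 0 (x zero))
                           (V.≈ᴹ-reflexive (≡.cong (λ i → frac i (c zero *ₗ x zero)) (ℕ.+-identityʳ k))))
               (lin-frac k (c ∘ suc) (x ∘ suc)))
    (V.≈ᴹ-sym (frac-+ k _ _))

  frac∈ : ∀ (U : Subspace R[1/s] M[1/s]) j k {x} → frac j x ∈ ∣ U ∣ → frac k x ∈ ∣ U ∣
  frac∈ U j k {x} p = resp U (V.≈ᴹ-trans (scale-frac R.1# k 0 x)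
      (V.≈ᴹ-trans (V.≈ᴹ-reflexive (≡.cong (λ i → frac i (R.1# *ₗ x)) (ℕ.+-identityʳ k)))
                  (frac-cong k (M.*ₗ-identityˡ x))))
    (*-closed U (R.1# , k) (resp U (V.≈ᴹ-sym (frac⁻¹ j x)) (*-closed U (s ^ j , 0) p)))

  frac-lin∈ : ∀ (U : Subspace R[1/s] M[1/s]) {d} k c (x : Fin d → Carrierᴹ) →
              (∀ j → frac 0 (x j) ∈ ∣ U ∣) → frac k (LM.lin c x) ∈ ∣ U ∣
  frac-lin∈ U k c x p = resp U (lin-frac k c x) (LV.lin∈ U (λ j → c j , k) p)

  -- The same subspace as `LV.linSpan` of the `frac 0 (x j)`, but written with coefficients in `R`
  -- and one denominator, the form to which saturation applies.
  span : ∀ {d} → (Fin d → Carrierᴹ) → Subspace R[1/s] M[1/s]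
  span {d} x = record
    { ∣_∣ = λ v → ∃ λ k → ∃ λ (c : Fin d → R.Carrier) → v V.≈ᴹ frac k (LM.lin c x)
    ; resp = λ v≈w (k , c , p) → k , c , V.≈ᴹ-trans (V.≈ᴹ-sym v≈w) p
    ; 0∈ = 0 , (λ _ → R.0#) , V.≈ᴹ-trans (V.≈ᴹ-sym (⊗-zero (R.1# , 0))) (frac-cong 0 (≈ᴹ-sym (LM.lin-zero x)))
    ; +-closed = λ (j , c , p) (k , c′ , q) → k ℕ.+ j , (λ i → s ^ k R.* c i R.+ s ^ j R.* c′ i) ,
        V.≈ᴹ-trans (add-frac p q)
          (frac-cong (k ℕ.+ j) (≈ᴹ-sym (≈ᴹ-trans (LM.lin-+ (λ i → s ^ k R.* c i) (λ i → s ^ j R.* c′ i) x)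
            (M.+ᴹ-cong (LM.lin-* (s ^ k) c x) (LM.lin-* (s ^ j) c′ x)))))
    ; *-closed = λ (a , j) (k , c , p) → j ℕ.+ k , (λ i → a R.* c i) ,
        V.≈ᴹ-trans (V.*ₗ-cong (S.refl {a , j}) p)
          (V.≈ᴹ-trans (scale-frac a j k (LM.lin c x)) (frac-cong (j ℕ.+ k) (≈ᴹ-sym (LM.lin-* a c x))))
    }

  frac∈span : ∀ {d} (x : Fin d → Carrierᴹ) j → frac 0 (x j) ∈ ∣ span x ∣
  frac∈span x j = 0 , unit j , frac-cong 0 (≈ᴹ-sym (lin-unit x j))
    where
    unit : ∀ {d} → Fin d → Fin d → R.Carrier
    unit zero    zero    = R.1#
    unit zero    (suc i) = R.0#
    unit (suc j) zero    = R.0#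
    unit (suc j) (suc i) = unit j i
    lin-unit : ∀ {d} (x : Fin d → Carrierᴹ) j → LM.lin (unit j) x ≈ᴹ x j
    lin-unit x zero    = ≈ᴹ-trans (M.+ᴹ-cong (M.*ₗ-identityˡ _) (LM.lin-zero (x ∘ suc))) (M.+ᴹ-identityʳ _)
    lin-unit x (suc j) = ≈ᴹ-trans (M.+ᴹ-cong (M.*ₗ-zeroˡ _) (lin-unit (x ∘ suc) j)) (M.+ᴹ-identityˡ _)

  span-isBasis : (∀ k {x y} → s ^ k *ₗ x ≈ᴹ s ^ k *ₗ y → x ≈ᴹ y) → ∀ {d} (x : Fin d → Carrierᴹ) →
                 (∀ c → LM.lin c x ≈ᴹ 0ᴹ → ∀ j → c j R.≈ R.0#) →
                 IsBasis R[1/s] M[1/s] (span x) (λ j → frac 0 (x j))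
  span-isBasis cancel x independent = record
    { b∈W = frac∈span x
    ; independent = λ q p j → let (k , c , q≈c) = commonDenominator q in
        S.trans (q≈c j) (cross (R.trans (R.*-congˡ (independent c (vanish k c (V.≈ᴹ-trans
          (V.≈ᴹ-sym (V.≈ᴹ-trans (LV.lin-cong (λ i → frac 0 (x i)) q≈c) (lin-frac k c x))) p)) j))
          (R.trans (R.zeroʳ _) (R.sym (R.zeroʳ _)))))
    ; spanning = λ (k , c , p) → (λ j → c j , k) , V.≈ᴹ-trans p (V.≈ᴹ-sym (lin-frac k c x))
    }
    where
    vanish : ∀ k c → frac k (LM.lin c x) V.≈ᴹ V.0ᴹ → LM.lin c x ≈ᴹ 0ᴹ
    vanish k c p = ≈ᴹ-trans (≈ᴹ-sym (M.*ₗ-identityˡ _)) (≈ᴹ-trans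
      (frac-injective cancel k 0 (V.≈ᴹ-trans p (V.≈ᴹ-sym (⊗-zero (R.1# , 0))))) (M.*ₗ-zeroʳ _))

-- Subspaces of ℚ ⊗ Â

module RationalCompletion (em : ∀ {b} → ExcludedMiddle b) {a : Level} {l : ℕ} (l-prime : Prime l)
  (A : AbelianGroup (a ⊔ a) a)
  (torsionDivisible : ∀ j m x → AbelianGroup._≈_ A (_·_ A (+ (l ℕ.^ j)) x) (AbelianGroup.ε A) →
                      _≡ᴬ_[mod_] A x (AbelianGroup.ε A) (l ℕ.^ m))
  (s : AdicInteger l)
  (seq-s^ : ∀ k n → AdicInteger.seq (Exp._^_ (CommutativeRing.semiring (ℤ-adic l)) s k) n ≡ + (l ℕ.^ k)) where

  open PrimePowers l-prime
  open AbelianGroup A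
  open Congruence A
  open Completion l-prime A torsionDivisible
  open LocalisedModule {a} (ℤ-adic l) s (adicCompletion A l)
  open Exp ℤₗ.semiring using (_^_)
  open Localisation (ℤ-adic l) s using (R[1/s]; equal-by)
  open AbelianGroupProperties A using (⁻¹-involutive; xyx⁻¹≈y)
  open CompatibleSequence
  open Subspace

  private
    module Â = LeftModule (adicCompletion A l)
    module ℚₗ = CommutativeRing R[1/s]

  private
    module V = LeftModule M[1/s]
    module LV = LinearCombination {k = R[1/s]} M[1/s]

  s^*ₗ : ∀ k x → s ^ k Â.*ₗ x Â.≈ᴹ l^ k Â.*ₗ x
  s^*ₗ k x n = ≈⇒≡ₐ (·-congʳ A (seq x n) (seq-s^ k n))

  s^-cancel : ∀ k {x y} → s ^ k Â.*ₗ x Â.≈ᴹ s ^ k Â.*ₗ y → x Â.≈ᴹ y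
  s^-cancel k {x} {y} p = Â-cancel k {x} {y} λ n →
    modᴬ-trans A (modᴬ-sym A (s^*ₗ k x n)) (modᴬ-trans A (p n) (s^*ₗ k y n))

  1≉0 : ¬ (ℚₗ.1# ℚₗ.≈ ℚₗ.0#)
  1≉0 (equal-by t p) = l∤1 (≡.subst (1ℤ ≡0[mod_]) (ℕ.*-identityʳ l)
    (ℤₗ-torsionFree l-prime t ℤₗ.1# (λ n → mod-trans (mod-reflexive (eq n))
      (mod-trans (p n) (mod-reflexive (ℤ.*-zeroʳ (Z.seq (s ^ t) n))))) 1))
    where
    eq : ∀ n → + (l ℕ.^ t) ℤ.* 1ℤ ≡ Z.seq (s ^ t) n ℤ.* (1ℤ ℤ.* 1ℤ)
    eq n = ≡.cong (ℤ._* 1ℤ) (≡.sym (seq-s^ t n))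

  private
    lastHolding : (P : ℕ → Set a) → P 0 → ∀ n → ¬ P n → ∃ λ k → P k × ¬ P (suc k)
    lastHolding P p zero    ¬p = contradiction p ¬p
    lastHolding P p (suc n) ¬p with em {P = P n}
    ... | yes q = n , q , ¬p
    ... | no ¬q = lastHolding P p n ¬q

  Approximable : ∀ {d} → Â.Carrierᴹ → (Fin d → Â.Carrierᴹ) → ℕ → Set a
  Approximable {d} z x n = ∃ λ (c : Fin d → ℤ) → seq z n ≡ₐ comb c (at x n) [ l ℕ.^ n ]

  module _ {d : ℕ} {x : Fin d → Â.Carrierᴹ} (pure : Pure x) (z : Â.Carrierᴹ) (k : ℕ)
           (c : Fin d → ℤ) (z≡ : seq z k ≡ₐ comb c (at x k) [ l ℕ.^ k ])
           (maximal : ¬ Approximable z x (suc k)) where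

    remainder : Â.Carrierᴹ
    remainder = z Â.+ᴹ Â.-ᴹ lin (constant ∘ c) x

    division : ∃ λ x₀ → remainder Â.≈ᴹ l^ k Â.*ₗ x₀
    division = Â-divide k remainder (≡ₐ⇒∙⁻¹ (modᴬ-trans A z≡ (modᴬ-sym A (lin≡comb (constant ∘ c) x k))))

    x₀ : Â.Carrierᴹ
    x₀ = proj₁ division

    extended : Fin (suc d) → Â.Carrierᴹ
    extended zero    = x₀
    extended (suc j) = x j

    -- In a relation modulo `l` whose head coefficient is divisible by `l`, the tail is handled by
    -- purity of `x`. Otherwise the relation can be solved for `x₀` modulo `l`; then `lᵏ x₀` is a
    -- combination of `x` modulo `lᵏ⁺¹`, and so is `z`, against the maximality of `k`.
    extended-pure : Pure extended
    extended-pure = pure-from-mod-l extended λ n c′ p → divisible n c′ p (em {P = c′ zero ≡0[mod l ]})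
      where
      down : ∀ (y : Â.Carrierᴹ) n → seq y (suc n) ≡ₐ seq y 1 [ l ]
      down y n = ≡ₐ-modulus (ℕ.*-identityʳ l) (Â-compatibleʳ y 1 n)
      across : ∀ (y : Â.Carrierᴹ) m n → seq y (suc m) ≡ₐ seq y (suc n) [ l ]
      across y m n = modᴬ-trans A (down y m) (modᴬ-sym A (down y n))
      divisible : ∀ n (c′ : Fin (suc d) → ℤ) → comb c′ (at extended (suc n)) ≡ₐ ε [ l ] →
                  Dec (c′ zero ≡0[mod l ]) → ∀ j → c′ j ≡0[mod l ]
      divisible n c′ p (yes q) zero    = q
      divisible n c′ p (yes q) (suc j) = ≡.subst (c′ (suc j) ≡0[mod_]) (ℕ.*-identityʳ l)
        (pure-at pure 1 (c′ ∘ suc) (≡ₐ-modulus (≡.sym (ℕ.*-identityʳ l)) (modᴬ-trans A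
          (modᴬ-sym A (comb-modʳ (c′ ∘ suc) (λ i → down (x i) n)))
          (≡ₐ-respˡ (identityˡ _) (modᴬ-trans A (modᴬ-∙ A (modᴬ-sym A (•≡ₐε (seq x₀ (suc n)) q)) ≡ₐ-refl) p)))) j)
      divisible n c′ p (no q) = contradiction (c″ , z≡″) maximal
        where
        u = proj₁ (inverse-mod-l q)
        K = l ℕ.^ k
        -- From `z = c·x + lᵏ x₀` and `x₀ ≡ - u (c′·x)` modulo `l`.
        c″ : Fin d → ℤ
        c″ j = c j ℤ.- + K ℤ.* (u ℤ.* c′ (suc j))
        X : Fin d → Carrier
        X = at x (suc k)
        C D : Carrier
        C = comb (c′ ∘ suc) X
        D = comb (λ j → u ℤ.* c′ (suc j)) X
        relation : c′ zero • seq x₀ (suc k) ∙ C ≡ₐ ε [ l ]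
        relation = modᴬ-trans A (comb-modʳ c′ (λ i → across (extended i) k n)) p
        x₀∙D≡ε : seq x₀ (suc k) ∙ D ≡ₐ ε [ l ]
        x₀∙D≡ε = modᴬ-trans A (modᴬ-∙ A
            (modᴬ-trans A (≈⇒≡ₐ (sym (•-1 _))) (modᴬ-trans A
              (•-≡ (seq x₀ (suc k)) (mod-sym (proj₂ (inverse-mod-l q))))
              (≈⇒≡ₐ (·-* A (seq x₀ (suc k)) u (c′ zero)))))
            (≈⇒≡ₐ (comb-* u (c′ ∘ suc) X)))
          (≡ₐ-respˡ (·-∙ A u _ C) (≡ₐ-respʳ (·-ε A u) (≡ₐ-• u relation)))
        x₀≡ : + K • seq x₀ (suc k) ≡ₐ (+ K • D) ⁻¹ [ l ℕ.^ suc k ]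
        x₀≡ = ≡ₐ-modulus (ℕ.*-comm K l) (≡ₐ-respʳ (•-⁻¹ (+ K) D) (≡ₐ-scale K
          (∙⁻¹⇒≡ₐ (≡ₐ-respˡ (∙-congˡ (sym (⁻¹-involutive D))) x₀∙D≡ε))))
        remainder≡ : seq z (suc k) ∙ comb c X ⁻¹ ≡ₐ + K • seq x₀ (suc k) [ l ℕ.^ suc k ]
        remainder≡ = modᴬ-trans A
          (modᴬ-∙ A ≡ₐ-refl (modᴬ-⁻¹ A (modᴬ-sym A (lin≡comb (constant ∘ c) x (suc k)))))
          (proj₂ division (suc k))
        z≡″ : seq z (suc k) ≡ₐ comb c″ X [ l ℕ.^ suc k ]
        z≡″ = ≡ₐ-respˡ (trans (sym (assoc _ _ _)) (xyx⁻¹≈y (comb c X) (seq z (suc k))))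
          (≡ₐ-respʳ (sym (trans (comb-- c (λ j → + K ℤ.* (u ℤ.* c′ (suc j))) X)
                               (∙-congˡ (⁻¹-cong (comb-* (+ K) (λ j → u ℤ.* c′ (suc j)) X)))))
            (modᴬ-∙ A (≡ₐ-refl {x = comb c X}) (modᴬ-trans A remainder≡ x₀≡)))

  -- Stated through all subspaces that contain the families, so that a change of basis needs only
  -- closure properties of subspaces and no matrices of coefficients.
  SameSpan : ∀ {d e} → (Fin d → V.Carrierᴹ) → (Fin e → V.Carrierᴹ) → Set (Level.suc a)
  SameSpan b b′ = ∀ (U : Subspace R[1/s] M[1/s]) → (∀ j → b j ∈ ∣ U ∣) ⇔ (∀ j → b′ j ∈ ∣ U ∣)

  frac∈⇔ : ∀ (U : Subspace R[1/s] M[1/s]) k v x → v V.≈ᴹ frac k x → v ∈ ∣ U ∣ ⇔ frac 0 x ∈ ∣ U ∣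
  frac∈⇔ U k v x v≈ = mk⇔ (λ p → frac∈ U k 0 {x} (resp U v≈ p))
                      (λ p → resp U (V.≈ᴹ-sym v≈) (frac∈ U 0 k {x} p))

  frac-divide : ∀ (U : Subspace R[1/s] M[1/s]) k x y → x Â.≈ᴹ l^ k Â.*ₗ y → frac 0 x ∈ ∣ U ∣ ⇔ frac 0 y ∈ ∣ U ∣
  frac-divide U k x y p = mk⇔ (Equivalence.from y⇔x) (Equivalence.to y⇔x)
    where
    s^y≈x : s ^ k Â.*ₗ y Â.≈ᴹ x
    s^y≈x n = modᴬ-trans A (s^*ₗ k y n) (modᴬ-sym A (p n))
    y⇔x : frac 0 y ∈ ∣ U ∣ ⇔ frac 0 x ∈ ∣ U ∣
    y⇔x = frac∈⇔ U (k ℕ.+ 0) (frac 0 y) x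
      (V.≈ᴹ-trans (frac-raise 0 k y) (frac-cong (k ℕ.+ 0) {s ^ k Â.*ₗ y} {x} s^y≈x))

  -- Given a pure basis for the tail of b, the head is modified by the tail to
  -- become divisible by the largest possible power lᵏ, and then divided by it.
  module Purify {d : ℕ} (b : Fin (suc d) → V.Carrierᴹ) (independent : LV.LinearlyIndependent b)
    (x : Fin d → Â.Carrierᴹ) (pure : Pure x) (same : SameSpan (b ∘ suc) (λ j → frac 0 (x j)))
    (k : ℕ) (z : Â.Carrierᴹ) (b₀≈ : b zero V.≈ᴹ frac k z) where

    Goal : Set (Level.suc a)
    Goal = ∃ λ (y : Fin (suc d) → Â.Carrierᴹ) → Pure y × SameSpan b (λ j → frac 0 (y j))

    -- Approximations at all levels would put `z` into the ℤ_l-span of `x`, and hence `b zero` into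
    -- the span of the remaining `b`; this is where independence over ℚ_l enters.
    notAllApproximable : ¬ (∀ n → Approximable z x n)
    notAllApproximable approximable = contradiction (LV.head∉tail b independent inU) 1≉0
      where
      U = LV.linSpan (b ∘ suc)
      closed = pure-closed pure z approximable
      inU : b zero ∈ ∣ U ∣
      inU = resp U (V.≈ᴹ-sym (V.≈ᴹ-trans b₀≈ (frac-cong k {z} {lin (proj₁ closed) x} (proj₂ closed))))
        (frac-lin∈ U k (proj₁ closed) x (Equivalence.to (same U) (LV.b∈linSpan (b ∘ suc))))

    module _ (m : ℕ) (c : Fin d → ℤ) (z≡ : seq z m ≡ₐ comb c (at x m) [ l ℕ.^ m ])
             (maximal : ¬ Approximable z x (suc m)) where

      y : Fin (suc d) → Â.Carrierᴹ
      y = extended pure z m c z≡ maximal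
      c·x : Â.Carrierᴹ
      c·x = lin (constant ∘ c) x

      c·x∈ : ∀ U → (∀ j → frac 0 (x j) ∈ ∣ U ∣) → frac 0 c·x ∈ ∣ U ∣
      c·x∈ U p = frac-lin∈ U 0 (constant ∘ c) x p

      r : Â.Carrierᴹ
      r = remainder pure z m c z≡ maximal

      remainder∈⇔ : ∀ U → frac 0 r ∈ ∣ U ∣ ⇔ frac 0 (y zero) ∈ ∣ U ∣
      remainder∈⇔ U = frac-divide U m r (y zero) (proj₂ (division pure z m c z≡ maximal))

      b₀∈⇔ : ∀ U → b zero ∈ ∣ U ∣ ⇔ frac 0 z ∈ ∣ U ∣
      b₀∈⇔ U = frac∈⇔ U k (b zero) z b₀≈

      to : ∀ U → (∀ j → b j ∈ ∣ U ∣) → ∀ j → frac 0 (y j) ∈ ∣ U ∣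
      to U p (suc j) = Equivalence.to (same U) (p ∘ suc) j
      to U p zero    = Equivalence.to (remainder∈⇔ U)
        (resp U (V.≈ᴹ-sym (V.≈ᴹ-trans (frac-+ 0 z (Â.-ᴹ c·x)) (V.+ᴹ-cong V.≈ᴹ-refl (frac-neg 0 c·x))))
          (+-closed U (Equivalence.to (b₀∈⇔ U) (p zero))
                      (LV.neg-closed U (c·x∈ U (Equivalence.to (same U) (p ∘ suc))))))

      from : ∀ U → (∀ j → frac 0 (y j) ∈ ∣ U ∣) → ∀ j → b j ∈ ∣ U ∣
      from U p (suc j) = Equivalence.from (same U) (p ∘ suc) j
      from U p zero    = Equivalence.from (b₀∈⇔ U)
        (resp U (V.≈ᴹ-trans (V.≈ᴹ-sym (frac-+ 0 r c·x)) (frac-cong 0 {r Â.+ᴹ c·x} {z} (minus-plus z c·x)))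
          (+-closed U (Equivalence.from (remainder∈⇔ U) (p zero)) (c·x∈ U (p ∘ suc))))
        where
        minus-plus : ∀ z w → (z Â.+ᴹ Â.-ᴹ w) Â.+ᴹ w Â.≈ᴹ z
        minus-plus z w n = ≈⇒≡ₐ (trans (assoc _ _ _) (trans (∙-congˡ (inverseˡ _)) (identityʳ _)))

      extend : Goal
      extend = y , extended-pure pure z m c z≡ maximal , λ U → mk⇔ (to U) (from U)

    goal : Goal
    goal = case em {P = ∃ λ n → ¬ Approximable z x n} of λ where
      (no all) → contradiction (λ n → decidable-stable em (λ ¬p → all (n , ¬p))) notAllApproximable
      (yes (n , ¬p)) →
        -- Level 0 is always approximable, as everything is congruent modulo `l ^ 0 = 1`; hence
        -- there is an approximable level whose successor is not.
        let (m , (c , z≡) , maximal) = lastHolding (Approximable z x) ((λ _ → 0ℤ) , ≡ₐ-1) n ¬p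
        in extend m c z≡ maximal

  purify : ∀ {d} (b : Fin d → V.Carrierᴹ) → LV.LinearlyIndependent b →
           ∃ λ (x : Fin d → Â.Carrierᴹ) → Pure x × SameSpan b (λ j → frac 0 (x j))
  purify {zero}  b independent = (λ ()) , mkPure (λ _ _ _ ()) , λ U → mk⇔ (λ _ ()) (λ _ ())
  purify {suc d} b independent =
    let (x , pure , same) = purify (b ∘ suc) (LV.tail-independent b independent)
        (k , z , b₀≈)     = normalForm (b zero)
    in Purify.goal b independent x pure same k z b₀≈

  Pure-hasBasis : ∀ {d} {x : Fin d → Â.Carrierᴹ} → Pure x → IsBasis R[1/s] M[1/s] (span x) (λ j → frac 0 (x j))
  Pure-hasBasis {x = x} pure = span-isBasis s^-cancel x (pure-independent pure)

  pureSubspace : ∀ {d} {x : Fin d → Â.Carrierᴹ} → Pure x → Σ (Subspace R[1/s] M[1/s]) (HasDimension R[1/s] M[1/s] d)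
  pureSubspace {x = x} pure = span x , (λ j → frac 0 (x j)) , Pure-hasBasis {x = x} pure

  pureBasis : ∀ {d} (W : Setoid.Carrier (Grass R[1/s] M[1/s] d)) →
              ∃ λ (x : Fin d → Â.Carrierᴹ) → Pure x × ∣ span x ∣ ≐ ∣ proj₁ W ∣
  pureBasis (W , b , isBasis) =
    let (x , pure , same) = purify b independent
        x∈W = Equivalence.to (same W) b∈W
        b∈span = Equivalence.from (same (span x)) (frac∈span x)
    in x , pure
     , (λ (k , c , v≈) → resp W (V.≈ᴹ-sym v≈) (frac-lin∈ W k c x x∈W))
     , (λ v∈W → let (q , v≈) = spanning v∈W in
          resp (span x) (V.≈ᴹ-sym v≈) (LV.lin∈ (span x) q b∈span))
    where open IsBasis isBasis

  -- Intersecting the rational span with the completion gives back the lattice, by saturation. This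
  -- is how divisibility data of an extension are recovered from its subspace.
  frac∈span⇔ : ∀ {d} {x : Fin d → Â.Carrierᴹ} → Pure x → ∀ z →
               frac 0 z ∈ ∣ span x ∣ ⇔ (∃ λ c → z Â.≈ᴹ lin c x)
  frac∈span⇔ {x = x} pure z = mk⇔
    (λ (k , c , p) → pure-saturated pure k z c (λ n → modᴬ-trans A (modᴬ-sym A (s^*ₗ k z n))
      (modᴬ-trans A (frac-injective s^-cancel 0 k {z} {lin c x} p n) (≈⇒≡ₐ (•-1 _)))))
    (λ (c , p) → 0 , c , frac-cong 0 {z} {lin c x} p)

-- Roots of separable polynomials

module SeparablePolynomials {c ℓ : Level} (R : CommutativeRing c ℓ) where

  open CommutativeRing R hiding (zero)
  open Polynomial R
  open RingProperties ring using (-‿distribʳ-*; -‿distribˡ-*)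
  open Exp semiring using (_^_)
  open RawMonoidDefs +-rawMonoid renaming (_×_ to _×ᴿ_)
  open Mult +-commutativeMonoid using (×-congʳ)
  open SetoidReasoning setoid

  coeff-+ : ∀ p q n → coeff (p +ᴾ q) n ≈ coeff p n + coeff q n
  coeff-+ []      q       n       = sym (+-identityˡ _)
  coeff-+ (a ∷ p) []      n       = sym (+-identityʳ _)
  coeff-+ (a ∷ p) (b ∷ q) zero    = refl
  coeff-+ (a ∷ p) (b ∷ q) (suc n) = coeff-+ p q n

  coeff-map : ∀ a p n → coeff (map (a *_) p) n ≈ a * coeff p n
  coeff-map a []      n       = sym (zeroʳ a)
  coeff-map a (b ∷ p) zero    = refl
  coeff-map a (b ∷ p) (suc n) = coeff-map a p n

  coeff-zero : ∀ n → coeff (0# ∷ []) n ≈ 0#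
  coeff-zero zero    = refl
  coeff-zero (suc n) = refl

  coeff-* : ∀ a p q n → coeff ((a ∷ p) *ᴾ q) n ≈ a * coeff q n + coeff (0# ∷ p *ᴾ q) n
  coeff-* a p q n = trans (coeff-+ (map (a *_) q) (0# ∷ p *ᴾ q) n) (+-congʳ (coeff-map a q n))

  coeff-derivative : ∀ p n → coeff (derivative p) n ≈ suc n ×ᴿ coeff p (suc n)
  coeff-derivative []      n       = sym (zero-× (suc n))
    where
    zero-× : ∀ n → n ×ᴿ 0# ≈ 0#
    zero-× zero    = refl
    zero-× (suc n) = trans (+-identityˡ _) (zero-× n)
  coeff-derivative (a ∷ p) zero    = coeff-+ p (0# ∷ derivative p) 0
  coeff-derivative (a ∷ p) (suc n) = trans (coeff-+ p (0# ∷ derivative p) (suc n))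
                                           (+-congˡ (coeff-derivative p n))

  ×-* : ∀ n x → n ×ᴿ x ≈ (n ×ᴿ 1#) * x
  ×-* zero    x = sym (zeroˡ x)
  ×-* (suc n) x = begin
    x + n ×ᴿ x                  ≈⟨ +-cong (sym (*-identityˡ x)) (×-* n x) ⟩
    1# * x + (n ×ᴿ 1#) * x      ≈⟨ distribʳ x 1# _ ⟨
    (1# + n ×ᴿ 1#) * x          ∎

  monomial : ℕ → Poly
  monomial zero    = 1# ∷ []
  monomial (suc k) = 0# ∷ monomial k

  eval-monomial : ∀ k x → eval (monomial k) x ≈ x ^ k
  eval-monomial zero    x = trans (+-congˡ (zeroʳ x)) (+-identityʳ 1#)
  eval-monomial (suc k) x = trans (+-identityˡ _) (*-congˡ (eval-monomial k x))

  coeff-monomial : ∀ k → coeff (monomial k) k ≈ 1#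
  coeff-monomial zero    = refl
  coeff-monomial (suc k) = coeff-monomial k

  coeff-monomial-≢ : ∀ k n → ¬ (n ≡ k) → coeff (monomial k) n ≈ 0#
  coeff-monomial-≢ zero    zero    n≢k = contradiction ≡.refl n≢k
  coeff-monomial-≢ zero    (suc n) n≢k = refl
  coeff-monomial-≢ (suc k) zero    n≢k = refl
  coeff-monomial-≢ (suc k) (suc n) n≢k = coeff-monomial-≢ k n (n≢k ∘ ≡.cong suc)

  module _ (separablyClosed : ∀ p → NonConstant p → Separable p → ∃ λ x → eval p x ≈ 0#)
           (1≉0 : ¬ (1# ≈ 0#)) (k : ℕ) (1/N : Carrier) (N*1/N : (suc k ×ᴿ 1#) * 1/N ≈ 1#) where

    N : ℕ
    N = suc k

    -- With p = Xᴺ − a and ab = 1, the Bézout relation is −b p + b (X / N) p′ = 1.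
    nthRoot : ∀ a b → a * b ≈ 1# → ∃ λ x → x ^ N ≈ a
    nthRoot a b ab≈1 = proj₁ root , (begin
      x ^ N                                   ≈⟨ +-identityˡ _ ⟨
      0# + x ^ N                              ≈⟨ +-congʳ (-‿inverseʳ a) ⟨
      (a - a) + x ^ N                         ≈⟨ +-assoc _ _ _ ⟩
      a + (- a + x * x ^ k)                   ≈⟨ +-congˡ (+-congˡ (*-congˡ (eval-monomial k x))) ⟨
      a + eval p x                            ≈⟨ +-congˡ (proj₂ root) ⟩
      a + 0#                                  ≈⟨ +-identityʳ a ⟩
      a                                       ∎)
      where
      p : Poly
      p = - a ∷ monomial k
      w = 1/N * b
      bézout : ∀ n → coeff ((- b ∷ []) *ᴾ p +ᴾ (0# ∷ w ∷ []) *ᴾ derivative p) n ≈ coeff 1ᴾ n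
      expand : ∀ n → coeff ((- b ∷ []) *ᴾ p +ᴾ (0# ∷ w ∷ []) *ᴾ derivative p) n ≈
                     - b * coeff p n + coeff (0# ∷ (w ∷ []) *ᴾ derivative p) n
      expand n = trans (coeff-+ ((- b ∷ []) *ᴾ p) ((0# ∷ w ∷ []) *ᴾ derivative p) n) (+-cong
        (trans (coeff-* (- b) [] p n) (trans (+-congˡ (coeff-zero n)) (+-identityʳ _)))
        (trans (coeff-* 0# (w ∷ []) (derivative p) n) (trans (+-congʳ (zeroˡ _)) (+-identityˡ _))))
      tail : ∀ m → coeff ((w ∷ []) *ᴾ derivative p) m ≈ w * (suc m ×ᴿ coeff (monomial k) m)
      tail m = trans (coeff-* w [] (derivative p) m) (trans (+-congˡ (coeff-zero m)) (trans (+-identityʳ _)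
        (*-congˡ (coeff-derivative p m))))
      bézout zero = begin
        _                  ≈⟨ expand 0 ⟩
        - b * - a + 0#     ≈⟨ +-identityʳ _ ⟩
        - b * - a          ≈⟨ -‿distribˡ-* b (- a) ⟨
        - (b * - a)        ≈⟨ -‿cong (-‿distribʳ-* b a) ⟨
        - - (b * a)        ≈⟨ -‿involutive _ ⟩
        b * a              ≈⟨ trans (*-comm b a) ab≈1 ⟩
        1#                 ∎
        where open AbelianGroupProperties +-abelianGroup renaming (⁻¹-involutive to -‿involutive)
      bézout (suc m) = trans (expand (suc m)) (trans (+-congˡ (tail m)) (case m ℕ.≟ k of λ where
        (no m≢k) → trans (+-cong (trans (*-congˡ (coeff-monomial-≢ k m m≢k)) (zeroʳ _))
                                 (trans (*-congˡ (trans (×-* (suc m) _)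
                                   (trans (*-congˡ (coeff-monomial-≢ k m m≢k)) (zeroʳ _)))) (zeroʳ _)))
                         (+-identityˡ 0#)
        (yes ≡.refl) → begin
          - b * coeff (monomial k) k + w * (N ×ᴿ coeff (monomial k) k)
            ≈⟨ +-cong (*-congˡ (coeff-monomial k)) (*-congˡ (×-congʳ N (coeff-monomial k))) ⟩
          - b * 1# + (1/N * b) * (N ×ᴿ 1#)
            ≈⟨ +-cong (*-identityʳ _) (trans (*-comm _ _) (trans (sym (*-assoc _ _ _))
                 (trans (*-congʳ N*1/N) (*-identityˡ b)))) ⟩
          - b + b
            ≈⟨ -‿inverseˡ b ⟩
          0# ∎))
      root = separablyClosed p (k , λ e → 1≉0 (trans (sym (coeff-monomial k)) e))
                             ((- b ∷ []) , (0# ∷ w ∷ []) , bézout)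
      x = proj₁ root

    ones : ℕ → Poly
    ones n = replicate n 1#

    coeff-ones-< : ∀ {n m} → m ℕ.< n → coeff (ones n) m ≡ 1#
    coeff-ones-< {suc n} {zero}  _           = ≡.refl
    coeff-ones-< {suc n} {suc m} (ℕ.s≤s m<n) = coeff-ones-< m<n

    coeff-ones-≥ : ∀ {n m} → n ℕ.≤ m → coeff (ones n) m ≡ 0#
    coeff-ones-≥ {zero}  {m}     _           = ≡.refl
    coeff-ones-≥ {suc n} {suc m} (ℕ.s≤s n≤m) = coeff-ones-≥ n≤m

    eval-ones : ∀ n x → x * eval (ones n) x + 1# ≈ eval (ones n) x + x ^ n
    eval-ones zero    x = trans (+-congʳ (zeroʳ x)) refl
    eval-ones (suc n) x = begin
      x * (1# + x * E) + 1#      ≈⟨ +-comm _ _ ⟩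
      1# + x * (1# + x * E)      ≈⟨ +-congˡ (*-congˡ (trans (+-comm _ _) (eval-ones n x))) ⟩
      1# + x * (E + x ^ n)       ≈⟨ +-congˡ (distribˡ x E (x ^ n)) ⟩
      1# + (x * E + x * x ^ n)   ≈⟨ +-assoc _ _ _ ⟨
      (1# + x * E) + x * x ^ n   ∎
      where E = eval (ones n) x

    eval-ones-1 : ∀ n {x} → x ≈ 1# → eval (ones n) x ≈ n ×ᴿ 1#
    eval-ones-1 zero    p = refl
    eval-ones-1 (suc n) p = +-congˡ (trans (*-cong p (eval-ones-1 n p)) (*-identityˡ _))

    -- With Φ = 1 + X + ⋯ + X^(N−1), differentiating (X − 1) Φ = Xᴺ − 1 gives the
    -- Bézout relation (1 + (1/N − 1) X) Φ + (1/N) (X² − X) Φ′ = 1.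
    nontrivialRootOfUnity : 0 ℕ.< k → ∃ λ x → x ^ N ≈ 1# × ¬ (x ≈ 1#)
    nontrivialRootOfUnity 0<k = x
      , trans (sym (+-identityˡ _)) (trans (+-congʳ (sym Φx≈0)) (trans (sym (eval-ones N x))
          (trans (+-congʳ (trans (*-congˡ Φx≈0) (zeroʳ x))) (+-identityˡ 1#))))
      , λ x≈1 → 1≉0 (trans (sym N*1/N) (trans (*-congʳ (trans (sym (eval-ones-1 N x≈1)) Φx≈0)) (zeroˡ _)))
      where
      Φ = ones N
      v = - 1/N ∷ 1/N ∷ []
      u = 1/N - 1#
      Φ′ = derivative Φ
      t : ℕ → Carrier
      t m = (suc m ×ᴿ 1#) * 1/N
      shifted : ∀ m → coeff (0# ∷ (1/N ∷ []) *ᴾ Φ′) m ≈ (1/N * (m ×ᴿ 1#)) * coeff Φ m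
      shifted zero    = sym (trans (*-congʳ (zeroʳ _)) (zeroˡ _))
      shifted (suc m) = begin
        coeff ((1/N ∷ []) *ᴾ Φ′) m                      ≈⟨ coeff-* 1/N [] Φ′ m ⟩
        1/N * coeff Φ′ m + coeff (0# ∷ []) m            ≈⟨ trans (+-congˡ (coeff-zero m)) (+-identityʳ _) ⟩
        1/N * coeff Φ′ m                                ≈⟨ *-congˡ (trans (coeff-derivative Φ m) (×-* (suc m) _)) ⟩
        1/N * ((suc m ×ᴿ 1#) * coeff Φ (suc m))         ≈⟨ *-assoc _ _ _ ⟨
        (1/N * (suc m ×ᴿ 1#)) * coeff Φ (suc m)         ∎
      second : ∀ m → coeff (v *ᴾ Φ′) m ≈ - t m * coeff Φ (suc m) + (1/N * (m ×ᴿ 1#)) * coeff Φ m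
      second m = begin
        coeff (v *ᴾ Φ′) m
          ≈⟨ coeff-* (- 1/N) (1/N ∷ []) Φ′ m ⟩
        - 1/N * coeff Φ′ m + coeff (0# ∷ (1/N ∷ []) *ᴾ Φ′) m
          ≈⟨ +-cong (*-congˡ (trans (coeff-derivative Φ m) (×-* (suc m) _))) (shifted m) ⟩
        - 1/N * ((suc m ×ᴿ 1#) * coeff Φ (suc m)) + (1/N * (m ×ᴿ 1#)) * coeff Φ m
          ≈⟨ +-congʳ (trans (sym (*-assoc _ _ _)) (*-congʳ (trans (sym (-‿distribˡ-* _ _)) (-‿cong (*-comm _ _))))) ⟩
        - t m * coeff Φ (suc m) + (1/N * (m ×ᴿ 1#)) * coeff Φ m ∎
      first : ∀ m → coeff ((1# ∷ u ∷ []) *ᴾ Φ) (suc m) ≈ coeff Φ (suc m) + u * coeff Φ m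
      first m = trans (coeff-* 1# (u ∷ []) Φ (suc m)) (+-cong (*-identityˡ _)
        (trans (coeff-* u [] Φ m) (trans (+-congˡ (coeff-zero m)) (+-identityʳ _))))
      1-t t-1 : ℕ → Carrier
      1-t m = 1# - t m
      t-1 m = u + 1/N * (m ×ᴿ 1#)
      cancel : ∀ m → 1-t m + t-1 m ≈ 0#
      cancel m = begin
        (1# - t m) + ((1/N - 1#) + 1/N * M)      ≈⟨ +-congˡ (+-congʳ (+-comm _ _)) ⟩
        (1# - t m) + ((- 1# + 1/N) + 1/N * M)    ≈⟨ +-congˡ (+-assoc _ _ _) ⟩
        (1# - t m) + (- 1# + (1/N + 1/N * M))    ≈⟨ +-congˡ (+-congˡ (trans (*-comm _ _)
                                                      (trans (distribˡ 1/N 1# M) (+-congʳ (*-identityʳ _))))) ⟨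
        (1# - t m) + (- 1# + t m)                ≈⟨ interchange 1# (- t m) (- 1#) (t m) ⟩
        (1# - 1#) + (- t m + t m)                ≈⟨ +-cong (-‿inverseʳ 1#) (-‿inverseˡ (t m)) ⟩
        0# + 0#                                  ≈⟨ +-identityˡ 0# ⟩
        0#                                       ∎
        where
        M = m ×ᴿ 1#
        open CommutativeSemigroupProperties +-commutativeSemigroup using (interchange)
      total : ∀ m → coeff ((1# ∷ u ∷ []) *ᴾ Φ +ᴾ (0# ∷ v) *ᴾ Φ′) (suc m) ≈
                    1-t m * coeff Φ (suc m) + t-1 m * coeff Φ m
      total m = begin
        _
          ≈⟨ coeff-+ ((1# ∷ u ∷ []) *ᴾ Φ) ((0# ∷ v) *ᴾ Φ′) (suc m) ⟩
        coeff ((1# ∷ u ∷ []) *ᴾ Φ) (suc m) + coeff ((0# ∷ v) *ᴾ Φ′) (suc m)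
          ≈⟨ +-cong (first m) (trans (coeff-* 0# v Φ′ (suc m))
               (trans (+-congʳ (zeroˡ _)) (trans (+-identityˡ _) (second m)))) ⟩
        (coeff Φ (suc m) + u * coeff Φ m) + (- t m * coeff Φ (suc m) + (1/N * (m ×ᴿ 1#)) * coeff Φ m)
          ≈⟨ interchange _ _ _ _ ⟩
        (coeff Φ (suc m) + - t m * coeff Φ (suc m)) + (u * coeff Φ m + (1/N * (m ×ᴿ 1#)) * coeff Φ m)
          ≈⟨ +-cong (+-congʳ (*-identityˡ _)) refl ⟨
        (1# * coeff Φ (suc m) + - t m * coeff Φ (suc m)) + (u * coeff Φ m + (1/N * (m ×ᴿ 1#)) * coeff Φ m)
          ≈⟨ +-cong (distribʳ _ _ _) (distribʳ _ _ _) ⟨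
        1-t m * coeff Φ (suc m) + t-1 m * coeff Φ m ∎
        where open CommutativeSemigroupProperties +-commutativeSemigroup using (interchange)
      bézout : ∀ n → coeff ((1# ∷ u ∷ []) *ᴾ Φ +ᴾ (0# ∷ v) *ᴾ Φ′) n ≈ coeff 1ᴾ n
      bézout zero = begin
        _                                     ≈⟨ coeff-+ ((1# ∷ u ∷ []) *ᴾ Φ) ((0# ∷ v) *ᴾ Φ′) 0 ⟩
        _                                     ≈⟨ +-cong (coeff-* 1# (u ∷ []) Φ 0) (coeff-* 0# v Φ′ 0) ⟩
        (1# * 1# + 0#) + (0# * coeff Φ′ 0 + 0#)  ≈⟨ +-cong (trans (+-identityʳ _) (*-identityˡ 1#))
                                                      (trans (+-identityʳ _) (zeroˡ _)) ⟩
        1# + 0#                               ≈⟨ +-identityʳ 1# ⟩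
        1#                                    ∎
      -- Below degree `N` both coefficients of `Φ` are 1 and the two factors cancel. In degree `N`
      -- only the lower coefficient survives, with factor `t-1 k`, which is zero because
      -- `N * 1/N = 1`. Beyond, both coefficients vanish.
      bézout (suc m) = trans (total m) (case ℕ.<-cmp (suc m) N of λ where
        (tri< m+1<N _ _) → trans (+-cong
            (trans (*-congˡ (reflexive (coeff-ones-< m+1<N))) (*-identityʳ _))
            (trans (*-congˡ (reflexive (coeff-ones-< (ℕ.<-trans (ℕ.n<1+n m) m+1<N)))) (*-identityʳ _)))
          (cancel m)
        (tri≈ _ ≡.refl _) → trans (+-cong
            (trans (*-congˡ (reflexive (coeff-ones-≥ (ℕ.≤-refl {N})))) (zeroʳ _))
            (trans (*-congʳ (trans (sym (+-identityˡ _)) (trans (+-congʳ (sym (trans (+-congˡ (-‿cong N*1/N))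
              (-‿inverseʳ 1#)))) (cancel k)))) (zeroˡ _)))
          (+-identityˡ 0#)
        (tri> _ _ N<m+1) → trans (+-cong
            (trans (*-congˡ (reflexive (coeff-ones-≥ (ℕ.<⇒≤ N<m+1)))) (zeroʳ _))
            (trans (*-congˡ (reflexive (coeff-ones-≥ (ℕ.s≤s⁻¹ N<m+1)))) (zeroʳ _)))
          (+-identityˡ 0#))
      root = separablyClosed Φ (0 , λ e → 1≉0 (trans (reflexive (≡.sym (coeff-ones-< (ℕ.s≤s 0<k)))) e))
                             ((1# ∷ u ∷ []) , (0# ∷ v) , bézout)
      x = proj₁ root
      Φx≈0 = proj₂ root

-- Monic polynomials over a domain

module MonicPolynomials {ℓ : Level} (R : CommutativeRing ℓ ℓ)
  (1≉0 : ¬ (CommutativeRing._≈_ R (CommutativeRing.1# R) (CommutativeRing.0# R)))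
  (noZeroDivisors : ∀ {x y} → CommutativeRing._≈_ R (CommutativeRing._*_ R x y) (CommutativeRing.0# R) →
     CommutativeRing._≈_ R x (CommutativeRing.0# R) ⊎ CommutativeRing._≈_ R y (CommutativeRing.0# R)) where

  open CommutativeRing R hiding (zero)
  open RingProperties ring using (-‿distribˡ-*)
  open Exp semiring using (_^_)
  open Solver commutativeSemiring using (solve; _:=_; _:+_; _:*_)
  open SetoidReasoning setoid

  -≈0⇒≈ : ∀ {x y} → x - y ≈ 0# → x ≈ y
  -≈0⇒≈ {x} {y} p = begin
    x               ≈⟨ +-identityʳ x ⟨
    x + 0#          ≈⟨ +-congˡ (-‿inverseˡ y) ⟨
    x + (- y + y)   ≈⟨ +-assoc _ _ _ ⟨
    (x - y) + y     ≈⟨ +-congʳ p ⟩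
    0# + y          ≈⟨ +-identityˡ y ⟩
    y               ∎

  -- The lower coefficients a₀, …, aₙ₋₁ stand for a₀ + ⋯ + aₙ₋₁ Xⁿ⁻¹ + Xⁿ.
  monic : ∀ {n} → Vec Carrier n → Carrier → Carrier
  monic []      x = 1#
  monic (a ∷ v) x = a + x * monic v x

  poly : ∀ {n} → Vec Carrier n → Carrier → Carrier
  poly []      x = 0#
  poly (a ∷ v) x = a + x * poly v x

  factor : ∀ {n} (v : Vec Carrier (suc n)) ρ →
           ∃ λ (w : Vec Carrier n) → ∀ x → monic v x ≈ (x - ρ) * monic w x + monic v ρ
  factor (a ∷ []) ρ = [] , λ x → begin
    a + x * 1#                       ≈⟨ +-congˡ (*-congʳ (split x)) ⟩
    a + ((x - ρ) + ρ) * 1#           ≈⟨ solve 4 (λ a d ρ o → a :+ (d :+ ρ) :* o := d :* o :+ (a :+ ρ :* o)) refl a (x - ρ) ρ 1# ⟩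
    (x - ρ) * 1# + (a + ρ * 1#)      ∎
    where
    split : ∀ x → x ≈ (x - ρ) + ρ
    split x = sym (trans (+-assoc _ _ _) (trans (+-congˡ (-‿inverseˡ ρ)) (+-identityʳ x)))
  factor (a ∷ v@(_ ∷ _)) ρ =
    let (w , v≈) = factor v ρ
        b = monic v ρ
    in b ∷ w , λ x → begin
      a + x * monic v x
        ≈⟨ +-congˡ (*-congˡ (v≈ x)) ⟩
      a + x * ((x - ρ) * monic w x + b)
        ≈⟨ +-congˡ (trans (distribˡ x _ _) (+-congˡ (*-congʳ (split x)))) ⟩
      a + (x * ((x - ρ) * monic w x) + ((x - ρ) + ρ) * b)
        ≈⟨ solve 6 (λ a x d w ρ b → a :+ (x :* (d :* w) :+ (d :+ ρ) :* b) :=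
                                    d :* (b :+ x :* w) :+ (a :+ ρ :* b)) refl a x (x - ρ) (monic w x) ρ b ⟩
      (x - ρ) * (b + x * monic w x) + (a + ρ * b) ∎
    where
    split : ∀ x → x ≈ (x - ρ) + ρ
    split x = sym (trans (+-assoc _ _ _) (trans (+-congˡ (-‿inverseˡ ρ)) (+-identityʳ x)))

  linearFactor : ∀ {n} (v : Vec Carrier (suc n)) {ρ} → monic v ρ ≈ 0# →
                 ∃ λ (w : Vec Carrier n) → ∀ x → monic v x ≈ (x - ρ) * monic w x
  linearFactor v {ρ} p =
    let (w , v≈) = factor v ρ
    in w , λ x → trans (v≈ x) (trans (+-congˡ p) (+-identityʳ _))

  Distinct : ∀ {n} → (Fin n → Carrier) → Set ℓ
  Distinct ρ = ∀ {i j} → ρ i ≈ ρ j → i ≡ j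

  private
    tail-distinct : ∀ {n} {ρ : Fin (suc n) → Carrier} → Distinct ρ → Distinct (ρ ∘ suc)
    tail-distinct distinct p = Fin.suc-injective (distinct p)

    cancelFactor : ∀ {n} {ρ : Fin (suc n) → Carrier} → Distinct ρ → ∀ i {y} →
                   (ρ (suc i) - ρ zero) * y ≈ 0# → y ≈ 0#
    cancelFactor distinct i p = case noZeroDivisors p of λ where
      (inj₂ q) → q
      (inj₁ q) → case distinct (-≈0⇒≈ q) of λ ()

  roots-exhaustive : ∀ {n} (v : Vec Carrier n) (ρ : Fin n → Carrier) → Distinct ρ →
                     (∀ i → monic v (ρ i) ≈ 0#) → ∀ {x} → monic v x ≈ 0# → ∃ λ i → x ≈ ρ i
  roots-exhaustive {zero}  []  ρ distinct roots p = contradiction p 1≉0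
  roots-exhaustive {suc n} v ρ distinct roots {x} p =
    let (w , v≈) = linearFactor v (roots zero)
    in case noZeroDivisors (trans (sym (v≈ x)) p) of λ where
      (inj₁ q) → zero , -≈0⇒≈ q
      (inj₂ q) → let (i , x≈) = roots-exhaustive w (ρ ∘ suc) (tail-distinct distinct)
                                  (λ i → cancelFactor distinct i (trans (sym (v≈ _)) (roots (suc i)))) q
                 in suc i , x≈

  -- If the m + n distinct roots of P Q, where P has degree m, are multiples of t
  -- by constants in C, then P(0) is a multiple of tᵐ by a constant in C.
  module _ {C : Pred Carrier ℓ} (C-1 : C 1#) (C-* : ∀ {x y} → C x → C y → C (x * y))
           (C-neg : ∀ {x} → C x → C (- x)) (t : Carrier) where

    constantTerm : ∀ {k m n} → k ≡ m ℕ.+ n → (P : Vec Carrier m) (Q : Vec Carrier n)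
                   (ρ : Fin k → Carrier) → Distinct ρ → (∀ i → ∃ λ c → C c × ρ i ≈ c * t) →
                   (∀ i → monic P (ρ i) * monic Q (ρ i) ≈ 0#) → ∃ λ c → C c × monic P 0# ≈ c * t ^ m
    constantTerm {m = zero} e [] Q ρ distinct ρ∈ roots = 1# , C-1 , sym (*-identityˡ 1#)
    constantTerm {m = suc m} {n} ≡.refl P Q ρ distinct ρ∈ roots = case noZeroDivisors (roots zero) of λ where
      (inj₁ p) →
        let (P′ , P≈) = linearFactor P p
            (c , c∈ , P′0≈) = constantTerm ≡.refl P′ Q (ρ ∘ suc) (tail-distinct distinct) (ρ∈ ∘ suc)
              (λ i → cancelFactor distinct i (trans (sym (*-assoc _ _ _))
                       (trans (*-congʳ (sym (P≈ _))) (roots (suc i)))))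
            (d , d∈ , ρ≈) = ρ∈ zero
        in - d * c , C-* (C-neg d∈) c∈ , (begin
             monic P 0#                          ≈⟨ P≈ 0# ⟩
             (0# - ρ zero) * monic P′ 0#         ≈⟨ *-cong (trans (+-identityˡ _) (-‿cong ρ≈)) P′0≈ ⟩
             (- (d * t)) * (c * t ^ m)           ≈⟨ *-congʳ (-‿distribˡ-* d t) ⟩
             (- d * t) * (c * t ^ m)             ≈⟨ solve 4 (λ d t c u → (d :* t) :* (c :* u) := (d :* c) :* (t :* u))
                                                      refl (- d) t c (t ^ m) ⟩
             (- d * c) * (t * t ^ m)             ∎)
      -- A root of `Q` is split off from `Q`: this leaves `P(0)` unchanged and keeps the number of
      -- roots equal to the sum of the two degrees.
      (inj₂ q) → second n Q ρ distinct ρ∈ roots q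
     where
      second : ∀ n (Q : Vec Carrier n) (ρ : Fin (suc m ℕ.+ n) → Carrier) → Distinct ρ →
               (∀ i → ∃ λ c → C c × ρ i ≈ c * t) → (∀ i → monic P (ρ i) * monic Q (ρ i) ≈ 0#) →
               monic Q (ρ zero) ≈ 0# → ∃ λ c → C c × monic P 0# ≈ c * t ^ suc m
      second zero    [] ρ distinct ρ∈ roots q = contradiction q 1≉0
      second (suc n) Q  ρ distinct ρ∈ roots q =
        let (Q′ , Q≈) = linearFactor Q q
        in constantTerm (ℕ.+-suc m n) P Q′ (ρ ∘ suc) (tail-distinct distinct) (ρ∈ ∘ suc)
             (λ i → cancelFactor distinct i (trans
               (solve 3 (λ d p q → d :* (p :* q) := p :* (d :* q)) refl _ _ _)
               (trans (*-congˡ (sym (Q≈ _))) (roots (suc i)))))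

  binomial : ∀ k → Carrier → Vec Carrier (suc k)
  binomial k a = - a ∷ Vec.replicate k 0#

  monic-binomial : ∀ k a x → monic (binomial k a) x ≈ x ^ suc k - a
  monic-binomial k a x = trans (+-comm _ _) (+-congʳ (*-congˡ (power k)))
    where
    power : ∀ k → monic (Vec.replicate k 0#) x ≈ x ^ k
    power zero    = refl
    power (suc k) = trans (+-identityˡ _) (*-congˡ (power k))

  record IsSubfield (L : Pred Carrier ℓ) : Set ℓ where
    field
      resp       : ∀ {x y} → x ≈ y → x ∈ L → y ∈ L
      +-closed   : ∀ {x y} → x ∈ L → y ∈ L → x + y ∈ L
      *-closed   : ∀ {x y} → x ∈ L → y ∈ L → x * y ∈ L
      neg-closed : ∀ {x} → x ∈ L → - x ∈ L
      1∈         : 1# ∈ L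
      inv-closed : ∀ {x y} → x ∈ L → x * y ≈ 1# → y ∈ L

    0∈ : 0# ∈ L
    0∈ = resp (-‿inverseʳ 1#) (+-closed 1∈ (neg-closed 1∈))

    ^-closed : ∀ n {x} → x ∈ L → x ^ n ∈ L
    ^-closed zero    p = 1∈
    ^-closed (suc n) p = *-closed p (^-closed n p)

  module _ {L : Pred Carrier ℓ} (isSubfield : IsSubfield L) where

    open IsSubfield isSubfield

    private
      lowerDegree : ∀ {m} (v : Vec Carrier (suc m)) (P : Vec Carrier m) → All L v → All L P →
                    ∃ λ r → ∃ λ (S : Vec Carrier m) → L r × All L S ×
                      (∀ x → poly v x ≈ r * monic P x + poly S x)
      lowerDegree (a ∷ []) [] (a∈ ∷ []) [] = a , [] , a∈ , [] , λ x →
        +-cong (sym (*-identityʳ a)) (zeroʳ x)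
      lowerDegree (a ∷ v) (p ∷ P) (a∈ ∷ v∈) (p∈ ∷ P∈) =
        let (r , S , r∈ , S∈ , v≈) = lowerDegree v P v∈ P∈
        in r , (a - r * p) ∷ S , r∈ , +-closed a∈ (neg-closed (*-closed r∈ p∈)) ∷ S∈ , λ x → begin
          a + x * poly v x
            ≈⟨ +-cong (trans (sym (+-identityʳ a)) (trans (+-congˡ (sym (-‿inverseˡ (r * p)))) (sym (+-assoc _ _ _))))
                      (*-congˡ (v≈ x)) ⟩
          ((a - r * p) + r * p) + x * (r * monic P x + poly S x)
            ≈⟨ solve 6 (λ d r p x m s → (d :+ r :* p) :+ x :* (r :* m :+ s) :=
                                        r :* (p :+ x :* m) :+ (d :+ x :* s)) refl
                 (a - r * p) r p x (monic P x) (poly S x) ⟩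
          r * (p + x * monic P x) + ((a - r * p) + x * poly S x) ∎

      difference : ∀ {m} (v w : Vec Carrier m) → All L v → All L w →
                   ∃ λ (S : Vec Carrier m) → All L S × (∀ x → monic v x ≈ monic w x + poly S x)
      difference [] [] [] [] = [] , [] , λ x → sym (+-identityʳ 1#)
      difference (a ∷ v) (b ∷ w) (a∈ ∷ v∈) (b∈ ∷ w∈) =
        let (S , S∈ , v≈) = difference v w v∈ w∈
        in (a - b) ∷ S , +-closed a∈ (neg-closed b∈) ∷ S∈ , λ x → begin
          a + x * monic v x
            ≈⟨ +-cong (trans (sym (+-identityʳ a)) (trans (+-congˡ (sym (-‿inverseˡ b))) (sym (+-assoc _ _ _))))
                      (*-congˡ (v≈ x)) ⟩
          ((a - b) + b) + x * (monic w x + poly S x)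
            ≈⟨ solve 5 (λ d b x m s → (d :+ b) :+ x :* (m :+ s) := (b :+ x :* m) :+ (d :+ x :* s)) refl
                 (a - b) b x (monic w x) (poly S x) ⟩
          (b + x * monic w x) + ((a - b) + x * poly S x) ∎

    divide : ∀ n {m} (v : Vec Carrier (n ℕ.+ m)) (P : Vec Carrier m) → All L v → All L P →
             ∃ λ (Q : Vec Carrier n) → ∃ λ (S : Vec Carrier m) → All L S ×
               (∀ x → monic v x ≈ monic P x * monic Q x + poly S x)
    divide zero v P v∈ P∈ =
      let (S , S∈ , v≈) = difference v P v∈ P∈
      in [] , S , S∈ , λ x → trans (v≈ x) (+-congʳ (sym (*-identityʳ _)))
    divide (suc n) (a ∷ v) P (a∈ ∷ v∈) P∈ =
      let (Q , S , S∈ , v≈)         = divide n v P v∈ P∈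
          (r , S′ , r∈ , S′∈ , aS≈) = lowerDegree (a ∷ S) P (a∈ ∷ S∈) P∈
      in r ∷ Q , S′ , S′∈ , λ x → begin
        a + x * monic v x
          ≈⟨ +-congˡ (*-congˡ (v≈ x)) ⟩
        a + x * (monic P x * monic Q x + poly S x)
          ≈⟨ solve 5 (λ a x p q s → a :+ x :* (p :* q :+ s) := p :* (x :* q) :+ (a :+ x :* s)) refl
               a x (monic P x) (monic Q x) (poly S x) ⟩
        monic P x * (x * monic Q x) + (a + x * poly S x)
          ≈⟨ +-congˡ (aS≈ x) ⟩
        monic P x * (x * monic Q x) + (r * monic P x + poly S′ x)
          ≈⟨ solve 5 (λ x p q r s → p :* (x :* q) :+ (r :* p :+ s) := p :* (r :+ x :* q) :+ s) refl
               x (monic P x) (monic Q x) r (poly S′ x) ⟩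
        monic P x * (r + x * monic Q x) + poly S′ x ∎

    module _ (em : ExcludedMiddle ℓ) (invertible : ∀ {x} → ¬ (x ≈ 0#) → ∃ λ y → x * y ≈ 1#) where

      Vanishing : ∀ {n} → Vec Carrier n → Set ℓ
      Vanishing v = All (_≈ 0#) v

      poly-vanishing : ∀ {n} {v : Vec Carrier n} → Vanishing v → ∀ x → poly v x ≈ 0#
      poly-vanishing []       x = refl
      poly-vanishing (p ∷ ps) x = trans (+-cong p (trans (*-congˡ (poly-vanishing ps x)) (zeroʳ x))) (+-identityˡ 0#)

      makeMonic : ∀ {n} (v : Vec Carrier n) → All L v → ¬ Vanishing v →
                  ∃ λ m → m ℕ.< n × ∃ λ (P : Vec Carrier m) → All L P × ∃ λ c → L c × ¬ (c ≈ 0#) ×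
                    (∀ x → poly v x ≈ c * monic P x)
      makeMonic [] [] ¬v = contradiction [] ¬v
      makeMonic (a ∷ v) (a∈ ∷ v∈) ¬av = case em {P = Vanishing v} of λ where
        (yes p) → 0 , ℕ.s≤s ℕ.z≤n , [] , [] , a , a∈ , (λ a≈0 → ¬av (a≈0 ∷ p)) , λ x →
          trans (+-congˡ (trans (*-congˡ (poly-vanishing p x)) (zeroʳ x)))
                (trans (+-identityʳ a) (sym (*-identityʳ a)))
        (no ¬p) →
          let (m , m<n , P , P∈ , c , c∈ , c≉0 , v≈) = makeMonic v v∈ ¬p
              (d , cd≈1) = invertible c≉0
          in suc m , ℕ.s≤s m<n , (d * a) ∷ P , *-closed (inv-closed c∈ cd≈1) a∈ ∷ P∈ , c , c∈ , c≉0 , λ x → begin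
               a + x * poly v x
                 ≈⟨ +-cong (trans (sym (*-identityˡ a)) (*-congʳ (sym cd≈1))) (*-congˡ (v≈ x)) ⟩
               (c * d) * a + x * (c * monic P x)
                 ≈⟨ solve 5 (λ c d a x m → (c :* d) :* a :+ x :* (c :* m) := c :* (d :* a :+ x :* m)) refl
                      c d a x (monic P x) ⟩
               c * (d * a + x * monic P x) ∎

      Relation : Carrier → ℕ → Set ℓ
      Relation t m = ∃ λ (P : Vec Carrier m) → All L P × monic P t ≈ 0#

      relation : ∀ {n} (v : Vec Carrier n) → All L v → ¬ Vanishing v → ∀ {t} → poly v t ≈ 0# →
                 ∃ λ m → m ℕ.< n × Relation t m
      relation v v∈ ¬v {t} p =
        let (m , m<n , P , P∈ , c , _ , c≉0 , v≈) = makeMonic v v∈ ¬v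
        in m , m<n , P , P∈ , (case noZeroDivisors (trans (sym (v≈ t)) p) of λ where
             (inj₁ c≈0) → contradiction c≈0 c≉0
             (inj₂ q)   → q)

      least : (T : ℕ → Set ℓ) → ∀ n → T n → ∃ λ m → m ℕ.≤ n × T m × (∀ k → k ℕ.< m → ¬ T k)
      least T n = ℕ.<-rec (λ n → T n → ∃ λ m → m ℕ.≤ n × T m × (∀ k → k ℕ.< m → ¬ T k)) (λ n rec p →
        case em {P = ∃ λ k → k ℕ.< n × T k} of λ where
          (yes (k , k<n , q)) → let (m , m≤k , r) = rec k<n q in m , ℕ.≤-trans m≤k (ℕ.<⇒≤ k<n) , r
          (no none) → n , ℕ.≤-refl , p , λ k k<n q → none (k , k<n , q)) n

      -- The minimal polynomial of t divides Xᴺ − a, whose roots are the ρ i; so its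
      -- constant term is a multiple of a power of t.
      power∈ : {C : Pred Carrier ℓ} → C 1# → (∀ {x y} → C x → C y → C (x * y)) → (∀ {x} → C x → C (- x)) →
               ∀ t k (let N = suc k) {a} → L a → (ρ : Fin N → Carrier) → Distinct ρ →
               (∀ i → ∃ λ c → C c × ρ i ≈ c * t) → (∀ i → ρ i ^ N ≈ a) → t ^ N ≈ a →
               (v : Vec Carrier N) → All L v → ¬ Vanishing v → poly v t ≈ 0# →
               ∃ λ m → 0 ℕ.< m × m ℕ.< N × ∃ λ c → C c × L (c * t ^ m)
      power∈ {C} C-1 C-* C-neg t k {a} a∈ ρ distinct ρ∈ ρ^N t^N v v∈ ¬v vt≈0 =
        let (n , n<N , rel) = relation v v∈ ¬v vt≈0
            (m , m≤n , (P , P∈ , Pt≈0) , minimal) = least (Relation t) n rel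
        in conclude m (ℕ.≤-<-trans m≤n n<N) P P∈ Pt≈0 minimal
        where
        N = suc k
        A = binomial k a
        root : ∀ {x} → x ^ N ≈ a → monic A x ≈ 0#
        root {x} p = trans (monic-binomial k a x) (trans (+-congʳ p) (-‿inverseʳ a))
        zeros∈ : ∀ k → All L (Vec.replicate k 0#)
        zeros∈ zero    = []
        zeros∈ (suc k) = 0∈ ∷ zeros∈ k
        conclude : ∀ m → m ℕ.< N → (P : Vec Carrier m) → All L P → monic P t ≈ 0# →
                   (∀ k → k ℕ.< m → ¬ Relation t k) →
                   ∃ λ m → 0 ℕ.< m × m ℕ.< N × ∃ λ c → C c × L (c * t ^ m)
        conclude zero    m<N [] P∈ Pt≈0 minimal = contradiction Pt≈0 1≉0
        conclude (suc m) m<N P@(p ∷ P′) P∈@(p∈ ∷ _) Pt≈0 minimal =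
          let n = N ℕ.∸ suc m
              e : N ≡ n ℕ.+ suc m
              e = ≡.sym (ℕ.m∸n+n≡m (ℕ.<⇒≤ m<N))
              (A′ , A′∈ , A′≈) = recast e A (neg-closed a∈ ∷ zeros∈ k)
              (Q , S , S∈ , A≈) = divide n A′ P A′∈ P∈
              St≈0 : poly S t ≈ 0#
              St≈0 = trans (sym (+-identityˡ _)) (trans (+-congʳ (sym (trans (*-congʳ Pt≈0) (zeroˡ _))))
                       (trans (sym (A≈ t)) (trans (A′≈ t) (root t^N))))
              -- Were `S` nonzero, its monic multiple would be a relation for `t` of degree below
              -- the minimal one.
              S-vanishing : Vanishing S
              S-vanishing = decidable-stable em λ ¬S →
                let (j , j<m , rel) = relation S S∈ ¬S St≈0 in minimal j j<m rel
              (c , c∈ , P0≈) = constantTerm C-1 C-* C-neg t (≡.trans e (ℕ.+-comm n (suc m))) P Q ρ distinct ρ∈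
                (λ i → trans (sym (+-identityʳ _)) (trans (+-congˡ (sym (poly-vanishing S-vanishing (ρ i))))
                         (trans (sym (A≈ (ρ i))) (trans (A′≈ (ρ i)) (root (ρ^N i))))))
          in suc m , ℕ.s≤s ℕ.z≤n , m<N , c , c∈ ,
               resp (trans (sym (trans (+-congˡ (zeroˡ _)) (+-identityʳ p))) P0≈) p∈
          where
          recast : ∀ {i j} → i ≡ j → (v : Vec Carrier i) → All L v →
                   ∃ λ (w : Vec Carrier j) → All L w × (∀ x → monic w x ≈ monic v x)
          recast ≡.refl v v∈ = v , v∈ , λ _ → refl

-- Kummer theory

module GroupHomomorphism {a b : Level} {A : AbelianGroup (a ⊔ a) a} {B : AbelianGroup (b ⊔ b) b}
  (f : AbelianGroup.Carrier A → AbelianGroup.Carrier B)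
  (f-cong : ∀ {x y} → AbelianGroup._≈_ A x y → AbelianGroup._≈_ B (f x) (f y))
  (f-∙ : ∀ x y → AbelianGroup._≈_ B (f (AbelianGroup._∙_ A x y)) (AbelianGroup._∙_ B (f x) (f y))) where

  private
    module A = AbelianGroup A
    module B = AbelianGroup B
    module CA = Congruence A
    module CB = Congruence B
    open AbelianGroupProperties B using (identityʳ-unique; inverseˡ-unique)

  f-ε : f A.ε B.≈ B.ε
  f-ε = identityʳ-unique (f A.ε) (f A.ε) (B.trans (B.sym (f-∙ A.ε A.ε)) (f-cong (A.identityˡ A.ε)))

  f-⁻¹ : ∀ x → f (x A.⁻¹) B.≈ f x B.⁻¹
  f-⁻¹ x = inverseˡ-unique (f (x A.⁻¹)) (f x)
    (B.trans (B.sym (f-∙ (x A.⁻¹) x)) (B.trans (f-cong (A.inverseˡ x)) f-ε))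

  f-•⁺ : ∀ n x → f (+ n CA.• x) B.≈ + n CB.• f x
  f-•⁺ zero    x = f-ε
  f-•⁺ (suc n) x = B.trans (f-∙ x (+ n CA.• x)) (B.∙-congˡ (f-•⁺ n x))

  f-• : ∀ z x → f (z CA.• x) B.≈ z CB.• f x
  f-• (+ n)    x = f-•⁺ n x
  f-• -[1+ n ] x = B.trans (f-⁻¹ (+ suc n CA.• x)) (B.⁻¹-cong (f-•⁺ (suc n) x))

  f-comb : ∀ {d} (c : Fin d → ℤ) x → f (CA.comb c x) B.≈ CB.comb c (λ j → f (x j))
  f-comb {zero}  c x = f-ε
  f-comb {suc d} c x = B.trans (f-∙ _ _) (B.∙-cong (f-• (c zero) (x zero)) (f-comb (c ∘ suc) (x ∘ suc)))

-- A and B play the roles of F* and Ω*; keeping them abstract lets Agda infer units.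
-- The level ℓ ⊔ ℓ is the one at which the unit groups are defined.
record KummerPair {ℓ : Level} (F Ω : CommutativeRing ℓ ℓ) (A B : AbelianGroup (ℓ ⊔ ℓ) ℓ) (l : ℕ) : Set ℓ where

  private
    module F = CommutativeRing F
    module Ω = CommutativeRing Ω
    module A = AbelianGroup A
    module B = AbelianGroup B
    module F[X] = Polynomial F
    module Ω[X] = Polynomial Ω
    open Exp Ω.semiring using (_^_)
    open RawMonoidDefs Ω.+-rawMonoid using () renaming (_×_ to _×ᴿ_)

  field
    ι                    : F.Carrier → Ω.Carrier
    ι-isRingHomomorphism : IsRingHomomorphism F.rawRing Ω.rawRing ι
    ι-injective          : ∀ {x} → ι x Ω.≈ Ω.0# → x F.≈ F.0#
    value                : B.Carrier → Ω.Carrier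
    value-cong           : ∀ {x y} → x B.≈ y → value x Ω.≈ value y
    value-injective      : ∀ {x y} → value x Ω.≈ value y → x B.≈ y
    value-∙              : ∀ x y → value (x B.∙ y) Ω.≈ value x Ω.* value y
    value-ε              : value B.ε Ω.≈ Ω.1#
    unit                 : ∀ x y → x Ω.* y Ω.≈ Ω.1# → ∃ λ b → value b Ω.≈ x
    embed                : A.Carrier → B.Carrier
    embed-cong           : ∀ {x y} → x A.≈ y → embed x B.≈ embed y
    embed-injective      : ∀ {x y} → embed x B.≈ embed y → x A.≈ y
    embed-∙              : ∀ x y → embed (x A.∙ y) B.≈ embed x B.∙ embed y
    embed∈F              : ∀ a → ∃ λ x → ι x Ω.≈ value (embed a)
    unitᶠ                : ∀ x → ¬ (ι x Ω.≈ Ω.0#) → ∃ λ a → value (embed a) Ω.≈ ι x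
    invertible           : ∀ {x} → ¬ (x Ω.≈ Ω.0#) → ∃ λ y → x Ω.* y Ω.≈ Ω.1#
    1≉0                  : ¬ (Ω.1# Ω.≈ Ω.0#)
    l≉0                  : ¬ (l ×ᴿ Ω.1# Ω.≈ Ω.0#)
    lthRoot              : ∀ a b → a Ω.* b Ω.≈ Ω.1# → ∃ λ x → x ^ l Ω.≈ a
    nontrivialRoot       : ∃ λ x → x ^ l Ω.≈ Ω.1# × ¬ (x Ω.≈ Ω.1#)
    roots∈F              : ∀ x n → x ^ (l ℕ.^ n) Ω.≈ Ω.1# → ∃ λ a → ι a Ω.≈ x
    algebraic            : ∀ x → ∃ λ p → ¬ (p F[X].≈ᴾ []) × Ω[X].eval (map ι p) x Ω.≈ Ω.0#

module Kummer (em : ∀ {a} → ExcludedMiddle a) {ℓ : Level} {F Ω : CommutativeRing ℓ ℓ}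
  {A B : AbelianGroup (ℓ ⊔ ℓ) ℓ} {l : ℕ} (l-prime : Prime l) (pair : KummerPair F Ω A B l) where

  open PrimePowers l-prime
  open KummerPair pair public
  module F = CommutativeRing F
  module A = AbelianGroup A
  module B = AbelianGroup B
  module CA = Congruence A
  module CB = Congruence B
  module ι = IsRingHomomorphism ι-isRingHomomorphism
  module Embed = GroupHomomorphism {A = A} {B = B} embed embed-cong embed-∙
  open CommutativeRing Ω hiding (zero)
  open Exp semiring using (_^_; ^-congˡ)
  open CB using (_•_; •-1; •-pos-*)

  noZeroDivisors : ∀ {x y} → x * y ≈ 0# → x ≈ 0# ⊎ y ≈ 0#
  noZeroDivisors {x} {y} xy≈0 = case em {P = x ≈ 0#} of λ where
    (yes x≈0) → inj₁ x≈0
    (no x≉0)  → let (x′ , xx′≈1) = invertible x≉0 in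
      inj₂ (trans (sym (*-identityˡ y)) (trans (*-congʳ (trans (sym xx′≈1) (*-comm x x′)))
        (trans (*-assoc _ _ _) (trans (*-congˡ xy≈0) (zeroʳ x′)))))

  open MonicPolynomials Ω 1≉0 noZeroDivisors public

  value-inverse : ∀ b → value b * value (b B.⁻¹) ≈ 1#
  value-inverse b = trans (sym (value-∙ b (b B.⁻¹))) (trans (value-cong (B.inverseʳ b)) value-ε)

  invertible⇒≉0 : ∀ {x y} → x * y ≈ 1# → ¬ (x ≈ 0#)
  invertible⇒≉0 xy≈1 x≈0 = 1≉0 (trans (sym xy≈1) (trans (*-congʳ x≈0) (zeroˡ _)))

  value≉0 : ∀ b → ¬ (value b ≈ 0#)
  value≉0 b = invertible⇒≉0 (value-inverse b)

  toUnit : ∀ {x} → ¬ (x ≈ 0#) → ∃ λ b → value b ≈ x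
  toUnit x≉0 = let (y , xy≈1) = invertible x≉0 in unit _ y xy≈1

  value-• : ∀ n b → value (+ n • b) ≈ value b ^ n
  value-• zero    b = value-ε
  value-• (suc n) b = trans (value-∙ b (+ n • b)) (*-congˡ (value-• n b))

  lthRootᵁ : ∀ b → ∃ λ y → + l • y B.≈ b
  lthRootᵁ b = go l {{l-nonZero}} (lthRoot (value b) (value (b B.⁻¹)) (value-inverse b))
    where
    go : ∀ n → .{{ℕ.NonZero n}} → (∃ λ x → x ^ n ≈ value b) → ∃ λ y → + n • y B.≈ b
    go (suc k) (x , x^n≈b) =
      let (y , y≈x) = unit x (x ^ k * value (b B.⁻¹))
            (trans (sym (*-assoc _ _ _)) (trans (*-congʳ x^n≈b) (value-inverse b)))
      in y , value-injective (trans (value-• (suc k) y) (trans (^-congˡ (suc k) y≈x) x^n≈b))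

  l^-thRootᵁ : ∀ n b → ∃ λ y → + (l ℕ.^ n) • y B.≈ b
  l^-thRootᵁ zero    b = b , •-1 b
  l^-thRootᵁ (suc n) b =
    let (y , p) = lthRootᵁ b
        (z , q) = l^-thRootᵁ n y
    in z , B.trans (•-pos-* l (l ℕ.^ n) z) (B.trans (·-congˡ B (+ l) q) p)

  private
    ζ₁ : ∃ λ z → + l • z B.≈ B.ε × ¬ (z B.≈ B.ε)
    ζ₁ = go l {{l-nonZero}} (nontrivialRoot)
      where
      go : ∀ n → .{{ℕ.NonZero n}} → (∃ λ x → x ^ n ≈ 1# × ¬ (x ≈ 1#)) → ∃ λ z → + n • z B.≈ B.ε × ¬ (z B.≈ B.ε)
      go (suc k) (x , x^n≈1 , x≉1) =
        let (z , z≈x) = unit x (x ^ k) x^n≈1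
        in z , value-injective (trans (value-• (suc k) z) (trans (^-congˡ (suc k) z≈x) (trans x^n≈1 (sym value-ε))))
             , λ z≈ε → x≉1 (trans (sym z≈x) (trans (value-cong z≈ε) value-ε))

  -- A generator of the Tate module of roots of unity. The first step must be a nontrivial root,
  -- since an arbitrary `l`-th root of `B.ε` could be trivial; from there on any `l`-th root has the
  -- right order.
  ζ : ℕ → B.Carrier
  ζ zero          = B.ε
  ζ (suc zero)    = proj₁ ζ₁
  ζ (suc (suc n)) = proj₁ (lthRootᵁ (ζ (suc n)))

  l•ζ : ∀ n → + l • ζ (suc n) B.≈ ζ n
  l•ζ zero    = proj₁ (proj₂ ζ₁)
  l•ζ (suc n) = proj₂ (lthRootᵁ (ζ (suc n)))

  l^•ζ : ∀ k n → + (l ℕ.^ k) • ζ (k ℕ.+ n) B.≈ ζ n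
  l^•ζ zero    n = •-1 (ζ n)
  l^•ζ (suc k) n = B.trans (B.trans (•-pos-* l (l ℕ.^ k) _) (CB.•-comm (+ l) (+ (l ℕ.^ k)) _))
    (B.trans (·-congˡ B (+ (l ℕ.^ k)) (l•ζ (k ℕ.+ n))) (l^•ζ k n))

  l^n•ζ≈ε : ∀ n → + (l ℕ.^ n) • ζ n B.≈ B.ε
  l^n•ζ≈ε n = ≡.subst (λ i → + (l ℕ.^ n) • ζ i B.≈ B.ε) (ℕ.+-identityʳ n) (l^•ζ n 0)

  •ζ≈ε : ∀ n {a} → a ≡0[mod l ℕ.^ n ] → a • ζ n B.≈ B.ε
  •ζ≈ε n {a} p = B.trans (·-congʳ B (ζ n) (ℤ∣._∣_.equality (≡0⇒∣ p)))
    (B.trans (·-* B (ζ n) q (+ (l ℕ.^ n))) (B.trans (·-congˡ B q (l^n•ζ≈ε n)) (·-ε B q)))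
    where q = ℤ∣.quotient (≡0⇒∣ p)

  •-- : ∀ a b x → (a ℤ.- b) • x B.≈ a • x B.∙ (b • x) B.⁻¹
  •-- a b x = B.trans (·-+ B x a (ℤ.- b)) (B.∙-congˡ (·-neg B x b))

  ζ-cong : ∀ n {a b} → a ≡ b [mod l ℕ.^ n ] → a • ζ n B.≈ b • ζ n
  ζ-cong n {a} {b} p = CB.∙⁻¹≈ε⇒≈ (B.trans (B.sym (•-- a b (ζ n))) (•ζ≈ε n (≡⇒-≡0 p)))

  -- Multiplying the relation by `l` lowers the level, so `a = lⁿ * q` by induction and then
  -- `q • ζ 1` is trivial. If `l` did not divide `q`, inverting `q` modulo `l` would make `ζ 1`
  -- itself trivial.
  ζ-faithful : ∀ n {a} → a • ζ n B.≈ B.ε → a ≡0[mod l ℕ.^ n ]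
  ζ-faithful zero    {a} p = mod∣ (divides (a ℤ.- 0ℤ) (≡.sym (ℤ.*-identityʳ _)))
  ζ-faithful (suc n) {a} p = ≡.subst (_≡0[mod l ℕ.^ suc n ]) (≡.sym a≡)
      (≡.subst (+ (l ℕ.^ n) ℤ.* q ≡0[mod_]) (ℕ.*-comm (l ℕ.^ n) l)
        (mod-trans (mod-scale {l ℕ.^ n} q≡0) (mod-reflexive (ℤ.*-zeroʳ (+ (l ℕ.^ n))))))
    where
    l^n∣a = ≡0⇒∣ (ζ-faithful n (B.trans (·-congˡ B a (B.sym (l•ζ n)))
      (B.trans (CB.•-comm a (+ l) (ζ (suc n))) (B.trans (·-congˡ B (+ l) p) (·-ε B (+ l))))))
    q = ℤ∣.quotient l^n∣a
    a≡ : a ≡ + (l ℕ.^ n) ℤ.* q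
    a≡ = ≡.trans (ℤ∣._∣_.equality l^n∣a) (ℤ.*-comm q _)
    q•ζ₁≈ε : q • ζ 1 B.≈ B.ε
    q•ζ₁≈ε = B.trans (·-congˡ B q (B.sym (≡.subst (λ i → + (l ℕ.^ n) • ζ i B.≈ ζ 1) (ℕ.+-comm n 1) (l^•ζ n 1))))
      (B.trans (CB.•-comm q (+ (l ℕ.^ n)) (ζ (suc n)))
        (B.trans (B.sym (·-* B (ζ (suc n)) (+ (l ℕ.^ n)) q)) (B.trans (·-congʳ B (ζ (suc n)) (≡.sym a≡)) p)))
    q≡0 : q ≡0[mod l ]
    q≡0 = decidable-stable em λ l∤q →
      let (u , uq≡1) = inverse-mod-l l∤q in
      proj₂ (proj₂ ζ₁) (B.trans (B.sym (•-1 (ζ 1)))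
        (B.trans (ζ-cong 1 (≡.subst (1ℤ ≡ u ℤ.* q [mod_]) (≡.sym (ℕ.*-identityʳ l)) (mod-sym uq≡1)))
          (B.trans (·-* B (ζ 1) u q) (B.trans (·-congˡ B u q•ζ₁≈ε) (·-ε B u)))))

  ζ-injective : ∀ n {a b} → a • ζ n B.≈ b • ζ n → a ≡ b [mod l ℕ.^ n ]
  ζ-injective n {a} {b} p = -≡0⇒≡ (ζ-faithful n (B.trans (•-- a b (ζ n))
    (B.trans (B.∙-congʳ p) (B.inverseʳ (b • ζ n)))))

  private
    lth-roots-of-unity : ∀ w → + l • w B.≈ B.ε → ∃ λ a → w B.≈ a • ζ 1
    lth-roots-of-unity w lw≈ε = go l {{l-nonZero}} ≡.refl
      where
      go : ∀ n → .{{ℕ.NonZero n}} → n ≡ l → ∃ λ a → w B.≈ a • ζ 1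
      go (suc k) ≡.refl =
        let (i , w≈) = roots-exhaustive (binomial k 1#) (λ i → value (+ toℕ i • ζ 1)) distinct
                         (λ i → root (+ toℕ i • ζ 1) (B.trans (CB.•-comm (+ l) (+ toℕ i) (ζ 1))
                           (B.trans (·-congˡ B (+ toℕ i) (l•ζ 0)) (·-ε B (+ toℕ i))))) (root w lw≈ε)
        in + toℕ i , value-injective w≈
        where
        distinct : Distinct (λ i → value (+ toℕ i • ζ 1))
        distinct {i} {j} p = Fin.toℕ-injective (mod-unique (Fin.toℕ<n i) (Fin.toℕ<n j)
          (≡.subst (+ toℕ i ≡ + toℕ j [mod_]) (ℕ.*-identityʳ l) (ζ-injective 1 (value-injective p))))
        root : ∀ x → + l • x B.≈ B.ε → monic (binomial k 1#) (value x) ≈ 0#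
        root x p = trans (monic-binomial k 1# (value x)) (trans (+-congʳ
          (trans (sym (value-• l x)) (trans (value-cong p) value-ε))) (-‿inverseʳ 1#))

  -- `lⁿ • b` is an `l`-th root of unity, hence `c • ζ 1` for some `c`; dividing `b` by
  -- `c • ζ (suc n)`, which has the same `lⁿ`-th power, leaves an `lⁿ`-th root of unity.
  l^n-th-roots-of-unity : ∀ n b → + (l ℕ.^ n) • b B.≈ B.ε → ∃ λ a → b B.≈ a • ζ n
  l^n-th-roots-of-unity zero    b p = 0ℤ , B.trans (B.sym (•-1 b)) p
  l^n-th-roots-of-unity (suc n) b p =
    let w = + (l ℕ.^ n) • b
        (c , w≈) = lth-roots-of-unity w (B.trans (B.sym (•-pos-* l (l ℕ.^ n) b)) p)
        b′ = b B.∙ (c • ζ (suc n)) B.⁻¹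
        (a , b′≈) = l^n-th-roots-of-unity n b′ (B.trans (·-∙ B (+ (l ℕ.^ n)) b _) (B.trans
          (B.∙-cong w≈ (B.trans (CB.•-⁻¹ (+ (l ℕ.^ n)) (c • ζ (suc n))) (B.⁻¹-cong (B.trans
            (CB.•-comm (+ (l ℕ.^ n)) c (ζ (suc n))) (·-congˡ B c
              (≡.subst (λ i → + (l ℕ.^ n) • ζ i B.≈ ζ 1) (ℕ.+-comm n 1) (l^•ζ n 1)))))))
          (B.inverseʳ (c • ζ 1))))
    in a ℤ.* + l ℤ.+ c , B.trans (CB.∙⁻¹≈⇒≈∙ b′≈) (B.trans
         (B.∙-congʳ (B.trans (·-congˡ B a (B.sym (l•ζ n))) (B.sym (·-* B (ζ (suc n)) a (+ l)))))
         (B.sym (·-+ B (ζ (suc n)) (a ℤ.* + l) c)))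

  value^ : ∀ n b → value (+ (l ℕ.^ n) • b) ≈ value b ^ (l ℕ.^ n)
  value^ n = value-• (l ℕ.^ n)

  _∈F : Pred Carrier ℓ
  x ∈F = ∃ λ a → ι a ≈ x

  ∈F⇒embed : ∀ {b} → value b ∈F → ∃ λ a → embed a B.≈ b
  ∈F⇒embed {b} (x , ιx≈b) =
    let (a , a≈x) = unitᶠ x (λ ιx≈0 → value≉0 b (trans (sym ιx≈b) ιx≈0))
    in a , value-injective (trans a≈x ιx≈b)

  ∈F-resp : ∀ {x y} → x ≈ y → x ∈F → y ∈F
  ∈F-resp p (a , q) = a , trans q p

  torsion-embedded : ∀ n b → + (l ℕ.^ n) • b B.≈ B.ε → ∃ λ a → embed a B.≈ b
  torsion-embedded n b p = ∈F⇒embed (roots∈F (value b) n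
    (trans (sym (value^ n b)) (trans (value-cong p) value-ε)))

  -- The form in which `μ_{l^∞} ⊂ F` is mostly used: the choice of an `lⁿ`-th root is immaterial up
  -- to `F*`.
  same-power : ∀ n x y → + (l ℕ.^ n) • x B.≈ + (l ℕ.^ n) • y → ∃ λ a → x B.≈ embed a B.∙ y
  same-power n x y p =
    let (a , a≈) = torsion-embedded n (x B.∙ y B.⁻¹) (B.trans (·-∙ B (+ (l ℕ.^ n)) x (y B.⁻¹))
          (B.trans (B.∙-cong p (CB.•-⁻¹ (+ (l ℕ.^ n)) y)) (B.inverseʳ _)))
    in a , CB.∙⁻¹≈⇒≈∙ (B.sym a≈)

  ζᴬ : ∀ n → ∃ λ a → embed a B.≈ ζ n
  ζᴬ n = torsion-embedded n (ζ n) (l^n•ζ≈ε n)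

  •ζ∈F : ∀ n z → value (z • ζ n) ∈F
  •ζ∈F n z = let (a , a≈) = ζᴬ n in ∈F-resp
    (value-cong (B.trans (Embed.f-• z a) (·-congˡ B z a≈))) (embed∈F (z CA.• a))

  -- A torsion element is a multiple of some `ζ j`, and `ζ j` is `lᵐ` times `ζ (m + j)`, which lies
  -- in `F` as well. Here roots of unity of unbounded order are required.
  torsionDivisible : ∀ j m x → + (l ℕ.^ j) CA.• x A.≈ A.ε → x CA.≡ₐ A.ε [ l ℕ.^ m ]
  torsionDivisible j m x p =
    let (c , x≈) = l^n-th-roots-of-unity j (embed x)
          (B.trans (B.sym (Embed.f-• (+ (l ℕ.^ j)) x)) (B.trans (embed-cong p) Embed.f-ε))
        (z , z≈) = ζᴬ (m ℕ.+ j)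
        M = + (l ℕ.^ m)
    in mod-by {quotient = c CA.• z} (embed-injective (B.trans x≈ (B.sym (B.trans (embed-∙ A.ε _)
         (B.trans (B.∙-congʳ Embed.f-ε) (B.trans (B.identityˡ _)
           (B.trans (Embed.f-• M (c CA.• z)) (B.trans (·-congˡ B M (B.trans (Embed.f-• c z) (·-congˡ B c z≈)))
             (B.trans (CB.•-comm M c _) (·-congˡ B c (l^•ζ m j)))))))))))

  F-isSubfield : IsSubfield _∈F
  F-isSubfield = record
    { resp       = ∈F-resp
    ; +-closed   = λ (a , p) (b , q) → a F.+ b , trans (ι.+-homo a b) (+-cong p q)
    ; *-closed   = λ (a , p) (b , q) → a F.* b , trans (ι.*-homo a b) (*-cong p q)
    ; neg-closed = λ (a , p) → F.- a , trans (ι.-‿homo a) (-‿cong p)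
    ; 1∈         = F.1# , ι.1#-homo
    ; inv-closed = λ {x} {y} (a , p) xy≈1 →
        let (b , b≈) = unitᶠ a (λ ιa≈0 → invertible⇒≉0 xy≈1 (trans (sym p) ιa≈0))
        in ∈F-resp (inverse-unique (trans b≈ p) xy≈1) (embed∈F (b A.⁻¹))
    }
    where
    inverse-unique : ∀ {b x y} → value (embed b) ≈ x → x * y ≈ 1# → value (embed (b A.⁻¹)) ≈ y
    inverse-unique {b} {x} {y} b≈x xy≈1 = begin
      value (embed (b A.⁻¹))                    ≈⟨ value-cong (Embed.f-⁻¹ b) ⟩
      value (embed b B.⁻¹)                      ≈⟨ *-identityʳ _ ⟨
      value (embed b B.⁻¹) * 1#                 ≈⟨ *-congˡ (trans (*-congʳ b≈x) xy≈1) ⟨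
      value (embed b B.⁻¹) * (value (embed b) * y)  ≈⟨ *-assoc _ _ _ ⟨
      (value (embed b B.⁻¹) * value (embed b)) * y  ≈⟨ *-congʳ (trans (*-comm _ _) (value-inverse (embed b))) ⟩
      1# * y                                    ≈⟨ *-identityˡ y ⟩
      y                                         ∎
      where open SetoidReasoning setoid

-- Polynomial expressions

data Expr {ℓ : Level} (C : Set ℓ) (X : Set) : Set ℓ where
  con  : C → Expr C X
  var  : X → Expr C X
  _⊞_  : Expr C X → Expr C X → Expr C X
  _⊠_  : Expr C X → Expr C X → Expr C X

module KummerTower (em : ∀ {a} → ExcludedMiddle a) {ℓ : Level} {F Ω : CommutativeRing ℓ ℓ}
  {A B : AbelianGroup (ℓ ⊔ ℓ) ℓ} {l : ℕ} (l-prime : Prime l) (pair : KummerPair F Ω A B l) where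

  open PrimePowers l-prime
  open Kummer em l-prime pair
  open CommutativeRing Ω hiding (zero)
  open RingProperties ring using (-‿distribˡ-*; -‿distribʳ-*)
  open Exp semiring using (_^_)
  open Solver commutativeSemiring using (solve; _:=_; _:+_; _:*_)
  open SetoidReasoning setoid

  E : Set → Set ℓ
  E = Expr F.Carrier

  eval : ∀ {X} → (X → Carrier) → E X → Carrier
  eval p (con a)  = ι a
  eval p (var i)  = p i
  eval p (e ⊞ f)  = eval p e + eval p f
  eval p (e ⊠ f)  = eval p e * eval p f

  eval-cong : ∀ {X} {p q : X → Carrier} → (∀ i → p i ≈ q i) → ∀ e → eval p e ≈ eval q e
  eval-cong p≈q (con a) = refl
  eval-cong p≈q (var i) = p≈q i
  eval-cong p≈q (e ⊞ f) = +-cong (eval-cong p≈q e) (eval-cong p≈q f)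
  eval-cong p≈q (e ⊠ f) = *-cong (eval-cong p≈q e) (eval-cong p≈q f)

  subst : ∀ {X Y} → (X → E Y) → E X → E Y
  subst s (con a) = con a
  subst s (var i) = s i
  subst s (e ⊞ f) = subst s e ⊞ subst s f
  subst s (e ⊠ f) = subst s e ⊠ subst s f

  eval-subst : ∀ {X Y} {p : X → Carrier} {q : Y → Carrier} (s : X → E Y) →
               (∀ i → eval q (s i) ≈ p i) → ∀ e → eval q (subst s e) ≈ eval p e
  eval-subst s p (con a) = refl
  eval-subst s p (var i) = p i
  eval-subst s p (e ⊞ f) = +-cong (eval-subst s p e) (eval-subst s p f)
  eval-subst s p (e ⊠ f) = *-cong (eval-subst s p e) (eval-subst s p f)

  negᴱ : ∀ {X} → E X → E X
  negᴱ e = con (F.- F.1#) ⊠ e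

  eval-neg : ∀ {X} (p : X → Carrier) e → eval p (negᴱ e) ≈ - eval p e
  eval-neg p e = trans (*-congʳ (trans (ι.-‿homo F.1#) (-‿cong ι.1#-homo)))
    (trans (sym (-‿distribˡ-* 1# _)) (-‿cong (*-identityˡ _)))

  _^ᴱ_ : ∀ {X} → E X → ℕ → E X
  e ^ᴱ zero  = con F.1#
  e ^ᴱ suc n = e ⊠ (e ^ᴱ n)

  eval-^ : ∀ {X} (p : X → Carrier) e n → eval p (e ^ᴱ n) ≈ eval p e ^ n
  eval-^ p e zero    = ι.1#-homo
  eval-^ p e (suc n) = *-congˡ (eval-^ p e n)

  -- For x algebraic over F, 1/x is a polynomial in x.
  module _ (L : Pred Carrier ℓ) (L-resp : ∀ {x y} → x ≈ y → x ∈ L → y ∈ L)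
           (L-F : ∀ a → ι a ∈ L) (L-+ : ∀ {x y} → x ∈ L → y ∈ L → x + y ∈ L)
           (L-* : ∀ {x y} → x ∈ L → y ∈ L → x * y ∈ L) where

    private
      module Ω[X] = Polynomial Ω
      module F[X] = Polynomial F

      polynomial∈ : ∀ (p : List F.Carrier) {x} → x ∈ L → Ω[X].eval (map ι p) x ∈ L
      polynomial∈ []      x∈ = L-resp ι.0#-homo (L-F F.0#)
      polynomial∈ (a ∷ p) x∈ = L-+ (L-F a) (L-* x∈ (polynomial∈ p x∈))

      inverse∈ : ∀ (p : List F.Carrier) {x y} → x ∈ L → x * y ≈ 1# → ¬ (p F[X].≈ᴾ []) →
                 Ω[X].eval (map ι p) x ≈ 0# → y ∈ L
      inverse∈ []      x∈ xy≈1 p≉0 px≈0 = contradiction (λ _ → F.refl) p≉0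
      -- A vanishing constant coefficient is divided out together with one factor `x`; otherwise
      -- `a + x * P = 0` gives `y = - P / a`.
      inverse∈ (a ∷ p) {x} {y} x∈ xy≈1 ap≉0 px≈0 = case em {P = ι a ≈ 0#} of λ where
          (yes a≈0) → inverse∈ p x∈ xy≈1
            (λ p≈0 → ap≉0 λ { zero → ι-injective a≈0 ; (suc n) → p≈0 n })
            (case noZeroDivisors (trans (sym (+-identityˡ _)) (trans (+-congʳ (sym a≈0)) px≈0)) of λ where
              (inj₁ x≈0) → contradiction x≈0 (invertible⇒≉0 xy≈1)
              (inj₂ q)   → q)
          (no a≉0) → let (b , b≈) = unitᶠ a a≉0 in
            L-resp (solution b b≈) (L-* (neg∈ (embed∈F (b A.⁻¹))) (polynomial∈ p x∈))
        where
        P = Ω[X].eval (map ι p) x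
        neg∈ : ∀ {z} → z ∈F → - z ∈ L
        neg∈ (c , c≈) = L-resp (trans (ι.-‿homo c) (-‿cong c≈)) (L-F (F.- c))
        ay+P≈0 : ι a * y + P ≈ 0#
        ay+P≈0 = begin
          ι a * y + P              ≈⟨ +-congˡ (trans (sym (*-identityˡ P)) (*-congʳ (trans (sym xy≈1) (*-comm x y)))) ⟩
          ι a * y + (y * x) * P    ≈⟨ solve 4 (λ a x y p → a :* y :+ (y :* x) :* p := y :* (a :+ x :* p)) refl (ι a) x y P ⟩
          y * (ι a + x * P)        ≈⟨ *-congˡ px≈0 ⟩
          y * 0#                   ≈⟨ zeroʳ y ⟩
          0#                       ∎
        solution : ∀ b → value (embed b) ≈ ι a → - value (embed (b A.⁻¹)) * P ≈ y
        solution b b≈ = begin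
          - b⁻¹ * P                 ≈⟨ -‿distribˡ-* b⁻¹ P ⟨
          - (b⁻¹ * P)               ≈⟨ -‿distribʳ-* b⁻¹ P ⟩
          b⁻¹ * - P                 ≈⟨ *-congˡ (inverseˡ-unique _ _ ay+P≈0) ⟨
          b⁻¹ * (ι a * y)           ≈⟨ *-assoc _ _ _ ⟨
          (b⁻¹ * ι a) * y           ≈⟨ *-congʳ (trans (*-cong (value-cong (Embed.f-⁻¹ b)) (sym b≈))
                                         (trans (*-comm _ _) (value-inverse (embed b)))) ⟩
          1# * y                    ≈⟨ *-identityˡ y ⟩
          y                         ∎
          where
          b⁻¹ = value (embed (b A.⁻¹))
          open AbelianGroupProperties +-abelianGroup using (inverseˡ-unique)

    algebra-isSubfield : IsSubfield L
    algebra-isSubfield = record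
      { resp       = L-resp
      ; +-closed   = L-+
      ; *-closed   = L-*
      ; neg-closed = λ {x} x∈ → L-resp (trans (*-congʳ (trans (ι.-‿homo F.1#) (-‿cong ι.1#-homo)))
          (trans (sym (-‿distribˡ-* 1# x)) (-‿cong (*-identityˡ x)))) (L-* (L-F (F.- F.1#)) x∈)
      ; 1∈         = L-resp ι.1#-homo (L-F F.1#)
      ; inv-closed = λ {x} x∈ xy≈1 → let (p , p≉0 , px≈0) = algebraic x in inverse∈ p x∈ xy≈1 p≉0 px≈0
      }

  -- Since everything is algebraic over `F`, expressions without division already give a field. A
  -- membership proof carries an expression, which automorphisms will later re-evaluate at conjugate
  -- radicals.
  F[_] : ∀ {X} → (X → Carrier) → Pred Carrier ℓ
  F[ p ] z = ∃ λ e → eval p e ≈ z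

  F[]-isSubfield : ∀ {X} (p : X → Carrier) → IsSubfield F[ p ]
  F[]-isSubfield p = algebra-isSubfield F[ p ] (λ x≈y (e , e≈) → e , trans e≈ x≈y) (λ a → con a , refl)
    (λ (e , e≈) (f , f≈) → e ⊞ f , +-cong e≈ f≈) (λ (e , e≈) (f , f≈) → e ⊠ f , *-cong e≈ f≈)

  eval∈ : ∀ {X} {L : Pred Carrier ℓ} → IsSubfield L → (∀ a → ι a ∈ L) → {p : X → Carrier} →
          (∀ i → p i ∈ L) → ∀ e → eval p e ∈ L
  eval∈ L F∈ p∈ (con a) = F∈ a
  eval∈ L F∈ p∈ (var i) = p∈ i
  eval∈ L F∈ p∈ (e ⊞ f) = IsSubfield.+-closed L (eval∈ L F∈ p∈ e) (eval∈ L F∈ p∈ f)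
  eval∈ L F∈ p∈ (e ⊠ f) = IsSubfield.*-closed L (eval∈ L F∈ p∈ e) (eval∈ L F∈ p∈ f)

-- Horner evaluation of families of coefficients

module PolynomialFunctions {ℓ : Level} (R : CommutativeRing ℓ ℓ) where

  open CommutativeRing R hiding (zero)
  open RingProperties ring using (-‿distribʳ-*)
  open Exp semiring using (_^_)
  open Solver commutativeSemiring using (solve; _:=_; _:+_; _:*_)
  open SetoidReasoning setoid

  horner : ∀ {n} → (Fin n → Carrier) → Carrier → Carrier
  horner {zero}  v t = 0#
  horner {suc n} v t = v zero + t * horner (v ∘ suc) t

  horner-cong : ∀ {n} {v w : Fin n → Carrier} t → (∀ i → v i ≈ w i) → horner v t ≈ horner w t
  horner-cong {zero}  t p = refl
  horner-cong {suc n} t p = +-cong (p zero) (*-congˡ (horner-cong t (p ∘ suc)))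

  horner-0 : ∀ {n} {v : Fin n → Carrier} t → (∀ i → v i ≈ 0#) → horner v t ≈ 0#
  horner-0 {zero}  t p = refl
  horner-0 {suc n} t p = trans (+-cong (p zero) (trans (*-congˡ (horner-0 t (p ∘ suc))) (zeroʳ t))) (+-identityˡ 0#)

  horner-+ : ∀ {n} (v w : Fin n → Carrier) t → horner (λ i → v i + w i) t ≈ horner v t + horner w t
  horner-+ {zero}  v w t = sym (+-identityˡ 0#)
  horner-+ {suc n} v w t = trans (+-congˡ (*-congˡ (horner-+ (v ∘ suc) (w ∘ suc) t)))
    (solve 5 (λ a b t x y → (a :+ b) :+ t :* (x :+ y) := (a :+ t :* x) :+ (b :+ t :* y)) refl
      (v zero) (w zero) t (horner (v ∘ suc) t) (horner (w ∘ suc) t))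

  horner-* : ∀ {n} c (v : Fin n → Carrier) t → horner (λ i → c * v i) t ≈ c * horner v t
  horner-* {zero}  c v t = sym (zeroʳ c)
  horner-* {suc n} c v t = trans (+-congˡ (*-congˡ (horner-* c (v ∘ suc) t)))
    (solve 4 (λ c a t x → c :* a :+ t :* (c :* x) := c :* (a :+ t :* x)) refl c (v zero) t (horner (v ∘ suc) t))

  horner-scaled : ∀ {n} z (v : Fin n → Carrier) t → horner (λ i → z ^ toℕ i * v i) t ≈ horner v (z * t)
  horner-scaled {zero}  z v t = refl
  horner-scaled {suc n} z v t = +-cong (*-identityˡ (v zero)) (begin
    t * horner (λ i → (z * z ^ toℕ i) * v (suc i)) t   ≈⟨ *-congˡ (horner-cong t (λ i → *-assoc z (z ^ toℕ i) (v (suc i)))) ⟩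
    t * horner (λ i → z * u i) t                       ≈⟨ *-congˡ (horner-* z u t) ⟩
    t * (z * horner u t)                               ≈⟨ *-congˡ (*-congˡ (horner-scaled z (v ∘ suc) t)) ⟩
    t * (z * horner (v ∘ suc) (z * t))                 ≈⟨ solve 3 (λ t z x → t :* (z :* x) := (z :* t) :* x) refl t z _ ⟩
    (z * t) * horner (v ∘ suc) (z * t)                 ∎)
    where
    u : Fin n → Carrier
    u i = z ^ toℕ i * v (suc i)

  horner-single : ∀ {n} (v : Fin n → Carrier) t k → (∀ i → ¬ (i ≡ k) → v i ≈ 0#) → horner v t ≈ t ^ toℕ k * v k
  horner-single v t zero    p = trans (+-congˡ (trans (*-congˡ (horner-0 t (λ i → p (suc i) λ ()))) (zeroʳ t)))
    (trans (+-identityʳ _) (sym (*-identityˡ _)))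
  horner-single v t (suc k) p = trans (+-cong (p zero λ ()) (*-congˡ
      (horner-single (v ∘ suc) t k (λ i i≢k → p (suc i) (i≢k ∘ Fin.suc-injective)))))
    (trans (+-identityˡ _) (sym (*-assoc _ _ _)))

  horner-last : ∀ {n} (v : Fin (suc n) → Carrier) t →
                horner v t ≈ horner (v ∘ inject₁) t + t ^ n * v (fromℕ n)
  horner-last {zero}  v t = trans (+-congˡ (zeroʳ t)) (trans (+-comm _ _) (+-congˡ (sym (*-identityˡ _))))
  horner-last {suc n} v t = trans (+-congˡ (*-congˡ (horner-last (v ∘ suc) t)))
    (solve 5 (λ a t x p b → a :+ t :* (x :+ p :* b) := (a :+ t :* x) :+ (t :* p) :* b) refl
      (v zero) t (horner (v ∘ suc ∘ inject₁) t) (t ^ n) (v (suc (fromℕ n))))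

  horner-difference : ∀ {n} c (v w : Fin n → Carrier) t → horner v t ≈ c * horner w t →
                      horner (λ i → v i - c * w i) t ≈ 0#
  horner-difference c v w t p = begin
    horner (λ i → v i - c * w i) t
      ≈⟨ horner-cong t (λ i → +-congˡ (trans (-‿cong (*-comm c (w i))) (trans (-‿distribʳ-* (w i) c) (*-comm (w i) (- c))))) ⟩
    horner (λ i → v i + - c * w i) t
      ≈⟨ trans (horner-+ v (λ i → - c * w i) t) (+-cong p (horner-* (- c) w t)) ⟩
    c * horner w t + - c * horner w t
      ≈⟨ trans (sym (distribʳ _ c (- c))) (trans (*-congʳ (-‿inverseʳ c)) (zeroˡ _)) ⟩
    0# ∎

-- Expressions reduced modulo a binomial, and exponents of radicals

module RadicalTower (em : ∀ {a} → ExcludedMiddle a) {ℓ : Level} {F Ω : CommutativeRing ℓ ℓ}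
  {A B : AbelianGroup (ℓ ⊔ ℓ) ℓ} {l : ℕ} (l-prime : Prime l) (pair : KummerPair F Ω A B l) where

  open PrimePowers l-prime
  open Kummer em l-prime pair
  open KummerTower em l-prime pair
  open CommutativeRing Ω hiding (zero)
  open Exp semiring using (_^_)
  open Solver commutativeSemiring using (solve; _:=_; _:+_; _:*_)
  open CB using (_•_; •-1; •-pos-*)
  open PolynomialFunctions Ω

  module Reduction {d : ℕ} (k : ℕ) (a : F.Carrier) where

    private
      N = suc k
      0ᴱ : E (Fin d)
      0ᴱ = con F.0#

    constantᴱ : E (Fin d) → Fin N → E (Fin d)
    constantᴱ e zero    = e
    constantᴱ e (suc i) = 0ᴱ

    -- Multiplication by the variable in the quotient by `Xᴺ - a`: a cyclic shift of the
    -- coefficients, twisted by `a`.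
    mulX : (Fin N → E (Fin d)) → Fin N → E (Fin d)
    mulX v zero    = con a ⊠ v (fromℕ k)
    mulX v (suc i) = v (inject₁ i)

    mul : ∀ {m} → (Fin m → E (Fin d)) → (Fin N → E (Fin d)) → Fin N → E (Fin d)
    mul {zero}  v w = λ _ → 0ᴱ
    mul {suc m} v w = λ i → (v zero ⊠ w i) ⊞ mulX (mul (v ∘ suc) w) i

    -- The coefficients of an expression as a polynomial in the first variable,
    -- reduced modulo Xᴺ = a.
    coefficients : E (Fin (suc d)) → Fin N → E (Fin d)
    coefficients (con c)       = constantᴱ (con c)
    coefficients (var zero)    = mulX (constantᴱ (con F.1#))
    coefficients (var (suc i)) = constantᴱ (var i)
    coefficients (e ⊞ f)       = λ i → coefficients e i ⊞ coefficients f i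
    coefficients (e ⊠ f)       = mul (coefficients e) (coefficients f)

    module _ (p : Fin (suc d) → Carrier) (t^N≈a : p zero ^ N ≈ ι a) where

      private
        t = p zero
        ⟪_⟫ : ∀ {m} → (Fin m → E (Fin d)) → Carrier
        ⟪ v ⟫ = horner (λ i → eval (p ∘ suc) (v i)) t

      eval-constant : ∀ e → ⟪ constantᴱ e ⟫ ≈ eval (p ∘ suc) e
      eval-constant e = trans (+-congˡ (trans (*-congˡ (horner-0 {k} {λ _ → ι F.0#} t (λ _ → ι.0#-homo))) (zeroʳ t))) (+-identityʳ _)

      eval-mulX : ∀ v → ⟪ mulX v ⟫ ≈ t * ⟪ v ⟫
      eval-mulX v = begin
        ι a * last + t * rest                ≈⟨ +-congʳ (*-congʳ t^N≈a) ⟨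
        (t * t ^ k) * last + t * rest        ≈⟨ solve 4 (λ t u x r → (t :* u) :* x :+ t :* r := t :* (r :+ u :* x)) refl t (t ^ k) last rest ⟩
        t * (rest + t ^ k * last)            ≈⟨ *-congˡ (horner-last (λ i → eval (p ∘ suc) (v i)) t) ⟨
        t * ⟪ v ⟫                            ∎
        where
        open SetoidReasoning setoid
        last = eval (p ∘ suc) (v (fromℕ k))
        rest = horner (λ i → eval (p ∘ suc) (v (inject₁ i))) t

      eval-mul : ∀ {m} (v : Fin m → E (Fin d)) w → ⟪ mul v w ⟫ ≈ ⟪ v ⟫ * ⟪ w ⟫
      eval-mul {zero}  v w = trans (horner-0 {N} {λ _ → ι F.0#} t (λ _ → ι.0#-homo)) (sym (zeroˡ _))
      eval-mul {suc m} v w = begin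
        ⟪ mul v w ⟫
          ≈⟨ horner-+ (λ i → eval (p ∘ suc) (v zero) * eval (p ∘ suc) (w i))
                      (λ i → eval (p ∘ suc) (mulX (mul (v ∘ suc) w) i)) t ⟩
        horner (λ i → eval (p ∘ suc) (v zero) * eval (p ∘ suc) (w i)) t + ⟪ mulX (mul (v ∘ suc) w) ⟫
          ≈⟨ +-cong (horner-* (eval (p ∘ suc) (v zero)) (λ i → eval (p ∘ suc) (w i)) t)
                    (trans (eval-mulX (mul (v ∘ suc) w)) (*-congˡ (eval-mul (v ∘ suc) w))) ⟩
        eval (p ∘ suc) (v zero) * ⟪ w ⟫ + t * (⟪ v ∘ suc ⟫ * ⟪ w ⟫)
          ≈⟨ solve 4 (λ a w t v → a :* w :+ t :* (v :* w) := (a :+ t :* v) :* w) refl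
               (eval (p ∘ suc) (v zero)) ⟪ w ⟫ t ⟪ v ∘ suc ⟫ ⟩
        ⟪ v ⟫ * ⟪ w ⟫ ∎
        where open SetoidReasoning setoid

      eval-coefficients : ∀ e → ⟪ coefficients e ⟫ ≈ eval p e
      eval-coefficients (con c)       = eval-constant (con c)
      eval-coefficients (var zero)    = trans (eval-mulX (constantᴱ (con F.1#)))
        (trans (*-congˡ (trans (eval-constant (con F.1#)) ι.1#-homo)) (*-identityʳ t))
      eval-coefficients (var (suc i)) = eval-constant (var i)
      eval-coefficients (e ⊞ f)       = trans
        (horner-+ (λ i → eval (p ∘ suc) (coefficients e i)) (λ i → eval (p ∘ suc) (coefficients f i)) t)
        (+-cong (eval-coefficients e) (eval-coefficients f))
      eval-coefficients (e ⊠ f)       = trans (eval-mul (coefficients e) (coefficients f))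
        (*-cong (eval-coefficients e) (eval-coefficients f))

  -- A subgroup of B containing m b and l^(n+1) b contains lⁿ b, if 0 < m < l^(n+1).
  module _ (S : Pred B.Carrier ℓ) (S-resp : ∀ {x y} → x B.≈ y → x ∈ S → y ∈ S)
           (S-∙ : ∀ {x y} → x ∈ S → y ∈ S → x B.∙ y ∈ S) (S-• : ∀ z {x} → x ∈ S → z • x ∈ S) where

    halfway : ∀ n m b → 0 ℕ.< m → m ℕ.< l ℕ.^ suc n → + m • b ∈ S → + (l ℕ.^ suc n) • b ∈ S → + (l ℕ.^ n) • b ∈ S
    -- If `l` does not divide `m`, then `1 = u * m + q * N` puts `b` itself into `S`. Otherwise `m`
    -- and `N` are both divided by `l` and `b` is replaced by `+ l • b`; for `n = 0` this case
    -- contradicts `0 < m < l`.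
    halfway n m b 0<m m<N mb∈ Nb∈ = case em {P = (+ m) ≡0[mod l ]} of λ where
        (no l∤m) →
          let (u , um≡1) = inverse-mod-l^ l∤m (suc n)
              q = ℤ∣.quotient (m∣a-b (mod-sym um≡1))
          in S-• (+ (l ℕ.^ n)) (S-resp (one u q (ℤ∣._∣_.equality (m∣a-b (mod-sym um≡1))))
               (S-∙ (S-• q Nb∈) (S-• u mb∈)))
        (yes l∣m) → divisible n (ℤ∣.∣⇒∣ᵤ (≡0⇒∣ l∣m)) m<N mb∈ Nb∈
      where
      N = l ℕ.^ suc n
      one : ∀ u q → 1ℤ ℤ.- u ℤ.* + m ≡ q ℤ.* + N → q • + N • b B.∙ u • + m • b B.≈ b
      one u q e = B.trans (B.∙-cong (B.sym (·-* B b q (+ N))) (B.sym (·-* B b u (+ m))))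
        (B.trans (B.sym (·-+ B b (q ℤ.* + N) (u ℤ.* + m)))
          (B.trans (·-congʳ B b (≡.trans (≡.cong (ℤ._+ u ℤ.* + m) (≡.sym e)) (cancel (u ℤ.* + m)))) (•-1 b)))
        where
        cancel : ∀ z → 1ℤ ℤ.- z ℤ.+ z ≡ 1ℤ
        cancel = solve-∀
      divisible : ∀ n → l ℕ.∣ m → m ℕ.< l ℕ.^ suc n → + m • b ∈ S → + (l ℕ.^ suc n) • b ∈ S → + (l ℕ.^ n) • b ∈ S
      divisible zero    l∣m m<N mb∈ Nb∈ = contradiction l∣m
        (ℕ.>⇒∤ {{ℕ.>-nonZero 0<m}} (≡.subst (m ℕ.<_) (ℕ.*-identityʳ l) m<N))
      divisible (suc n) (ℕ.divides m′ ≡.refl) m<N mb∈ Nb∈ =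
        S-resp (B.sym (assoc-l (l ℕ.^ n)))
          (halfway n m′ (+ l • b) (0<m′ m′ 0<m) (ℕ.*-cancelʳ-< l m′ (l ℕ.^ suc n) (≡.subst (m ℕ.<_) (ℕ.*-comm l (l ℕ.^ suc n)) m<N))
            (S-resp (•-pos-* m′ l b) mb∈) (S-resp (assoc-l (l ℕ.^ suc n)) Nb∈))
        where
        assoc-l : ∀ k → + (l ℕ.* k) • b B.≈ + k • + l • b
        assoc-l k = B.trans (•-pos-* l k b) (CB.•-comm (+ l) (+ k) b)
        0<m′ : ∀ m′ → 0 ℕ.< m′ ℕ.* l → 0 ℕ.< m′
        0<m′ (suc _) _ = ℕ.s≤s ℕ.z≤n

-- Conjugates and semi-invariants of radicals at a single level

module RadicalConjugates (em : ∀ {a} → ExcludedMiddle a) {ℓ : Level} {F Ω : CommutativeRing ℓ ℓ}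
  {A B : AbelianGroup (ℓ ⊔ ℓ) ℓ} {l : ℕ} (l-prime : Prime l) (pair : KummerPair F Ω A B l)
  (n k : ℕ) (l^n≡1+k : l ℕ.^ n ≡ suc k) where

  open PrimePowers l-prime
  open Kummer em l-prime pair
  open KummerTower em l-prime pair
  open RadicalTower em l-prime pair
  open CommutativeRing Ω hiding (zero)
  open Exp semiring using (_^_; ^-congˡ)
  open CB using (_•_; •-1; •-pos-*)
  open PolynomialFunctions Ω

  N : ℕ
  N = l ℕ.^ n

  PureModulo : ∀ {d} → (Fin d → A.Carrier) → Set ℓ
  PureModulo {d} x = ∀ (c : Fin d → ℤ) → CA.comb c x CA.≡ₐ A.ε [ N ] → ∀ j → c j ≡0[mod N ]

  IsRoot : ∀ {d} → (Fin d → B.Carrier) → (Fin d → A.Carrier) → Set ℓ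
  IsRoot y x = ∀ j → + N • y j B.≈ embed (x j)

  shift : ∀ {d} → Fin d → (Fin d → B.Carrier) → Fin d → B.Carrier
  shift zero    y zero    = ζ n B.∙ y zero
  shift zero    y (suc i) = y (suc i)
  shift (suc j) y zero    = y zero
  shift (suc j) y (suc i) = shift j (y ∘ suc) i

  shift-root : ∀ {d} (j : Fin d) {y x} → IsRoot y x → IsRoot (shift j y) x
  shift-root zero    r zero    = B.trans (·-∙ B (+ N) (ζ n) _)
    (B.trans (B.∙-congʳ (l^n•ζ≈ε n)) (B.trans (B.identityˡ _) (r zero)))
  shift-root zero    r (suc i) = r (suc i)
  shift-root (suc j) r zero    = r zero
  shift-root (suc j) r (suc i) = shift-root j (r ∘ suc) i

  Point : ∀ {d} → (Fin d → B.Carrier) → Fin d → Carrier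
  Point y j = value (y j)

  -- Transitivity of the Galois group on systems of roots, expressed without automorphisms.
  Conjugate : ∀ {d} → (Fin d → A.Carrier) → Set ℓ
  Conjugate {d} x = ∀ (y y′ : Fin d → B.Carrier) → IsRoot y x → IsRoot y′ x →
                ∀ e → eval (Point y) e ≈ 0# → eval (Point y′) e ≈ 0#

  SemiInvariant : ∀ {d} → (Fin d → B.Carrier) → E (Fin d) → Set ℓ
  SemiInvariant y e = ∀ j → ∃ λ η → η ∈F × eval (Point (shift j y)) e ≈ η * eval (Point y) e

  IsMonomial : ∀ {d} → (Fin d → B.Carrier) → Carrier → Set ℓ
  IsMonomial {d} y z = ∃ λ a → ∃ λ (c : Fin d → ℤ) → z ≈ value (embed a B.∙ CB.comb c y)

  -- Kummer theory of the radical field: eigenvectors for all shifts are single monomials. Besides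
  -- its later uses it feeds the induction for `Conjugate`, through `y₀-power∉`.
  Monomial : ∀ {d} → (Fin d → A.Carrier) → Set ℓ
  Monomial {d} x = ∀ (y : Fin d → B.Carrier) → IsRoot y x → ∀ e → SemiInvariant y e →
                eval (Point y) e ≈ 0# ⊎ IsMonomial y (eval (Point y) e)

  value-root : ∀ {b a c} → + N • b B.≈ embed a → ι c ≈ value (embed a) → value b ^ suc k ≈ ι c
  value-root {b} {a} {c} p q = trans (reflexive (≡.cong (value b ^_) (≡.sym l^n≡1+k)))
    (trans (sym (value^ n b)) (trans (value-cong p) (sym q)))

  -- By conjugacy the polynomial identity `e^M = c`, with `c` in `F`, persists at the shifted roots.
  -- The two values are then `M`-th roots of the same element and differ by a root of unity, which
  -- lies in `F`.
  power-semiInvariant : ∀ {d} {x : Fin d → A.Carrier} → Conjugate x → ∀ y → IsRoot y x → ∀ e m b a →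
    eval (Point y) e ≈ value b → + (l ℕ.^ m) • b B.≈ embed a → SemiInvariant y e
  power-semiInvariant conj y r e m b a e≈b lb≈a j =
    value (embed u) , embed∈F u , trans (sym b′≈) (trans (value-cong b′≈ub) (trans (value-∙ _ _) (*-congˡ (sym e≈b))))
    where
    M = l ℕ.^ m
    c = proj₁ (embed∈F a)
    g = (e ^ᴱ M) ⊞ negᴱ (con c)
    y′ = shift j y
    eval-g : ∀ p → eval p g ≈ eval p e ^ M - ι c
    eval-g p = +-cong (eval-^ p e M) (eval-neg p (con c))
    e^M≈c : value b ^ M ≈ ι c
    e^M≈c = trans (sym (value^ m b)) (trans (value-cong lb≈a) (sym (proj₂ (embed∈F a))))
    e′^M≈c : eval (Point y′) e ^ M ≈ ι c
    e′^M≈c = -≈0⇒≈ (trans (sym (eval-g (Point y′))) (conj y y′ r (shift-root j r) g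
      (trans (eval-g (Point y)) (trans (+-congʳ (trans (^-congˡ M e≈b) e^M≈c)) (-‿inverseʳ (ι c))))))
    e′≉0 : ¬ (eval (Point y′) e ≈ 0#)
    e′≉0 p = value≉0 (embed a) (trans (sym (proj₂ (embed∈F a))) (trans (sym e′^M≈c)
      (power-zero M {{l^-nonZero m}} p)))
      where
      power-zero : ∀ j .{{_ : ℕ.NonZero j}} {z} → z ≈ 0# → z ^ j ≈ 0#
      power-zero (suc j) p = trans (*-congʳ p) (zeroˡ _)
    b′ = proj₁ (toUnit e′≉0)
    b′≈ = proj₂ (toUnit e′≉0)
    same = same-power m b′ b (value-injective (trans (value^ m b′) (trans (^-congˡ M b′≈)
      (trans e′^M≈c (trans (sym e^M≈c) (sym (value^ m b)))))))
    u = proj₁ same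
    b′≈ub = proj₂ same

  module Step {d : ℕ} (x : Fin (suc d) → A.Carrier) (pure : PureModulo x)
              (conj : Conjugate (x ∘ suc)) (mono : Monomial (x ∘ suc)) where

    private
      a = proj₁ (embed∈F (x zero))
      a≈ = proj₂ (embed∈F (x zero))

    open Reduction {d} k a

    module _ (y : Fin (suc d) → B.Carrier) (r : IsRoot y x) where

      private
        t = value (y zero)
        L = F[ Point (y ∘ suc) ]
        L-isSubfield = F[]-isSubfield (Point (y ∘ suc))
        module L = IsSubfield L-isSubfield

      •∈ : ∀ z {b} → value b ∈ L → value (z • b) ∈ L
      •∈ (+ m)    {b} p = L.resp (sym (value-• m b)) (L.^-closed m p)
      •∈ -[1+ m ] {b} p = L.inv-closed (L.resp (sym (value-• (suc m) b)) (L.^-closed (suc m) p))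
                                       (value-inverse (+ suc m • b))

      -- The `l`-th power of this element is `x zero`, so inside `L` it would be semi-invariant,
      -- hence a monomial in the other radicals. Taking `N`-th powers turns this into a relation
      -- modulo `N` between the `x j` whose coefficient at `zero` is `l^n′`, smaller than `N`; this
      -- contradicts purity.
      y₀-power∉ : ∀ n′ → n ≡ suc n′ → ¬ (value (+ (l ℕ.^ n′) • y zero) ∈ L)
      y₀-power∉ n′ n≡ (e , e≈) = case mono (y ∘ suc) (r ∘ suc) e semi of λ where
          (inj₁ e≈0) → value≉0 b (trans (sym e≈) e≈0)
          (inj₂ (u , c , e≈m)) → contradiction (ℤ∣.∣⇒∣ᵤ (≡0⇒∣ (pure (coeffs c) (relation≡ε u c e≈m) zero)))
                                   (ℕ.>⇒∤ {{l^-nonZero n′}} K<N)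
        where
        K = l ℕ.^ n′
        b = + K • y zero
        x₀ = x zero
        x′ = x ∘ suc
        N≡ : l ℕ.^ 1 ℕ.* K ≡ N
        N≡ = ≡.trans (≡.cong (ℕ._* K) (ℕ.*-identityʳ l)) (≡.cong (l ℕ.^_) (≡.sym n≡))
        K<N : K ℕ.< N
        K<N = ≡.subst (λ i → K ℕ.< l ℕ.^ i) (≡.sym n≡)
          (ℕ.^-monoʳ-< l (ℕ.nonTrivial⇒n>1 l {{ℕ.prime⇒nonTrivial l-prime}}) (ℕ.n<1+n n′))
        semi : SemiInvariant (y ∘ suc) e
        semi = power-semiInvariant conj (y ∘ suc) (r ∘ suc) e 1 b x₀ e≈
          (B.trans (B.sym (•-pos-* (l ℕ.^ 1) K (y zero))) (B.trans (·-congʳ B (y zero) (≡.cong +_ N≡)) (r zero)))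
        coeffs : (Fin d → ℤ) → Fin (suc d) → ℤ
        coeffs c zero    = + K
        coeffs c (suc j) = ℤ.- c j
        relationᴬ : ∀ u c → value b ≈ value (embed u B.∙ CB.comb c (y ∘ suc)) →
                   + K CA.• x₀ A.≈ + N CA.• u A.∙ CA.comb c x′
        relationᴬ u c p = embed-injective (B.trans (Embed.f-• (+ K) x₀) (B.trans (·-congˡ B (+ K) (B.sym (r zero)))
          (B.trans (CB.•-comm (+ K) (+ N) (y zero)) (B.trans (·-congˡ B (+ N) (value-injective p))
            (B.trans (·-∙ B (+ N) (embed u) (CB.comb c (y ∘ suc))) (B.trans (B.∙-cong (B.sym (Embed.f-• (+ N) u))
              (B.trans (B.sym (CB.comb-*ʳ (+ N) c (y ∘ suc))) (B.trans (CB.comb-congʳ c (r ∘ suc)) (B.sym (Embed.f-comb c x′)))))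
              (B.sym (embed-∙ _ _))))))))
        relation≡ε : ∀ u c → eval (Point (y ∘ suc)) e ≈ value (embed u B.∙ CB.comb c (y ∘ suc)) →
                     CA.comb (coeffs c) x CA.≡ₐ A.ε [ N ]
        relation≡ε u c p = CA.≡ₐ-respˡ (A.sym (A.trans
            (A.∙-cong (relationᴬ u c (trans (sym e≈) p)) (CA.comb-neg c x′))
            (A.trans (A.assoc _ _ _) (A.trans (A.∙-congˡ (A.inverseʳ _)) (A.identityʳ _)))))
          (CA.multiple≡ₐε u)

      no-smaller-power : ∀ m → 0 ℕ.< m → m ℕ.< suc k → ¬ (value (+ m • y zero) ∈ L)
      no-smaller-power m 0<m m<N p = go n ≡.refl
        where
        go : ∀ i → n ≡ i → ⊥
        go zero    e = ℕ.<⇒≱ 0<m (ℕ.s≤s⁻¹ (≡.subst (m ℕ.<_) (≡.trans (≡.sym l^n≡1+k) (≡.cong (l ℕ.^_) e)) m<N))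
        go (suc i) e = y₀-power∉ i e (halfway (λ b → value b ∈ L) (λ q → L.resp (value-cong q))
          (λ q q′ → L.resp (sym (value-∙ _ _)) (L.*-closed q q′)) •∈ i m (y zero) 0<m
          (≡.subst (m ℕ.<_) (≡.trans (≡.sym l^n≡1+k) (≡.cong (l ℕ.^_) e)) m<N) p
          (L.resp (value-cong (≡.subst (λ i → embed (x zero) B.≈ + (l ℕ.^ i) • y zero) e (B.sym (r zero))))
            (con a , a≈)))

      private
        -- All of `F*` rather than the roots of unity, because the constant term of the minimal
        -- polynomial comes with a sign.
        C : Pred Carrier ℓ
        C c = ∃ λ u → c ≈ value (embed u)

        horner-poly : ∀ {m} (v : Fin m → Carrier) s → poly (Vec.tabulate v) s ≈ horner v s
        horner-poly {zero}  v s = refl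
        horner-poly {suc m} v s = +-congˡ (*-congˡ (horner-poly (v ∘ suc) s))

        tabulate⁺ : ∀ {P : Pred Carrier ℓ} {m} (v : Fin m → Carrier) → (∀ i → v i ∈ P) → All P (Vec.tabulate v)
        tabulate⁺ {m = zero}  v p = []
        tabulate⁺ {m = suc m} v p = p zero ∷ tabulate⁺ (v ∘ suc) (p ∘ suc)

        tabulate⁻ : ∀ {P : Pred Carrier ℓ} {m} (v : Fin m → Carrier) → All P (Vec.tabulate v) → ∀ i → v i ∈ P
        tabulate⁻ v (p ∷ _)  zero    = p
        tabulate⁻ v (_ ∷ ps) (suc i) = tabulate⁻ (v ∘ suc) ps i

      -- In other words, `t` has degree `N` over `L`. A shorter relation would give, by `power∈`
      -- applied to the `N` distinct roots `ζⁱ t`, an element `c * tᵐ` of `L` with `c` in `F*` and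
      -- `0 < m < N`; the factor `c` is removed and `no-smaller-power` applies.
      powers-independent : (v : Fin (suc k) → Carrier) → (∀ i → v i ∈ L) → horner v t ≈ 0# → ∀ i → v i ≈ 0#
      powers-independent v v∈ vt≈0 = tabulate⁻ v (decidable-stable em λ ¬v →
        let (m , 0<m , m<N , c , (u , c≈u) , ct∈) = power∈ L-isSubfield em invertible
              {C} (A.ε , trans (sym value-ε) (value-cong (B.sym Embed.f-ε)))
              (λ (u , p) (w , q) → u A.∙ w , trans (*-cong p q) (trans (sym (value-∙ _ _)) (value-cong (B.sym (embed-∙ u w)))))
              C-neg t k {ι a} (con a , refl) ρ distinct ρ∈ (λ i → value-root {ρᵁ i} {x zero} {a} (ρ-root i) a≈) (value-root {y zero} {x zero} {a} (r zero) a≈)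
              (Vec.tabulate v) (tabulate⁺ v v∈) ¬v (trans (horner-poly v t) vt≈0)
        in no-smaller-power m 0<m m<N (L.resp (strip u c m c≈u)
             (L.*-closed (L.inv-closed (u∈ u) (value-inverse (embed u))) ct∈)))
        where
        ρᵁ : Fin (suc k) → B.Carrier
        ρᵁ i = + toℕ i • ζ n B.∙ y zero
        ρ : Fin (suc k) → Carrier
        ρ i = value (ρᵁ i)
        <N : ∀ i → toℕ {suc k} i ℕ.< N
        <N i = ≡.subst (toℕ i ℕ.<_) (≡.sym l^n≡1+k) (Fin.toℕ<n i)
        distinct : Distinct ρ
        distinct {i} {j} p = Fin.toℕ-injective (mod-unique (<N i) (<N j) (ζ-injective n
          (∙-cancelʳ (y zero) _ _ (value-injective p))))
          where open AbelianGroupProperties B using (∙-cancelʳ)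
        ρ∈ : ∀ i → ∃ λ c → C c × ρ i ≈ c * t
        ρ∈ i = let (u , u≈) = ∈F⇒embed (•ζ∈F n (+ toℕ i)) in
          value (embed u) , (u , refl) , trans (value-∙ _ _) (*-congʳ (value-cong (B.sym u≈)))
        ρ-root : ∀ i → + N • ρᵁ i B.≈ embed (x zero)
        ρ-root i = B.trans (·-∙ B (+ N) (+ toℕ i • ζ n) (y zero)) (B.trans (B.∙-cong
          (B.trans (CB.•-comm (+ N) (+ toℕ i) (ζ n)) (B.trans (·-congˡ B (+ toℕ i) (l^n•ζ≈ε n)) (·-ε B (+ toℕ i))))
          (r zero)) (B.identityˡ _))
        C-neg : ∀ {c} → C c → C (- c)
        C-neg {c} (u , p) =
          let (z , z≈) = IsSubfield.neg-closed F-isSubfield (embed∈F u)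
              (w , w≈) = unitᶠ z (λ z≈0 → value≉0 (embed u) (-‿injective (trans (sym z≈) (trans z≈0 (sym -0#≈0#)))))
          in w , trans (-‿cong p) (trans (sym z≈) (sym w≈))
          where
          open RingProperties ring using (-0#≈0#)
          open AbelianGroupProperties +-abelianGroup using () renaming (⁻¹-injective to -‿injective)
        u∈ : ∀ u → value (embed u) ∈ L
        u∈ u = let (z , z≈) = embed∈F u in con z , z≈
        strip : ∀ u c m → c ≈ value (embed u) → value (embed u B.⁻¹) * (c * t ^ m) ≈ value (+ m • y zero)
        strip u c m p = trans (sym (*-assoc _ _ _)) (trans (*-congʳ (trans (*-comm _ _) (trans (*-congʳ p)
          (value-inverse (embed u))))) (trans (*-identityˡ _) (sym (value-• m (y zero)))))

      coefficientsAt : E (Fin (suc d)) → Fin (suc k) → Carrier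
      coefficientsAt e i = eval (Point (y ∘ suc)) (coefficients e i)

      horner-coefficients : ∀ e → horner (coefficientsAt e) t ≈ eval (Point y) e
      horner-coefficients = eval-coefficients (Point y) (value-root {y zero} {x zero} {a} (r zero) a≈)

      coefficientsAt∈ : ∀ e i → coefficientsAt e i ∈ L
      coefficientsAt∈ e i = coefficients e i , refl

    -- By independence of the powers of the first radical, all reduced coefficients of a vanishing
    -- expression vanish. They are expressions in the remaining radicals, so the induction
    -- hypothesis moves them to the other system.
    conjugate : Conjugate x
    conjugate y y′ r r′ e p = trans (sym (horner-coefficients y′ r′ e)) (horner-0 (value (y′ zero)) λ i →
      conj (y ∘ suc) (y′ ∘ suc) (r ∘ suc) (r′ ∘ suc) (coefficients e i)
        (powers-independent y r (coefficientsAt y r e) (coefficientsAt∈ y r e) (trans (horner-coefficients y r e) p) i))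

    -- Semi-invariance under the shift of the first variable leaves a single power of
    -- it; the coefficient is again semi-invariant.
    monomial : Monomial x
    monomial y r e semi = case em {P = ∃ λ i → ¬ (v i ≈ 0#)} of λ where
        (no none) → inj₁ (trans (sym (horner-coefficients y r e))
                      (horner-0 t λ i → decidable-stable em λ v≉0 → none (i , v≉0)))
        (yes (i , v≉0)) → inj₂ (single i v≉0)
      where
      open SetoidReasoning setoid
      open IsSubfield (F[]-isSubfield (Point (y ∘ suc)))
      y′ = y ∘ suc
      t = value (y zero)
      z = value (ζ n)
      v = coefficientsAt y r e
      ∈F⇒∈ : ∀ {u} → u ∈F → u ∈ F[ Point y′ ]
      ∈F⇒∈ (c , p) = con c , p
      minus∈ : ∀ {u w} → u ∈ F[ Point y′ ] → w ∈ F[ Point y′ ] → u - w ∈ F[ Point y′ ]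
      minus∈ p q = +-closed p (neg-closed q)
      η = proj₁ (semi zero)
      -- The shift multiplies the `i`-th power of the first radical by `zⁱ`, while semi-invariance
      -- multiplies everything by `η`. Comparing coefficients forces `zⁱ = η` wherever the
      -- coefficient is nonzero, which singles out one exponent below `N`.
      scaled : horner (λ i → z ^ toℕ i * v i) t ≈ η * horner v t
      scaled = begin
        horner (λ i → z ^ toℕ i * v i) t        ≈⟨ horner-scaled z v t ⟩
        horner v (z * t)                        ≈⟨ horner-point v (sym (value-∙ (ζ n) (y zero))) ⟩
        horner v (value (ζ n B.∙ y zero))       ≈⟨ horner-coefficients (shift zero y) (shift-root zero {y} {x} r) e ⟩
        eval (Point (shift zero y)) e           ≈⟨ proj₂ (proj₂ (semi zero)) ⟩
        η * eval (Point y) e                    ≈⟨ *-congˡ (horner-coefficients y r e) ⟨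
        η * horner v t                          ∎
        where
        horner-point : ∀ {m} (v : Fin m → Carrier) {s s′} → s ≈ s′ → horner v s ≈ horner v s′
        horner-point {zero}  v p = refl
        horner-point {suc m} v p = +-congˡ (*-cong p (horner-point (v ∘ suc) p))
      z^i*v≈η*v : ∀ i → z ^ toℕ i * v i ≈ η * v i
      z^i*v≈η*v i = -≈0⇒≈ (powers-independent y r (λ i → z ^ toℕ i * v i - η * v i)
        (λ i → minus∈ (*-closed (^-closed (toℕ i) (∈F⇒∈ (∈F-resp (value-cong (•-1 (ζ n))) (•ζ∈F n 1ℤ)))) (coefficientsAt∈ y r e i))
                      (*-closed (∈F⇒∈ (proj₁ (proj₂ (semi zero)))) (coefficientsAt∈ y r e i)))
        (horner-difference η (λ i → z ^ toℕ i * v i) v t scaled) i)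
      z^i≈η : ∀ i → ¬ (v i ≈ 0#) → z ^ toℕ i ≈ η
      z^i≈η i v≉0 = case noZeroDivisors (trans (*-comm _ _) (trans (distribˡ (v i) _ _) (trans
          (+-cong (trans (*-comm _ _) (z^i*v≈η*v i)) (trans (sym (-‿distribʳ-* (v i) η)) (-‿cong (*-comm (v i) η))))
          (-‿inverseʳ (η * v i))))) of λ where
        (inj₁ p) → -≈0⇒≈ p
        (inj₂ p) → contradiction p v≉0
       where open RingProperties ring using (-‿distribʳ-*)
      unique : ∀ i j → ¬ (v i ≈ 0#) → ¬ (v j ≈ 0#) → i ≡ j
      unique i j p q = Fin.toℕ-injective (mod-unique (<N i) (<N j) (ζ-injective n
        (value-injective (trans (value-• (toℕ i) (ζ n)) (trans (z^i≈η i p)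
          (trans (sym (z^i≈η j q)) (sym (value-• (toℕ j) (ζ n)))))))))
        where
        <N : ∀ i → toℕ {suc k} i ℕ.< N
        <N i = ≡.subst (toℕ i ℕ.<_) (≡.sym l^n≡1+k) (Fin.toℕ<n i)
      -- Shifting a later radical leaves `t` alone, so semi-invariance may be compared coefficient
      -- by coefficient. The shifted coefficients stay in the same field because `ζ n` lies in `F`.
      coefficient-semi : ∀ i → SemiInvariant y′ (coefficients e i)
      coefficient-semi i j = η′ , η′∈F , -≈0⇒≈ (powers-independent y r (λ i → w i - η′ * v i)
        (λ i → minus∈ (w∈ i) (*-closed (∈F⇒∈ η′∈F) (coefficientsAt∈ y r e i)))
        (horner-difference η′ w v t (trans (horner-coefficients (shift (suc j) y) (shift-root (suc j) {y} {x} r) e)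
          (trans (proj₂ (proj₂ (semi (suc j)))) (*-congˡ (sym (horner-coefficients y r e)))))) i)
        where
        η′ = proj₁ (semi (suc j))
        η′∈F = proj₁ (proj₂ (semi (suc j)))
        w : Fin (suc k) → Carrier
        w i = eval (Point (shift j y′)) (coefficients e i)
        shifted∈ : ∀ {m} {L : Pred Carrier ℓ} → IsSubfield L → (∀ {u} → u ∈F → u ∈ L) → (j : Fin m) (y : Fin m → B.Carrier) →
                   (∀ i → value (y i) ∈ L) → ∀ i → value (shift j y i) ∈ L
        shifted∈ L F∈ zero    y p zero    = IsSubfield.resp L (sym (value-∙ (ζ n) (y zero)))
          (IsSubfield.*-closed L (F∈ (∈F-resp (value-cong (•-1 (ζ n))) (•ζ∈F n 1ℤ))) (p zero))
        shifted∈ L F∈ zero    y p (suc i) = p (suc i)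
        shifted∈ L F∈ (suc j) y p zero    = p zero
        shifted∈ L F∈ (suc j) y p (suc i) = shifted∈ L F∈ j (y ∘ suc) (p ∘ suc) i
        w∈ : ∀ i → w i ∈ F[ Point y′ ]
        w∈ i = eval∈ (F[]-isSubfield (Point y′)) (λ c → con c , refl)
          (shifted∈ (F[]-isSubfield (Point y′)) ∈F⇒∈ j y′ (λ i → var i , refl)) (coefficients e i)
      single : ∀ i → ¬ (v i ≈ 0#) → IsMonomial y (eval (Point y) e)
      single i v≉0 = case mono y′ (r ∘ suc) (coefficients e i) (coefficient-semi i) of λ where
          (inj₁ v≈0) → contradiction v≈0 v≉0
          (inj₂ (u , c , v≈)) → u , extend c , (begin
            eval (Point y) e
              ≈⟨ horner-coefficients y r e ⟨
            horner v t
              ≈⟨ horner-single v t i (λ j j≢i → decidable-stable em λ vj≉0 → j≢i (unique j i vj≉0 v≉0)) ⟩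
            t ^ toℕ i * v i
              ≈⟨ *-cong (sym (value-• (toℕ i) (y zero))) v≈ ⟩
            value (+ toℕ i • y zero) * value (embed u B.∙ CB.comb c y′)
              ≈⟨ value-∙ _ _ ⟨
            value (+ toℕ i • y zero B.∙ (embed u B.∙ CB.comb c y′))
              ≈⟨ value-cong (x∙yz≈y∙xz _ _ _) ⟩
            value (embed u B.∙ (+ toℕ i • y zero B.∙ CB.comb c y′)) ∎)
        where
        open CommutativeSemigroupProperties B.commutativeSemigroup using (x∙yz≈y∙xz)
        extend : (Fin d → ℤ) → Fin (suc d) → ℤ
        extend c zero    = + toℕ i
        extend c (suc j) = c j

  tail-pure : ∀ {d} (x : Fin (suc d) → A.Carrier) → PureModulo x → PureModulo (x ∘ suc)
  tail-pure {d} x pure c p j = pure c′ (CA.≡ₐ-respˡ (A.sym (A.identityˡ _)) p) (suc j)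
    where
    c′ : Fin (suc d) → ℤ
    c′ zero    = 0ℤ
    c′ (suc j) = c j

  radical-conjugates : ∀ d (x : Fin d → A.Carrier) → PureModulo x → Conjugate x × Monomial x
  radical-conjugates zero x pure = (λ y y′ _ _ e p → trans (sym (eval-cong (λ ()) e)) p) , mono
    where
    mono : Monomial x
    mono y r e _ = case em {P = eval (Point y) e ≈ 0#} of λ where
        (yes p) → inj₁ p
        (no ¬p) → let (c , c≈) = eval∈ F-isSubfield (λ a → a , refl) (λ ()) e
                      (a , a≈) = unitᶠ c (λ c≈0 → ¬p (trans (sym c≈) c≈0))
                  in inj₂ (a , (λ ()) , trans (sym c≈) (trans (sym a≈) (value-cong (B.sym (B.identityʳ _)))))
  radical-conjugates (suc d) x pure =
    let (conj , mono) = radical-conjugates d (x ∘ suc) (tail-pure x pure)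
    in Step.conjugate x pure conj mono , Step.monomial x pure conj mono

-- Galois groups acting on units

kronecker : ∀ {d} → Fin d → Fin d → ℕ
kronecker zero    zero    = 1
kronecker zero    (suc i) = 0
kronecker (suc j) zero    = 0
kronecker (suc j) (suc i) = kronecker j i

indicator : ∀ {d} → Fin d → Fin d → ℤ
indicator j i = + kronecker j i

homo⇒isGroupHomomorphism : ∀ {a b c d} (G : Group a b) (H : Group c d) (f : Group.Carrier G → Group.Carrier H) →
  (∀ {x y} → Group._≈_ G x y → Group._≈_ H (f x) (f y)) →
  (∀ x y → Group._≈_ H (f (Group._∙_ G x y)) (Group._∙_ H (f x) (f y))) →
  IsGroupHomomorphism (Group.rawGroup G) (Group.rawGroup H) f
homo⇒isGroupHomomorphism G H f f-cong f-∙ = record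
  { isMonoidHomomorphism = record
    { isMagmaHomomorphism = record { isRelHomomorphism = record { cong = f-cong } ; homo = f-∙ }
    ; ε-homo = f-ε
    }
  ; ⁻¹-homo = λ x → inverseˡ-unique (f (x G.⁻¹)) (f x)
      (H.trans (H.sym (f-∙ (x G.⁻¹) x)) (H.trans (f-cong (G.inverseˡ x)) f-ε))
  }
  where
  module G = Group G
  module H = Group H
  open GroupProperties H using (identityʳ-unique; inverseˡ-unique)
  f-ε : f G.ε H.≈ H.ε
  f-ε = identityʳ-unique (f G.ε) (f G.ε) (H.trans (H.sym (f-∙ G.ε G.ε)) (f-cong (G.identityˡ G.ε)))

module GaloisAction (em : ∀ {a} → ExcludedMiddle a) {ℓ : Level} (F Ω : HeytingField ℓ ℓ ℓ)
  {A B : AbelianGroup (ℓ ⊔ ℓ) ℓ} {l : ℕ} (l-prime : Prime l) (pair : KummerPair (ringOf F) (ringOf Ω) A B l) where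

  open PrimePowers l-prime
  open Kummer em l-prime pair hiding (module F)
  open CommutativeRing (ringOf Ω) hiding (zero)
  open CB using (_•_; •-1)
  open Extension F Ω (KummerPair.ι pair) hiding (_∈F)

  same-power-ζ : ∀ n u v → + (l ℕ.^ n) • u B.≈ + (l ℕ.^ n) • v → ∃ λ c → u B.≈ c • ζ n B.∙ v
  same-power-ζ n u v p =
    let (c , q) = l^n-th-roots-of-unity n (u B.∙ v B.⁻¹) (B.trans (·-∙ B (+ (l ℕ.^ n)) u (v B.⁻¹))
          (B.trans (B.∙-cong p (CB.•-⁻¹ (+ (l ℕ.^ n)) v)) (B.inverseʳ _)))
    in c , CB.∙⁻¹≈⇒≈∙ q

  comb-indicator : ∀ {d} (j : Fin d) (c : Fin d → ℤ) b → CB.comb c (λ i → indicator j i • b) B.≈ c j • b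
  comb-indicator zero c b = B.trans (B.∙-cong (·-congˡ B (c zero) (•-1 b)) (comb-0 (c ∘ suc))) (B.identityʳ _)
    where
    comb-0 : ∀ {m} (c : Fin m → ℤ) → CB.comb c (λ i → 0ℤ • b) B.≈ B.ε
    comb-0 {zero}  c = B.refl
    comb-0 {suc m} c = B.trans (B.∙-cong (·-ε B (c zero)) (comb-0 (c ∘ suc))) (B.identityˡ _)
  comb-indicator (suc j) c b = B.trans (B.∙-cong (·-ε B (c zero)) (comb-indicator j (c ∘ suc) b)) (B.identityˡ _)

  module Action (K : IntermediateField) where

    private module K = IntermediateField K
    open Automorphism

    ∣K∣ : Pred Carrier ℓ
    ∣K∣ = K.∣_∣

    Kᵁ : AbelianGroup (ℓ ⊔ ℓ) ℓ
    Kᵁ = record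
      { Carrier = ∃ λ b → value b ∈ ∣K∣
      ; _≈_ = λ x y → proj₁ x B.≈ proj₁ y
      ; _∙_ = λ (b , b∈) (c , c∈) → b B.∙ c , K.resp (sym (value-∙ b c)) (K.*-closed b∈ c∈)
      ; ε = B.ε , K.resp (sym value-ε) K.1∈
      ; _⁻¹ = λ (b , b∈) → b B.⁻¹ , K.inv-closed b∈ (value-inverse b)
      ; isAbelianGroup = record
        { isGroup = record
          { isMonoid = record
            { isSemigroup = record
              { isMagma = record
                { isEquivalence = record { refl = B.refl ; sym = B.sym ; trans = B.trans }
                ; ∙-cong = B.∙-cong
                }
              ; assoc = λ _ _ _ → B.assoc _ _ _
              }
            ; identity = (λ _ → B.identityˡ _) , (λ _ → B.identityʳ _)
            }
          ; inverse = (λ _ → B.inverseˡ _) , (λ _ → B.inverseʳ _)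
          ; ⁻¹-cong = B.⁻¹-cong
          }
        ; comm = λ _ _ → B.comm _ _
        }
      }

    module Kᵁ = AbelianGroup Kᵁ
    module CK = Congruence Kᵁ
    module Include = GroupHomomorphism {A = Kᵁ} {B = B} proj₁ id (λ _ _ → B.refl)

    comb∈K : ∀ {d} (c : Fin d → ℤ) {b} → (∀ j → value (b j) ∈ ∣K∣) → value (CB.comb c b) ∈ ∣K∣
    comb∈K c {b} b∈ = K.resp (value-cong (Include.f-comb c (λ j → b j , b∈ j))) (proj₂ (CK.comb c (λ j → b j , b∈ j)))

    embed∈K : ∀ a → value (embed a) ∈ ∣K∣
    embed∈K a = let (c , c≈) = embed∈F a in K.resp c≈ (K.F⊆ c)

    module _ (σ : Automorphism K) where

      act : ∀ {z} → z ∈ ∣K∣ → Carrier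
      act {z} z∈ = proj₁ (to σ (z , z∈))

      act-cong : ∀ {z w} (z∈ : z ∈ ∣K∣) (w∈ : w ∈ ∣K∣) → z ≈ w → act z∈ ≈ act w∈
      act-cong {z} {w} z∈ w∈ p = to-cong σ {z , z∈} {w , w∈} p

      act-F : ∀ {z} (z∈ : z ∈ ∣K∣) → z ∈F → act z∈ ≈ z
      act-F z∈ (a , a≈) = trans (act-cong z∈ (K.F⊆ a) (sym a≈)) (trans (fixesF σ a) a≈)

      act-≉0 : ∀ {z} (z∈ : z ∈ ∣K∣) → ¬ (z ≈ 0#) → ¬ (act z∈ ≈ 0#)
      act-≉0 {z} z∈ z≉0 p = z≉0 (injective σ {z , z∈} {0# , K.0∈} (trans p (sym (0#-homo σ))))

      -- Images are taken in `B`, where they are compared with roots of unity and elements of `F*`;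
      -- no membership proofs then have to be carried along.
      actᵁ : Kᵁ.Carrier → B.Carrier
      actᵁ (b , b∈) = proj₁ (toUnit (act-≉0 b∈ (value≉0 b)))

      value-actᵁ : ∀ b → value (actᵁ b) ≈ act (proj₂ b)
      value-actᵁ (b , b∈) = proj₂ (toUnit (act-≉0 b∈ (value≉0 b)))

      actᵁ-cong : ∀ {b c} → b Kᵁ.≈ c → actᵁ b B.≈ actᵁ c
      actᵁ-cong {b} {c} p = value-injective (trans (value-actᵁ b)
        (trans (act-cong (proj₂ b) (proj₂ c) (value-cong p)) (sym (value-actᵁ c))))

      actᵁ-∙ : ∀ b c → actᵁ (b Kᵁ.∙ c) B.≈ actᵁ b B.∙ actᵁ c
      actᵁ-∙ b@(_ , b∈) c@(_ , c∈) = value-injective (trans (value-actᵁ (b Kᵁ.∙ c)) (trans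
        (act-cong (proj₂ (b Kᵁ.∙ c)) (K.*-closed b∈ c∈) (value-∙ _ _)) (trans (*-homo σ _ _)
          (trans (*-cong (sym (value-actᵁ b)) (sym (value-actᵁ c))) (sym (value-∙ _ _))))))

      module Actᵁ = GroupHomomorphism {A = Kᵁ} {B = B} actᵁ (λ {b} {c} → actᵁ-cong {b} {c}) actᵁ-∙

      actᵁ-embed : ∀ b a → proj₁ b B.≈ embed a → actᵁ b B.≈ embed a
      actᵁ-embed b a p = value-injective (trans (value-actᵁ b)
        (trans (act-F (proj₂ b) (∈F-resp (value-cong (B.sym p)) (embed∈F a))) (value-cong p)))

  open Completion l-prime A torsionDivisible using (lin; lin≡comb)
  private module Â = LeftModule (adicCompletion A l)

  -- The Kummer subgroup of `F̂*` attached to `K`. One root per level suffices, as any other differs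
  -- from it by a root of unity in `F`; changing a component modulo `lⁿ`-th powers changes its root
  -- by an element of `F*`.
  RootsIn : IntermediateField → Â.Carrierᴹ → Set ℓ
  RootsIn K z = ∀ n → ∃ λ b → value b ∈ IntermediateField.∣ K ∣ × + (l ℕ.^ n) • b B.≈ embed (CompatibleSequence.seq z n)

  lin-RootsIn : ∀ K {d} (x : Fin d → Â.Carrierᴹ) → (∀ j → RootsIn K (x j)) → ∀ c z → z Â.≈ᴹ lin c x → RootsIn K z
  lin-RootsIn K x roots c z z≈ n = CB.comb cₙ y B.∙ embed q
      , K.resp (sym (value-∙ _ _)) (K.*-closed (comb∈K cₙ (λ j → proj₁ (proj₂ (roots j n)))) (embed∈K q))
      , (begin
          + N • (CB.comb cₙ y B.∙ embed q)
            ≈⟨ ·-∙ B (+ N) (CB.comb cₙ y) (embed q) ⟩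
          + N • CB.comb cₙ y B.∙ + N • embed q
            ≈⟨ B.∙-cong (B.trans (B.sym (CB.comb-*ʳ (+ N) cₙ y)) (B.trans
                 (CB.comb-congʳ cₙ (λ j → proj₂ (proj₂ (roots j n)))) (B.sym (Embed.f-comb cₙ xₙ)))) (B.sym (Embed.f-• (+ N) q)) ⟩
          embed (CA.comb cₙ xₙ) B.∙ embed (+ N CA.• q)
            ≈⟨ embed-∙ _ _ ⟨
          embed (CA.comb cₙ xₙ A.∙ + N CA.• q)
            ≈⟨ embed-cong (_≡ᴬ_[mod_].x≈y∙mz z≡) ⟨
          embed (CompatibleSequence.seq z n) ∎)
    where
    open SetoidReasoning B.setoid
    open Action K
    module K = IntermediateField K
    N = l ℕ.^ n
    cₙ = λ j → AdicInteger.seq (c j) n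
    xₙ = λ j → CompatibleSequence.seq (x j) n
    y = λ j → proj₁ (roots j n)
    z≡ = modᴬ-trans A (z≈ n) (lin≡comb c x n)
    q = _≡ᴬ_[mod_].quotient z≡

-- From a pure basis to an extension

module RadicalExtension (em : ∀ {a} → ExcludedMiddle a) {ℓ : Level} (F Ω : HeytingField ℓ ℓ ℓ)
  {A B : AbelianGroup (ℓ ⊔ ℓ) ℓ} {l : ℕ} (l-prime : Prime l) (pair : KummerPair (ringOf F) (ringOf Ω) A B l) where

  open PrimePowers l-prime
  open Kummer em l-prime pair hiding (module F)
  open KummerTower em l-prime pair
  open CommutativeRing (ringOf Ω) hiding (zero)
  open CB using (_•_; •-1; •-pos-*)
  open Extension F Ω (KummerPair.ι pair) hiding (_∈F)
  open GaloisAction em F Ω l-prime pair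
  open Completion l-prime A torsionDivisible using (at; Pure; pure-at; lin; pure-closed; Â-compatibleʳ; ≡ₐ-unscale)
  open CompatibleSequence
  private
    module Â = LeftModule (adicCompletion A l)
    module F = CommutativeRing (ringOf F)
    module Z = AdicInteger

  module Level-n (n : ℕ) = RadicalConjugates em l-prime pair n (ℕ.pred (l ℕ.^ n))
    (≡.sym (ℕ.suc-pred (l ℕ.^ n) {{l^-nonZero n}}))

  module _ {d : ℕ} (x : Fin d → Â.Carrierᴹ) (pure : Pure x) where

    private
      y₀ : Fin d → ℕ → B.Carrier
      y₀ j n = proj₁ (l^-thRootᵁ n (embed (seq (x j) n)))

      y₀-root : ∀ j n → + (l ℕ.^ n) • y₀ j n B.≈ embed (seq (x j) n)
      y₀-root j n = proj₂ (l^-thRootᵁ n (embed (seq (x j) n)))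

      -- The roots `y₀` are chosen separately at each level, and successive components of `x j` are
      -- only congruent, so `l`-th powers match up to an element of `F*` alone. With `q` the
      -- quotient of that congruence, `+ l • y₀ j (suc n)` and `embed q B.∙ y₀ j n` have the same
      -- `lⁿ`-th power.
      link : ∀ j n → ∃ λ b → + l • y₀ j (suc n) B.≈ embed b B.∙ y₀ j n
      link j n =
        let mod-by {quotient = q} x≈ = compatible (x j) n
            (a , p) = same-power n (+ l • y₀ j (suc n)) (embed q B.∙ y₀ j n)
              (B.trans (B.trans (CB.•-comm (+ (l ℕ.^ n)) (+ l) _) (B.sym (•-pos-* l (l ℕ.^ n) _)))
                (B.trans (y₀-root j (suc n)) (B.trans (embed-cong x≈) (B.trans (embed-∙ _ _)
                  (B.trans (B.comm _ _) (B.trans (B.∙-cong (Embed.f-• (+ (l ℕ.^ n)) q) (B.sym (y₀-root j n)))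
                    (B.sym (·-∙ B (+ (l ℕ.^ n)) (embed q) (y₀ j n)))))))))
        in a A.∙ q , B.trans p (B.trans (B.sym (B.assoc _ _ _)) (B.∙-congʳ (B.sym (embed-∙ a q))))

    -- Sharing the linking factors of `y₀` is what singles out its conjugates among all systems of
    -- roots; these form a torsor under ℤ_lᵈ.
    record Coherent (y : Fin d → ℕ → B.Carrier) : Set ℓ where
      field
        root : ∀ j n → + (l ℕ.^ n) • y j n B.≈ embed (seq (x j) n)
        step : ∀ j n → + l • y j (suc n) B.≈ embed (proj₁ (link j n)) B.∙ y j n

    open Coherent

    y₀-coherent : Coherent y₀
    y₀-coherent = record { root = y₀-root ; step = λ j n → proj₂ (link j n) }

    -- The image of y₀ under the automorphism to be attached to g.
    y[_] : (Fin d → AdicInteger l) → Fin d → ℕ → B.Carrier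
    y[ g ] j n = Z.seq (g j) n • ζ n B.∙ y₀ j n

    y[]-coherent : ∀ g → Coherent y[ g ]
    y[]-coherent g = record
      { root = λ j n → B.trans (·-∙ B (+ (l ℕ.^ n)) (Z.seq (g j) n • ζ n) (y₀ j n))
          (B.trans (B.∙-cong (B.trans (CB.•-comm (+ (l ℕ.^ n)) (Z.seq (g j) n) (ζ n))
            (B.trans (·-congˡ B (Z.seq (g j) n) (l^n•ζ≈ε n)) (·-ε B (Z.seq (g j) n)))) (y₀-root j n)) (B.identityˡ _))
      ; step = λ j n → B.trans (·-∙ B (+ l) (Z.seq (g j) (suc n) • ζ (suc n)) (y₀ j (suc n)))
          (B.trans (B.∙-cong (B.trans (CB.•-comm (+ l) (Z.seq (g j) (suc n)) (ζ (suc n)))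
            (B.trans (·-congˡ B (Z.seq (g j) (suc n)) (l•ζ n)) (ζ-cong n (Z.compatible (g j) n)))) (proj₂ (link j n)))
            (x∙yz≈y∙xz _ _ _))
      }
      where open CommutativeSemigroupProperties B.commutativeSemigroup using (x∙yz≈y∙xz)

    Variable : Set
    Variable = Fin d × ℕ

    point : (Fin d → ℕ → B.Carrier) → Variable → Carrier
    point y (j , n) = value (y j n)

    pointAt : (Fin d → ℕ → B.Carrier) → ℕ → Fin d → Carrier
    pointAt y n j = value (y j n)

    private
      b⁻¹ : ∀ j n → ∃ λ c → ι c ≈ value (embed (proj₁ (link j n) A.⁻¹))
      b⁻¹ j n = embed∈F (proj₁ (link j n) A.⁻¹)

      -- Replaces a radical of level `n` by the `l`-th power of the one above it, divided by the
      -- linking factor. The rewriting is uniform in the coherent system, because the factor is.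
      raise : ∀ n → E (Fin d) → E (Fin d)
      raise n = subst (λ j → con (proj₁ (b⁻¹ j n)) ⊠ (var j ^ᴱ l))

      eval-raise : ∀ {y} → Coherent y → ∀ n e → eval (pointAt y (suc n)) (raise n e) ≈ eval (pointAt y n) e
      eval-raise {y} coh n = eval-subst (λ j → con (proj₁ (b⁻¹ j n)) ⊠ (var j ^ᴱ l)) λ j →
        trans (*-cong (proj₂ (b⁻¹ j n)) (trans (eval-^ (pointAt y (suc n)) (var j) l) (sym (value-• l (y j (suc n))))))
          (trans (sym (value-∙ _ _)) (value-cong (cancel (proj₁ (link j n)) (step coh j n))))
        where
        cancel : ∀ b {u v} → u B.≈ embed b B.∙ v → embed (b A.⁻¹) B.∙ u B.≈ v
        cancel b p = B.trans (B.∙-cong (Embed.f-⁻¹ b) p) (B.trans (B.sym (B.assoc _ _ _))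
          (B.trans (B.∙-congʳ (B.inverseˡ _)) (B.identityˡ _)))

    lift-by : ∀ k n (e : E (Fin d)) → ∃ λ (e′ : E (Fin d)) → ∀ {y} → Coherent y → eval (pointAt y (k ℕ.+ n)) e′ ≈ eval (pointAt y n) e
    lift-by zero    n e = e , λ _ → refl
    lift-by (suc k) n e =
      let (e′ , p) = lift-by k n e
      in raise (k ℕ.+ n) e′ , λ coh → trans (eval-raise coh (k ℕ.+ n) e′) (p coh)

    lift-to : ∀ {m n} → m ℕ.≤ n → ∀ (e : E (Fin d)) → ∃ λ (e′ : E (Fin d)) → ∀ {y} → Coherent y → eval (pointAt y n) e′ ≈ eval (pointAt y m) e
    lift-to {m} {n} m≤n e = ≡.subst (λ i → ∃ λ (e′ : E (Fin d)) → ∀ {y} → Coherent y → eval (pointAt y i) e′ ≈ eval (pointAt y m) e)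
      (ℕ.m∸n+n≡m m≤n) (lift-by (n ℕ.∸ m) m e)

    -- An expression involves finitely many radicals, hence lives at one finite level, where the
    -- results on conjugates apply. The levels are added as a simple common upper bound.
    toLevel : ∀ e → ∃ λ n → ∃ λ (e′ : E (Fin d)) → ∀ {y} → Coherent y → eval (pointAt y n) e′ ≈ eval (point y) e
    toLevel (con c) = 0 , con c , λ _ → refl
    toLevel (var (j , n)) = n , var j , λ _ → refl
    toLevel (e ⊞ f) =
      let (m , e′ , p) = toLevel e
          (n , f′ , q) = toLevel f
          (e″ , p′) = lift-to (ℕ.m≤m+n m n) e′
          (f″ , q′) = lift-to (ℕ.m≤n+m n m) f′
      in m ℕ.+ n , e″ ⊞ f″ , λ coh → +-cong (trans (p′ coh) (p coh)) (trans (q′ coh) (q coh))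
    toLevel (e ⊠ f) =
      let (m , e′ , p) = toLevel e
          (n , f′ , q) = toLevel f
          (e″ , p′) = lift-to (ℕ.m≤m+n m n) e′
          (f″ , q′) = lift-to (ℕ.m≤n+m n m) f′
      in m ℕ.+ n , e″ ⊠ f″ , λ coh → *-cong (trans (p′ coh) (p coh)) (trans (q′ coh) (q coh))

    levelConjugates : ∀ n → Level-n.Conjugate n (at x n) × Level-n.Monomial n (at x n)
    levelConjugates n = Level-n.radical-conjugates n d (at x n) (pure-at pure n)

    conjugates : ∀ {y y′} → Coherent y → Coherent y′ → ∀ e → eval (point y) e ≈ 0# → eval (point y′) e ≈ 0#
    conjugates {y} {y′} coh coh′ e p =
      let (n , e′ , e′≈) = toLevel e
      in trans (sym (e′≈ coh′)) (proj₁ (levelConjugates n) (λ j → y j n) (λ j → y′ j n)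
           (λ j → root coh j n) (λ j → root coh′ j n) e′ (trans (e′≈ coh) p))

    conjugates-≈ : ∀ {y y′} → Coherent y → Coherent y′ → ∀ e f →
                   eval (point y) e ≈ eval (point y) f → eval (point y′) e ≈ eval (point y′) f
    conjugates-≈ {y} {y′} coh coh′ e f p = -≈0⇒≈ (trans (+-congˡ (sym (eval-neg (point y′) f)))
      (conjugates coh coh′ (e ⊞ negᴱ f) (trans (+-congˡ (eval-neg (point y) f))
        (trans (+-congʳ p) (-‿inverseʳ _)))))

    field-K : IntermediateField
    field-K = record
      { ∣_∣        = F[ point y₀ ]
      ; resp       = IsSubfield.resp isSubfield
      ; F⊆         = λ a → con a , refl
      ; +-closed   = λ (e , p) (f , q) → e ⊞ f , +-cong p q
      ; *-closed   = λ (e , p) (f , q) → e ⊠ f , *-cong p q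
      ; neg-closed = λ (e , p) → negᴱ e , trans (eval-neg (point y₀) e) (-‿cong p)
      ; 0∈         = con F.0# , ι.0#-homo
      ; 1∈         = con F.1# , ι.1#-homo
      ; inv-closed = IsSubfield.inv-closed isSubfield
      }
      where isSubfield = F[]-isSubfield (point y₀)

    private
      module K = IntermediateField field-K
      open Action field-K using (∣K∣; Kᵁ; module Kᵁ; module CK; module Include; act; act-cong; actᵁ; value-actᵁ; module Actᵁ; actᵁ-∙; actᵁ-embed; actᵁ-cong; comb∈K; embed∈K)
      Kᴿ = RawRing.Carrier (subfield field-K)

    -- Shows that the image of an element stays in `field-K`: evaluation at the moved radicals is
    -- evaluation at `y₀` of an expression whose coefficients have absorbed the roots of unity.
    twist : (Fin d → AdicInteger l) → E Variable → E Variable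
    twist g = subst λ (j , n) → con (proj₁ (•ζ∈F n (Z.seq (g j) n))) ⊠ var (j , n)

    module ℤₗᵈ = LinearTopologicalGroup (ℤ-adic^ l d)

    eval-twist : ∀ g h e → eval (point y[ h ]) (twist g e) ≈ eval (point y[ g ℤₗᵈ.∙ h ]) e
    eval-twist g h = eval-subst _ λ (j , n) → trans (*-congʳ (proj₂ (•ζ∈F n (Z.seq (g j) n))))
      (trans (sym (value-∙ _ _)) (value-cong (B.trans (B.sym (B.assoc _ _ _))
        (B.∙-congʳ (B.sym (·-+ B (ζ n) (Z.seq (g j) n) (Z.seq (h j) n)))))))

    point-cong : ∀ {g h} → g ℤₗᵈ.≈ h → ∀ v → point y[ g ] v ≈ point y[ h ] v
    point-cong p (j , n) = value-cong (B.∙-congʳ (ζ-cong n (p j n)))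

    point-ε : ∀ v → point y[ ℤₗᵈ.ε ] v ≈ point y₀ v
    point-ε (j , n) = value-cong (B.identityˡ _)

    eval-ε : ∀ e → eval (point y[ ℤₗᵈ.ε ]) e ≈ eval (point y₀) e
    eval-ε = eval-cong point-ε

    eval-twist₀ : ∀ g e → eval (point y₀) (twist g e) ≈ eval (point y[ g ]) e
    eval-twist₀ g e = trans (sym (eval-ε (twist g e))) (trans (eval-twist g ℤₗᵈ.ε e)
      (eval-cong (point-cong {g ℤₗᵈ.∙ ℤₗᵈ.ε} {g} (ℤₗᵈ.identityʳ g)) e))

    σ-map : (Fin d → AdicInteger l) → Kᴿ → Kᴿ
    σ-map g (z , e , p) = eval (point y[ g ]) e , twist g e , eval-twist₀ g e

    -- Independence of the expression that names an element; this is exactly conjugacy of `y₀` and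
    -- `y[ g ]`.
    σ-cong : ∀ g {u v : Kᴿ} → proj₁ u ≈ proj₁ v → proj₁ (σ-map g u) ≈ proj₁ (σ-map g v)
    σ-cong g {z , e , p} {w , f , q} z≈w = conjugates-≈ y₀-coherent (y[]-coherent g) e f (trans p (trans z≈w (sym q)))

    σ-injective : ∀ g {u v : Kᴿ} → proj₁ (σ-map g u) ≈ proj₁ (σ-map g v) → proj₁ u ≈ proj₁ v
    σ-injective g {z , e , p} {w , f , q} r =
      trans (sym p) (trans (conjugates-≈ (y[]-coherent g) y₀-coherent e f r) q)

    σ-surjective : ∀ g (u : Kᴿ) → ∃ λ v → ∀ {w : Kᴿ} → proj₁ w ≈ proj₁ v → proj₁ (σ-map g w) ≈ proj₁ u
    σ-surjective g u@(z , e , p) = v , λ {w} w≈v → trans (σ-cong g {w} {v} w≈v)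
        (trans (eval-twist (g ℤₗᵈ.⁻¹) g e)
          (trans (eval-cong (point-cong {(g ℤₗᵈ.⁻¹) ℤₗᵈ.∙ g} {ℤₗᵈ.ε} (ℤₗᵈ.inverseˡ g)) e) (trans (eval-ε e) p)))
      where
      v : Kᴿ
      v = σ-map (g ℤₗᵈ.⁻¹) u

    σ : (Fin d → AdicInteger l) → Automorphism field-K
    σ g = record
      { to = σ-map g
      ; isRingIsomorphism = record
        { isRingMonomorphism = record
          { isRingHomomorphism = record
            { isSemiringHomomorphism = record
              { isNearSemiringHomomorphism = record
                { +-isMonoidHomomorphism = record
                  { isMagmaHomomorphism = record
                    { isRelHomomorphism = record { cong = λ {u} {v} → σ-cong g {u} {v} }
                    ; homo = λ _ _ → refl
                    }
                  ; ε-homo = ι.0#-homo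
                  }
                ; *-homo = λ _ _ → refl
                }
              ; 1#-homo = ι.1#-homo
              }
            ; -‿homo = λ (z , e , p) → eval-neg (point y[ g ]) e
            }
          ; injective = λ {u} {v} → σ-injective g {u} {v}
          }
        ; surjective = σ-surjective g
        }
      ; fixesF = λ _ → refl
      }

    yᴷ : Fin d → ℕ → Kᵁ.Carrier
    yᴷ j n = y₀ j n , var (j , n) , refl

    image : Automorphism field-K → Fin d → ℕ → B.Carrier
    image τ j n = actᵁ τ (yᴷ j n)

    image-coherent : ∀ τ → Coherent (image τ)
    image-coherent τ = record
      { root = λ j n → B.trans (B.sym (Actᵁ.f-• τ (+ (l ℕ.^ n)) (yᴷ j n)))
          (actᵁ-embed τ (+ (l ℕ.^ n) CK.• yᴷ j n) (seq (x j) n)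
            (B.trans (Include.f-• (+ (l ℕ.^ n)) (yᴷ j n)) (y₀-root j n)))
      ; step = λ j n → let b = proj₁ (link j n) in
          B.trans (B.sym (Actᵁ.f-• τ (+ l) (yᴷ j (suc n))))
            (B.trans (actᵁ-cong τ {+ l CK.• yᴷ j (suc n)} {(embed b , embed∈K b) Kᵁ.∙ yᴷ j n}
                       (B.trans (Include.f-• (+ l) (yᴷ j (suc n))) (proj₂ (link j n))))
              (B.trans (actᵁ-∙ τ (embed b , embed∈K b) (yᴷ j n)) (B.∙-congʳ (actᵁ-embed τ (embed b , embed∈K b) b B.refl))))
      }

    -- At each level the quotient by `y₀` is a root of unity. Both systems obey the same linking
    -- factors, so the exponents are compatible and assemble to `l`-adic integers.
    coherent⇒y[] : ∀ {y} → Coherent y → ∃ λ g → ∀ j n → y j n B.≈ y[ g ] j n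
    coherent⇒y[] {y} coh = (λ j → mkAdic (c j) (compat j)) , λ j n → y≈ j n
      where
      quotient : ∀ j n → ∃ λ c → y j n B.≈ c • ζ n B.∙ y₀ j n
      quotient j n = same-power-ζ n (y j n) (y₀ j n) (B.trans (root coh j n) (B.sym (y₀-root j n)))
      c : Fin d → ℕ → ℤ
      c j n = proj₁ (quotient j n)
      y≈ : ∀ j n → y j n B.≈ c j n • ζ n B.∙ y₀ j n
      y≈ j n = proj₂ (quotient j n)
      open AbelianGroupProperties B using (∙-cancelʳ)
      open CommutativeSemigroupProperties B.commutativeSemigroup using (x∙yz≈y∙xz)
      compat : ∀ j n → c j (suc n) ≡ c j n [mod l ℕ.^ n ]
      compat j n = ζ-injective n (∙-cancelʳ (embed b B.∙ y₀ j n) _ _ (begin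
        c j (suc n) • ζ n B.∙ (embed b B.∙ y₀ j n)
          ≈⟨ B.∙-cong (B.trans (CB.•-comm (+ l) (c j (suc n)) (ζ (suc n))) (·-congˡ B (c j (suc n)) (l•ζ n))) (proj₂ (link j n)) ⟨
        + l • c j (suc n) • ζ (suc n) B.∙ + l • y₀ j (suc n)
          ≈⟨ ·-∙ B (+ l) (c j (suc n) • ζ (suc n)) (y₀ j (suc n)) ⟨
        + l • (c j (suc n) • ζ (suc n) B.∙ y₀ j (suc n))
          ≈⟨ ·-congˡ B (+ l) (y≈ j (suc n)) ⟨
        + l • y j (suc n)
          ≈⟨ step coh j n ⟩
        embed b B.∙ y j n
          ≈⟨ B.∙-congˡ (y≈ j n) ⟩
        embed b B.∙ (c j n • ζ n B.∙ y₀ j n)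
          ≈⟨ x∙yz≈y∙xz _ _ _ ⟩
        c j n • ζ n B.∙ (embed b B.∙ y₀ j n) ∎))
        where
        b = proj₁ (link j n)
        open SetoidReasoning B.setoid

    Θ : Automorphism field-K → Fin d → AdicInteger l
    Θ τ = proj₁ (coherent⇒y[] (image-coherent τ))

    image≈ : ∀ τ j n → image τ j n B.≈ y[ Θ τ ] j n
    image≈ τ = proj₂ (coherent⇒y[] (image-coherent τ))

    y[]-injective-at : ∀ {g h} j n → y[ g ] j n B.≈ y[ h ] j n → Z.seq (g j) n ≡ Z.seq (h j) n [mod l ℕ.^ n ]
    y[]-injective-at j n p = ζ-injective n (∙-cancelʳ (y₀ j n) _ _ p)
      where open AbelianGroupProperties B using (∙-cancelʳ)

    Θ-unique : ∀ τ {g} → (∀ j n → image τ j n B.≈ y[ g ] j n) → Θ τ ℤₗᵈ.≈ g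
    Θ-unique τ {g} p j n = y[]-injective-at {Θ τ} {g} j n (B.trans (B.sym (image≈ τ j n)) (p j n))

    image-value : ∀ τ e → proj₁ (Automorphism.to τ (eval (point y₀) e , e , refl)) ≈ eval (point (image τ)) e
    image-value τ (con a) = Automorphism.fixesF τ a
    image-value τ (var (j , n)) = sym (value-actᵁ τ (yᴷ j n))
    image-value τ (e ⊞ f) = trans (act-cong τ (e ⊞ f , refl) (e ⊞ f , +-cong refl refl) refl)
      (trans (Automorphism.+-homo τ (_ , e , refl) (_ , f , refl)) (+-cong (image-value τ e) (image-value τ f)))
    image-value τ (e ⊠ f) = trans (act-cong τ (e ⊠ f , refl) (e ⊠ f , *-cong refl refl) refl)
      (trans (Automorphism.*-homo τ (_ , e , refl) (_ , f , refl)) (*-cong (image-value τ e) (image-value τ f)))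

    to≈ : ∀ τ (u : Kᴿ) → proj₁ (Automorphism.to τ u) ≈ eval (point y[ Θ τ ]) (proj₁ (proj₂ u))
    to≈ τ (z , e , p) = trans (act-cong τ (e , p) (e , refl) (sym p))
      (trans (image-value τ e) (eval-cong (λ (j , n) → value-cong (image≈ τ j n)) e))

    image-σ : ∀ g j n → image (σ g) j n B.≈ y[ g ] j n
    image-σ g j n = value-injective (value-actᵁ (σ g) (yᴷ j n))

    private
      module Gal = LinearTopologicalGroup (galoisGroup field-K)

    Θ-cong : ∀ {τ τ′} → τ Gal.≈ τ′ → Θ τ ℤₗᵈ.≈ Θ τ′
    Θ-cong {τ} {τ′} p = Θ-unique τ {Θ τ′} λ j n → B.trans (value-injective (trans (value-actᵁ τ (yᴷ j n))
      (trans (p (value (y₀ j n) , var (j , n) , refl)) (sym (value-actᵁ τ′ (yᴷ j n)))))) (image≈ τ′ j n)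

    -- The exponents add because `τ` fixes the roots of unity by which `τ′` moves the radicals.
    Θ-∙ : ∀ τ τ′ → Θ (τ Gal.∙ τ′) ℤₗᵈ.≈ Θ τ ℤₗᵈ.∙ Θ τ′
    Θ-∙ τ τ′ = Θ-unique (τ Gal.∙ τ′) {Θ τ ℤₗᵈ.∙ Θ τ′} λ j n →
      let (u , u≈) = ∈F⇒embed (•ζ∈F n (Z.seq (Θ τ′ j) n))
          uᴷ = embed u , embed∈K u
          w = uᴷ Kᵁ.∙ yᴷ j n
      in B.trans (value-injective (trans (value-actᵁ (τ Gal.∙ τ′) (yᴷ j n))
             (trans (act-cong τ (proj₂ (Automorphism.to τ′ (value (y₀ j n) , var (j , n) , refl))) (proj₂ w)
               (trans (sym (value-actᵁ τ′ (yᴷ j n))) (value-cong (B.trans (image≈ τ′ j n) (B.∙-congʳ (B.sym u≈))))))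
             (sym (value-actᵁ τ w)))))
           (B.trans (actᵁ-∙ τ uᴷ (yᴷ j n)) (B.trans (B.∙-cong (B.trans (actᵁ-embed τ uᴷ u B.refl) u≈) (image≈ τ j n))
             (B.trans (B.sym (B.assoc _ _ _)) (B.∙-congʳ (B.trans (B.comm _ _)
               (B.sym (·-+ B (ζ n) (Z.seq (Θ τ j) n) (Z.seq (Θ τ′ j) n))))))))

    y[]-level : ∀ {g h} n → (∀ j → Z.seq (g j) n ≡ Z.seq (h j) n [mod l ℕ.^ n ]) → ∀ j → pointAt y[ g ] n j ≈ pointAt y[ h ] n j
    y[]-level n p j = value-cong (B.∙-congʳ (ζ-cong n (p j)))

    level : Kᴿ → ℕ
    level (z , e , p) = proj₁ (toLevel e)

    σ-level : ∀ {g h} (u : Kᴿ) → (∀ j → Z.seq (g j) (level u) ≡ Z.seq (h j) (level u) [mod l ℕ.^ level u ]) →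
              proj₁ (σ-map g u) ≈ proj₁ (σ-map h u)
    σ-level {g} {h} (z , e , p) g≡h =
      let (n , e′ , e′≈) = toLevel e
      in trans (sym (e′≈ (y[]-coherent g))) (trans (eval-cong (y[]-level {g} {h} n g≡h) e′) (e′≈ (y[]-coherent h)))

    isomorphism : TopologicalGroupIsomorphism (galoisGroup field-K) (ℤ-adic^ l d)
    isomorphism = record
      { bijection = record
        { to = Θ
        ; from = σ
        ; to-cong = λ {τ} {τ′} → Θ-cong {τ} {τ′}
        ; from-cong = λ {g} {h} p (z , e , _) → eval-cong (point-cong {g} {h} p) e
        ; inverse = (λ {g} {τ} τ≈σg → Θ-unique τ {g} λ j n → B.trans
              (value-injective (trans (value-actᵁ τ (yᴷ j n)) (trans (τ≈σg (value (y₀ j n) , var (j , n) , refl))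
                (sym (value-actᵁ (σ g) (yᴷ j n)))))) (image-σ g j n))
            , (λ {τ} {g} g≈Θτ u → trans (eval-cong (point-cong {g} {Θ τ} g≈Θτ) (proj₁ (proj₂ u))) (sym (to≈ τ u)))
        }
      ; isGroupHomomorphism = isHom
      -- An automorphism that fixes the radicals of level `k` has all its exponents divisible by
      -- `lᵏ`.
      ; to-continuous = λ τ k → List.tabulate (λ j → value (y₀ j k) , var (j , k) , refl) , λ τ′ fixes j →
          mod-trans (mod-+ (mod-sym (IsGroupHomomorphism.⁻¹-homo isHom τ j k)) (mod-reflexive ≡.refl))
            (mod-trans (mod-sym (Θ-∙ (τ Gal.⁻¹) τ′ j k))
              (ζ-faithful k (fixed-ε (Θ (τ Gal.⁻¹ Gal.∙ τ′)) j k
                (B.trans (B.sym (image≈ (τ Gal.⁻¹ Gal.∙ τ′) j k)) (value-injective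
                  (trans (value-actᵁ (τ Gal.⁻¹ Gal.∙ τ′) (yᴷ j k)) (ListAll.tabulate⁻ fixes j)))))
            ))
      ; from-continuous = λ g us → levels us , λ h p → fixes g h us p
      }
      where
      isHom = homo⇒isGroupHomomorphism Gal.group ℤₗᵈ.group Θ (λ {τ} {τ′} → Θ-cong {τ} {τ′}) Θ-∙
      fixed-ε : ∀ (g : Fin d → AdicInteger l) j k → y[ g ] j k B.≈ y₀ j k → Z.seq (g j) k • ζ k B.≈ B.ε
      fixed-ε g j k p = identityˡ-unique _ _ p
        where open AbelianGroupProperties B using (identityˡ-unique)
      -- A sum instead of a maximum, to match `_⊓_` for the basic neighbourhoods of ℤ_lᵈ.
      levels : List Kᴿ → ℕ
      levels []       = 0
      levels (u ∷ us) = level u ℕ.+ levels us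
      fixes : ∀ g h us → ℤₗᵈ.N (levels us) (g ℤₗᵈ.⁻¹ ℤₗᵈ.∙ h) → Gal.N us (σ g Gal.⁻¹ Gal.∙ σ h)
      fixes g h []       p = ListAll.[]
      fixes g h (u ∷ us) p =
        let (p₁ , p₂) = ℤₗᵈ.N-⊓ (level u) (levels us) {g ℤₗᵈ.⁻¹ ℤₗᵈ.∙ h} p
        in sym (pull field-K (σ g) {u} {σ-map h u} (σ-level {g} {h} u λ j → difference (p₁ j))) ListAll.∷ fixes g h us p₂
        where
        difference : ∀ {a b m} → ℤ.- a ℤ.+ b ≡0[mod m ] → a ≡ b [mod m ]
        difference {a} {b} q = mod-sym (-≡0⇒≡ (mod-trans (mod-reflexive (ℤ.+-comm b (ℤ.- a))) q))

    -- The element δ j of ℤ_lᵈ acts at each level as the shift of the j-th radical.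
    δ : Fin d → Fin d → AdicInteger l
    δ j i = constant (indicator j i)

    shift≈δ : ∀ n j i → Level-n.shift n j (λ i → y₀ i n) i B.≈ y[ δ j ] i n
    shift≈δ n j = go j (λ i → y₀ i n)
      where
      go : ∀ {m} (j : Fin m) (y : Fin m → B.Carrier) i → Level-n.shift n j y i B.≈ indicator j i • ζ n B.∙ y i
      go zero    y zero    = B.∙-congʳ (B.sym (•-1 (ζ n)))
      go zero    y (suc i) = B.sym (B.identityˡ _)
      go (suc j) y zero    = B.sym (B.identityˡ _)
      go (suc j) y (suc i) = go j (y ∘ suc) i

    monomial-of : ∀ n e → Level-n.SemiInvariant n (λ j → y₀ j n) e → ¬ (eval (pointAt y₀ n) e ≈ 0#) →
                  ∃ λ a → ∃ λ (c : Fin d → ℤ) → eval (pointAt y₀ n) e ≈ value (embed a B.∙ CB.comb c (λ j → y₀ j n))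
    monomial-of n e semi ≉0 = case proj₂ (levelConjugates n) (λ j → y₀ j n) (λ j → y₀-root j n) e semi of λ where
      (inj₁ ≈0) → contradiction ≈0 ≉0
      (inj₂ m)  → m

    σ-point : ∀ n j e → eval (Level-n.Point n (Level-n.shift n j (λ i → y₀ i n))) e ≈ eval (pointAt y[ δ j ] n) e
    σ-point n j e = eval-cong (λ i → value-cong (shift≈δ n j i)) e

    -- Fixed elements are semi-invariant, so a nonzero one is an element of `F*` times a monomial in
    -- the radicals of some level `n`. Applying `σ (δ j)` multiplies it by `c j • ζ n`; invariance
    -- makes `lⁿ` divide `c j`, and the monomial becomes an element of `F`.
    fixed⇒∈F : ∀ (u : Kᴿ) → (∀ τ → proj₁ (Automorphism.to τ u) ≈ proj₁ u) → proj₁ u ∈F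
    fixed⇒∈F u@(z , e , p) fixed = case em {P = z ≈ 0#} of λ where
        (yes z≈0) → F.0# , trans ι.0#-homo (sym z≈0)
        (no z≉0)  → nonzero (λ q → z≉0 (trans (sym (trans (e′≈ y₀-coherent) p)) q))
      where
      n = proj₁ (toLevel e)
      e′ = proj₁ (proj₂ (toLevel e))
      e′≈ : ∀ {y} → Coherent y → eval (pointAt y n) e′ ≈ eval (point y) e
      e′≈ = proj₂ (proj₂ (toLevel e))
      z≈ : eval (pointAt y₀ n) e′ ≈ z
      z≈ = trans (e′≈ y₀-coherent) p
      semi : Level-n.SemiInvariant n (λ j → y₀ j n) e′
      semi j = 1# , (F.1# , ι.1#-homo) , trans (σ-point n j e′) (trans (e′≈ (y[]-coherent (δ j)))
        (trans (fixed (σ (δ j))) (trans (sym z≈) (sym (*-identityˡ _)))))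
      nonzero : ¬ (eval (pointAt y₀ n) e′ ≈ 0#) → z ∈F
      nonzero ≉0 = ∈F-resp (trans (value-cong (B.sym w≈embed)) (trans (sym m≈) z≈)) (embed∈F (a A.∙ CA.comb q xₙ))
        where
        m = monomial-of n e′ semi ≉0
        a = proj₁ m
        c = proj₁ (proj₂ m)
        m≈ = proj₂ (proj₂ m)
        yₙ = λ j → yᴷ j n
        xₙ = at x n
        aᴷ : Kᵁ.Carrier
        aᴷ = embed a , embed∈K a
        w : Kᵁ.Carrier
        w = aᴷ Kᵁ.∙ CK.comb c yₙ
        w≈ : proj₁ w B.≈ embed a B.∙ CB.comb c (λ j → y₀ j n)
        w≈ = B.∙-congˡ (Include.f-comb c yₙ)
        z≈w : z ≈ value (proj₁ w)
        z≈w = trans (sym z≈) (trans m≈ (value-cong (B.sym w≈)))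
        w-fixed : ∀ τ → actᵁ τ w B.≈ proj₁ w
        w-fixed τ = value-injective (trans (value-actᵁ τ w) (trans (act-cong τ (proj₂ w) (e , p) (sym z≈w))
          (trans (fixed τ) z≈w)))
        ζ-part : ∀ g → CB.comb c (λ i → Z.seq (g i) n • ζ n) B.≈ B.ε
        ζ-part g = identityˡ-unique _ (embed a B.∙ CB.comb c (λ j → y₀ j n)) (begin
          CB.comb c (λ i → Z.seq (g i) n • ζ n) B.∙ (embed a B.∙ CB.comb c (λ j → y₀ j n))
            ≈⟨ x∙yz≈y∙xz _ _ _ ⟩
          embed a B.∙ (CB.comb c (λ i → Z.seq (g i) n • ζ n) B.∙ CB.comb c (λ j → y₀ j n))
            ≈⟨ B.∙-congˡ (CB.comb-∙ c (λ i → Z.seq (g i) n • ζ n) (λ j → y₀ j n)) ⟨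
          embed a B.∙ CB.comb c (λ j → y[ g ] j n)
            ≈⟨ B.∙-cong (actᵁ-embed (σ g) aᴷ a B.refl) (CB.comb-congʳ c (λ j → image-σ g j n)) ⟨
          actᵁ (σ g) aᴷ B.∙ CB.comb c (λ j → actᵁ (σ g) (yₙ j))
            ≈⟨ B.∙-congˡ (Actᵁ.f-comb (σ g) c yₙ) ⟨
          actᵁ (σ g) aᴷ B.∙ actᵁ (σ g) (CK.comb c yₙ)
            ≈⟨ actᵁ-∙ (σ g) aᴷ (CK.comb c yₙ) ⟨
          actᵁ (σ g) w
            ≈⟨ w-fixed (σ g) ⟩
          proj₁ w
            ≈⟨ w≈ ⟩
          embed a B.∙ CB.comb c (λ j → y₀ j n) ∎)
          where
          open SetoidReasoning B.setoid
          open AbelianGroupProperties B using (identityˡ-unique)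
          open CommutativeSemigroupProperties B.commutativeSemigroup using (x∙yz≈y∙xz)
        c≡0 : ∀ j → c j ≡0[mod l ℕ.^ n ]
        c≡0 j = ζ-faithful n (B.trans (B.sym (comb-indicator j c (ζ n))) (ζ-part (δ j)))
        q = proj₁ (CB.comb-divisible c (λ j → y₀ j n) c≡0)
        w≈embed : embed a B.∙ CB.comb c (λ j → y₀ j n) B.≈ embed (a A.∙ CA.comb q xₙ)
        w≈embed = B.trans (B.∙-congˡ (B.trans (proj₂ (CB.comb-divisible c (λ j → y₀ j n) c≡0))
          (B.trans (B.sym (CB.comb-*ʳ (+ (l ℕ.^ n)) q (λ j → y₀ j n))) (B.trans (CB.comb-congʳ q (λ j → y₀-root j n))
            (B.sym (Embed.f-comb q xₙ)))))) (B.sym (embed-∙ _ _))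

    isℤₗExtension : IsℤₗExtension field-K l d
    isℤₗExtension = record
      { isGalois    = record { algebraic = λ {z} _ → algebraic z ; fixedField = fixed⇒∈F }
      ; isomorphism = isomorphism
      }

    x-RootsIn : ∀ j → RootsIn field-K (x j)
    x-RootsIn j n = y₀ j n , (var (j , n) , refl) , y₀-root j n

    -- A root `b` of component `n` lies at some level `M`, with `M` at least `n`. It is
    -- semi-invariant, hence a monomial with exponents `c` there. Its power of exponent `P * Q`,
    -- with `P = l^M` and `Q = lⁿ`, relates `P • z` to `(Q c)·x`. Purity gives `P ∣ Q * c j`, and
    -- cancelling `P` approximates `z` modulo `Q`.
    RootsIn⇒∈span : ∀ z → RootsIn field-K z → ∃ λ c → z Â.≈ᴹ lin c x
    RootsIn⇒∈span z roots = pure-closed pure z λ n → approximate n (roots n)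
      where
      approximate : ∀ n → (∃ λ b → value b ∈ ∣K∣ × + (l ℕ.^ n) • b B.≈ embed (seq z n)) →
                    ∃ λ (c : Fin d → ℤ) → seq z n CA.≡ₐ CA.comb c (at x n) [ l ℕ.^ n ]
      approximate n (b , (e , e≈b) , root-b) = c′ , modᴬ-trans A (≡ₐ-unscale M n eqn) (CA.comb-modʳ c′ λ j → Â-compatibleʳ (x j) n m)
        where
        open SetoidReasoning A.setoid
        m = proj₁ (toLevel e)
        M = n ℕ.+ m
        lifted = lift-to (ℕ.m≤n+m m n) (proj₁ (proj₂ (toLevel e)))
        e′ = proj₁ lifted
        e′≈b : eval (pointAt y₀ M) e′ ≈ value b
        e′≈b = trans (proj₂ lifted y₀-coherent) (trans (proj₂ (proj₂ (toLevel e)) y₀-coherent) e≈b)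
        yM = λ j → y₀ j M
        semi : Level-n.SemiInvariant M yM e′
        semi = Level-n.power-semiInvariant M {x = at x M} (proj₁ (levelConjugates M)) yM (λ j → y₀-root j M)
                 e′ n b (seq z n) e′≈b root-b
        mono = monomial-of M e′ semi (λ ≈0 → value≉0 b (trans (sym e′≈b) ≈0))
        f = proj₁ mono
        c = proj₁ (proj₂ mono)
        b≈ : b B.≈ embed f B.∙ CB.comb c yM
        b≈ = value-injective (trans (sym e′≈b) (proj₂ (proj₂ mono)))
        P = l ℕ.^ M
        Q = l ℕ.^ n
        P•b : A.Carrier
        P•b = + P CA.• f A.∙ CA.comb c (at x M)
        P•b≈ : + P • b B.≈ embed P•b
        P•b≈ = B.trans (·-congˡ B (+ P) b≈) (B.trans (·-∙ B (+ P) (embed f) (CB.comb c yM)) (B.trans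
          (B.∙-cong (B.sym (Embed.f-• (+ P) f)) (B.trans (B.sym (CB.comb-*ʳ (+ P) c yM))
            (B.trans (CB.comb-congʳ c (λ j → y₀-root j M)) (B.sym (Embed.f-comb c (at x M)))))) (B.sym (embed-∙ _ _))))
        P•z≈ : + P CA.• seq z n A.≈ + Q CA.• + P CA.• f A.∙ CA.comb (λ j → + Q ℤ.* c j) (at x M)
        P•z≈ = begin
          + P CA.• seq z n                               ≈⟨ embed-injective (B.trans (Embed.f-• (+ P) (seq z n)) (B.trans (·-congˡ B (+ P) (B.sym root-b))
                                                              (B.trans (CB.•-comm (+ P) (+ Q) b) (B.trans (·-congˡ B (+ Q) P•b≈) (B.sym (Embed.f-• (+ Q) P•b)))))) ⟩
          + Q CA.• P•b                                   ≈⟨ ·-∙ A (+ Q) (+ P CA.• f) (CA.comb c (at x M)) ⟩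
          + Q CA.• + P CA.• f A.∙ + Q CA.• CA.comb c (at x M)   ≈⟨ A.∙-congˡ (CA.comb-* (+ Q) c (at x M)) ⟨
          + Q CA.• + P CA.• f A.∙ CA.comb (λ j → + Q ℤ.* c j) (at x M)  ∎
        Qc≡0 : ∀ j → + Q ℤ.* c j ≡0[mod P ]
        Qc≡0 = pure-at pure M (λ j → + Q ℤ.* c j) (modᴬ-trans A
          (CA.≈⇒≡ₐ (A.sym (A.identityˡ _))) (modᴬ-trans A
            (modᴬ-∙ A (modᴬ-sym A (CA.≡ₐ-respˡ (CA.•-comm (+ P) (+ Q) f) (CA.multiple≡ₐε (+ Q CA.• f)))) CA.≡ₐ-refl)
            (CA.≡ₐ-respˡ P•z≈ (CA.multiple≡ₐε (seq z n)))))
        factored = CA.comb-divisible (λ j → + Q ℤ.* c j) (at x M) Qc≡0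
        c′ = proj₁ factored
        eqn : + P CA.• seq z n CA.≡ₐ + P CA.• CA.comb c′ (at x M) [ P ℕ.* Q ]
        eqn = mod-by {quotient = f} (A.trans P•z≈ (A.trans (A.comm _ _) (A.∙-cong (proj₂ factored)
          (A.trans (CA.•-comm (+ Q) (+ P) f) (A.sym (CA.•-pos-* P Q f))))))

-- Finite sums

module UniqueSum {c ℓ a : Level} (M : CommutativeMonoid c ℓ) {X : Set a} (_~_ : X → X → Set a)
  (~-sym : ∀ {x y} → x ~ y → y ~ x) (~-trans : ∀ {x y z} → x ~ y → y ~ z → x ~ z)
  (f : X → CommutativeMonoid.Carrier M)
  (f-resp : ∀ {x y} → x ~ y → CommutativeMonoid._≈_ M (f x) (f y)) where

  open CommutativeMonoid M

  total : List X → Carrier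
  total []       = ε
  total (x ∷ xs) = f x ∙ total xs

  Unique : List X → Set a
  Unique = AllPairs (λ x y → ¬ (x ~ y))

  private
    record Removal (x : X) (ys : List X) : Set (c ⊔ ℓ ⊔ Level.suc a) where
      field
        y         : X
        x~y       : x ~ y
        rest      : List X
        total≈    : total ys ≈ f y ∙ total rest
        unique    : Unique rest
        all       : ∀ {P : Pred X a} → ListAll.All P ys → ListAll.All P rest
        distinct  : ListAll.All (λ z → ¬ (y ~ z)) rest
        find      : ∀ {z} → Any (z ~_) ys → (z ~ y) ⊎ Any (z ~_) rest

    remove : ∀ {x ys} → Unique ys → Any (x ~_) ys → Removal x ys
    remove {x} {y ∷ ys} (y≁ ∷ uniq) (here x~y) = record
      { y = y ; x~y = x~y ; rest = ys ; total≈ = refl ; unique = uniq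
      ; all = λ { (_ ListAll.∷ ps) → ps } ; distinct = y≁
      ; find = λ { (here p) → inj₁ p ; (there p) → inj₂ p } }
    remove {x} {z ∷ ys} (z≁ ∷ uniq) (there x∈) = record
      { y = R.y ; x~y = R.x~y ; rest = z ∷ R.rest
      ; total≈ = trans (∙-congˡ R.total≈) (x∙yz≈y∙xz _ _ _)
      ; unique = R.all z≁ ∷ R.unique
      ; all = λ { (p ListAll.∷ ps) → p ListAll.∷ R.all ps }
      ; distinct = (λ y~z → ≁-any z≁ (Any.map (~-trans (~-sym R.x~y)) x∈) (~-sym y~z)) ListAll.∷ R.distinct
      ; find = λ { (here p) → inj₂ (here p)
                 ; (there p) → case R.find p of λ { (inj₁ q) → inj₁ q ; (inj₂ q) → inj₂ (there q) } } }
      where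
      module R = Removal (remove uniq x∈)
      open CommutativeSemigroupProperties commutativeSemigroup using (x∙yz≈y∙xz)
      ≁-any : ∀ {z y ys} → ListAll.All (λ w → ¬ (z ~ w)) ys → Any (y ~_) ys → z ~ y → ⊥
      ≁-any (z≁w ListAll.∷ _) (here y~w)  z~y = contradiction (~-trans z~y y~w) z≁w
      ≁-any (_ ListAll.∷ z≁)  (there y∈) z~y = ≁-any z≁ y∈ z~y

  -- Every entry of the first list is matched with an equivalent one of the second, which is then
  -- removed. This makes a sum over representatives of classes invariant under translation.
  total-unique : ∀ {xs ys} → Unique xs → Unique ys → ListAll.All (λ x → Any (x ~_) ys) xs →
                 ListAll.All (λ y → Any (y ~_) xs) ys → total xs ≈ total ys
  total-unique {[]}     {[]}    _ _ _ _ = refl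
  total-unique {[]}     {_ ∷ _} _ _ _ (() ListAll.∷ _)
  total-unique {x ∷ xs} {ys} (x≁ ∷ uniq) uniq′ (x∈ ListAll.∷ xs⊆) ys⊆ =
    trans (∙-cong (f-resp R.x~y) (total-unique uniq R.unique
      (ListAll.zipWith (λ (x≁z , z∈) → case R.find z∈ of λ where
        (inj₁ z~y) → contradiction (~-trans R.x~y (~-sym z~y)) x≁z
        (inj₂ q)   → q) (x≁ , xs⊆))
      (ListAll.zipWith (λ { (y≁z , here z~x) → contradiction (~-trans (~-sym R.x~y) (~-sym z~x)) y≁z
                          ; (y≁z , there z∈) → z∈ }) (R.distinct , R.all ys⊆))))
      (sym R.total≈)
    where module R = Removal (remove uniq′ x∈)

generated : ∀ {s d} (S : Pred (Fin d → ℕ) s) → (∀ {u v} → (∀ j → u j ≡ v j) → u ∈ S → v ∈ S) →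
            (λ _ → 0) ∈ S → (∀ {u v} → u ∈ S → v ∈ S → (λ j → u j ℕ.+ v j) ∈ S) →
            (∀ j → kronecker j ∈ S) → ∀ v → v ∈ S
generated {d = zero}  S S-resp S-0 S-+ S-unit v = S-resp (λ ()) S-0
generated {d = suc d} S S-resp S-0 S-+ S-unit v =
  S-resp (λ { zero → ℕ.+-identityʳ _ ; (suc j) → ≡.refl })
    (S-+ (first (v zero)) (generated (λ u → cons 0 u ∈ S)
      (λ p → S-resp λ { zero → ≡.refl ; (suc j) → p j }) (S-resp (λ { zero → ≡.refl ; (suc j) → ≡.refl }) S-0)
      (λ p q → S-resp (λ { zero → ≡.refl ; (suc j) → ≡.refl }) (S-+ p q))
      (λ j → S-resp (λ { zero → ≡.refl ; (suc i) → ≡.refl }) (S-unit (suc j))) (v ∘ suc)))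
  where
  cons : ∀ {d} → ℕ → (Fin d → ℕ) → Fin (suc d) → ℕ
  cons n v zero    = n
  cons n v (suc j) = v j
  first : ∀ n → cons n (λ _ → 0) ∈ S
  first zero    = S-resp (λ { zero → ≡.refl ; (suc j) → ≡.refl }) S-0
  first (suc n) = S-resp (λ { zero → ≡.refl ; (suc j) → ≡.refl }) (S-+ (S-unit zero) (first n))

module RangeSum {ℓ : Level} (R : CommutativeRing ℓ ℓ) where

  open CommutativeRing R hiding (zero)
  open Exp semiring using (_^_)
  open RawMonoidDefs +-rawMonoid using () renaming (_×_ to _×ᴿ_)
  open CommutativeSemigroupProperties +-commutativeSemigroup using (interchange)

  Σ< : ℕ → (ℕ → Carrier) → Carrier
  Σ< zero    f = 0#
  Σ< (suc n) f = f 0 + Σ< n (f ∘ suc)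

  Σ<-cong : ∀ n {f g : ℕ → Carrier} → (∀ i → f i ≈ g i) → Σ< n f ≈ Σ< n g
  Σ<-cong zero    p = refl
  Σ<-cong (suc n) p = +-cong (p 0) (Σ<-cong n (p ∘ suc))

  Σ<-0 : ∀ n → Σ< n (λ _ → 0#) ≈ 0#
  Σ<-0 zero    = refl
  Σ<-0 (suc n) = trans (+-identityˡ _) (Σ<-0 n)

  Σ<-+ : ∀ n (f g : ℕ → Carrier) → Σ< n (λ i → f i + g i) ≈ Σ< n f + Σ< n g
  Σ<-+ zero    f g = sym (+-identityˡ 0#)
  Σ<-+ (suc n) f g = trans (+-congˡ (Σ<-+ n (f ∘ suc) (g ∘ suc))) (interchange _ _ _ _)

  Σ<-* : ∀ n c (f : ℕ → Carrier) → Σ< n (λ i → c * f i) ≈ c * Σ< n f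
  Σ<-* zero    c f = sym (zeroʳ c)
  Σ<-* (suc n) c f = trans (+-congˡ (Σ<-* n c (f ∘ suc))) (sym (distribˡ c _ _))

  Σ<-*ʳ : ∀ n c (f : ℕ → Carrier) → Σ< n (λ i → f i * c) ≈ Σ< n f * c
  Σ<-*ʳ n c f = trans (Σ<-cong n λ i → *-comm (f i) c) (trans (Σ<-* n c f) (*-comm c _))

  Σ<-swap : ∀ m n (f : ℕ → ℕ → Carrier) → Σ< m (λ i → Σ< n (f i)) ≈ Σ< n (λ j → Σ< m (λ i → f i j))
  Σ<-swap zero    n f = sym (Σ<-0 n)
  Σ<-swap (suc m) n f = trans (+-congˡ (Σ<-swap m n (f ∘ suc))) (sym (Σ<-+ n (f 0) _))

  Σ<-last : ∀ n (f : ℕ → Carrier) → f 0 + Σ< n (f ∘ suc) ≈ Σ< n f + f n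
  Σ<-last zero    f = +-comm _ _
  Σ<-last (suc n) f = trans (+-congˡ (Σ<-last n (f ∘ suc))) (sym (+-assoc _ _ _))

  Σ<-cyclic : ∀ n (f : ℕ → Carrier) → f n ≈ f 0 → Σ< n (f ∘ suc) ≈ Σ< n f
  Σ<-cyclic n f p = ∙-cancelˡ (f 0) _ _ (trans (Σ<-last n f) (trans (+-congˡ p) (+-comm _ _)))
    where open AbelianGroupProperties +-abelianGroup using (∙-cancelˡ)

  Σ<-constant : ∀ n → Σ< n (λ _ → 1#) ≈ n ×ᴿ 1#
  Σ<-constant zero    = refl
  Σ<-constant (suc n) = +-congˡ (Σ<-constant n)

  Σ<-head : ∀ n (f : ℕ → Carrier) → (∀ i → i ℕ.< n → f (suc i) ≈ 0#) → Σ< (suc n) f ≈ f 0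
  Σ<-head n f p = trans (+-congˡ (vanish n (f ∘ suc) p)) (+-identityʳ _)
    where
    vanish : ∀ n (f : ℕ → Carrier) → (∀ i → i ℕ.< n → f i ≈ 0#) → Σ< n f ≈ 0#
    vanish zero    f p = refl
    vanish (suc n) f p = trans (+-cong (p 0 (ℕ.s≤s ℕ.z≤n)) (vanish n (f ∘ suc) (λ i i<n → p (suc i) (ℕ.s≤s i<n)))) (+-identityˡ 0#)

  Σ<-geometric : ∀ n ω → ω ^ n ≈ 1# → ω * Σ< n (λ i → ω ^ i) ≈ Σ< n (λ i → ω ^ i)
  Σ<-geometric n ω p = trans (sym (Σ<-* n ω (λ i → ω ^ i))) (Σ<-cyclic n (λ i → ω ^ i) p)

-- Hilbert 90

module Hilbert90 (em : ∀ {a} → ExcludedMiddle a) {ℓ : Level} (F Ω : HeytingField ℓ ℓ ℓ)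
  {A B : AbelianGroup (ℓ ⊔ ℓ) ℓ} {l : ℕ} (l-prime : Prime l) (pair : KummerPair (ringOf F) (ringOf Ω) A B l)
  (K : Extension.IntermediateField F Ω (KummerPair.ι pair)) where

  open Kummer em l-prime pair hiding (module F)
  open CommutativeRing (ringOf Ω) hiding (zero)
  open CB using (_•_)
  open Extension F Ω (KummerPair.ι pair) hiding (_∈F)
  open Automorphism
  open GaloisAction em F Ω l-prime pair
  open Action K
  open SetoidReasoning setoid
  open Solver commutativeSemiring using (solve; _:=_; _:+_; _:*_)

  private
    module K = IntermediateField K
    module Gal = LinearTopologicalGroup (galoisGroup K)
    Aut = Automorphism K
    Kᴿ = RawRing.Carrier (subfield K)

    _⋆_ _⊹_ : Kᴿ → Kᴿ → Kᴿ
    (z , z∈) ⋆ (w , w∈) = z * w , K.*-closed z∈ w∈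
    (z , z∈) ⊹ (w , w∈) = z + w , K.+-closed z∈ w∈

    F∈K : ∀ {z} → z ∈F → z ∈ ∣K∣
    F∈K (a , a≈) = K.resp a≈ (K.F⊆ a)

  module _ (xs : List Kᴿ) where

    -- Agreement on `xs` means lying in the same left coset of the stabiliser of `xs`; these cosets
    -- stand in for a finite quotient of the Galois group.
    record Agree (σ τ : Aut) : Set ℓ where
      constructor agree
      field agreement : ListAll.All (λ x → proj₁ (to σ x) ≈ proj₁ (to τ x)) xs

    open Agree public

    Agree-sym : ∀ {σ τ} → Agree σ τ → Agree τ σ
    Agree-sym (agree p) = agree (ListAll.map sym p)

    Agree-trans : ∀ {σ τ ρ} → Agree σ τ → Agree τ ρ → Agree σ ρ
    Agree-trans (agree p) (agree q) = agree (ListAll.zipWith (λ (a , b) → trans a b) (p , q))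

    -- z lies in the fixed field of the automorphisms that fix xs.
    record InFixed (z : Kᴿ) : Set ℓ where
      constructor inFixed
      field fixed : ∀ {σ τ} → Agree σ τ → proj₁ (to σ z) ≈ proj₁ (to τ z)

    open InFixed public

    private
      evaluate : ∀ {n} → Vec (Carrier × Aut) n → Kᴿ → Carrier
      evaluate []             z = 0#
      evaluate ((c , σ) ∷ ps) z = c * proj₁ (to σ z) + evaluate ps z

      reduce : ∀ {n} → Kᴿ → Carrier → Vec (Carrier × Aut) n → Vec (Carrier × Aut) n
      reduce w u []             = []
      reduce w u ((c , σ) ∷ ps) = (c * (proj₁ (to σ w) - u) , σ) ∷ reduce w u ps

      evaluate-reduce : ∀ {n} w u (ps : Vec (Carrier × Aut) n) z →
                        evaluate ps (w ⋆ z) ≈ evaluate (reduce w u ps) z + u * evaluate ps z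
      evaluate-reduce w u []             z = sym (trans (+-identityˡ _) (zeroʳ u))
      evaluate-reduce w u ((c , σ) ∷ ps) z = begin
        c * proj₁ (to σ (w ⋆ z)) + evaluate ps (w ⋆ z)
          ≈⟨ +-cong (*-congˡ (trans (*-homo σ w z) (*-congʳ split))) (evaluate-reduce w u ps z) ⟩
        c * ((v + u) * s) + (evaluate (reduce w u ps) z + u * evaluate ps z)
          ≈⟨ solve 6 (λ c v u s r e → c :* ((v :+ u) :* s) :+ (r :+ u :* e) := (c :* v :* s :+ r) :+ u :* (c :* s :+ e)) refl
               c v u s (evaluate (reduce w u ps) z) (evaluate ps z) ⟩
        (c * v * s + evaluate (reduce w u ps) z) + u * (c * s + evaluate ps z) ∎
        where
        s = proj₁ (to σ z)
        v = proj₁ (to σ w) - u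
        split : proj₁ (to σ w) ≈ v + u
        split = sym (trans (+-assoc _ _ _) (trans (+-congˡ (-‿inverseˡ u)) (+-identityʳ _)))

      reduce-All : ∀ {n} {P : Pred Aut ℓ} w u {ps : Vec (Carrier × Aut) n} →
                   All (P ∘ proj₂) ps → All (P ∘ proj₂) (reduce w u ps)
      reduce-All w u []       = []
      reduce-All w u (p ∷ ps) = p ∷ reduce-All w u ps

    -- The classical shortening of a relation `f`: since `σ` and `τ` disagree, some `w` in `xs` has
    -- different images, and `f (w z) - τ(w) f(z)` loses the term of `τ` but keeps that of `σ`, with
    -- coefficient `c * (σ(w) - τ(w))`. Here the relation is tested only on elements whose image
    -- depends on the class alone; `w` is one of them.
    dedekind : ∀ {n} (ps : Vec (Carrier × Aut) n) c σ → ¬ (c ≈ 0#) → All (λ p → ¬ Agree σ (proj₂ p)) ps →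
               (∀ z → InFixed z → evaluate ((c , σ) ∷ ps) z ≈ 0#) → ⊥
    dedekind [] c σ c≉0 [] f≈0 = c≉0 (begin
      c                                      ≈⟨ *-identityʳ c ⟨
      c * 1#                                 ≈⟨ *-congˡ (1#-homo σ) ⟨
      c * proj₁ (to σ (1# , K.1∈))           ≈⟨ +-identityʳ _ ⟨
      c * proj₁ (to σ (1# , K.1∈)) + 0#      ≈⟨ f≈0 (1# , K.1∈) (inFixed λ {σ} {τ} _ → trans (1#-homo σ) (sym (1#-homo τ))) ⟩
      0#                                     ∎)
    dedekind (p@(d , τ) ∷ ps) c σ c≉0 (σ≁τ ∷ σ≁) f≈0 =
      dedekind (reduce w u ps) (c * v) σ cv≉0 (reduce-All {P = λ ρ → ¬ Agree σ ρ} w u σ≁) λ z z∈ → begin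
        c * v * proj₁ (to σ z) + evaluate (reduce w u ps) z
          ≈⟨ +-congˡ (trans (sym (+-identityˡ _)) (+-congʳ (sym (trans (*-congʳ (trans (*-congˡ (-‿inverseʳ u)) (zeroʳ d))) (zeroˡ _))))) ⟩
        evaluate (reduce w u ((c , σ) ∷ p ∷ ps)) z
          ≈⟨ +-identityʳ _ ⟨
        evaluate (reduce w u ((c , σ) ∷ p ∷ ps)) z + 0#
          ≈⟨ +-congˡ (trans (*-congˡ (f≈0 z z∈)) (zeroʳ u)) ⟨
        evaluate (reduce w u ((c , σ) ∷ p ∷ ps)) z + u * evaluate ((c , σ) ∷ p ∷ ps) z
          ≈⟨ evaluate-reduce w u ((c , σ) ∷ p ∷ ps) z ⟨
        evaluate ((c , σ) ∷ p ∷ ps) (w ⋆ z)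
          ≈⟨ f≈0 (w ⋆ z) (inFixed λ {ρ} {ρ′} q → trans (*-homo ρ w z) (trans (*-cong (fixed w∈ q) (fixed z∈ q)) (sym (*-homo ρ′ w z)))) ⟩
        0# ∎
      where
      witness : ∀ ys → (∀ {ρ ρ′} → Agree ρ ρ′ → ListAll.All (λ y → proj₁ (to ρ y) ≈ proj₁ (to ρ′ y)) ys) →
                ¬ ListAll.All (λ x → proj₁ (to σ x) ≈ proj₁ (to τ x)) ys →
                ∃ λ w → InFixed w × ¬ (proj₁ (to σ w) ≈ proj₁ (to τ w))
      witness []       f ¬p = contradiction ListAll.[] ¬p
      witness (y ∷ ys) f ¬p = case em {P = proj₁ (to σ y) ≈ proj₁ (to τ y)} of λ where
        (yes q) → witness ys (λ r → ListAll.tail (f r)) (λ qs → ¬p (q ListAll.∷ qs))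
        (no ¬q) → y , inFixed (λ r → ListAll.head (f r)) , ¬q
      found = witness xs agreement (σ≁τ ∘ agree)
      w = proj₁ found
      w∈ : InFixed w
      w∈ = proj₁ (proj₂ found)
      u = proj₁ (to τ w)
      v = proj₁ (to σ w) - u
      cv≉0 : ¬ (c * v ≈ 0#)
      cv≉0 q = case noZeroDivisors q of λ where
        (inj₁ c≈0) → c≉0 c≈0
        (inj₂ v≈0) → proj₂ (proj₂ found) (-≈0⇒≈ v≈0)

    module _ (n : ℕ) (χ : Aut → ℤ) (χ-∙ : ∀ σ τ → χ (σ Gal.∙ τ) ≡ χ σ ℤ.+ χ τ [mod l ℕ.^ n ])
             (χ-agree : ∀ {σ τ} → Agree σ τ → χ σ ≡ χ τ [mod l ℕ.^ n ])
             (cover : List Aut) (covers : ∀ σ → Any (Agree σ) cover) where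

      private
        nub : List Aut → List Aut
        nub []       = []
        nub (σ ∷ σs) = case em {P = Any (Agree σ) (nub σs)} of λ where
          (yes _) → nub σs
          (no  _) → σ ∷ nub σs

        AllDistinct : List Aut → Set ℓ
        AllDistinct = AllPairs (λ σ τ → ¬ Agree σ τ)

        nub-unique : ∀ σs → AllDistinct (nub σs)
        nub-unique []       = []
        nub-unique (σ ∷ σs) with em {P = Any (Agree σ) (nub σs)}
        ... | yes _ = nub-unique σs
        ... | no ¬p = ListAll.¬Any⇒All¬ (nub σs) ¬p ∷ nub-unique σs

        nub-covers : ∀ σs {τ} → Any (Agree τ) σs → Any (Agree τ) (nub σs)
        nub-covers (σ ∷ σs) p with em {P = Any (Agree σ) (nub σs)} | p
        ... | yes q | here r  = Any.map (Agree-trans r) q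
        ... | yes q | there r = nub-covers σs r
        ... | no _  | here r  = here r
        ... | no _  | there r = there (nub-covers σs r)

        weight : Aut → Carrier
        weight σ = value ((ℤ.- χ σ) • ζ n)

        weight∈F : ∀ σ → weight σ ∈F
        weight∈F σ = •ζ∈F n (ℤ.- χ σ)

        term : Kᴿ → Aut → Kᴿ
        term z σ = (weight σ , F∈K (weight∈F σ)) ⋆ to σ z

        -- A Lagrange resolvent, once the list consists of one representative per class. The sign in
        -- the weights makes `ρ` multiply it by `χ ρ • ζ n`.
        sumᴷ : Kᴿ → List Aut → Kᴿ
        sumᴷ z []       = 0# , K.0∈
        sumᴷ z (σ ∷ σs) = term z σ ⊹ sumᴷ z σs

        termᶜ : Kᴿ → Aut → Carrier
        termᶜ z σ = weight σ * proj₁ (to σ z)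

        representatives : List Aut
        representatives = nub cover

        weight-∙ : ∀ ρ σ → weight σ ≈ value (χ ρ • ζ n) * weight (ρ Gal.∙ σ)
        weight-∙ ρ σ = trans (value-cong (B.trans (ζ-cong n (congruence ρ σ)) (·-+ B (ζ n) (χ ρ) _))) (value-∙ _ _)
          where
          congruence : ∀ ρ σ → ℤ.- χ σ ≡ χ ρ ℤ.+ ℤ.- χ (ρ Gal.∙ σ) [mod l ℕ.^ n ]
          congruence ρ σ = mod-trans (mod-reflexive (eq (χ ρ) (χ σ)))
            (mod-+ {a = χ ρ} (mod-reflexive ≡.refl) (mod-neg (mod-sym (χ-∙ ρ σ))))
            where
            eq : ∀ a b → ℤ.- b ≡ a ℤ.+ ℤ.- (a ℤ.+ b)
            eq = solve-∀

      module _ (z : Kᴿ) (z∈ : InFixed z) where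

        private
          termᶜ-resp : ∀ {σ τ} → Agree σ τ → termᶜ z σ ≈ termᶜ z τ
          termᶜ-resp p = *-cong (value-cong (ζ-cong n (mod-neg (χ-agree p)))) (fixed z∈ p)

          open UniqueSum +-commutativeMonoid Agree Agree-sym Agree-trans (termᶜ z) termᶜ-resp

          sum≈total : ∀ σs → proj₁ (sumᴷ z σs) ≈ total σs
          sum≈total []       = refl
          sum≈total (σ ∷ σs) = +-congˡ (sum≈total σs)

          act-sum : ∀ ρ σs → proj₁ (to ρ (sumᴷ z σs)) ≈ value (χ ρ • ζ n) * total (map (ρ Gal.∙_) σs)
          act-sum ρ []       = trans (0#-homo ρ) (sym (zeroʳ _))
          act-sum ρ (σ ∷ σs) = begin
            proj₁ (to ρ (term z σ ⊹ sumᴷ z σs))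
              ≈⟨ +-homo ρ (term z σ) (sumᴷ z σs) ⟩
            proj₁ (to ρ (term z σ)) + proj₁ (to ρ (sumᴷ z σs))
              ≈⟨ +-cong (trans (*-homo ρ (weight σ , F∈K (weight∈F σ)) (to σ z))
                   (*-congʳ (trans (act-F ρ (F∈K (weight∈F σ)) (weight∈F σ)) (weight-∙ ρ σ)))) (act-sum ρ σs) ⟩
            (value (χ ρ • ζ n) * weight (ρ Gal.∙ σ)) * proj₁ (to ρ (to σ z)) + value (χ ρ • ζ n) * total (map (ρ Gal.∙_) σs)
              ≈⟨ trans (+-congʳ (*-assoc _ _ _)) (sym (distribˡ _ _ _)) ⟩
            value (χ ρ • ζ n) * (termᶜ z (ρ Gal.∙ σ) + total (map (ρ Gal.∙_) σs)) ∎

          -- ρ permutes the classes of automorphisms.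
          permute : ∀ ρ → total (map (ρ Gal.∙_) representatives) ≈ total representatives
          permute ρ = total-unique (translated-unique (nub-unique cover)) (nub-unique cover)
            (ListAll.universal (λ σ → nub-covers cover (covers σ)) _)
            (ListAll.universal (λ τ → translated-covers τ (nub-covers cover (covers (ρ Gal.⁻¹ Gal.∙ τ)))) _)
            where
            reflect : ∀ {σ τ} → Agree (ρ Gal.∙ σ) (ρ Gal.∙ τ) → Agree σ τ
            reflect {σ} {τ} (agree q) = agree (ListAll.map (λ {x} p → injective ρ {to σ x} {to τ x} p) q)
            translated-unique : ∀ {σs} → AllDistinct σs → AllDistinct (map (ρ Gal.∙_) σs)
            translated-unique []       = []
            translated-unique (p ∷ ps) = ListAll.map⁺ (ListAll.map (λ ¬a a → ¬a (reflect a)) p) ∷ translated-unique ps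
            translated-covers : ∀ τ {σs} → Any (Agree (ρ Gal.⁻¹ Gal.∙ τ)) σs → Any (Agree τ) (map (ρ Gal.∙_) σs)
            translated-covers τ = Any.map⁺ ∘ Any.map λ {σ} (agree q) → agree (ListAll.map (λ {x} p →
              trans (sym (to∘from ρ (to τ x))) (to-cong ρ {to (ρ Gal.⁻¹ Gal.∙ τ) x} {to σ x} p)) q)

        resolvent-equivariant : ∀ ρ → proj₁ (to ρ (sumᴷ z representatives)) ≈
                                value (χ ρ • ζ n) * proj₁ (sumᴷ z representatives)
        resolvent-equivariant ρ = trans (act-sum ρ representatives)
          (*-congˡ (trans (permute ρ) (sym (sum≈total representatives))))

      private
        weighted : (σs : List Aut) → Vec (Carrier × Aut) (List.length σs)
        weighted []       = []
        weighted (σ ∷ σs) = (weight σ , σ) ∷ weighted σs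

        weighted-All : ∀ {P : Pred Aut ℓ} {σs} → ListAll.All P σs → All (P ∘ proj₂) (weighted σs)
        weighted-All ListAll.[]       = []
        weighted-All (p ListAll.∷ ps) = p ∷ weighted-All ps

        sum-evaluate : ∀ z σs → evaluate (weighted σs) z ≈ proj₁ (sumᴷ z σs)
        sum-evaluate z []       = refl
        sum-evaluate z (σ ∷ σs) = +-congˡ (sum-evaluate z σs)

        -- A resolvent vanishing at all admissible `z` would be a linear relation between pairwise
        -- inequivalent automorphisms, excluded by `dedekind`. The class of the identity shows that
        -- the list is not empty.
        nonvanishing : ∀ σs → AllDistinct σs → Any (Agree (idᴬ K)) σs → ∃ λ z → InFixed z × ¬ (proj₁ (sumᴷ z σs) ≈ 0#)
        nonvanishing (σ ∷ σs) (σ≁ ∷ _) _ = decidable-stable em λ none →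
          dedekind (weighted σs) (weight σ) σ (value≉0 _) (weighted-All {P = λ τ → ¬ Agree σ τ} σ≁)
            λ z z∈ → trans (+-congˡ (sum-evaluate z σs)) (decidable-stable em λ ≉0 → none (z , z∈ , ≉0))

      -- As `ζ n` is fixed by every automorphism, `σ ↦ χ σ • ζ n` is a cocycle; a nonvanishing
      -- resolvent exhibits it as a coboundary.
      hilbert90 : ∃ λ (b : Kᵁ.Carrier) → ∀ σ → actᵁ σ b B.≈ χ σ • ζ n B.∙ proj₁ b
      hilbert90 = (b , K.resp (sym b≈) (proj₂ s)) , λ σ → value-injective (trans (value-actᵁ σ (b , K.resp (sym b≈) (proj₂ s)))
          (trans (act-cong σ (K.resp (sym b≈) (proj₂ s)) (proj₂ s) b≈)
            (trans (resolvent-equivariant z z∈ σ) (trans (*-congˡ (sym b≈)) (sym (value-∙ _ _))))))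
        where
        nv = nonvanishing representatives (nub-unique cover) (nub-covers cover (covers (idᴬ K)))
        z = proj₁ nv
        z∈ : InFixed z
        z∈ = proj₁ (proj₂ nv)
        s = sumᴷ z representatives
        b = proj₁ (toUnit (proj₂ (proj₂ nv)))
        b≈ = proj₂ (toUnit (proj₂ (proj₂ nv)))

-- The radical basis of a ℤ_lᵈ-extension

module GaloisKummer (em : ∀ {a} → ExcludedMiddle a) {ℓ : Level} (F Ω : HeytingField ℓ ℓ ℓ)
  {A B : AbelianGroup (ℓ ⊔ ℓ) ℓ} {l : ℕ} (l-prime : Prime l) (pair : KummerPair (ringOf F) (ringOf Ω) A B l)
  (K : Extension.IntermediateField F Ω (KummerPair.ι pair))
  (isGalois : Extension.IsGalois F Ω (KummerPair.ι pair) K) {d : ℕ}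
  (iso : TopologicalGroupIsomorphism (Extension.galoisGroup F Ω (KummerPair.ι pair) K) (ℤ-adic^ l d)) where

  open PrimePowers l-prime
  open Kummer em l-prime pair hiding (module F)
  open CommutativeRing (ringOf Ω) hiding (zero)
  open CB using (_•_; •-pos-*)
  open Extension F Ω (KummerPair.ι pair) hiding (_∈F)
  open Automorphism
  open GaloisAction em F Ω l-prime pair
  open Action K
  open Hilbert90 em F Ω l-prime pair K
  open Completion l-prime A torsionDivisible using (at; Pure; mkPure; lin; pure-closed)
  open CompatibleSequence

  private
    module Â = LeftModule (adicCompletion A l)
    module Z = AdicInteger
    module K = IntermediateField K
    module Gal = LinearTopologicalGroup (galoisGroup K)
    module ℤₗᵈ = LinearTopologicalGroup (ℤ-adic^ l d)
    module T = TopologicalGroupIsomorphism iso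
    module TH = IsGroupHomomorphism T.isGroupHomomorphism
    Aut = Automorphism K
    Kᴿ = RawRing.Carrier (subfield K)
    Vector = Fin d → AdicInteger l

  φ : Vector → Aut
  φ = T.from

  φ-∙ : ∀ g h → φ (g ℤₗᵈ.∙ h) Gal.≈ φ g Gal.∙ φ h
  φ-∙ g h = Gal.trans {φ (g ℤₗᵈ.∙ h)} {φ (T.to (φ g Gal.∙ φ h))} {φ g Gal.∙ φ h}
    (T.from-cong {g ℤₗᵈ.∙ h} {T.to (φ g Gal.∙ φ h)} (ℤₗᵈ.sym {T.to (φ g Gal.∙ φ h)} {g ℤₗᵈ.∙ h}
      (ℤₗᵈ.trans {T.to (φ g Gal.∙ φ h)} {T.to (φ g) ℤₗᵈ.∙ T.to (φ h)} {g ℤₗᵈ.∙ h} (TH.homo (φ g) (φ h))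
        (ℤₗᵈ.∙-cong {T.to (φ g)} {g} {T.to (φ h)} {h} (T.strictlyInverseˡ g) (T.strictlyInverseˡ h)))))
    (T.strictlyInverseʳ (φ g Gal.∙ φ h))

  φ-cong : ∀ {g h} → g ℤₗᵈ.≈ h → φ g Gal.≈ φ h
  φ-cong {g} {h} = T.from-cong {g} {h}

  φ-ε : φ ℤₗᵈ.ε Gal.≈ Gal.ε
  φ-ε = Gal.trans {φ ℤₗᵈ.ε} {φ (T.to Gal.ε)} {Gal.ε}
    (φ-cong {ℤₗᵈ.ε} {T.to Gal.ε} (ℤₗᵈ.sym {T.to Gal.ε} {ℤₗᵈ.ε} TH.ε-homo)) (T.strictlyInverseʳ Gal.ε)

  φ-to : ∀ σ → φ (T.to σ) Gal.≈ σ
  φ-to = T.strictlyInverseʳ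

  stabiliser : ∀ xs → ∃ λ m → ∀ h → ℤₗᵈ.N m h → Gal.N xs (φ h)
  stabiliser xs =
    let (m , f) = T.from-continuous ℤₗᵈ.ε xs
    in m , λ h h∈ → ListAll.map (λ {x} p → trans (sym (trans (to-cong (φ ℤₗᵈ.ε) {x} {to (φ ℤₗᵈ.ε Gal.⁻¹ Gal.∙ φ h) x} (sym p))
                       (to∘from (φ ℤₗᵈ.ε) (to (φ h) x)))) (φ-ε x))
         (f h (ℤₗᵈ.N-resp m {h} {ℤₗᵈ.ε ℤₗᵈ.⁻¹ ℤₗᵈ.∙ h} (λ j n → mod-reflexive (≡.sym (ℤ.+-identityˡ _))) h∈))

  congruent⇒agree : ∀ xs → ∃ λ m → ∀ g h → (∀ j → Z.seq (g j) m ≡ Z.seq (h j) m [mod l ℕ.^ m ]) → Agree xs (φ g) (φ h)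
  congruent⇒agree xs =
    let (m , f) = stabiliser xs
    in m , λ g h g≡h → agree (ListAll.map (λ {x} p →
         sym (trans (φ-cong {h} {g ℤₗᵈ.∙ (g ℤₗᵈ.⁻¹ ℤₗᵈ.∙ h)} (λ j n → mod-reflexive (eq (Z.seq (g j) n) (Z.seq (h j) n))) x)
           (trans (φ-∙ g (g ℤₗᵈ.⁻¹ ℤₗᵈ.∙ h) x) (to-cong (φ g) {to (φ (g ℤₗᵈ.⁻¹ ℤₗᵈ.∙ h)) x} {x} p))))
         (f (g ℤₗᵈ.⁻¹ ℤₗᵈ.∙ h) λ j → mod-trans (mod-+ (mod-neg (g≡h j)) (mod-reflexive ≡.refl))
           (mod-reflexive (ℤ.+-inverseˡ (Z.seq (h j) m)))))
    where
    eq : ∀ a b → b ≡ a ℤ.+ (ℤ.- a ℤ.+ b)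
    eq = solve-∀

  private
    cons : ∀ {d} → ℕ → (Fin d → ℕ) → Fin (suc d) → ℕ
    cons n v zero    = n
    cons n v (suc j) = v j

    box : ℕ → ∀ d → List (Fin d → ℕ)
    box N zero    = (λ ()) ∷ []
    box N (suc d) = List.cartesianProductWith cons (List.upTo N) (box N d)

    box-complete : ∀ N d (v : Fin d → ℕ) → (∀ j → v j ℕ.< N) → Any (λ w → ∀ j → v j ≡ w j) (box N d)
    box-complete N zero    v v< = here λ ()
    box-complete N (suc d) v v< = Any.cartesianProductWith⁺ cons (λ { p q zero → p ; p q (suc j) → q j })
      (List.∈-upTo⁺ (v< zero)) (box-complete N d (v ∘ suc) (v< ∘ suc))

    natural : (Fin d → ℕ) → Vector
    natural v j = constant (+ v j)

  -- The stabiliser of `xs` contains the image of `lᵐ ℤ_lᵈ` for some `m`, so the `box` of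
  -- representatives of `(ℤ/lᵐ)ᵈ` meets every class.
  finiteCover : ∀ xs → ∃ λ (cover : List Aut) → ∀ σ → Any (Agree xs σ) cover
  finiteCover xs = map (φ ∘ natural) (box (l ℕ.^ m) d) , λ σ →
      let r = λ j → mod-reduce {l ℕ.^ m} {{l^-nonZero m}} (Z.seq (T.to σ j) m)
      in Any.map⁺ (Any.map (λ {w} v≡w → covers σ w λ j → mod-trans (proj₂ (proj₂ (r j))) (mod-reflexive (≡.cong +_ (v≡w j))))
           (box-complete (l ℕ.^ m) d (λ j → proj₁ (r j)) (λ j → proj₁ (proj₂ (r j)))))
    where
    m = proj₁ (congruent⇒agree xs)
    covers : ∀ σ w → (∀ j → Z.seq (T.to σ j) m ≡ + w j [mod l ℕ.^ m ]) → Agree xs σ (φ (natural w))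
    covers σ w p = Agree-trans xs (agree (ListAll.universal (λ x → sym (φ-to σ x)) xs))
      (proj₂ (congruent⇒agree xs) (T.to σ) (natural w) p)

  χ : Fin d → ℕ → Aut → ℤ
  χ j n σ = Z.seq (T.to σ j) n

  χ-∙ : ∀ j n σ τ → χ j n (σ Gal.∙ τ) ≡ χ j n σ ℤ.+ χ j n τ [mod l ℕ.^ n ]
  χ-∙ j n σ τ = TH.homo σ τ j n

  χ-open : ∀ n → ∃ λ xs → ∀ {σ τ} → Agree xs σ τ → ∀ j → χ j n σ ≡ χ j n τ [mod l ℕ.^ n ]
  χ-open n =
    let (xs , f) = T.to-continuous Gal.ε n
    in xs , λ {σ} {τ} (agree p) j →
      let ρ = σ Gal.⁻¹ Gal.∙ τ
          ρ∈N : Gal.N xs ρ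
          ρ∈N = ListAll.map (λ {x} q → sym (pull K σ {x} {to τ x} q)) p
          Θρ≡0 : χ j n ρ ≡0[mod l ℕ.^ n ]
          Θρ≡0 = mod-trans (mod-sym (mod-trans (mod-+ (mod-neg (TH.ε-homo j n)) (mod-reflexive ≡.refl))
                   (mod-reflexive (ℤ.+-identityˡ (χ j n ρ)))))
                 (f ρ (Gal.N-∙ xs {Gal.ε Gal.⁻¹} {ρ} (Gal.N-⁻¹ xs {Gal.ε} (Gal.N-ε xs)) ρ∈N) j)
      in mod-sym (-≡0⇒≡ (mod-trans (mod-trans (mod-reflexive (ℤ.+-comm (χ j n τ) _))
           (mod-+ (mod-sym (TH.⁻¹-homo σ j n)) (mod-reflexive ≡.refl)))
           (mod-trans (mod-sym (χ-∙ j n (σ Gal.⁻¹) τ)) Θρ≡0)))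

  private abstract
    eigenvector : ∀ j n → ∃ λ (b : Kᵁ.Carrier) → ∀ σ → actᵁ σ b B.≈ χ j n σ • ζ n B.∙ proj₁ b
    eigenvector j n =
      let (xs , χ-agree)    = χ-open n
          (cover , covers) = finiteCover xs
      in hilbert90 xs n (χ j n) (χ-∙ j n) (λ p → χ-agree p j) cover covers

  yᴷ : Fin d → ℕ → Kᵁ.Carrier
  yᴷ j n = proj₁ (eigenvector j n)

  y : Fin d → ℕ → B.Carrier
  y j n = proj₁ (yᴷ j n)

  act-y : ∀ σ j n → actᵁ σ (yᴷ j n) B.≈ χ j n σ • ζ n B.∙ y j n
  act-y σ j n = proj₂ (eigenvector j n) σ

  fixed⇒embed : ∀ (b : Kᵁ.Carrier) → (∀ σ → actᵁ σ b B.≈ proj₁ b) → ∃ λ a → embed a B.≈ proj₁ b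
  fixed⇒embed (b , b∈) p = ∈F⇒embed (IsGalois.fixedField isGalois (value b , b∈)
    λ σ → trans (sym (value-actᵁ σ (b , b∈))) (value-cong (p σ)))

  private abstract
    power : ∀ j n → ∃ λ a → embed a B.≈ + (l ℕ.^ n) • y j n
    power j n =
      let N = + (l ℕ.^ n)
          (a , a≈) = fixed⇒embed (N CK.• yᴷ j n) λ σ → B.trans (Actᵁ.f-• σ N (yᴷ j n))
            (B.trans (·-congˡ B N (act-y σ j n)) (B.trans (·-∙ B N (χ j n σ • ζ n) (y j n))
              (B.trans (B.∙-cong (B.trans (CB.•-comm N (χ j n σ) (ζ n)) (B.trans (·-congˡ B (χ j n σ) (l^n•ζ≈ε n))
                (·-ε B (χ j n σ)))) (B.sym (Include.f-• N (yᴷ j n)))) (B.identityˡ _))))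
      in a , B.trans a≈ (Include.f-• N (yᴷ j n))

    -- Compatibility of the coordinates modulo `lⁿ` makes both sides transform by the same root of
    -- unity; their quotient is fixed, hence lies in `F`.
    link : ∀ j n → ∃ λ a → embed a B.∙ y j n B.≈ + l • y j (suc n)
    link j n =
      let w = (+ l CK.• yᴷ j (suc n)) Kᵁ.∙ (yᴷ j n Kᵁ.⁻¹)
          (a , a≈) = fixed⇒embed w λ σ → B.trans (actᵁ-∙ σ (+ l CK.• yᴷ j (suc n)) (yᴷ j n Kᵁ.⁻¹)) (B.trans
            (B.∙-cong (B.trans (Actᵁ.f-• σ (+ l) (yᴷ j (suc n))) (B.trans (·-congˡ B (+ l) (act-y σ j (suc n)))
                (B.trans (·-∙ B (+ l) (χ j (suc n) σ • ζ (suc n)) (y j (suc n))) (B.∙-cong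
                  (B.trans (CB.•-comm (+ l) (χ j (suc n) σ) (ζ (suc n))) (B.trans (·-congˡ B (χ j (suc n) σ) (l•ζ n))
                    (ζ-cong n (Z.compatible (T.to σ j) n)))) (B.sym (Include.f-• (+ l) (yᴷ j (suc n))))))))
              (B.trans (Actᵁ.f-⁻¹ σ (yᴷ j n)) (B.⁻¹-cong (act-y σ j n))))
            (CB.∙-cancel-⁻¹ (χ j n σ • ζ n) (proj₁ (+ l CK.• yᴷ j (suc n))) (y j n)))
      in a , B.trans (B.∙-congʳ a≈) (B.trans (B.assoc _ _ _) (B.trans (B.∙-congˡ (B.inverseˡ _))
               (B.trans (B.identityʳ _) (Include.f-• (+ l) (yᴷ j (suc n))))))

  -- Hilbert 90 is applied separately at each level. The factors from `link` make the powers
  -- `lⁿ • y j n` compatible modulo `lⁿ`-th powers, which is all that an element of `F̂*` requires.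
  basis : Fin d → Â.Carrierᴹ
  basis j = mkSeq (λ n → proj₁ (power j n)) λ n → mod-by {quotient = proj₁ (link j n)} (embed-injective (begin
      embed (proj₁ (power j (suc n)))
        ≈⟨ proj₂ (power j (suc n)) ⟩
      + (l ℕ.* l ℕ.^ n) • y j (suc n)
        ≈⟨ B.trans (•-pos-* l (l ℕ.^ n) _) (CB.•-comm (+ l) (+ (l ℕ.^ n)) _) ⟩
      + (l ℕ.^ n) • + l • y j (suc n)
        ≈⟨ ·-congˡ B (+ (l ℕ.^ n)) (proj₂ (link j n)) ⟨
      + (l ℕ.^ n) • (embed (proj₁ (link j n)) B.∙ y j n)
        ≈⟨ ·-∙ B (+ (l ℕ.^ n)) (embed (proj₁ (link j n))) (y j n) ⟩
      + (l ℕ.^ n) • embed (proj₁ (link j n)) B.∙ + (l ℕ.^ n) • y j n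
        ≈⟨ B.∙-cong (B.sym (Embed.f-• (+ (l ℕ.^ n)) (proj₁ (link j n)))) (B.sym (proj₂ (power j n))) ⟩
      embed (+ (l ℕ.^ n) CA.• proj₁ (link j n)) B.∙ embed (proj₁ (power j n))
        ≈⟨ B.trans (B.comm _ _) (B.sym (embed-∙ _ _)) ⟩
      embed (proj₁ (power j n) A.∙ + (l ℕ.^ n) CA.• proj₁ (link j n)) ∎))
    where open SetoidReasoning B.setoid

  y-root : ∀ j n → + (l ℕ.^ n) • y j n B.≈ embed (seq (basis j) n)
  y-root j n = B.sym (proj₂ (power j n))

  basis-RootsIn : ∀ j → RootsIn K (basis j)
  basis-RootsIn j n = y j n , proj₂ (yᴷ j n) , y-root j n

  δ : Fin d → Vector
  δ i j = constant (indicator i j)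

  e : Fin d → Aut
  e i = φ (δ i)

  χ-e : ∀ i j n → χ j n (e i) ≡ indicator i j [mod l ℕ.^ n ]
  χ-e i j n = T.strictlyInverseˡ (δ i) j n

  act-e-comb : ∀ i n (c : Fin d → ℤ) → actᵁ (e i) (CK.comb c (λ j → yᴷ j n)) B.≈ c i • ζ n B.∙ CB.comb c (λ j → y j n)
  act-e-comb i n c = B.trans (Actᵁ.f-comb (e i) c (λ j → yᴷ j n)) (B.trans
    (CB.comb-congʳ c (λ j → B.trans (act-y (e i) j n) (B.∙-congʳ (ζ-cong n (χ-e i j n)))))
    (B.trans (CB.comb-∙ c (λ j → indicator i j • ζ n) (λ j → y j n)) (B.∙-congʳ (comb-indicator i c (ζ n)))))

  -- If the combination is an `lⁿ`-th power in `F*`, the corresponding monomial in the radicals lies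
  -- in `F*` and is fixed by `e i`; but `e i` multiplies it by `c i • ζ n`.
  basis-pure : Pure basis
  basis-pure = mkPure λ n c p i →
    let N = + (l ℕ.^ n)
        q = _≡ᴬ_[mod_].quotient p
        (u , u≈) = same-power n (CB.comb c (λ j → y j n)) (embed q) (B.trans (B.sym (CB.comb-*ʳ N c (λ j → y j n)))
          (B.trans (CB.comb-congʳ c (λ j → y-root j n)) (B.trans (B.sym (Embed.f-comb c (at basis n)))
            (B.trans (embed-cong (A.trans (_≡ᴬ_[mod_].x≈y∙mz p) (A.identityˡ _))) (Embed.f-• N q)))))
        w = CK.comb c (λ j → yᴷ j n)
    in ζ-faithful n (identityˡ-unique _ (CB.comb c (λ j → y j n)) (B.trans (B.sym (act-e-comb i n c))
         (B.trans (actᵁ-embed (e i) w (u A.∙ q) (B.trans (Include.f-comb c (λ j → yᴷ j n)) (B.trans u≈ (B.sym (embed-∙ u q)))))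
           (B.trans (embed-∙ u q) (B.sym u≈)))))
    where open AbelianGroupProperties B using (identityˡ-unique)

  -- The e i generate a dense subgroup, and u has an open stabiliser.
  fixed-by-generators : ∀ (u : Kᴿ) → (∀ i → proj₁ (to (e i) u) ≈ proj₁ u) → ∀ σ → proj₁ (to σ u) ≈ proj₁ u
  fixed-by-generators u fixed-e σ =
    let r = λ j → mod-reduce {l ℕ.^ m} {{l^-nonZero m}} (Z.seq (T.to σ j) m)
    in trans (sym (φ-to σ u)) (trans
         (ListAll.head (agreement (proj₂ (congruent⇒agree (u ∷ [])) (T.to σ) (natural (proj₁ ∘ r)) (λ j → proj₂ (proj₂ (r j))))))
         (generated Fixing
           (λ {v} {w} v≡w p → trans (φ-cong {natural w} {natural v} (λ j n → mod-reflexive (≡.cong +_ (≡.sym (v≡w j)))) u) p)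
           (trans (φ-cong {natural (λ _ → 0)} {ℤₗᵈ.ε} (λ j n → mod-reflexive ≡.refl) u) (φ-ε u))
           (λ {v} {w} p q → trans (φ-cong {natural (λ j → v j ℕ.+ w j)} {natural v ℤₗᵈ.∙ natural w} (λ j n → mod-reflexive ≡.refl) u)
             (trans (φ-∙ (natural v) (natural w) u) (trans (to-cong (φ (natural v)) {to (φ (natural w)) u} {u} q) p)))
           fixed-e (proj₁ ∘ r)))
    where
    m = proj₁ (congruent⇒agree (u ∷ []))
    Fixing : Pred (Fin d → ℕ) ℓ
    Fixing v = proj₁ (to (φ (natural v)) u) ≈ proj₁ u

  -- Dividing `b` by the monomial with the same eigenvalues leaves an element fixed by the
  -- generators, hence by the whole group.
  eigen⇒monomial : ∀ n (b : Kᵁ.Carrier) (c : Fin d → ℤ) → (∀ i → actᵁ (e i) b B.≈ c i • ζ n B.∙ proj₁ b) →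
                   ∃ λ a → proj₁ b B.≈ embed a B.∙ CB.comb c (λ j → y j n)
  eigen⇒monomial n b c eigen =
    let (a , a≈) = fixed⇒embed w λ σ → value-injective (trans (value-actᵁ σ w)
          (fixed-by-generators (value (proj₁ w) , proj₂ w)
            (λ i → trans (sym (value-actᵁ (e i) w)) (value-cong (w-fixed i))) σ))
    in a , B.trans (CB.∙⁻¹≈⇒≈∙ (B.sym a≈)) (B.∙-congˡ (Include.f-comb c yₙ))
    where
    yₙ = λ j → yᴷ j n
    m = CK.comb c yₙ
    w = b Kᵁ.∙ (m Kᵁ.⁻¹)
    w-fixed : ∀ i → actᵁ (e i) w B.≈ proj₁ w
    w-fixed i = B.trans (actᵁ-∙ (e i) b (m Kᵁ.⁻¹)) (B.trans (B.∙-cong (eigen i) (B.trans (Actᵁ.f-⁻¹ (e i) m)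
      (B.⁻¹-cong (B.trans (act-e-comb i n c) (B.∙-congˡ (B.sym (Include.f-comb c yₙ)))))))
      (CB.∙-cancel-⁻¹ (c i • ζ n) (proj₁ b) (proj₁ m)))

  -- The `lⁿ`-th power of a root `b` lies in `F`, so every `e i` multiplies `b` by a root of unity.
  -- Thus `b` is a monomial up to `F*`, and its `lⁿ`-th power gives the combination.
  RootsIn⇒∈span : ∀ z → RootsIn K z → ∃ λ c → z Â.≈ᴹ lin c basis
  RootsIn⇒∈span z roots = pure-closed basis-pure z λ n → approximate n (roots n)
    where
    approximate : ∀ n → (∃ λ b → value b ∈ ∣K∣ × + (l ℕ.^ n) • b B.≈ embed (seq z n)) →
                  ∃ λ (c : Fin d → ℤ) → seq z n CA.≡ₐ CA.comb c (at basis n) [ l ℕ.^ n ]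
    approximate n (b , b∈ , b-root) = c , mod-by {quotient = proj₁ mono} (embed-injective (begin
        embed (seq z n)
          ≈⟨ b-root ⟨
        N • b
          ≈⟨ ·-congˡ B N (proj₂ mono) ⟩
        N • (embed (proj₁ mono) B.∙ CB.comb c (λ j → y j n))
          ≈⟨ B.trans (·-∙ B N (embed (proj₁ mono)) (CB.comb c (λ j → y j n))) (B.comm _ _) ⟩
        N • CB.comb c (λ j → y j n) B.∙ N • embed (proj₁ mono)
          ≈⟨ B.∙-cong (B.trans (B.sym (CB.comb-*ʳ N c (λ j → y j n))) (B.trans (CB.comb-congʳ c (λ j → y-root j n))
               (B.sym (Embed.f-comb c (at basis n))))) (B.sym (Embed.f-• N (proj₁ mono))) ⟩
        embed (CA.comb c (at basis n)) B.∙ embed (N CA.• proj₁ mono)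
          ≈⟨ embed-∙ _ _ ⟨
        embed (CA.comb c (at basis n) A.∙ N CA.• proj₁ mono) ∎))
      where
      open SetoidReasoning B.setoid
      N = + (l ℕ.^ n)
      bᴷ : Kᵁ.Carrier
      bᴷ = b , b∈
      conjugate : ∀ i → ∃ λ c → actᵁ (e i) bᴷ B.≈ c • ζ n B.∙ b
      conjugate i = same-power-ζ n (actᵁ (e i) bᴷ) b (B.trans (B.sym (Actᵁ.f-• (e i) N bᴷ))
        (B.trans (actᵁ-embed (e i) (N CK.• bᴷ) (seq z n) (B.trans (Include.f-• N bᴷ) b-root)) (B.sym b-root)))
      c : Fin d → ℤ
      c i = proj₁ (conjugate i)
      mono = eigen⇒monomial n bᴷ c (λ i → proj₂ (conjugate i))

-- Decomposition into eigenvectors of the topological generators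

module GaloisDecomposition (em : ∀ {a} → ExcludedMiddle a) {ℓ : Level} (F Ω : HeytingField ℓ ℓ ℓ)
  {A B : AbelianGroup (ℓ ⊔ ℓ) ℓ} {l : ℕ} (l-prime : Prime l) (pair : KummerPair (ringOf F) (ringOf Ω) A B l)
  (K : Extension.IntermediateField F Ω (KummerPair.ι pair))
  (isGalois : Extension.IsGalois F Ω (KummerPair.ι pair) K) {d : ℕ}
  (iso : TopologicalGroupIsomorphism (Extension.galoisGroup F Ω (KummerPair.ι pair) K) (ℤ-adic^ l d)) where

  open PrimePowers l-prime
  open Kummer em l-prime pair hiding (module F)
  open CommutativeRing (ringOf Ω) hiding (zero)
  open Exp semiring using (_^_)
  open RawMonoidDefs +-rawMonoid using () renaming (_×_ to _×ᴿ_)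
  open CB using (_•_)
  open Extension F Ω (KummerPair.ι pair) hiding (_∈F)
  open Automorphism
  open GaloisAction em F Ω l-prime pair
  open Action K
  open GaloisKummer em F Ω l-prime pair K isGalois iso
  open RangeSum (ringOf Ω)

  private
    module K = IntermediateField K
    module ℤₗᵈ = LinearTopologicalGroup (ℤ-adic^ l d)
    Aut = Automorphism K
    Kᴿ = RawRing.Carrier (subfield K)

    _⋆_ _⊹_ : Kᴿ → Kᴿ → Kᴿ
    (z , z∈) ⋆ (w , w∈) = z * w , K.*-closed z∈ w∈
    (z , z∈) ⊹ (w , w∈) = z + w , K.+-closed z∈ w∈

    F∈K : ∀ {z} → z ∈F → z ∈ ∣K∣
    F∈K (a , a≈) = K.resp a≈ (K.F⊆ a)

    act-scale : ∀ (σ : Aut) {c} (c∈ : c ∈F) u → proj₁ (to σ ((c , F∈K c∈) ⋆ u)) ≈ c * proj₁ (to σ u)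
    act-scale σ c∈ u = trans (*-homo σ (_ , F∈K c∈) u) (*-congʳ (act-F σ (F∈K c∈) c∈))

    sumᴷ : ℕ → (ℕ → Kᴿ) → Kᴿ
    sumᴷ zero    f = 0# , K.0∈
    sumᴷ (suc n) f = f 0 ⊹ sumᴷ n (f ∘ suc)

    sumᴷ≈ : ∀ n (f : ℕ → Kᴿ) → proj₁ (sumᴷ n f) ≈ Σ< n (proj₁ ∘ f)
    sumᴷ≈ zero    f = refl
    sumᴷ≈ (suc n) f = +-congˡ (sumᴷ≈ n (f ∘ suc))

    act-sumᴷ : ∀ (σ : Aut) n (f : ℕ → Kᴿ) → proj₁ (to σ (sumᴷ n f)) ≈ Σ< n (λ i → proj₁ (to σ (f i)))
    act-sumᴷ σ zero    f = 0#-homo σ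
    act-sumᴷ σ (suc n) f = trans (+-homo σ (f 0) (sumᴷ n (f ∘ suc))) (+-congˡ (act-sumᴷ σ n (f ∘ suc)))

    φ-commute : ∀ g h (u : Kᴿ) → proj₁ (to (φ g) (to (φ h) u)) ≈ proj₁ (to (φ h) (to (φ g) u))
    φ-commute g h u = trans (sym (φ-∙ g h u)) (trans
      (φ-cong {g ℤₗᵈ.∙ h} {h ℤₗᵈ.∙ g} (λ j n → mod-reflexive (ℤ.+-comm (AdicInteger.seq (g j) n) (AdicInteger.seq (h j) n))) u)
      (φ-∙ h g u))

  module _ (m k : ℕ) (l^m≡1+k : l ℕ.^ m ≡ suc k) where

    private N = suc k

    Eigen : Aut → Carrier → Kᴿ → Set ℓ
    Eigen σ c u = proj₁ (to σ u) ≈ c * proj₁ u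

    -- The projections of u to the eigenspaces of e i, up to the factor N = lᵐ.
    module Projection (i : Fin d) where

      iterate : ℕ → Kᴿ → Kᴿ
      iterate zero    u = u
      iterate (suc s) u = to (e i) (iterate s u)

      weight : ℕ → ℕ → Carrier
      weight c s = value ((ℤ.- (+ c ℤ.* + s)) • ζ m)

      weight∈F : ∀ c s → weight c s ∈F
      weight∈F c s = •ζ∈F m (ℤ.- (+ c ℤ.* + s))

      term : Kᴿ → ℕ → ℕ → Kᴿ
      term u c s = (weight c s , F∈K (weight∈F c s)) ⋆ iterate s u

      projection : ℕ → Kᴿ → Kᴿ
      projection c u = sumᴷ N (term u c)

      eigen-iterate : ∀ g {c} → c ∈F → ∀ u → Eigen (φ g) c u → ∀ s → Eigen (φ g) c (iterate s u)
      eigen-iterate g c∈ u p zero    = p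
      eigen-iterate g {c} c∈ u p (suc s) = trans (φ-commute g (δ i) (iterate s u))
        (trans (to-cong (e i) {to (φ g) (iterate s u)} {(c , F∈K c∈) ⋆ iterate s u} (eigen-iterate g c∈ u p s))
          (act-scale (e i) c∈ (iterate s u)))

      eigen-projection : ∀ g {c} → c ∈F → ∀ u → Eigen (φ g) c u → ∀ t → Eigen (φ g) c (projection t u)
      eigen-projection g {c} c∈ u p t = trans (act-sumᴷ (φ g) N (term u t)) (trans
        (Σ<-cong N λ s → trans (act-scale (φ g) (weight∈F t s) (iterate s u))
          (trans (*-congˡ (eigen-iterate g c∈ u p s)) (x∙yz≈y∙xz _ _ _)))
        (trans (Σ<-* N c (λ s → weight t s * proj₁ (iterate s u))) (*-congˡ (sym (sumᴷ≈ N (term u t))))))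
        where open CommutativeSemigroupProperties *-commutativeSemigroup using (x∙yz≈y∙xz)

      iterate-φ : ∀ s u → proj₁ (iterate s u) ≈ proj₁ (to (φ (λ j → constant (+ s ℤ.* indicator i j))) u)
      iterate-φ zero    u = sym (trans (φ-cong {λ j → constant (0ℤ ℤ.* indicator i j)} {ℤₗᵈ.ε}
        (λ j n → mod-reflexive (ℤ.*-zeroˡ (indicator i j))) u) (φ-ε u))
      iterate-φ (suc s) u = trans (to-cong (e i) {iterate s u} {to (φ sδ) u} (iterate-φ s u)) (trans (sym (φ-∙ (δ i) sδ u))
        (φ-cong {δ i ℤₗᵈ.∙ sδ} {λ j → constant (+ suc s ℤ.* indicator i j)}
          (λ j n → mod-reflexive (≡.sym (ℤ.suc-* (+ s) (indicator i j)))) u))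
        where sδ = λ j → constant (+ s ℤ.* indicator i j)

      module _ (u : Kᴿ) (stable : ∀ g → ℤₗᵈ.N m g → proj₁ (to (φ g) u) ≈ proj₁ u) where

        private
          N≡0 : ∀ z → + N ℤ.* z ≡0[mod l ℕ.^ m ]
          N≡0 z = ≡.subst (λ n → + N ℤ.* z ≡0[mod n ]) (≡.sym l^m≡1+k) (multiple≡0 z)

        iterate-period : proj₁ (iterate N u) ≈ proj₁ u
        iterate-period = trans (iterate-φ N u) (stable _ (λ j → N≡0 (indicator i j)))

        -- Applying `e i` shifts the index of summation. The sum is cyclic because the weights have
        -- period `N` and the `N`-th power of `e i` fixes `u`.
        projection-eigen : ∀ c → Eigen (e i) (value (+ c • ζ m)) (projection c u)
        projection-eigen c = trans (act-sumᴷ (e i) N (term u c)) (trans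
            (Σ<-cong N λ s → trans (act-scale (e i) (weight∈F c s) (iterate s u))
              (trans (*-congʳ (weight-suc s)) (*-assoc _ _ _)))
            (trans (Σ<-* N (value (+ c • ζ m)) (λ s → g (suc s))) (*-congˡ (trans (Σ<-cyclic N g periodic) (sym (sumᴷ≈ N (term u c)))))))
          where
          g : ℕ → Carrier
          g s = weight c s * proj₁ (iterate s u)
          weight-suc : ∀ s → weight c s ≈ value (+ c • ζ m) * weight c (suc s)
          weight-suc s = trans (value-cong (B.trans (·-congʳ B (ζ m) (eq (+ c) (+ s))) (·-+ B (ζ m) (+ c) (ℤ.- (+ c ℤ.* + suc s))))) (value-∙ _ _)
            where
            eq : ∀ c s → ℤ.- (c ℤ.* s) ≡ c ℤ.+ ℤ.- (c ℤ.* (1ℤ ℤ.+ s))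
            eq = solve-∀
          periodic : g N ≈ g 0
          periodic = *-cong (value-cong (ζ-cong m (mod-neg (mod-trans
              (mod-trans (mod-reflexive (ℤ.*-comm (+ c) (+ N))) (N≡0 (+ c)))
              (mod-reflexive (≡.sym (ℤ.*-zeroʳ (+ c))))))))
            iterate-period

        -- Orthogonality: a full geometric sum in `ω` is unchanged by the factor `ω`, and `ω`
        -- differs from 1 because `suc s` lies strictly between 0 and `N`.
        sum-of-weights : ∀ s → s ℕ.< k → Σ< N (λ c → weight c (suc s)) ≈ 0#
        sum-of-weights s s<k = case noZeroDivisors (trans (distribʳ S ω (- 1#)) (trans
            (+-cong Σ<-geometric-S (trans (sym (-‿distribˡ-* 1# S)) (-‿cong (*-identityˡ S))))
            (-‿inverseʳ S))) of λ where
            (inj₁ ω-1≈0) → contradiction (mod-unique (≡.subst (suc s ℕ.<_) (≡.sym l^m≡1+k) (ℕ.s≤s s<k))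
                (≡.subst (0 ℕ.<_) (≡.sym l^m≡1+k) (ℕ.s≤s ℕ.z≤n)) (ω≈1⇒ (-≈0⇒≈ ω-1≈0))) λ ()
            (inj₂ S≈0) → S≈0
          where
          open RingProperties ring using (-‿distribˡ-*)
          z : B.Carrier
          z = (ℤ.- + suc s) • ζ m
          ω = value z
          S = Σ< N (λ c → weight c (suc s))
          weight≈ : ∀ c → weight c (suc s) ≈ ω ^ c
          weight≈ c = trans (value-cong (B.trans (·-congʳ B (ζ m) (ℤ.neg-distribʳ-* (+ c) (+ suc s)))
            (·-* B (ζ m) (+ c) (ℤ.- + suc s)))) (value-• c z)
          ω^N≈1 : ω ^ N ≈ 1#
          ω^N≈1 = trans (sym (weight≈ N)) (trans (value-cong (•ζ≈ε m (mod-neg (N≡0 (+ suc s))))) value-ε)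
          Σ<-geometric-S : ω * S ≈ S
          Σ<-geometric-S = trans (*-congˡ (Σ<-cong N weight≈)) (trans (Σ<-geometric N ω ω^N≈1) (sym (Σ<-cong N weight≈)))
          ω≈1⇒ : ω ≈ 1# → + suc s ≡ + 0 [mod l ℕ.^ m ]
          ω≈1⇒ p = mod-trans (mod-reflexive (≡.sym (ℤ.neg-involutive (+ suc s))))
            (mod-neg (ζ-faithful m {ℤ.- + suc s} (value-injective (trans p (sym value-ε)))))

        -- Fourier inversion on the cyclic group of order `N`: after exchanging the sums, only the
        -- iterate with `s = 0` survives.
        sum-of-projections : Σ< N (λ c → proj₁ (projection c u)) ≈ (N ×ᴿ 1#) * proj₁ u
        sum-of-projections = begin
          Σ< N (λ c → proj₁ (projection c u))
            ≈⟨ Σ<-cong N (λ c → sumᴷ≈ N (term u c)) ⟩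
          Σ< N (λ c → Σ< N (λ s → weight c s * proj₁ (iterate s u)))
            ≈⟨ Σ<-swap N N (λ c s → weight c s * proj₁ (iterate s u)) ⟩
          Σ< N (λ s → Σ< N (λ c → weight c s * proj₁ (iterate s u)))
            ≈⟨ Σ<-cong N (λ s → Σ<-*ʳ N (proj₁ (iterate s u)) (λ c → weight c s)) ⟩
          Σ< N (λ s → Σ< N (λ c → weight c s) * proj₁ (iterate s u))
            ≈⟨ Σ<-head k (λ s → Σ< N (λ c → weight c s) * proj₁ (iterate s u)) (λ s s<k → trans (*-congʳ (sum-of-weights s s<k)) (zeroˡ _)) ⟩
          Σ< N (λ c → weight c 0) * proj₁ u
            ≈⟨ *-congʳ (trans (Σ<-cong N λ c → trans (value-cong (·-congʳ B (ζ m) (≡.cong ℤ.-_ (ℤ.*-zeroʳ (+ c))))) value-ε)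
                 (Σ<-constant N)) ⟩
          (N ×ᴿ 1#) * proj₁ u ∎
          where open SetoidReasoning setoid

    module _ (K′ : IntermediateField) (roots : ∀ j → RootsIn K′ (basis j)) where

      private module K′ = IntermediateField K′

      -- The given root in `K′` and `y j m` have the same `lᵐ`-th power, so they differ by an
      -- element of `F*` and `K′` contains the radicals themselves.
      monomial∈ : ∀ a c → value (embed a B.∙ CB.comb c (λ j → y j m)) ∈ K′.∣_∣
      monomial∈ a c = K′.resp (sym (value-∙ _ _)) (K′.*-closed (A′.embed∈K a) (A′.comb∈K c λ j →
        let (b , b∈ , b-root) = roots j m
            (u , u≈) = same-power m (y j m) b (B.trans (y-root j m) (B.sym b-root))
        in K′.resp (value-cong (B.sym u≈)) (K′.resp (sym (value-∙ _ _)) (K′.*-closed (A′.embed∈K u) b∈))))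
        where module A′ = Action K′

      eigenvectors∈ : ∀ (u : Kᴿ) (c : Fin d → ℤ) → (∀ i → Eigen (e i) (value (c i • ζ m)) u) → proj₁ u ∈ K′.∣_∣
      eigenvectors∈ u c eigen = case em {P = proj₁ u ≈ 0#} of λ where
          (yes z≈0) → K′.resp (sym z≈0) K′.0∈
          (no z≉0)  → nonzero z≉0
        where
        nonzero : ¬ (proj₁ u ≈ 0#) → proj₁ u ∈ K′.∣_∣
        nonzero z≉0 = K′.resp (trans (value-cong (B.sym (proj₂ mono))) b≈) (monomial∈ (proj₁ mono) c)
          where
          b : B.Carrier
          b = proj₁ (toUnit z≉0)
          b≈ : value b ≈ proj₁ u
          b≈ = proj₂ (toUnit z≉0)
          bᴷ : Kᵁ.Carrier
          bᴷ = b , K.resp (sym b≈) (proj₂ u)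
          act-b : ∀ i → actᵁ (e i) bᴷ B.≈ c i • ζ m B.∙ b
          act-b i = value-injective (trans (value-actᵁ (e i) bᴷ)
            (trans (act-cong (e i) (proj₂ bᴷ) (proj₂ u) b≈) (trans (eigen i) (trans (*-congˡ (sym b≈)) (sym (value-∙ _ _))))))
          mono : ∃ λ a → b B.≈ embed a B.∙ CB.comb c (λ j → y j m)
          mono = eigen⇒monomial m bᴷ c act-b

      -- Set up for descending induction on the number `t` of generators for which `u` is already an
      -- eigenvector: `t = d` is the case of simultaneous eigenvectors, and `t = 0` imposes no
      -- eigenvector condition.
      Decomposable : ℕ → Set ℓ
      Decomposable t = ∀ u → (∀ g → ℤₗᵈ.N m g → proj₁ (to (φ g) u) ≈ proj₁ u) →
        (∀ i → toℕ i ℕ.< t → ∃ λ c → Eigen (e i) (value (c • ζ m)) u) → proj₁ u ∈ K′.∣_∣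

      private
        sum∈ : ∀ n {f : ℕ → Carrier} → (∀ i → f i ∈ K′.∣_∣) → Σ< n f ∈ K′.∣_∣
        sum∈ zero    p = K′.0∈
        sum∈ (suc n) p = K′.+-closed (p 0) (sum∈ n (p ∘ suc))

        l^×≉0 : ∀ n → ¬ ((l ℕ.^ n) ×ᴿ 1# ≈ 0#)
        l^×≉0 zero    p = 1≉0 (trans (sym (+-identityʳ 1#)) p)
        l^×≉0 (suc n) p = case noZeroDivisors (trans (sym (×1-homo-* l (l ℕ.^ n))) p) of λ where
            (inj₁ q) → l≉0 q
            (inj₂ q) → l^×≉0 n q
          where open SemiringMult semiring using (×1-homo-*)

        N×1∈F : (N ×ᴿ 1#) ∈F
        N×1∈F = multiple N
          where
          multiple : ∀ n → (n ×ᴿ 1#) ∈F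
          multiple zero    = IsSubfield.0∈ F-isSubfield
          multiple (suc n) = IsSubfield.+-closed F-isSubfield (IsSubfield.1∈ F-isSubfield) (multiple n)

        all-eigen : Decomposable d
        all-eigen u stable eigen = eigenvectors∈ u (λ i → proj₁ (eigen i (Fin.toℕ<n i))) (λ i → proj₂ (eigen i (Fin.toℕ<n i)))

        -- Up to the factor `N`, `u` is the sum of its projections for `e i`. Each is an eigenvector
        -- of `e i` and, since the generators commute, keeps the eigenvalues for the earlier ones.
        -- `N` is invertible in `F` because `l` is nonzero there.
        descend : ∀ (i : Fin d) → Decomposable (suc (toℕ i)) → Decomposable (toℕ i)
        descend i dec u stable eigen = K′.resp cancel (K′.*-closed v∈K′ (sum∈ N projection∈))
          where
          open Projection i
          1∈F = IsSubfield.1∈ F-isSubfield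
          N×1-inverse : ∃ λ v → (N ×ᴿ 1#) * v ≈ 1#
          N×1-inverse = invertible λ p → l^×≉0 m (trans (reflexive (≡.cong (_×ᴿ 1#) l^m≡1+k)) p)
          v = proj₁ N×1-inverse
          v∈F : v ∈F
          v∈F = IsSubfield.inv-closed F-isSubfield N×1∈F (proj₂ N×1-inverse)
          v∈K′ : v ∈ K′.∣_∣
          v∈K′ = K′.resp (proj₂ v∈F) (K′.F⊆ (proj₁ v∈F))
          cancel : v * Σ< N (λ c → proj₁ (projection c u)) ≈ proj₁ u
          cancel = trans (*-congˡ (sum-of-projections u stable)) (trans (sym (*-assoc _ _ _))
            (trans (*-congʳ (trans (*-comm _ _) (proj₂ N×1-inverse))) (*-identityˡ _)))
          projection-stable : ∀ c g → ℤₗᵈ.N m g → proj₁ (to (φ g) (projection c u)) ≈ proj₁ (projection c u)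
          projection-stable c g g∈ = trans
            (eigen-projection g 1∈F u (trans (stable g g∈) (sym (*-identityˡ _))) c) (*-identityˡ _)
          projection-eigen-≤ : ∀ c j → toℕ j ℕ.< suc (toℕ i) → ∃ λ a → Eigen (e j) (value (a • ζ m)) (projection c u)
          projection-eigen-≤ c j j≤i = case ℕ.m≤n⇒m<n∨m≡n (ℕ.s≤s⁻¹ j≤i) of λ where
            (inj₁ j<i) → proj₁ (eigen j j<i) , eigen-projection (δ j) (•ζ∈F m (proj₁ (eigen j j<i))) u (proj₂ (eigen j j<i)) c
            (inj₂ j≡i) → + c , ≡.subst (λ j → Eigen (e j) (value (+ c • ζ m)) (projection c u))
                                 (Fin.toℕ-injective (≡.sym j≡i)) (projection-eigen u stable c)
          projection∈ : ∀ c → proj₁ (projection c u) ∈ K′.∣_∣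
          projection∈ c = dec (projection c u) (projection-stable c) (projection-eigen-≤ c)

      decomposable : ∀ n t → n ℕ.+ t ≡ d → Decomposable t
      decomposable zero    t ≡.refl = all-eigen
      decomposable (suc n) t eq = ≡.subst Decomposable (Fin.toℕ-fromℕ< t<d)
          (descend i (≡.subst Decomposable (≡.cong suc (≡.sym (Fin.toℕ-fromℕ< t<d)))
            (decomposable n (suc t) (≡.trans (ℕ.+-suc n t) eq))))
        where
        t<d : t ℕ.< d
        t<d = ≡.subst (t ℕ.<_) eq (ℕ.s≤s (ℕ.m≤n+m t n))
        i = fromℕ< t<d

  -- By continuity some `lᵐ ℤ_lᵈ` fixes `z`, and the decomposition is carried out at that level `m`.
  contained : ∀ (K′ : IntermediateField) → (∀ j → RootsIn K′ (basis j)) → ∣K∣ ⊆ IntermediateField.∣ K′ ∣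
  contained K′ roots {z} z∈ =
    let (m , stable) = stabiliser ((z , z∈) ∷ [])
    in decomposable m (ℕ.pred (l ℕ.^ m)) (≡.sym (ℕ.suc-pred (l ℕ.^ m) {{l^-nonZero m}})) K′ roots d 0 (ℕ.+-identityʳ d)
         (z , z∈) (λ g g∈ → ListAll.head (stable g g∈)) (λ _ ())

-- The correspondence

module Correspondence (em : ∀ {a} → ExcludedMiddle a) {ℓ : Level} (F Ω : HeytingField ℓ ℓ ℓ)
  {A B : AbelianGroup (ℓ ⊔ ℓ) ℓ} {l : ℕ} (l-prime : Prime l) (pair : KummerPair (ringOf F) (ringOf Ω) A B l)
  (s : AdicInteger l)
  (seq-s^ : ∀ k n → AdicInteger.seq (Exp._^_ (CommutativeRing.semiring (ℤ-adic l)) s k) n ≡ + (l ℕ.^ k)) (d : ℕ) where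

  open Kummer em l-prime pair using (torsionDivisible)
  open Extension F Ω (KummerPair.ι pair)
  open GaloisAction em F Ω l-prime pair using (RootsIn; lin-RootsIn)
  open Completion l-prime A torsionDivisible using (Pure; lin)
  open LocalisedModule {ℓ} (ℤ-adic l) s (adicCompletion A l) using (M[1/s]; span; frac-cong; frac∈span)
  open RationalCompletion em l-prime A torsionDivisible s seq-s^
  open Subspace
  private
    module Â = LeftModule (adicCompletion A l)
    module V = LeftModule M[1/s]
    module Radical = RadicalExtension em F Ω l-prime pair
    module Ext = Setoid (ℤₗExtensions l d)
    module Gr = Setoid (Grass (Localisation.R[1/s] (ℤ-adic l) s) M[1/s] d)

  -- All that the correspondence needs from an extension. `roots` and `spanning` characterise the
  -- lattice of the basis through `RootsIn` alone, so its span does not depend on how the basis was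
  -- chosen.
  record Description (K : IntermediateField) : Set (Level.suc ℓ) where
    field
      basis     : Fin d → Â.Carrierᴹ
      pure      : Pure basis
      roots     : ∀ j → RootsIn K (basis j)
      spanning  : ∀ z → RootsIn K z → ∃ λ c → z Â.≈ᴹ lin c basis
      contained : ∀ K′ → (∀ j → RootsIn K′ (basis j)) → IntermediateField.∣ K ∣ ⊆ IntermediateField.∣ K′ ∣

    combination⇒RootsIn : ∀ z → (∃ λ c → z Â.≈ᴹ lin c basis) → RootsIn K z
    combination⇒RootsIn z (c , z≈) = lin-RootsIn K basis roots c z z≈

  open Description

  abstract
    describe : ∀ K → IsℤₗExtension K l d → Description K
    describe K ext = record
      { basis = G.basis ; pure = G.basis-pure ; roots = G.basis-RootsIn
      ; spanning = G.RootsIn⇒∈span ; contained = GaloisDecomposition.contained em F Ω l-prime pair K isGalois isomorphism }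
      where
      open IsℤₗExtension ext
      module G = GaloisKummer em F Ω l-prime pair K isGalois isomorphism

  span-mono : ∀ (x x′ : Fin d → Â.Carrierᴹ) → (∀ z → (∃ λ c → z Â.≈ᴹ lin c x) → ∃ λ c → z Â.≈ᴹ lin c x′) →
              ∀ v → v ∈ ∣ span x ∣ → v ∈ ∣ span x′ ∣
  span-mono x x′ f v (k , c , v≈) =
    let (c′ , p) = f (lin c x) (c , Â.≈ᴹ-refl {lin c x})
    in k , c′ , V.≈ᴹ-trans v≈ (frac-cong k {lin c x} {lin c′ x′} p)

  module _ {K K′ : IntermediateField} (D : Description K) (D′ : Description K′) where

    description-mono : IntermediateField.∣ K ∣ ⊆ IntermediateField.∣ K′ ∣ →
                       ∀ v → v ∈ ∣ span (basis D) ∣ → v ∈ ∣ span (basis D′) ∣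
    description-mono K⊆K′ = span-mono (basis D) (basis D′) λ z z∈ → spanning D′ z λ n →
      let (b , b∈ , p) = combination⇒RootsIn D z z∈ n in b , K⊆K′ b∈ , p

    -- Inclusion of rational spans becomes inclusion of lattices by saturation; hence `K′` contains
    -- all roots of the basis of `K`, and these generate `K`.
    description-reflects : (∀ v → v ∈ ∣ span (basis D) ∣ → v ∈ ∣ span (basis D′) ∣) →
                           IntermediateField.∣ K ∣ ⊆ IntermediateField.∣ K′ ∣
    description-reflects W⊆W′ = contained D K′ λ j → combination⇒RootsIn D′ (basis D j)
      (Equivalence.to (frac∈span⇔ {x = basis D′} (pure D′) (basis D j)) (W⊆W′ _ (frac∈span (basis D) j)))

  toGrass : Ext.Carrier → Gr.Carrier
  toGrass (K , ext) = pureSubspace {x = basis (describe K ext)} (pure (describe K ext))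

  toGrass-cong : ∀ {K K′} → K Ext.≈ K′ → toGrass K Gr.≈ toGrass K′
  toGrass-cong {K , ext} {K′ , ext′} (p , q) =
      (λ {v} → description-mono (describe K ext) (describe K′ ext′) p v)
    , (λ {v} → description-mono (describe K′ ext′) (describe K ext) q v)

  toGrass-injective : ∀ {K K′} → toGrass K Gr.≈ toGrass K′ → K Ext.≈ K′
  toGrass-injective {K , ext} {K′ , ext′} (p , q) =
      description-reflects (describe K ext) (describe K′ ext′) (λ v → p {v})
    , description-reflects (describe K′ ext′) (describe K ext) (λ v → q {v})

  extensionOf : ∀ (x : Fin d → Â.Carrierᴹ) → Pure x → Ext.Carrier
  extensionOf x p = Radical.field-K x p , Radical.isℤₗExtension x p

  -- The basis extracted from the radical field by Hilbert 90 need not be `x`, but both generate the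
  -- elements of `F̂*` all of whose roots lie in that field.
  toGrass-extensionOf : ∀ x p → ∣ span x ∣ ≐ ∣ proj₁ (toGrass (extensionOf x p)) ∣
  toGrass-extensionOf x p =
      (λ {v} → span-mono x (basis D) (λ z (c , z≈) →
        spanning D z (lin-RootsIn (Radical.field-K x p) x (Radical.x-RootsIn x p) c z z≈)) v)
    , (λ {v} → span-mono (basis D) x (λ z z∈ → Radical.RootsIn⇒∈span x p z (combination⇒RootsIn D z z∈)) v)
    where
    D : Description (Radical.field-K x p)
    D = describe (Radical.field-K x p) (Radical.isℤₗExtension x p)

  bijection : Bijection (ℤₗExtensions l d) (Grass (Localisation.R[1/s] (ℤ-adic l) s) M[1/s] d)
  bijection = record
    { to        = toGrass
    ; cong      = λ {K} {K′} → toGrass-cong {K} {K′}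
    ; bijective = (λ {K} {K′} → toGrass-injective {K} {K′}) , surjective
    }
    where
    surjective : ∀ W → ∃ λ K → ∀ {K′} → K′ Ext.≈ K → toGrass K′ Gr.≈ W
    surjective W =
      let (x , p , span≐W) = pureBasis W
          K = extensionOf x p
      in K , λ {K′} K′≈K → Gr.trans {toGrass K′} {toGrass K} {W} (toGrass-cong {K′} {K} K′≈K)
           ( (λ v∈ → proj₁ span≐W (proj₂ (toGrass-extensionOf x p) v∈))
           , (λ v∈ → proj₁ (toGrass-extensionOf x p) (proj₂ span≐W v∈)) )

-- Kummer pairs from separable closures

heyting-invertible : (∀ {a} → ExcludedMiddle a) → ∀ {ℓ} (H : HeytingField ℓ ℓ ℓ) → let open HeytingField H in
                     ∀ {x} → ¬ (x ≈ 0#) → ∃ λ y → x * y ≈ 1#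
heyting-invertible em H {x} x≉0 =
  let (y , _ , p) = H.#⇒invertible x#0
  in y , trans (*-congʳ (sym (trans (+-congˡ -0#≈0#) (+-identityʳ x)))) p
  where
  module H = HeytingField H
  open CommutativeRing (ringOf H)
  open RingProperties ring using (-0#≈0#)
  x#0 : x H.# 0#
  x#0 = decidable-stable em λ ¬x#0 → x≉0 (proj₁ (H.tight x 0#) ¬x#0)

heyting-1≉0 : ∀ {ℓ} (H : HeytingField ℓ ℓ ℓ) → let open HeytingField H in ¬ (1# ≈ 0#)
heyting-1≉0 H 1≈0 = proj₂ (H.tight 1# 0#) 1≈0 (H.invertible⇒#
    (1# , trans (*-identityˡ _) 1-0≈1 , trans (*-identityʳ _) 1-0≈1))
  where
  module H = HeytingField H
  open CommutativeRing (ringOf H)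
  open RingProperties ring using (-0#≈0#)
  1-0≈1 : 1# - 0# ≈ 1#
  1-0≈1 = trans (+-congˡ -0#≈0#) (+-identityʳ 1#)

module _ {ℓ : Level} (R : CommutativeRing ℓ ℓ) where

  open CommutativeRing R
  open RawMonoidDefs +-rawMonoid using () renaming (_×_ to _×ᴿ_)
  open Congruence +-abelianGroup using (_•_)

  -- Serves to turn the hypothesis on the characteristic into `l * 1 ≉ 0`. If `n * 1` vanished with
  -- `n` prime to `l`, an inverse of `n` modulo `l` would give `1 = 0`.
  prime-characteristic : (∀ {a} → ExcludedMiddle a) → ¬ (1# ≈ 0#) → ∀ {l} → Prime l →
                         l ×ᴿ 1# ≈ 0# → HasCharacteristic R l
  prime-characteristic em 1≉0 {l} l-prime l≈0 n = mk⇔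
      (λ n≈0 → decidable-stable em λ l∤n → 1≉0 (one n≈0 (inverse-mod-l (l∤n ∘ ℤ∣.∣⇒∣ᵤ ∘ ≡0⇒∣))))
      (λ { (ℕ.divides q ≡.refl) → trans (·-congʳ +-abelianGroup 1# (ℤ.pos-* q l)) (multiple (+ q)) })
    where
    open PrimePowers l-prime
    open SetoidReasoning setoid
    multiple : ∀ q → (q ℤ.* + l) • 1# ≈ 0#
    multiple q = trans (·-* +-abelianGroup 1# q (+ l)) (trans (·-congˡ +-abelianGroup q l≈0) (·-ε +-abelianGroup q))
    one : n ×ᴿ 1# ≈ 0# → (∃ λ u → u ℤ.* + n ≡ 1ℤ [mod l ]) → 1# ≈ 0#
    one n≈0 (u , mod∣ (divides q e)) = begin
        1#
          ≈⟨ +-identityʳ 1# ⟨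
        1ℤ • 1#
          ≈⟨ ·-congʳ +-abelianGroup 1# (≡.trans (eq (u ℤ.* + n)) (≡.cong (ℤ._-_ (u ℤ.* + n)) e)) ⟩
        (u ℤ.* + n ℤ.- q ℤ.* + l) • 1#
          ≈⟨ ·-+ +-abelianGroup 1# (u ℤ.* + n) (ℤ.- (q ℤ.* + l)) ⟩
        (u ℤ.* + n) • 1# + (ℤ.- (q ℤ.* + l)) • 1#
          ≈⟨ +-cong (trans (·-* +-abelianGroup 1# u (+ n)) (trans (·-congˡ +-abelianGroup u n≈0) (·-ε +-abelianGroup u)))
                    (trans (·-neg +-abelianGroup 1# (q ℤ.* + l)) (-‿cong (multiple q))) ⟩
        0# - 0#
          ≈⟨ -‿inverseʳ 0# ⟩
        0# ∎
      where
      eq : ∀ a → 1ℤ ≡ a ℤ.- (a ℤ.- 1ℤ)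
      eq = solve-∀

module _ (em : ∀ {a} → ExcludedMiddle a) {ℓ : Level} {l : ℕ} (l-prime : Prime l) (F : HeytingField ℓ ℓ ℓ)
         (¬char : ¬ HasCharacteristic (ringOf F) l) (Fˢᵉᵖ : SeparableClosure F)
         (rootsOfUnity : ContainsRootsOfUnity Fˢᵉᵖ l) where

  open SeparableClosure Fˢᵉᵖ
  private
    module F = CommutativeRing (ringOf F)
    module Ω = CommutativeRing (ringOf Ω)
    module ι = IsRingHomomorphism ι-isRingHomomorphism
    open RawMonoidDefs Ω.+-rawMonoid using () renaming (_×_ to _×Ω_)
    open RawMonoidDefs F.+-rawMonoid using () renaming (_×_ to _×F_)
    open Exp Ω.semiring using (_^_)

    1≉0 : ¬ (Ω.1# Ω.≈ Ω.0#)
    1≉0 = heyting-1≉0 Ω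

    ι-injective : ∀ {x} → ι x Ω.≈ Ω.0# → x F.≈ F.0#
    ι-injective {x} ιx≈0 = decidable-stable em λ x≉0 →
      let (y , xy≈1) = heyting-invertible em F x≉0
      in 1≉0 (Ω.trans (Ω.sym ι.1#-homo) (Ω.trans (ι.⟦⟧-cong (F.sym xy≈1)) (Ω.trans (ι.*-homo x y)
           (Ω.trans (Ω.*-congʳ ιx≈0) (Ω.zeroˡ _)))))

    ι-× : ∀ n → ι (n ×F F.1#) Ω.≈ n ×Ω Ω.1#
    ι-× zero    = ι.0#-homo
    ι-× (suc n) = Ω.trans (ι.+-homo F.1# (n ×F F.1#)) (Ω.+-cong ι.1#-homo (ι-× n))

    l×1≉0 : ¬ (l ×Ω Ω.1# Ω.≈ Ω.0#)
    l×1≉0 p = ¬char (prime-characteristic (ringOf F) em (heyting-1≉0 F) l-prime (ι-injective (Ω.trans (ι-× l) p)))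

    nthRoots : ∀ n .{{_ : ℕ.NonZero n}} → ¬ (n ×Ω Ω.1# Ω.≈ Ω.0#) → ∀ a b → a Ω.* b Ω.≈ Ω.1# → ∃ λ x → x ^ n Ω.≈ a
    nthRoots (suc k) n≉0 = SeparablePolynomials.nthRoot (ringOf Ω) separablyClosed 1≉0 k (proj₁ inverse) (proj₂ inverse)
      where inverse = heyting-invertible em Ω n≉0

    nontrivialRoots : ∀ n .{{_ : ℕ.NonTrivial n}} → ¬ (n ×Ω Ω.1# Ω.≈ Ω.0#) → ∃ λ x → x ^ n Ω.≈ Ω.1# × ¬ (x Ω.≈ Ω.1#)
    nontrivialRoots (suc (suc k)) n≉0 = SeparablePolynomials.nontrivialRootOfUnity (ringOf Ω) separablyClosed 1≉0
        (suc k) (proj₁ inverse) (proj₂ inverse) (ℕ.s≤s ℕ.z≤n)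
      where inverse = heyting-invertible em Ω n≉0

    -≈0⇒≈ : ∀ x y → x F.- y F.≈ F.0# → x F.≈ y
    -≈0⇒≈ x y p = F.trans (inverseˡ-unique x (F.- y) p) (⁻¹-involutive y)
      where open AbelianGroupProperties F.+-abelianGroup using (inverseˡ-unique; ⁻¹-involutive)

  kummerPair : KummerPair (ringOf F) (ringOf Ω) (unitGroup (ringOf F)) (unitGroup (ringOf Ω)) l
  kummerPair = record
    { ι                    = ι
    ; ι-isRingHomomorphism = ι-isRingHomomorphism
    ; ι-injective          = ι-injective
    ; value                = Unit.value
    ; value-cong           = id
    ; value-injective      = id
    ; value-∙              = λ _ _ → Ω.refl
    ; value-ε              = Ω.refl
    ; unit                 = λ x y xy≈1 → mkUnit x y xy≈1 , Ω.refl
    ; embed                = λ (mkUnit x y xy≈1) → mkUnit (ι x) (ι y)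
        (Ω.trans (Ω.sym (ι.*-homo x y)) (Ω.trans (ι.⟦⟧-cong xy≈1) ι.1#-homo))
    ; embed-cong           = ι.⟦⟧-cong
    ; embed-injective      = λ {a} {b} p → -≈0⇒≈ (Unit.value a) (Unit.value b) (ι-injective
        (Ω.trans (ι.+-homo _ _) (Ω.trans (Ω.+-cong p (ι.-‿homo _)) (Ω.-‿inverseʳ _))))
    ; embed-∙              = λ _ _ → ι.*-homo _ _
    ; embed∈F              = λ a → Unit.value a , Ω.refl
    ; unitᶠ                = λ x ιx≉0 →
        let (y , xy≈1) = heyting-invertible em F (λ x≈0 → ιx≉0 (Ω.trans (ι.⟦⟧-cong x≈0) ι.0#-homo))
        in mkUnit x y xy≈1 , Ω.refl
    ; invertible           = heyting-invertible em Ω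
    ; 1≉0                  = 1≉0
    ; l≉0                  = l×1≉0
    ; lthRoot              = nthRoots l {{ℕ.prime⇒nonZero l-prime}} l×1≉0
    ; nontrivialRoot       = nontrivialRoots l {{ℕ.prime⇒nonTrivial l-prime}} l×1≉0
    ; roots∈F              = rootsOfUnity
    ; algebraic            = λ x →
        let (p , isMinimal , _)  = separable x
            (n , leading≈1 , _) = IsMinimalPolynomial.monic isMinimal
        in p , (λ p≈0 → heyting-1≉0 F (F.trans (F.sym leading≈1) (p≈0 n))) , IsMinimalPolynomial.vanishes isMinimal
    }

-- The ring ℚ_l of the theorem is the localisation of ℤ_l at an element that is private
-- to its definition; this equation identifies the element without naming it.
Localises : ∀ {l} → AdicInteger l → (S : CommutativeRing 0ℓ 0ℓ) (φ : AdicInteger l → CommutativeRing.Carrier S) →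
            IsRingHomomorphism (CommutativeRing.rawRing (ℤ-adic l)) (CommutativeRing.rawRing S) φ → Set₁
Localises {l} s S φ φ-homo = _≡_
  {A = ∃ λ S → ∃ λ φ → IsRingHomomorphism (CommutativeRing.rawRing (ℤ-adic l)) (CommutativeRing.rawRing S) φ}
  (S , φ , φ-homo)
  (Localisation.R[1/s] (ℤ-adic l) s , Localisation.fromR (ℤ-adic l) s , Localisation.fromR-isRingHomomorphism (ℤ-adic l) s)

-- Generalised over the ring `S` and its structure map so that the identification with the
-- localisation can be matched against `refl`. Of `s` only the components of its powers are used.
correspondence : (em : ∀ {a} → ExcludedMiddle a) → ∀ {ℓ l} → Prime l → (F : HeytingField ℓ ℓ ℓ) →
  ¬ HasCharacteristic (ringOf F) l → (Fˢᵉᵖ : SeparableClosure F) → ContainsRootsOfUnity Fˢᵉᵖ l → ∀ d →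
  ∀ {s S φ} {φ-homo : IsRingHomomorphism (CommutativeRing.rawRing (ℤ-adic l)) (CommutativeRing.rawRing S) φ} →
  Localises s S φ φ-homo →
  (∀ k n → AdicInteger.seq (Exp._^_ (CommutativeRing.semiring (ℤ-adic l)) s k) n ≡ + (l ℕ.^ k)) →
  Bijection (SeparableClosure.ℤₗExtensions Fˢᵉᵖ l d) (Grass S (extendScalars {R = ℤ-adic l} {S = S} φ-homo (F̂* l F)) d)
correspondence em l-prime F ¬char Fˢᵉᵖ roots d {s} ≡.refl seq-s^ =
  Correspondence.bijection em F (SeparableClosure.Ω Fˢᵉᵖ) l-prime (kummerPair em l-prime F ¬char Fˢᵉᵖ roots) s seq-s^ d

theoremA1 : (∀ {a} → ExcludedMiddle a) →
    ∀ {ℓ} (l : ℕ) → Prime l →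
    (F : HeytingField ℓ ℓ ℓ) →
    ¬ HasCharacteristic (ringOf F) l →
    (Fˢᵉᵖ : SeparableClosure F) →
    ContainsRootsOfUnity Fˢᵉᵖ l →
    (d : ℕ) →
    Bijection (SeparableClosure.ℤₗExtensions Fˢᵉᵖ l d) (Grass (ℚ-adic l) (ℚ⊗F̂* l F) d)
theoremA1 em l l-prime F ¬char Fˢᵉᵖ roots d =
  correspondence em l-prime F ¬char Fˢᵉᵖ roots d ≡.refl seq-l#^
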